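{- Let $\Gamma$ be a commutative weakly distance-regular digraph of valency $k>3$ and girth $g$. Suppose that $\Gamma$ has one type of arcs, that is, every arc of $\Gamma$ is of type $(1,g-1)$, so that $k=k_{1,g-1}$. If $p_{(1,g-1),(1,g-1)}^{(2,g-2)}\geq k-2$, then $\Gamma$ is isomorphic to one of the following digraphs: (i) $\mathrm{Cay}(\mathbb{Z}_{11},\{1,3,4,5,9\})$; (ii) $\mathrm{Cay}(\mathbb{Z}_{14},\{1,2,4,8,9,11\})$; (iii) $\mathrm{Cay}(\mathbb{Z}_{26},\{1,3,9,14,16,22\})$; (iv) $\mathrm{Cay}(\mathbb{Z}_{3}\times\mathbb{Z}_{k+1},\{(1,1),(1,2),\ldots,(1,k)\})$; (v) $\mathrm{Cay}(\mathbb{Z}_{g}\times\mathbb{Z}_k,\{(1,0),(1,1),\ldots,(1,k-1)\})$.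
   Context: All digraphs are finite, simple, strongly connected and not undirected. For vertices $x,y$ of a digraph $\Gamma$, $\partial(x,y)$ is the length of a shortest directed path from $x$ to $y$, and the two-way distance is $\tilde{\partial}(x,y)=(\partial(x,y),\partial(y,x))$; $\tilde{\partial}(\Gamma)$ is the set of all such pairs. $\Gamma$ is weakly distance-regular if for all $\tilde h,\tilde i,\tilde j\in\tilde\partial(\Gamma)$ the number $p^{\tilde h}_{\tilde i,\tilde j}$ of vertices $z$ with $\tilde\partial(x,z)=\tilde i$ and $\tilde\partial(z,y)=\tilde j$ depends only on $\tilde h=\tilde\partial(x,y)$; it is commutative if $p^{\tilde h}_{\tilde i,\tilde j}=p^{\tilde h}_{\tilde j,\tilde i}$ always. $k_{\tilde i}$ denotes the size of $\{y:\tilde\partial(x,y)=\tilde i\}$ (independent of $x$); write $k_{a,b}$ for $k_{(a,b)}$. An arc $(u,v)$ is of type $(1,q-1)$ if $\partial(v,u)=q-1$. The girth is the length of a shortest directed cycle. For a group $G$ and $S\subseteq G$, $\mathrm{Cay}(G,S)$ has vertex set $G$ and arcs $(x,y)$ with $y-x\in S$. -}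

module Defs where

open import Data.Nat using (ℕ; zero; suc; _+_; _∸_; _≤ᵇ_; _≡ᵇ_; _≤_; _<_)
open import Data.Bool using (Bool; true; false; if_then_else_; _∧_; not)
open import Data.Fin using (Fin; toℕ)
open import Data.Fin.Properties using () renaming (_≟_ to _≟F_)
open import Data.List using (List; []; _∷_; map; applyUpTo; allFin)
open import Data.Bool.ListAction using (any)
open import Data.Nat.ListAction using (sum)
open import Data.Product using (Σ; ∃; ∃₂; _×_; _,_)
open import Relation.Nullary.Decidable using (⌊_⌋)
open import Relation.Binary.PropositionalEquality using (_≡_)
open import Function.Bundles using (_⤖_; Bijection)

-- A digraph on vertex set Fin n is given by a Boolean arc relation A.
Rel : ℕ → Set
Rel n = Fin n → Fin n → Bool

module _ {n : ℕ} (A : Rel n) where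

  countᵇ : (Fin n → Bool) → ℕ
  countᵇ P = sum (map (λ z → if P z then 1 else 0) (allFin n))

  walk : ℕ → Fin n → Fin n → Bool
  walk zero    x y = ⌊ x ≟F y ⌋
  walk (suc m) x y = any (λ z → A x z ∧ walk m z y) (allFin n)

  -- least i < b with P i (returns b if none)
  least : (ℕ → Bool) → ℕ → ℕ
  least P zero    = zero
  least P (suc b) = if P zero then zero else suc (least (λ i → P (suc i)) b)

  -- ∂(x,y): length of a shortest directed path from x to y
  -- (correct whenever y is reachable from x, since shortest paths have length < n)
  dist : Fin n → Fin n → ℕ
  dist x y = least (λ m → walk m x y) n

  dist2 : Fin n → Fin n → ℕ × ℕ
  dist2 x y = (dist x y , dist y x)

  _==₂_ : ℕ × ℕ → ℕ × ℕ → Bool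
  (a , b) ==₂ (c , d) = (a ≡ᵇ c) ∧ (b ≡ᵇ d)

  pcount : Fin n → Fin n → ℕ × ℕ → ℕ × ℕ → ℕ
  pcount x y i j = countᵇ (λ z → (dist2 x z ==₂ i) ∧ (dist2 z y ==₂ j))

  IsDigraph : Set
  IsDigraph = (∀ x → A x x ≡ false)
            × (∀ x y → ∃ λ m → walk m x y ≡ true)
            × (∃₂ λ x y → (A x y ≡ true) × (A y x ≡ false))

  IsWeaklyDistanceRegular : Set
  IsWeaklyDistanceRegular =
    ∀ x y x′ y′ i j → dist2 x y ≡ dist2 x′ y′ → pcount x y i j ≡ pcount x′ y′ i j

  IsCommutative : Set
  IsCommutative = ∀ x y i j → pcount x y i j ≡ pcount x y j i

  HasValency : ℕ → Set
  HasValency k = ∀ x → countᵇ (A x) ≡ k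

  -- girth g: length of a shortest directed cycle, i.e. of a shortest closed walk of positive length
  HasGirth : ℕ → Set
  HasGirth g = (1 ≤ g)
             × (∃ λ x → walk g x x ≡ true)
             × (∀ m x → 1 ≤ m → m < g → walk m x x ≡ false)

  AllArcsOfType : ℕ → Set
  AllArcsOfType g = ∀ u v → A u v ≡ true → dist v u ≡ g ∸ 1

  IsomorphicTo : (V : Set) → (V → V → Bool) → Set
  IsomorphicTo V R = Σ (Fin n ⤖ V) λ f →
    ∀ x y → A x y ≡ R (Bijection.to f x) (Bijection.to f y)

-- (y - x) mod m for 0 ≤ x, y < m
subMod : ℕ → ℕ → ℕ → ℕ
subMod m y x = if x ≤ᵇ y then y ∸ x else (m + y) ∸ x

elemℕ : ℕ → List ℕ → Bool
elemℕ d S = any (λ s → d ≡ᵇ s) S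

elem₂ : ℕ × ℕ → List (ℕ × ℕ) → Bool
elem₂ (a , b) S = any (λ { (c , d) → (a ≡ᵇ c) ∧ (b ≡ᵇ d) }) S

CayZ : (m : ℕ) → List ℕ → Fin m → Fin m → Bool
CayZ m S x y = elemℕ (subMod m (toℕ y) (toℕ x)) S

CayZ² : (a b : ℕ) → List (ℕ × ℕ) → Fin a × Fin b → Fin a × Fin b → Bool
CayZ² a b S (x₁ , x₂) (y₁ , y₂) =
  elem₂ (subMod a (toℕ y₁) (toℕ x₁) , subMod b (toℕ y₂) (toℕ x₂)) S

S-iv : ℕ → List (ℕ × ℕ)
S-iv k = applyUpTo (λ j → (1 , suc j)) k

S-v : ℕ → List (ℕ × ℕ)
S-v k = applyUpTo (λ j → (1 , j)) k

{-# OPTIONS --safe #-}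
-- Functions of the two-way distance form an algebra of commuting matrices, so counting arguments are identities
-- between products of the adjacency matrix A, its transpose and the class T = (2 , g − 2).  Let P be the number of
-- two-paths over a pair in T and co the number of common out-neighbours.  If P = k, the out-neighbourhoods along a
-- shortest cycle are the levels of (v).  If P < k and g ≥ 4, the number of first steps along a shortest cycle is
-- monotone and k divides P |T|, which leaves k = 4 or k = 6 with few parameters; each of them dies by inspecting two
-- or three consecutive neighbourhoods.  If g = 3, then T is the transpose of A.  For P = k − 1 the unique vertex
-- missed by an out-neighbour defines a matching, which gives (iv).  For P = k − 2 the number a of two-paths over an
-- arc is 0 or 2: a = 2 forces the Paley digraph on 11 points or the doubled one on 7 points, and for a = 0 the
-- possible values of co on out-neighbours leave the doubled Cay(ℤ₁₃ , {1 , 3 , 9}).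
module Submission where

open import Defs
open import Data.Nat hiding (2+)
open import Data.Nat.Properties
open import Data.Nat.DivMod hiding (result)
open import Data.Nat.Divisibility using (_∣_; _∣?_; divides; ∣m+n∣m⇒∣n; ∣⇒≤; n∣m*n)
open import Data.Nat.ListAction using (sum)
open import Data.Nat.Tactic.RingSolver using (solve-∀)
open import Data.Bool using (Bool; true; false; _∧_; _∨_; not; if_then_else_; T)
open import Data.Bool.ListAction using (any)
open import Data.Bool.Properties using (∧-comm)
import Data.Bool.Properties as 𝔹
open import Data.Fin as F using (Fin; zero; suc; toℕ; fromℕ<; punchIn; remQuot)
open import Data.Fin.Patterns using (0F; 1F; 2F; 3F; 4F; 5F; 6F; 7F; 8F; 9F)
open import Data.Fin.Properties as FP using (all?; any?; injective⇒≤; toℕ<n; toℕ-injective; toℕ-fromℕ<; punchInᵢ≢i; punchIn-injective; combine-remQuot; remQuot-combine)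
open import Data.List as L using (List; []; _∷_; _++_; map; applyUpTo; tabulate)
open import Data.Vec as V using (Vec; []; _∷_; lookup; zipWith; replicate)
open import Data.Product using (_×_; _,_; Σ; ∃; ∃₂; uncurry) renaming (proj₁ to fst; proj₂ to snd)
open import Data.Product.Properties using (,-injective)
open import Data.Sum using (_⊎_; inj₁; inj₂; [_,_]′)
open import Data.Empty
open import Data.Unit using (⊤; tt)
open import Relation.Nullary
open import Relation.Nullary.Decidable using (⌊_⌋; from-yes; from-no; _→-dec_; _⊎-dec_; _×-dec_; dec-true)
open import Relation.Binary.PropositionalEquality
open import Function using (_∘_; id)
open import Function.Bundles using (_⤖_; mk⤖)

-- Regularity controls a number only through the two-way distance of a pair, and most classes that
-- arise have unknown distances. Two devices deal with this. Matrices built from A by products,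
-- transposes and pointwise operations are expressions `Ex`, so they are constant on classes and
-- commute. The size `R# x y` of the class of a pair is usable without naming that class: `k`
-- divides it times any entry there of a product with A, and it times the entry of any matrix is at
-- most a row sum. Divisibility and row sums then pin the entry, and a contradiction often comes
-- from two relations with different entries that are forced to the same distances. The counting
-- lives on siblings, that is, out-neighbours of one vertex: over an arc, the entry of A A Aᵗ adds
-- up common out-neighbours of siblings when bracketed one way and two-paths when bracketed the
-- other way. Its two evaluations give small Diophantine systems; what survives them needs local
-- geometry.

pattern in1 p = inj₂ (inj₁ p)
pattern in2 p = inj₂ (in1 p)
pattern in3 p = inj₂ (in2 p)
pattern in4 p = inj₂ (in3 p)
pattern in5 p = inj₂ (in4 p)
pattern 2+ n = suc (suc n)
pattern 3+ n = suc (2+ n)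
pattern 4+ n = suc (3+ n)
pattern 5+ n = suc (4+ n)
pattern 6+ n = suc (5+ n)
pattern 7+ n = suc (6+ n)
pattern ≤2+ n = s≤s (s≤s n)
pattern ≤3+ n = s≤s (≤2+ n)
pattern ≤4+ n = s≤s (≤3+ n)
pattern ≤5+ n = s≤s (≤4+ n)
pattern ≤6+ n = s≤s (≤5+ n)
pattern ≤7+ n = s≤s (≤6+ n)


+≡ : ∀ {a b c d : ℕ} → a ≡ b → c ≡ d → a + c ≡ b + d
+≡ = cong₂ _+_

-- Linear arithmetic over the natural numbers by reflection

infixl 6 _⊹_

infixl 7 _⊙_

infix 4 _≼_ _≋_

data Ln (m : ℕ) : Set where
 κ : ℕ → Ln m
 ν : Fin m → Ln m
 _⊹_ : Ln m → Ln m → Ln m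
 _⊙_ : ℕ → Ln m → Ln m

eval : ∀ {m} → Ln m → Vec ℕ m → ℕ
eval (κ c) ρ = c
eval (ν i) ρ = lookup ρ i
eval (e ⊹ f) ρ = eval e ρ + eval f ρ
eval (c ⊙ e) ρ = c * eval e ρ

data Con (m : ℕ) : Set where
 _≼_ _≋_ : Ln m → Ln m → Con m

holds : ∀ {m} → Con m → Vec ℕ m → Set
holds (e ≼ f) ρ = eval e ρ ≤ eval f ρ
holds (e ≋ f) ρ = eval e ρ ≡ eval f ρ

Holds : ∀ {m} → List (Con m) → Vec ℕ m → Set
Holds [] ρ = ⊤
Holds (c ∷ []) ρ = holds c ρ
Holds (c ∷ cs@(_ ∷ _)) ρ = holds c ρ × Holds cs ρ

-- A normal form is a constant followed by the coefficients.
NF : ℕ → Set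
NF m = ℕ × Vec ℕ m
_∔_ : ∀ {m} → NF m → NF m → NF m
(a , as) ∔ (b , bs) = a + b , zipWith _+_ as bs

_∗_ : ∀ {m} → ℕ → NF m → NF m
c ∗ (a , as) = c * a , V.map (c *_) as

unit : ∀ {m} → Fin m → Vec ℕ m
unit zero = 1 ∷ replicate _ 0
unit (suc i) = 0 ∷ unit i

nf : ∀ {m} → Ln m → NF m
nf (κ c) = c , replicate _ 0
nf (ν i) = 0 , unit i
nf (e ⊹ f) = nf e ∔ nf f
nf (c ⊙ e) = c ∗ nf e

dot : ∀ {m} → Vec ℕ m → Vec ℕ m → ℕ
dot [] [] = 0
dot (a ∷ as) (x ∷ xs) = a * x + dot as xs

valᴸ : ∀ {m} → NF m → Vec ℕ m → ℕ
valᴸ (a , as) ρ = a + dot as ρ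

dot-0 : ∀ {m} (ρ : Vec ℕ m) → dot (replicate _ 0) ρ ≡ 0
dot-0 [] = refl
dot-0 (x ∷ ρ) = dot-0 ρ

dot-unit : ∀ {m} (i : Fin m) (ρ : Vec ℕ m) → dot (unit i) ρ ≡ lookup ρ i
dot-unit zero (x ∷ ρ) rewrite dot-0 ρ = trans (+-identityʳ _) (+-identityʳ x)
dot-unit (suc i) (x ∷ ρ) = dot-unit i ρ

dot-+ : ∀ {m} (as bs ρ : Vec ℕ m) → dot (zipWith _+_ as bs) ρ ≡ dot as ρ + dot bs ρ
dot-+ [] [] [] = refl
dot-+ (a ∷ as) (b ∷ bs) (x ∷ ρ) rewrite dot-+ as bs ρ = lem a b x (dot as ρ) (dot bs ρ) where
 lem : ∀ a b x p q → (a + b) * x + (p + q) ≡ a * x + p + (b * x + q)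
 lem = solve-∀

dot-* : ∀ {m} c (as ρ : Vec ℕ m) → dot (V.map (c *_) as) ρ ≡ c * dot as ρ
dot-* c [] [] = sym (*-zeroʳ c)
dot-* c (a ∷ as) (x ∷ ρ) rewrite dot-* c as ρ = lem c a x (dot as ρ) where
 lem : ∀ c a x p → c * a * x + c * p ≡ c * (a * x + p)
 lem = solve-∀

val-∔ : ∀ {m} (p q : NF m) ρ → valᴸ (p ∔ q) ρ ≡ valᴸ p ρ + valᴸ q ρ
val-∔ (a , as) (b , bs) ρ rewrite dot-+ as bs ρ = lem a b (dot as ρ) (dot bs ρ) where
 lem : ∀ a b p q → a + b + (p + q) ≡ a + p + (b + q)
 lem = solve-∀

val-∗ : ∀ {m} c (p : NF m) ρ → valᴸ (c ∗ p) ρ ≡ c * valᴸ p ρ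
val-∗ c (a , as) ρ rewrite dot-* c as ρ = sym (*-distribˡ-+ c a (dot as ρ))

nf-ok : ∀ {m} (e : Ln m) ρ → valᴸ (nf e) ρ ≡ eval e ρ
nf-ok (κ c) ρ rewrite dot-0 ρ = +-identityʳ c
nf-ok (ν i) ρ = dot-unit i ρ
nf-ok (e ⊹ f) ρ = trans (val-∔ (nf e) (nf f) ρ) (+≡ (nf-ok e ρ) (nf-ok f ρ))
nf-ok (c ⊙ e) ρ = trans (val-∗ c (nf e) ρ) (cong (c *_) (nf-ok e ρ))

Ineq : ℕ → Set
Ineq m = NF m × NF m

true' : ∀ {m} → Ineq m → Vec ℕ m → Set
true' (p , q) ρ = valᴸ p ρ ≤ valᴸ q ρ

ineqs : ∀ {m} → List (Con m) → List (Ineq m)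
ineqs [] = []
ineqs ((e ≼ f) ∷ cs) = (nf e , nf f) ∷ ineqs cs
ineqs ((e ≋ f) ∷ cs) = (nf e , nf f) ∷ (nf f , nf e) ∷ ineqs cs

Trues : ∀ {m} → List (Ineq m) → Vec ℕ m → Set
Trues [] ρ = ⊤
Trues (c ∷ cs) ρ = true' c ρ × Trues cs ρ

head-holds : ∀ {m} c (cs : List (Con m)) ρ → Holds (c ∷ cs) ρ → holds c ρ
head-holds c [] ρ h = h
head-holds c (_ ∷ _) ρ h = fst h

tail-holds : ∀ {m} c (cs : List (Con m)) ρ → Holds (c ∷ cs) ρ → Holds cs ρ
tail-holds c [] ρ h = tt
tail-holds c (_ ∷ _) ρ h = snd h

ineqs-ok : ∀ {m} (cs : List (Con m)) ρ → Holds cs ρ → Trues (ineqs cs) ρ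
ineqs-ok [] ρ h = tt
ineqs-ok ((e ≼ f) ∷ cs) ρ h =
 subst₂ _≤_ (sym (nf-ok e ρ)) (sym (nf-ok f ρ)) (head-holds (e ≼ f) cs ρ h) , ineqs-ok cs ρ (tail-holds (e ≼ f) cs ρ h)
ineqs-ok ((e ≋ f) ∷ cs) ρ h =
 ≤-reflexive eq , ≤-reflexive (sym eq) , ineqs-ok cs ρ (tail-holds (e ≋ f) cs ρ h)
 where eq = trans (nf-ok e ρ) (trans (head-holds (e ≋ f) cs ρ h) (sym (nf-ok f ρ)))

combine : ∀ {m} → List ℕ → List (Ineq m) → Ineq m
combine (c ∷ cs) ((p , q) ∷ is) = let (p' , q') = combine cs is in (c ∗ p) ∔ p' , (c ∗ q) ∔ q'
combine _ _ = (0 , replicate _ 0) , (0 , replicate _ 0)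

combine-ok : ∀ {m} cs (is : List (Ineq m)) ρ → Trues is ρ → true' (combine cs is) ρ
combine-ok [] is ρ _ = ≤-refl
combine-ok (c ∷ cs) [] ρ _ = ≤-refl
combine-ok (c ∷ cs) ((p , q) ∷ is) ρ (h , hs)
 rewrite val-∔ (c ∗ p) (fst (combine cs is)) ρ | val-∔ (c ∗ q) (snd (combine cs is)) ρ
       | val-∗ c p ρ | val-∗ c q ρ = +-mono-≤ (*-monoʳ-≤ c h) (combine-ok cs is ρ hs)

domᴸ : ∀ {m} → Vec ℕ m → Vec ℕ m → Bool
domᴸ [] [] = true
domᴸ (a ∷ as) (b ∷ bs) = (b ≤ᵇ a) ∧ domᴸ as bs

-- Variables are natural numbers, so coefficients need not cancel: it suffices that those on the
-- left dominate and that the left constant is strictly larger.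
absurd' : ∀ {m} → Ineq m → Bool
absurd' ((a , as) , (b , bs)) = (b <ᵇ a) ∧ domᴸ as bs

T-∧ : ∀ a b → T (a ∧ b) → T a × T b
T-∧ true true _ = tt , tt

dom-ok : ∀ {m} (as bs ρ : Vec ℕ m) → T (domᴸ as bs) → dot bs ρ ≤ dot as ρ
dom-ok [] [] [] _ = z≤n
dom-ok (a ∷ as) (b ∷ bs) (x ∷ ρ) t with T-∧ (b ≤ᵇ a) (domᴸ as bs) t
... | t1 , t2 = +-mono-≤ (*-monoˡ-≤ x (≤ᵇ⇒≤ b a t1)) (dom-ok as bs ρ t2)

absurd-ok : ∀ {m} (i : Ineq m) ρ → T (absurd' i) → ¬ true' i ρ
absurd-ok ((a , as) , (b , bs)) ρ t h with T-∧ (b <ᵇ a) (domᴸ as bs) t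
... | t1 , t2 = <-irrefl refl (<-≤-trans (+-mono-<-≤ (<ᵇ⇒< b a t1) (dom-ok as bs ρ t2)) h)

-- Fourier–Motzkin search for Farkas multipliers; its result is only trusted after `absurd'`.
Tracked : ℕ → Set
Tracked m = Ineq m × List ℕ
addL : List ℕ → List ℕ → List ℕ
addL [] ys = ys
addL xs [] = xs
addL (x ∷ xs) (y ∷ ys) = (x + y) ∷ addL xs ys

hd : ∀ {m} → Vec ℕ (suc m) → ℕ
hd (x ∷ _) = x

tlI : ∀ {m} → Ineq (suc m) → Ineq m
tlI ((a , _ ∷ as) , (b , _ ∷ bs)) = (a , as) , (b , bs)

cL cRᴸ : ∀ {m} → Ineq (suc m) → ℕ
cL ((_ , as) , (_ , bs)) = hd as ∸ hd bs
cRᴸ ((_ , as) , (_ , bs)) = hd bs ∸ hd as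

addI : ∀ {m} → Ineq m → Ineq m → Ineq m
addI (p , q) (p' , q') = p ∔ p' , q ∔ q'

scI : ∀ {m} → ℕ → Ineq m → Ineq m
scI c (p , q) = c ∗ p , c ∗ q

isZ : ℕ → Bool
isZ zero = true
isZ _ = false

-- An inequality whose variable occurs only on the left can drop it (it is nonnegative).
stepᴸ : ∀ {m} → List (Tracked (suc m)) → List (Tracked m)
stepᴸ {m} ts = keep ts ++ pairs ups where
 keep : List (Tracked (suc m)) → List (Tracked m)
 keep [] = []
 keep ((i , c) ∷ ts) = if isZ (cRᴸ i) then (tlI i , c) ∷ keep ts else keep ts
 sel : List (Tracked (suc m)) → List (Tracked (suc m))
 sel [] = []
 sel ((i , c) ∷ ts) = if isZ (cL i) then sel ts else (i , c) ∷ sel ts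
 ups = sel ts
 lows : List (Tracked (suc m)) → List (Tracked (suc m))
 lows [] = []
 lows ((i , c) ∷ ts) = if isZ (cRᴸ i) then lows ts else (i , c) ∷ lows ts
 pair : Tracked (suc m) → List (Tracked (suc m)) → List (Tracked m)
 pair u [] = []
 pair (i , c) ((j , d) ∷ ls) =
  (tlI (addI (scI (cRᴸ j) i) (scI (cL i) j)) , addL (L.map (cRᴸ j *_) c) (L.map (cL i *_) d)) ∷ pair (i , c) ls
 pairs : List (Tracked (suc m)) → List (Tracked m)
 pairs [] = []
 pairs (u ∷ us) = pair u (lows ts) ++ pairs us
pickᴸ : List (Tracked 0) → List ℕ
pickᴸ [] = []
pickᴸ ((i , c) ∷ ts) = if absurd' i then c else pickᴸ ts

elimᴸ : ∀ {m} → List (Tracked m) → List ℕ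
elimᴸ {zero} ts = pickᴸ ts
elimᴸ {suc m} ts = elimᴸ (stepᴸ ts)

-- `pre` holds the zeros in front of the 1: each hypothesis starts with a unit vector of
-- multipliers.
track : ∀ {m} → List ℕ → List (Ineq m) → List (Tracked m)
track pre [] = []
track pre (i ∷ is) = (i , pre ++ (1 ∷ [])) ∷ track (0 ∷ pre) is

refutes : ∀ {m} → List (Con m) → Bool
refutes cs = absurd' (combine (elimᴸ (track [] (ineqs cs))) (ineqs cs))

-- `T (refutes cs)` evaluates to the unit type when the search succeeds, so the implicit argument is
-- solved by conversion. The search sees only `cs`; the values `ρ` enter through the proof `h`.
lia : ∀ {X : Set} {m} (ρ : Vec ℕ m) (cs : List (Con m)) → {T (refutes cs)} → Holds cs ρ → X
lia ρ cs {t} h = ⊥-elim (absurd-ok (combine mult (ineqs cs)) ρ t (combine-ok mult (ineqs cs) ρ (ineqs-ok cs ρ h)))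
 where mult = elimᴸ (track [] (ineqs cs))

cons-holds : ∀ {m} c (cs : List (Con m)) ρ → holds c ρ → Holds cs ρ → Holds (c ∷ cs) ρ
cons-holds c [] ρ h _ = h
cons-holds c (_ ∷ _) ρ h hs = h , hs

-- Integrality enters here: the negated goal is added in the form `1 + f ≤ e`.
lia≤ : ∀ {m} (ρ : Vec ℕ m) (cs : List (Con m)) (e f : Ln m) →
       {T (refutes ((κ 1 ⊹ f ≼ e) ∷ cs))} → Holds cs ρ → eval e ρ ≤ eval f ρ
lia≤ ρ cs e f {t} h with eval e ρ ≤? eval f ρ
... | yes p = p
... | no ¬p = lia ρ ((κ 1 ⊹ f ≼ e) ∷ cs) {t} (cons-holds (κ 1 ⊹ f ≼ e) cs ρ (≰⇒> ¬p) h)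

lia≡ : ∀ {m} (ρ : Vec ℕ m) (cs : List (Con m)) (e f : Ln m) →
       {T (refutes ((κ 1 ⊹ f ≼ e) ∷ cs))} → {T (refutes ((κ 1 ⊹ e ≼ f) ∷ cs))} → Holds cs ρ → eval e ρ ≡ eval f ρ
lia≡ ρ cs e f {t} {t'} h = ≤-antisym (lia≤ ρ cs e f {t} h) (lia≤ ρ cs f e {t'} h)

pattern ν0 = ν zero
pattern ν1 = ν (suc zero)
pattern ν2 = ν (2+ zero)
pattern ν3 = ν (3+ zero)
pattern ν4 = ν (4+ zero)
pattern ν5 = ν (5+ zero)

-- Booleans and their indicators

β : Bool → ℕ
β true = 1
β false = 0

β≤1 : ∀ b → β b ≤ 1
β≤1 true = ≤-refl
β≤1 false = z≤n

β-∧ : ∀ a b → β (a ∧ b) ≡ β a * β b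
β-∧ true b = sym (+-identityʳ _)
β-∧ false b = refl

1≤β : ∀ b → 1 ≤ β b → b ≡ true
1≤β true _ = refl

β-split : ∀ a b m → β a * m ≡ β (a ∧ b) * m + β (a ∧ not b) * m
β-split true true m = sym (+-identityʳ _)
β-split true false m = refl
β-split false b m = refl

2≢3 : 2 ≢ 3
2≢3 ()

2≢6 : 2 ≢ 6
2≢6 ()

1≢5 : 1 ≢ 5
1≢5 ()

1≢3 : 1 ≢ 3
1≢3 ()

∧-intro : ∀ {a b} → a ≡ true → b ≡ true → a ∧ b ≡ true
∧-intro refl refl = refl

∧-fst : ∀ {a b} → a ∧ b ≡ true → a ≡ true
∧-fst {true} _ = refl

∧-snd : ∀ {a b} → a ∧ b ≡ true → b ≡ true
∧-snd {true} p = p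

t≢f : ∀ {X : Set} {b} → b ≡ true → b ≡ false → X
t≢f refl ()

¬t : ∀ {b} → (b ≡ true → ⊥) → b ≡ false
¬t {true} h = ⊥-elim (h refl)
¬t {false} h = refl

not-t : ∀ {b} → not b ≡ true → b ≡ false
not-t {false} _ = refl

not-f : ∀ {b} → b ≡ false → not b ≡ true
not-f refl = refl

iff : ∀ {a b} → (a ≡ true → b ≡ true) → (b ≡ true → a ≡ true) → a ≡ b
iff {true} f g = sym (f refl)
iff {false} {true} f g = g refl
iff {false} {false} f g = refl

cases : ∀ b → (b ≡ true) ⊎ (b ≡ false)
cases true = inj₁ refl
cases false = inj₂ refl

elimʳ : ∀ {X Y : Set} → (Y → ⊥) → X ⊎ Y → X
elimʳ f = [ id , ⊥-elim ∘ f ]′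

elimˡ : ∀ {X Y : Set} → (X → ⊥) → X ⊎ Y → Y
elimˡ f = [ ⊥-elim ∘ f , id ]′

infixr 6 _·_ _»_
_·_ : ∀ {X : Set} {a b c : X} → a ≡ b → b ≡ c → a ≡ c
_·_ = trans

_»_ : ∀ {a b c : ℕ} → a ≤ b → b ≤ c → a ≤ c
_»_ = ≤-trans

eq≤ : ∀ {a b : ℕ} → a ≡ b → a ≤ b
eq≤ = ≤-reflexive

eq≥ : ∀ {a b : ℕ} → a ≡ b → b ≤ a
eq≥ e = ≤-reflexive (sym e)

≥1 : ∀ {a b : ℕ} → a ≡ suc b → 1 ≤ a
≥1 refl = z<s

private variable
 m n : ℕ

-- Finite sums, counting and enumeration

opaque
 ∑ : ∀ {m} → (Fin m → ℕ) → ℕ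
 ∑ {zero} f = 0
 ∑ {suc m} f = f zero + ∑ (f ∘ suc)
 ∑-suc : (f : Fin (suc m) → ℕ) → ∑ f ≡ f zero + ∑ (f ∘ suc)
 ∑-suc f = refl
 ∑-nil : (f : Fin 0 → ℕ) → ∑ f ≡ 0
 ∑-nil f = refl
 ∑-cong : {f g : Fin m → ℕ} → (∀ i → f i ≡ g i) → ∑ f ≡ ∑ g
 ∑-cong {zero} h = refl
 ∑-cong {suc m} h = +≡ (h zero) (∑-cong (h ∘ suc))
 ∑-mono : {f g : Fin m → ℕ} → (∀ i → f i ≤ g i) → ∑ f ≤ ∑ g
 ∑-mono {zero} h = z≤n
 ∑-mono {suc m} h = +-mono-≤ (h zero) (∑-mono (h ∘ suc))
 ∑-+ : (f g : Fin m → ℕ) → ∑ (λ i → f i + g i) ≡ ∑ f + ∑ g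
 ∑-+ {zero} f g = refl
 ∑-+ {suc m} f g rewrite ∑-+ (f ∘ suc) (g ∘ suc) = lem (f zero) (g zero) _ _ where
  lem : ∀ a b c d → a + b + (c + d) ≡ a + c + (b + d)
  lem = solve-∀
 ∑-*ˡ : ∀ c (f : Fin m → ℕ) → ∑ (λ i → c * f i) ≡ c * ∑ f
 ∑-*ˡ {zero} c f = sym (*-zeroʳ c)
 ∑-*ˡ {suc m} c f rewrite ∑-*ˡ c (f ∘ suc) = sym (*-distribˡ-+ c (f zero) _)
 ∑-*ʳ : ∀ c (f : Fin m → ℕ) → ∑ (λ i → f i * c) ≡ ∑ f * c
 ∑-*ʳ c f = trans (∑-cong λ i → *-comm (f i) c) (trans (∑-*ˡ c f) (*-comm c _))
 ∑-0 : ∑ {m} (λ _ → 0) ≡ 0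
 ∑-0 {zero} = refl
 ∑-0 {suc m} = ∑-0 {m}
 ∑-comm : (f : Fin m → Fin n → ℕ) → ∑ (λ i → ∑ (f i)) ≡ ∑ (λ j → ∑ (λ i → f i j))
 ∑-comm {zero} {n} f = sym (∑-0 {n})
 ∑-comm {suc m} f rewrite ∑-comm (f ∘ suc) = sym (∑-+ (f zero) _)
 elem≤∑ : (f : Fin m → ℕ) (i : Fin m) → f i ≤ ∑ f
 elem≤∑ f zero = m≤m+n _ _
 elem≤∑ f (suc i) = ≤-trans (elem≤∑ (f ∘ suc) i) (m≤n+m _ _)
 -- The equality case of a termwise bound. Most rigidity arguments below end here: once the totals
 -- agree, every term does, and a count turns into adjacencies.
 ∑≥⇒≡ : {f g : Fin m → ℕ} → (∀ i → f i ≤ g i) → ∑ g ≤ ∑ f → ∀ i → f i ≡ g i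
 ∑≥⇒≡ {suc m} {f} {g} h p zero = ≤-antisym (h zero) (+-cancelʳ-≤ (∑ (g ∘ suc)) _ _ (≤-trans p (+-monoʳ-≤ (f zero) (∑-mono (h ∘ suc)))))
 ∑≥⇒≡ {suc m} {f} {g} h p (suc i) = ∑≥⇒≡ (h ∘ suc) (+-cancelˡ-≤ (g zero) _ _ (≤-trans p (+-monoˡ-≤ (∑ (f ∘ suc)) (h zero)))) i
 1≤∑ : (f : Fin m → ℕ) → 1 ≤ ∑ f → ∃ λ i → 1 ≤ f i
 1≤∑ {suc m} f p with f zero in eq
 ... | suc _ = zero , subst (1 ≤_) (sym eq) z<s
 ... | zero with 1≤∑ (f ∘ suc) p
 ... | i , q = suc i , q

# : (Fin m → Bool) → ℕ
# P = ∑ (β ∘ P)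

_==_ : Fin m → Fin m → Bool
i == j = ⌊ i F.≟ j ⌋

==-refl : (i : Fin m) → i == i ≡ true
==-refl i with i F.≟ i
... | yes _ = refl
... | no q = ⊥-elim (q refl)

==⇒≡ : {i j : Fin m} → i == j ≡ true → i ≡ j
==⇒≡ {i = i} {j} p with i F.≟ j
... | yes q = q

≢⇒== : {i j : Fin m} → i ≢ j → i == j ≡ false
≢⇒== q = ¬t (q ∘ ==⇒≡)

==-false : {i j : Fin m} → i == j ≡ false → i ≢ j
==-false {i = i} p refl = t≢f (==-refl i) p

==-sym : (i j : Fin m) → i == j ≡ j == i
==-sym i j = iff (λ p → subst (λ l → l == i ≡ true) (==⇒≡ p) (==-refl i)) (λ p → subst (λ l → l == j ≡ true) (==⇒≡ p) (==-refl j))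

==-suc : (i j : Fin m) → (suc i == suc j) ≡ (i == j)
==-suc i j = iff (λ p → subst (λ l → i == l ≡ true) (FP.suc-injective (==⇒≡ p)) (==-refl i)) (λ p → subst (λ l → suc i == suc l ≡ true) (==⇒≡ p) (==-refl (suc i)))

opaque
 unfolding ∑
 ∑-pick : (i : Fin m) (h : Fin m → ℕ) → ∑ (λ x → β (i == x) * h x) ≡ h i
 ∑-pick {suc m} zero h rewrite ∑-0 {m} = trans (+-identityʳ _) (+-identityʳ _)
 ∑-pick {suc m} (suc i) h = trans (∑-cong (λ x → cong (λ b → β b * h (suc x)) (==-suc i x))) (∑-pick i (h ∘ suc))

∑-pick' : (i : Fin m) (h : Fin m → ℕ) → ∑ (λ x → β (x == i) * h x) ≡ h i
∑-pick' i h = trans (∑-cong λ x → cong (λ b → β b * h x) (==-sym x i)) (∑-pick i h)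

#∃ : {P : Fin m → Bool} → 1 ≤ # P → ∃ λ i → P i ≡ true
#∃ {P = P} p with 1≤∑ (β ∘ P) p
... | i , q = i , 1≤β _ q

∃# : {P : Fin m → Bool} (i : Fin m) → P i ≡ true → 1 ≤ # P
∃# {P = P} i p = ≤-trans (≤-reflexive (sym (cong β p))) (elem≤∑ (β ∘ P) i)

#-cong : {P Q : Fin m → Bool} → (∀ i → P i ≡ Q i) → # P ≡ # Q
#-cong h = ∑-cong (cong β ∘ h)

#-mono : {P Q : Fin m → Bool} → (∀ i → P i ≡ true → Q i ≡ true) → # P ≤ # Q
#-mono {P = P} {Q} h = ∑-mono λ i → le (P i) (Q i) (h i) where
 le : ∀ a b → (a ≡ true → b ≡ true) → β a ≤ β b
 le true b f rewrite f refl = ≤-refl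
 le false b f = z≤n

#-split : (P Q : Fin m → Bool) → # P ≡ # (λ i → P i ∧ Q i) + # (λ i → P i ∧ not (Q i))
#-split P Q = trans (∑-cong λ i → lem (P i) (Q i)) (∑-+ _ _) where
 lem : ∀ a b → β a ≡ β (a ∧ b) + β (a ∧ not b)
 lem true true = refl
 lem true false = refl
 lem false b = refl

#-rest : ∀ {a b} (P Q : Fin m → Bool) → # P ≡ a + b → # (λ i → P i ∧ Q i) ≡ a → # (λ i → P i ∧ not (Q i)) ≡ b
#-rest P Q e f = +-cancelˡ-≡ _ _ _ (cong (_+ # (λ i → P i ∧ not (Q i))) (sym f) · sym (#-split P Q) · e)

#-sub≡ : {P Q : Fin m → Bool} → (∀ i → P i ≡ true → Q i ≡ true) → # Q ≤ # P → ∀ i → Q i ≡ true → P i ≡ true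
#-sub≡ {P = P} {Q} h p i q = 1≤β _ (≤-reflexive (sym (trans (∑≥⇒≡ (λ j → le (P j) (Q j) (h j)) p i) (cong β q)))) where
 le : ∀ a b → (a ≡ true → b ≡ true) → β a ≤ β b
 le true b f rewrite f refl = ≤-refl
 le false b f = z≤n

Enum : (Fin m → Bool) → ℕ → Set
Enum {m} P l = Σ (Fin l → Fin m) λ f → (∀ i → P (f i) ≡ true) × (∀ i j → f i ≡ f j → i ≡ j) × (∀ x → P x ≡ true → ∃ λ i → f i ≡ x)

enum : (P : Fin m → Bool) → Enum P (# P)
enum {zero} P rewrite ∑-nil (β ∘ P) = (λ ()) , (λ ()) , (λ ()) , λ ()
enum {suc m} P rewrite ∑-suc (β ∘ P) with enum (P ∘ suc) | P zero in eq
... | f , a , b , c | false = (λ i → suc (f i)) , a , (λ i j p → b i j (FP.suc-injective p)) , cov where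
 cov : ∀ x → P x ≡ true → ∃ λ i → suc (f i) ≡ x
 cov zero p = t≢f p eq
 cov (suc x) p with c x p
 ... | i , q = i , cong suc q
... | f , a , b , c | true = f' , a' , b' , cov where
 f' : Fin (suc _) → Fin (suc m)
 f' zero = zero
 f' (suc i) = suc (f i)
 a' : ∀ i → P (f' i) ≡ true
 a' zero = eq
 a' (suc i) = a i
 b' : ∀ i j → f' i ≡ f' j → i ≡ j
 b' zero zero p = refl
 b' zero (suc j) ()
 b' (suc i) zero ()
 b' (suc i) (suc j) p = cong suc (b i j (FP.suc-injective p))
 cov : ∀ x → P x ≡ true → ∃ λ i → f' i ≡ x
 cov zero p = zero , refl
 cov (suc x) p with c x p
 ... | i , q = suc i , cong suc q

enum≡ : (P : Fin m → Bool) {l : ℕ} → # P ≡ l → Enum P l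
enum≡ P refl = enum P

inj≤# : {P : Fin m → Bool} {l : ℕ} (f : Fin l → Fin m) → (∀ i j → f i ≡ f j → i ≡ j) → (∀ i → P (f i) ≡ true) → l ≤ # P
inj≤# {P = P} f inj h with enum P
... | e , _ , _ , c = injective⇒≤ {f = g} λ {i} {j} p → inj i j (trans (sym (snd (c (f i) (h i)))) (trans (cong e p) (snd (c (f j) (h j)))))
 where g = λ i → fst (c (f i) (h i))

-- A missed `x` would extend `f` to an injection of `suc l` indices.
covers : {P : Fin m → Bool} {l : ℕ} (f : Fin l → Fin m) → (∀ i j → f i ≡ f j → i ≡ j) → (∀ i → P (f i) ≡ true) → # P ≤ l → ∀ x → P x ≡ true → ∃ λ i → f i ≡ x
covers {m} {P} {l} f inj h p x q with any? (λ i → f i F.≟ x)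
... | yes r = r
... | no r = ⊥-elim (<-irrefl refl (≤-trans (inj≤# {P = P} f' inj' h') p)) where
 f' : Fin (suc l) → Fin m
 f' zero = x
 f' (suc i) = f i
 inj' : ∀ i j → f' i ≡ f' j → i ≡ j
 inj' zero zero _ = refl
 inj' zero (suc j) e = ⊥-elim (r (j , sym e))
 inj' (suc i) zero e = ⊥-elim (r (i , e))
 inj' (suc i) (suc j) e = cong suc (inj i j e)
 h' : ∀ i → P (f' i) ≡ true
 h' zero = q
 h' (suc i) = h i

-- Each `h (f i)` is a sum against the indicator of `f i`; after the sums are exchanged, the
-- indicators over `i` add up to that of `P`.
∑-enum : {P : Fin m → Bool} {l : ℕ} ((f , _) : Enum P l) (h : Fin m → ℕ) → ∑ (λ x → β (P x) * h x) ≡ ∑ (λ i → h (f i))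
∑-enum {m} {P} {l} (f , a , b , c) h = sym (begin
 ∑ (λ i → h (f i)) ≡⟨ ∑-cong (λ i → ∑-pick (f i) h) ⟨
 ∑ (λ i → ∑ (λ x → β (f i == x) * h x)) ≡⟨ ∑-comm _ ⟩
 ∑ (λ x → ∑ (λ i → β (f i == x) * h x)) ≡⟨ ∑-cong (λ x → trans (∑-*ʳ (h x) _) (cong (_* h x) (cnt x))) ⟩
 ∑ (λ x → β (P x) * h x) ∎) where
 open ≡-Reasoning
 cnt : ∀ x → ∑ (λ i → β (f i == x)) ≡ β (P x)
 cnt x with P x in eq
 ... | false = trans (∑-cong λ i → cong β (≢⇒== λ e → t≢f (a i) (trans (cong P e) eq))) (∑-0 {l})
 ... | true with c x eq
 ... | i , refl = trans (∑-cong λ j → cong β (iff (λ p → subst (λ z → z == i ≡ true) (b i j (sym (==⇒≡ p))) (==-refl i)) (λ p → subst (λ z → f z == f i ≡ true) (sym (==⇒≡ p)) (==-refl (f i))))) (trans (∑-cong λ j → sym (*-identityʳ _)) (∑-pick' i (λ _ → 1)))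

-- The list vocabulary of the statement, and subtraction modulo `m`

any-tab : ∀ {m l} (p : Fin l → Bool) (h : Fin m → Fin l) → any p (tabulate h) ≡ true → ∃ λ i → p (h i) ≡ true
any-tab {suc m} p h q with p (h zero) in eq
... | true = zero , eq
... | false with any-tab p (h ∘ suc) q
... | i , r = suc i , r

any-tab' : ∀ {m l} (p : Fin l → Bool) (h : Fin m → Fin l) i → p (h i) ≡ true → any p (tabulate h) ≡ true
any-tab' {suc m} p h zero q rewrite q = refl
any-tab' {suc m} p h (suc i) q with p (h zero)
... | true = refl
... | false = any-tab' p (h ∘ suc) i q

opaque
 unfolding ∑
 sum-tab : ∀ {m l} (f : Fin l → ℕ) (h : Fin m → Fin l) → sum (map f (tabulate h)) ≡ ∑ (f ∘ h)
 sum-tab {zero} f h = refl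
 sum-tab {suc m} f h = cong (f (h zero) +_) (sum-tab f (h ∘ suc))

if≡β : ∀ b → (if b then 1 else 0) ≡ β b
if≡β true = refl
if≡β false = refl

countᵇ≡# : ∀ {n} (A : Rel n) (P : Fin n → Bool) → countᵇ A P ≡ # P
countᵇ≡# A P = sum-tab _ id · (∑-cong λ i → if≡β (P i))

≡ᵇ-refl : ∀ m → (m ≡ᵇ m) ≡ true
≡ᵇ-refl zero = refl
≡ᵇ-refl (suc m) = ≡ᵇ-refl m

≡ᵇ⇒ : ∀ m n → (m ≡ᵇ n) ≡ true → m ≡ n
≡ᵇ⇒ m n p = ≡ᵇ⇒≡ m n (subst T (sym p) tt)

≡⇒ᵇ : ∀ {m n} → m ≡ n → (m ≡ᵇ n) ≡ true
≡⇒ᵇ {m} refl = ≡ᵇ-refl m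

re4 : ∀ a b c e → a * b * (c * e) ≡ b * e * (a * c)
re4 = solve-∀

re3 : ∀ a b c → a * (b * c) ≡ a * c * b
re3 = solve-∀

elem2-elim : ∀ k a b (h : ℕ → ℕ) → elem₂ (a , b) (applyUpTo (λ j → (1 , h j)) k) ≡ true → a ≡ 1 × ∃ λ j → j < k × b ≡ h j
elem2-elim (suc k) a b h p with (a ≡ᵇ 1) ∧ (b ≡ᵇ h 0) in eq
... | true = ≡ᵇ⇒ a 1 (∧-fst eq) , 0 , z<s , ≡ᵇ⇒ b (h 0) (∧-snd {a ≡ᵇ 1} eq)
... | false with elem2-elim k a b (h ∘ suc) p
... | q , j , r , s = q , suc j , s≤s r , s

elem2-intro : ∀ k a b (h : ℕ → ℕ) j → j < k → a ≡ 1 → b ≡ h j → elem₂ (a , b) (applyUpTo (λ j → (1 , h j)) k) ≡ true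
elem2-intro (suc k) a b h zero p refl refl rewrite ≡⇒ᵇ {h 0} refl = refl
elem2-intro (suc k) a b h (suc j) (s≤s p) q r with (a ≡ᵇ 1) ∧ (b ≡ᵇ h 0)
... | true = refl
... | false = elem2-intro k a b (h ∘ suc) j p q r

≤ᵇ-yes : ∀ {m n} → m ≤ n → (m ≤ᵇ n) ≡ true
≤ᵇ-yes {m} {n} p with m ≤ᵇ n | ≤⇒≤ᵇ p
... | true | _ = refl

≤ᵇ-no : ∀ {m n} → n < m → (m ≤ᵇ n) ≡ false
≤ᵇ-no {m} {n} p = ¬t λ q → <⇒≱ p (≤ᵇ⇒≤ m n (subst T (sym q) _))

subMod-≤ : ∀ m {x y} → x ≤ y → subMod m y x ≡ y ∸ x
subMod-≤ m p rewrite ≤ᵇ-yes p = refl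

subMod-> : ∀ m {x y} → y < x → subMod m y x ≡ (m + y) ∸ x
subMod-> m p rewrite ≤ᵇ-no p = refl

subMod< : ∀ m x y → x < m → y < m → subMod m y x < m
subMod< m x y p q with x ≤? y
... | yes r rewrite subMod-≤ m r = ≤-<-trans (m∸n≤m y x) q
... | no r rewrite subMod-> m (≰⇒> r) = +-cancelʳ-< x _ _ (subst (_< m + x) (sym (m∸n+n≡m (<⇒≤ p » m≤m+n m y))) (+-monoʳ-< m (≰⇒> r)))

subMod-0 : ∀ m x y → x < m → y < m → subMod m y x ≡ 0 → x ≡ y
subMod-0 m x y p q e with x ≤? y
... | yes r rewrite subMod-≤ m r = ≤-antisym r (m∸n≡0⇒m≤n e)
... | no r rewrite subMod-> m (≰⇒> r) = ⊥-elim (<⇒≱ p (m≤m+n m y » m∸n≡0⇒m≤n e))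

subMod-self : ∀ m x → subMod m x x ≡ 0
subMod-self m x rewrite subMod-≤ m (≤-refl {x}) = n∸n≡0 x

next-Iso : ℕ → ℕ → ℕ
next-Iso m x = if suc x ≡ᵇ m then 0 else suc x

subMod-next : ∀ m x y → 2 ≤ m → x < m → y < m → subMod m y x ≡ 1 → y ≡ next-Iso m x
subMod-next m x y m>1 p q e with suc x ≟ m
... | yes refl rewrite ≡⇒ᵇ {m} refl with x ≤? y
... | yes r rewrite subMod-≤ (suc x) r = ⊥-elim (<⇒≱ q (eq≥ (cong (_+ x) e) » eq≤ (m∸n+n≡m r)))
... | no r rewrite subMod-> (suc x) (≰⇒> r) = lem e where
 lem : (suc x + y) ∸ x ≡ 1 → y ≡ 0
 lem f rewrite +-comm (suc x) y | +-∸-assoc y {suc x} {x} (n≤1+n x) | m+n∸n≡m 1 x = +-cancelʳ-≡ 1 y 0 f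
subMod-next m x y m>1 p q e | no s with suc x ≡ᵇ m in eq
... | true = ⊥-elim (s (≡ᵇ⇒ (suc x) m eq))
... | false with x ≤? y
... | yes r rewrite subMod-≤ m r = sym (m∸n+n≡m r) · cong (_+ x) e
... | no r rewrite subMod-> m (≰⇒> r) = ⊥-elim (s (≤-antisym p (m≤m+n m y » eq≤ (sym (m∸n+n≡m (<⇒≤ p » m≤m+n m y)) · cong (_+ x) e))))

next-subMod : ∀ m x → 2 ≤ m → x < m → subMod m (next-Iso m x) x ≡ 1
next-subMod m x m>1 p with suc x ≡ᵇ m in eq
... | false rewrite subMod-≤ m (n≤1+n x) = m+n∸n≡m 1 x
... | true with ≡ᵇ⇒ (suc x) m eq
... | refl with x
... | zero = ⊥-elim (1+n≰n m>1)
... | suc x' rewrite +-identityʳ x' = m+n∸n≡m 1 x'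

-- Coordinates on the vertex set, and residues

mkBij : ∀ {n} {B : Set} (f : Fin n → B) → (∀ {x y} → f x ≡ f y → x ≡ y) → (∀ b → ∃ λ x → f x ≡ b) → Fin n ⤖ B
mkBij f i s = mk⤖ (i , λ b → fst (s b) , λ { refl → snd (s b) })

-- Arcs of (v) depend on the first coordinate alone, so the listing of each level may be arbitrary.
module Levels {n a b : ℕ} (lev : Fin n → Fin a) (en : ∀ i → Enum (λ x → lev x == i) b) where
 idx : Fin n → Fin b
 idx x = fst (snd (snd (snd (en (lev x)))) x (==-refl (lev x)))
 idx-ok : ∀ x → fst (en (lev x)) (idx x) ≡ x
 idx-ok x = snd (snd (snd (snd (en (lev x)))) x (==-refl (lev x)))
 loc : Fin n → Fin a × Fin b
 loc x = lev x , idx x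
 loc-inj : ∀ {x y} → loc x ≡ loc y → x ≡ y
 loc-inj {x} {y} e = sym (idx-ok x) · cong (λ { (i , j) → fst (en i) j }) e · idx-ok y
 loc-sur : ∀ p → ∃ λ x → loc x ≡ p
 loc-sur (i , j) = x , aux (lev x) (==⇒≡ (fst (snd (en i)) j)) refl where
  x = fst (en i) j
  -- `idx x` lives in the listing of level `lev x`, so the level is generalised to `l` before the
  -- equation is matched.
  aux : ∀ l → l ≡ i → lev x ≡ l → loc x ≡ (i , j)
  aux .i refl e = cong₂ _,_ e (fst (snd (snd (en i))) _ _ (cong (λ l → fst (en l) (idx x)) (sym e) · idx-ok x))
 bij : Fin n ⤖ (Fin a × Fin b)
 bij = mkBij loc loc-inj loc-sur

module _ (g : ℕ) .{{_ : NonZero g}} where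
 %-add : ∀ m c → (m + c * g) % g ≡ m % g
 %-add m c = [m+kn]%n≡m%n m c g
 %-0 : ∀ m → m % g ≡ 0 → m ≡ (m / g) * g
 %-0 m p = m≡m%n+[m/n]*n m g · cong (_+ (m / g) * g) p
 -- `r` is the length of a common way back: two walks closed up by the same return have lengths that
 -- agree modulo `g` as soon as closed walks have length divisible by `g`.
 %-match : ∀ m m' r → (m + r) % g ≡ 0 → (m' + r) % g ≡ 0 → m % g ≡ m' % g
 %-match m m' r p q = sym (%-add m ((m' + r) / g)) · cong (_% g) (cong (m +_) (sym (%-0 _ q)) · lem m m' r · cong (m' +_) (%-0 _ p)) · %-add m' ((m + r) / g) where
  lem : ∀ m m' r → m + (m' + r) ≡ m' + (m + r)
  lem = solve-∀
 %-suc : ∀ m → suc m % g ≡ next-Iso g (m % g)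
 %-suc m = cong (λ u → suc u % g) (m≡m%n+[m/n]*n m g) · %-add (suc (m % g)) (m / g) · lem (m % g) (m%n<n m g) where
  lem : ∀ r → r < g → suc r % g ≡ next-Iso g r
  lem r p with suc r ≡ᵇ g in eq
  ... | true = cong (_% g) (≡ᵇ⇒ (suc r) g eq) · n%n≡0 g
  ... | false = m<n⇒m%n≡m (≤∧≢⇒< p λ e → t≢f (≡⇒ᵇ e) eq)

next-inj : ∀ g a b → next-Iso g a ≡ next-Iso g b → a < g → b < g → a ≡ b
next-inj g a b e p q with suc a ≡ᵇ g in ea | suc b ≡ᵇ g in eb
... | true | true = suc-injective (≡ᵇ⇒ (suc a) g ea · sym (≡ᵇ⇒ (suc b) g eb))
... | false | false = suc-injective e

wsum : ∀ {m} (b : Fin m → Bool) (f : Fin m → ℕ) c → (∀ y → b y ≡ true → f y ≡ c) → ∑ (λ y → β (b y) * f y) ≡ # b * c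
wsum b f c h = (∑-cong λ y → aux (b y) (h y)) · (∑-*ʳ c _) where
 aux : ∀ {e} b → (b ≡ true → e ≡ c) → β b * e ≡ β b * c
 aux true h = cong (1 *_) (h refl)
 aux false h = refl

-- Arithmetic of the parameters

p∣2 : ∀ p t → (2 + p) * (1 + p) ≡ t * p → p ≤ 2
p∣2 p t e = ∣⇒≤ (∣m+n∣m⇒∣n {p} {(3 + p) * p} {2} (subst (p ∣_) (sym e · lem p) (n∣m*n t)) (n∣m*n (3 + p))) where
 lem : ∀ p → (2 + p) * (1 + p) ≡ (3 + p) * p + 2
 lem = solve-∀

p∣4 : ∀ p t → (2 + p) * (2 + p) ≡ t * p → p ∣ 4
p∣4 p t e = ∣m+n∣m⇒∣n {p} {(4 + p) * p} {4} (subst (p ∣_) (sym e · lem p) (n∣m*n t)) (n∣m*n (4 + p)) where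
 lem : ∀ p → (2 + p) * (2 + p) ≡ (4 + p) * p + 4
 lem = solve-∀

p∣1 : ∀ p t → (1 + p) * (1 + p) ≡ t * p → p ≤ 1
p∣1 p t e = ∣⇒≤ (∣m+n∣m⇒∣n {p} {(2 + p) * p} {1} (subst (p ∣_) (sym e · lem p) (n∣m*n t)) (n∣m*n (2 + p))) where
 lem : ∀ p → (1 + p) * (1 + p) ≡ (2 + p) * p + 1
 lem = solve-∀

quarter : ∀ p → p ∣ 4 → 2 ≤ p → p ≡ 2 ⊎ p ≡ 4
quarter 2 _ _ = inj₁ refl
quarter 4 _ _ = inj₂ refl
quarter 3 (divides (2+ q) ()) _
quarter 3 (divides 1 ()) _
quarter 3 (divides 0 ()) _
quarter (5+ _) dv _ with ∣⇒≤ dv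
... | ≤4+ ()
quarter 1 _ (s≤s ())
quarter 0 _ ()

-- The equation is `kQ`. Modulo `P` its left side is 1 when `k = Q = 1 + P`, and it is 2 or 4 when
-- `k = 2 + P` and `Q` is `1 + P` or `2 + P`; so `P` divides 1, 2 or 4.
numeric : ∀ k P Q t → 3 < k → k ≤ 2 + P → P < k → P < Q → Q ≤ k → k * Q ≡ t * P →
 (k ≡ 4 × P ≡ 2 × Q ≡ 3 × t ≡ 6) ⊎ (k ≡ 4 × P ≡ 2 × Q ≡ 4 × t ≡ 8) ⊎ (k ≡ 6 × P ≡ 4 × Q ≡ 6 × t ≡ 9)
numeric k P Q t a b c e f h with k ≟ 1 + P
... | yes refl with ≤-antisym f e
... | refl = lia (P ∷ []) ((κ 4 ≼ κ 1 ⊹ ν0) ∷ (ν0 ≼ κ 1) ∷ []) (a , p∣1 P t h)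
numeric k P Q t a b c e f h | no ne with ≤-antisym b (≤∧≢⇒< c (ne ∘ sym))
... | refl with Q ≟ 1 + P
... | yes refl with ≤-antisym (p∣2 P t h) (≤-pred (≤-pred a))
... | refl = inj₁ (refl , refl , refl , *-cancelʳ-≡ t 6 2 (sym h))
numeric k P Q t a b c e f h | no ne | refl | no ne' with ≤-antisym f (≤∧≢⇒< e (ne' ∘ sym))
... | refl with quarter P (p∣4 P t h) (≤-pred (≤-pred a))
... | inj₁ refl = inj₂ (inj₁ (refl , refl , refl , *-cancelʳ-≡ t 8 2 (sym h)))
... | inj₂ refl = inj₂ (inj₂ (refl , refl , refl , *-cancelʳ-≡ t 9 4 (sym h)))

opaque
 unfolding ∑
 -- The handshake argument: entries off the diagonal come in equal pairs. It is applied to the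
 -- matrix that pairs each vertex with its twin.
 even : ∀ {m} (s : Fin m → Fin m → ℕ) → (∀ i j → s i j ≡ s j i) → (∀ i → s i i ≡ 0) → ∃ λ h → ∑ (λ i → ∑ (s i)) ≡ h + h
 even {zero} s _ _ = 0 , refl
 even {suc m} s sy dz with even (λ i j → s (suc i) (suc j)) (λ i j → sy (suc i) (suc j)) (λ i → dz (suc i))
 ... | h , e = ∑ (λ j → s zero (suc j)) + h , (begin
  s zero zero + R + ∑ (λ i → s (suc i) zero + ∑ (λ j → s (suc i) (suc j)))
   ≡⟨ cong₂ (λ a b → a + R + b) (dz zero) (∑-+ (λ i → s (suc i) zero) _) ⟩
  R + (∑ (λ i → s (suc i) zero) + ∑ (λ i → ∑ (λ j → s (suc i) (suc j))))
   ≡⟨ cong₂ (λ a b → R + (a + b)) (∑-cong λ i → sy (suc i) zero) e ⟩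
  R + (R + (h + h))
   ≡⟨ lem R h ⟩
  R + h + (R + h) ∎) where
  open ≡-Reasoning
  R : ℕ
  R = ∑ (λ j → s zero (suc j))
  lem : ∀ r h → r + (r + (h + h)) ≡ r + h + (r + h)
  lem = solve-∀
 ∑5 : (f : Fin 5 → ℕ) → ∑ f ≡ f 0F + (f 1F + (f 2F + (f 3F + f 4F)))
 ∑5 f = cong (λ u → f 0F + (f 1F + (f 2F + (f 3F + u)))) (+-identityʳ _)
 ∑6 : (f : Fin 6 → ℕ) → ∑ f ≡ f 0F + (f 1F + (f 2F + (f 3F + (f 4F + f 5F))))
 ∑6 f = cong (λ u → f 0F + (f 1F + (f 2F + (f 3F + (f 4F + u))))) (+-identityʳ _)
 ∑7 : (f : Fin 7 → ℕ) → ∑ f ≡ f 0F + (f 1F + (f 2F + (f 3F + (f 4F + (f 5F + f 6F)))))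
 ∑7 f = cong (λ u → f 0F + (f 1F + (f 2F + (f 3F + (f 4F + (f 5F + u)))))) (+-identityʳ _)

module _ {m : ℕ} (S : Fin m → Bool) (f : Fin m → ℕ) (b : ℕ) (bd : ∀ y → S y ≡ true → f y < b) where
 bin : ℕ → ℕ
 bin c = # (λ y → S y ∧ (f y ≡ᵇ c))
 private
  hit1 : ∀ y → S y ≡ true → (h : ℕ → ℕ) → ∑ {b} (λ c → β (S y ∧ (f y ≡ᵇ toℕ c)) * h (toℕ c)) ≡ h (f y)
  hit1 y p h = (∑-cong λ c → cong (λ u → β u * h (toℕ c)) (aux c)) · ∑-pick (fromℕ< (bd y p)) (λ c → h (toℕ c)) · cong h (toℕ-fromℕ< (bd y p)) where
   open import Data.Fin.Properties using (toℕ-fromℕ<; toℕ-injective)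
   aux : ∀ c → (S y ∧ (f y ≡ᵇ toℕ c)) ≡ (fromℕ< (bd y p) == c)
   aux c = cong (_∧ (f y ≡ᵇ toℕ c)) p · (iff (λ q → subst (λ u → fromℕ< (bd y p) == u ≡ true) (toℕ-injective (toℕ-fromℕ< (bd y p) · ≡ᵇ⇒ _ _ q)) (==-refl _))
                         (λ q → ≡⇒ᵇ (sym (toℕ-fromℕ< (bd y p)) · cong toℕ (==⇒≡ q))))
  hit0 : ∀ y (h : ℕ → ℕ) → β (S y) * h (f y) ≡ ∑ {b} (λ c → β (S y ∧ (f y ≡ᵇ toℕ c)) * h (toℕ c))
  hit0 y h with S y in e
  ... | true = (+-identityʳ _) · sym ((∑-cong λ c → cong (λ u → β (u ∧ (f y ≡ᵇ toℕ c)) * h (toℕ c)) (sym e)) · hit1 y e h)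
  ... | false = sym (∑-0 {b})
 -- The sum is regrouped by the value of `f`. With `h` constant 1 and with `h` the identity this
 -- yields the two moments of the sibling profile.
 bins : ∀ (h : ℕ → ℕ) → ∑ (λ y → β (S y) * h (f y)) ≡ ∑ {b} (λ c → bin (toℕ c) * h (toℕ c))
 bins h = (∑-cong λ y → hit0 y h) · ∑-comm _ · (∑-cong λ c → ∑-*ʳ (h (toℕ c)) _)

incl : ∀ {m} (p q r : Fin m → Bool) → (∀ z → p z ≡ true → r z ≡ true) → (∀ z → q z ≡ true → r z ≡ true) → # p + # q ≤ # r + # (λ z → p z ∧ q z)
incl p q r h h' = subst₂ _≤_ (∑-+ _ _) (∑-+ _ _) (∑-mono λ z → aux (p z) (q z) (r z) (h z) (h' z)) where
 aux : ∀ p q r → (p ≡ true → r ≡ true) → (q ≡ true → r ≡ true) → β p + β q ≤ β r + β (p ∧ q)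
 aux true true r h h' rewrite h refl = ≤-refl
 aux true false r h h' rewrite h refl = ≤-refl
 aux false true r h h' rewrite h' refl = ≤-refl
 aux false false r h h' = z≤n

two≤ : ∀ {m} {P : Fin m → Bool} {a b : Fin m} → P a ≡ true → P b ≡ true → a ≢ b → 2 ≤ # P
two≤ {m} {P} {a} {b} p q ne = inj≤# {P = P} f inj h where
 f : Fin 2 → Fin m
 f 0F = a
 f 1F = b
 inj : ∀ i j → f i ≡ f j → i ≡ j
 inj 0F 0F _ = refl
 inj 0F 1F e = ⊥-elim (ne e)
 inj 1F 0F e = ⊥-elim (ne (sym e))
 inj 1F 1F _ = refl
 h : ∀ i → P (f i) ≡ true
 h 0F = p
 h 1F = q

-- Three times the first equation, subtracted from the second, leaves `m4 + 2 m5 + 3 m6 = 3`; the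
-- last two equations make `m4` even and `m5` a multiple of 5.
num6 : ∀ m3 m4 m5 m6 F4 F5 → m3 + (m4 + (m5 + m6)) ≡ 5 → 3 * m3 + (4 * m4 + (5 * m5 + 6 * m6)) ≡ 18 → 6 * m4 ≡ 4 * F4 → 6 * m5 ≡ 5 * F5 → m6 ≡ 1 × m3 ≡ 4
num6 m3 m4 0 m6 F4 F5 a b c e = go m4 F4 a b c where
 go : ∀ m4 F4 → m3 + (m4 + (0 + m6)) ≡ 5 → 3 * m3 + (4 * m4 + (0 + 6 * m6)) ≡ 18 → 6 * m4 ≡ 4 * F4 → m6 ≡ 1 × m3 ≡ 4
 go 0 F4 a b c = lia≡ (m3 ∷ m6 ∷ []) ((ν0 ⊹ ν1 ≋ κ 5) ∷ (3 ⊙ ν0 ⊹ 6 ⊙ ν1 ≋ κ 18) ∷ []) ν1 (κ 1) (a , b) , lia≡ (m3 ∷ m6 ∷ []) ((ν0 ⊹ ν1 ≋ κ 5) ∷ (3 ⊙ ν0 ⊹ 6 ⊙ ν1 ≋ κ 18) ∷ []) ν0 (κ 4) (a , b)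
 go 1 0 a b ()
 go 1 1 a b ()
 go 1 (2+ F4) a b c = lia (F4 ∷ []) ((κ 6 ≋ 4 ⊙ (κ 2 ⊹ ν0)) ∷ []) c
 go 2 F4 a b c = ⊥-elim (odd m6 (lia≡ (m3 ∷ m6 ∷ []) ((ν0 ⊹ (κ 2 ⊹ ν1) ≋ κ 5) ∷ (3 ⊙ ν0 ⊹ (κ 8 ⊹ 6 ⊙ ν1) ≋ κ 18) ∷ []) (3 ⊙ ν1) (κ 1) (a , b))) where
  odd : ∀ m → 3 * m ≡ 1 → ⊥
  odd (suc m) e = lia (m ∷ []) ((3 ⊙ (κ 1 ⊹ ν0) ≋ κ 1) ∷ []) e
 go 3 0 a b ()
 go 3 1 a b ()
 go 3 2 a b ()
 go 3 3 a b ()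
 go 3 4 a b ()
 go 3 (5+ F4) a b c = lia (F4 ∷ []) ((κ 18 ≋ 4 ⊙ (κ 5 ⊹ ν0)) ∷ []) c
 go (4+ m4) F4 a b c = lia (m3 ∷ m4 ∷ m6 ∷ []) ((ν0 ⊹ (κ 4 ⊹ ν1 ⊹ ν2) ≋ κ 5) ∷ (3 ⊙ ν0 ⊹ (4 ⊙ (κ 4 ⊹ ν1) ⊹ 6 ⊙ ν2) ≋ κ 18) ∷ []) (a , b)
num6 m3 m4 1 m6 F4 0 a b c ()
num6 m3 m4 1 m6 F4 1 a b c ()
num6 m3 m4 1 m6 F4 (2+ F5) a b c e = lia (F5 ∷ []) ((κ 6 ≋ 5 ⊙ (κ 2 ⊹ ν0)) ∷ []) e
num6 m3 m4 (2+ m5) m6 F4 F5 a b c e = lia (m3 ∷ m4 ∷ m5 ∷ m6 ∷ []) ((ν0 ⊹ (ν1 ⊹ (κ 2 ⊹ ν2 ⊹ ν3)) ≋ κ 5) ∷ (3 ⊙ ν0 ⊹ (4 ⊙ ν1 ⊹ (5 ⊙ (κ 2 ⊹ ν2) ⊹ 6 ⊙ ν3)) ≋ κ 18) ∷ []) (a , b)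

num4 : ∀ a b c e → a + (b + (c + e)) ≡ 3 → a + (2 * b + (3 * c + 4 * e)) ≡ 4 → b ≡ 1 × a ≡ 2
num4 a b 0 0 p q = lia≡ (a ∷ b ∷ []) ((ν0 ⊹ (ν1 ⊹ κ 0) ≋ κ 3) ∷ (ν0 ⊹ (2 ⊙ ν1 ⊹ κ 0) ≋ κ 4) ∷ []) ν1 (κ 1) (p , q) , lia≡ (a ∷ b ∷ []) ((ν0 ⊹ (ν1 ⊹ κ 0) ≋ κ 3) ∷ (ν0 ⊹ (2 ⊙ ν1 ⊹ κ 0) ≋ κ 4) ∷ []) ν0 (κ 2) (p , q)
num4 a b (suc c) e p q = lia (a ∷ b ∷ c ∷ e ∷ []) ((ν0 ⊹ (ν1 ⊹ (κ 1 ⊹ ν2 ⊹ ν3)) ≋ κ 3) ∷ (ν0 ⊹ (2 ⊙ ν1 ⊹ (3 ⊙ (κ 1 ⊹ ν2) ⊹ 4 ⊙ ν3)) ≋ κ 4) ∷ []) (p , q)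
num4 a b 0 (suc e) p q = lia (a ∷ b ∷ e ∷ []) ((ν0 ⊹ (ν1 ⊹ (κ 1 ⊹ ν2)) ≋ κ 3) ∷ (ν0 ⊹ (2 ⊙ ν1 ⊹ 4 ⊙ (κ 1 ⊹ ν2)) ≋ κ 4) ∷ []) (p , q)

s-cases : ∀ s w → s * w ≡ 4 → s ≡ 1 ⊎ s ≡ 2 ⊎ s ≡ 4
s-cases 1 w e = inj₁ refl
s-cases 2 w e = in1 refl
s-cases 4 w e = inj₂ (inj₂ refl)
s-cases 3 0 ()
s-cases 3 1 ()
s-cases 3 (2+ w) e = lia (w ∷ []) ((3 ⊙ (κ 2 ⊹ ν0) ≋ κ 4) ∷ []) e
s-cases (5+ s) 0 e = ⊥-elim (0≢1+n (sym (*-zeroʳ s) · e))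
s-cases (5+ s) (suc w) e = lia (w ∷ s * suc w ∷ []) ((κ 5 ⊹ 5 ⊙ ν0 ⊹ ν1 ≋ κ 4) ∷ []) (lem w (s * suc w) · e) where
 lem : ∀ w u → 5 + 5 * w + u ≡ suc w + (suc w + (suc w + (suc w + (suc w + u))))
 lem = solve-∀

no46 : ∀ m → 4 * m ≡ 6 → ⊥
no46 0 ()
no46 1 ()
no46 (2+ m) e = lia (m ∷ []) ((4 ⊙ (κ 2 ⊹ ν0) ≋ κ 6) ∷ []) e

-- The difference of the first two equations is `b + 2 c + 3 e = 3`, and the third makes `c` a
-- multiple of 3, hence 0.
num6s : ∀ a b c e F → a + (b + (c + e)) ≡ 3 → a + (2 * b + (3 * c + 4 * e)) ≡ 6 → 4 * c ≡ 3 * F → (b ≡ 3) ⊎ (e ≡ 1 × a ≡ 2)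
num6s a b 0 0 F p q r = inj₁ (lia≡ (a ∷ b ∷ []) ((ν0 ⊹ (ν1 ⊹ κ 0) ≋ κ 3) ∷ (ν0 ⊹ (2 ⊙ ν1 ⊹ κ 0) ≋ κ 6) ∷ []) ν1 (κ 3) (p , q))
num6s a b 0 1 F p q r = inj₂ (refl , lia≡ (a ∷ b ∷ []) ((ν0 ⊹ (ν1 ⊹ κ 1) ≋ κ 3) ∷ (ν0 ⊹ (2 ⊙ ν1 ⊹ κ 4) ≋ κ 6) ∷ []) ν0 (κ 2) (p , q))
num6s a b 0 (2+ e) F p q r = lia (a ∷ b ∷ e ∷ []) ((ν0 ⊹ (ν1 ⊹ (κ 2 ⊹ ν2)) ≋ κ 3) ∷ (ν0 ⊹ (2 ⊙ ν1 ⊹ 4 ⊙ (κ 2 ⊹ ν2)) ≋ κ 6) ∷ []) (p , q)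
num6s a b 1 e 0 p q ()
num6s a b 1 e 1 p q ()
num6s a b 1 e (2+ F) p q r = lia (F ∷ []) ((κ 4 ≋ 3 ⊙ (κ 2 ⊹ ν0)) ∷ []) r
num6s a b (2+ c) e F p q r = lia (a ∷ b ∷ c ∷ e ∷ []) ((ν0 ⊹ (ν1 ⊹ (κ 2 ⊹ ν2 ⊹ ν3)) ≋ κ 3) ∷ (ν0 ⊹ (2 ⊙ ν1 ⊹ (3 ⊙ (κ 2 ⊹ ν2) ⊹ 4 ⊙ ν3)) ≋ κ 6) ∷ []) (p , q)

≡-sum : ∀ a b c e → a + (b + (c + e)) ≡ 3 → a + (2 * b + (3 * c + 4 * e)) ≡ 3 → a ≡ 3
≡-sum a b c e p q = lia≡ (a ∷ b ∷ c ∷ e ∷ []) ((ν0 ⊹ (ν1 ⊹ (ν2 ⊹ ν3)) ≋ κ 3) ∷ (ν0 ⊹ (2 ⊙ ν1 ⊹ (3 ⊙ ν2 ⊹ 4 ⊙ ν3)) ≋ κ 3) ∷ []) ν0 (κ 3) (p , q)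

pair∃ : ∀ {m} {P : Fin m → Bool} → 2 ≤ # P → ∃₂ λ a b → P a ≡ true × P b ≡ true × a ≢ b
pair∃ {P = P} p with # P | enum P
pair∃ (≤2+ _) | 2+ l | f , h , inj , _ = f 0F , f 1F , h 0F , h 1F , λ e → 0F≢1F (inj 0F 1F e) where
 0F≢1F : _≢_ {A = Fin (2+ l)} 0F 1F
 0F≢1F ()

unique : ∀ {m} {P : Fin m → Bool} {a b : Fin m} → # P ≡ 1 → P a ≡ true → P b ≡ true → a ≡ b
unique {P = P} {a} {b} e p q with a F.≟ b
... | yes r = r
... | no r = ⊥-elim (1+n≰n (two≤ {P = P} p q r » eq≤ e))

-- The second equation gives `u = 2 r`; then `4 q = 6 r` makes `r` even.
r-two : ∀ q r u → 4 * q ≡ u * 3 → 6 * r ≡ u * 3 → r ≤ 3 → 1 ≤ u → r ≡ 2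
r-two q 0 u a b c e = lia (u ∷ []) ((κ 0 ≋ 3 ⊙ ν0) ∷ (κ 1 ≼ ν0) ∷ []) (b · *-comm u 3 , e)
r-two q 1 u a b c e = ⊥-elim (no46 q (a · sym b))
r-two q 2 u a b c e = refl
r-two q 3 u a b c e = ⊥-elim (odd q (a · sym b)) where
 odd : ∀ q → 4 * q ≡ 18 → ⊥
 odd (5+ q) e = lia (q ∷ []) ((4 ⊙ (κ 5 ⊹ ν0) ≋ κ 18) ∷ []) e
 odd 0 ()
 odd 1 ()
 odd 2 ()
 odd 3 ()
 odd 4 ()
r-two q (4+ r) u a b (≤3+ ()) e

even46 : ∀ m c → 4 * m ≡ 6 * c → c ≤ 2 → c ≡ 0 ⊎ c ≡ 2
even46 m 0 _ _ = inj₁ refl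
even46 m 1 e _ = ⊥-elim (no46 m e)
even46 m 2 _ _ = inj₂ refl
even46 m (3+ c) _ (≤2+ ())

-- `r` is 4 or 8, so the factor 3 of `6 q` must divide `t`.
mul12 : ∀ r m₊ q t → r ≡ 4 * m₊ → r * t ≡ 6 * q → 1 ≤ t → r < 12 → 1 ≤ r → 3 ≤ t
mul12 r m₊ q (3+ t) _ _ _ _ _ = ≤3+ z≤n
mul12 .(4 * 0) 0 q 1 refl e _ _ ()
mul12 .(4 * 0) 0 q 2 refl e _ _ ()
mul12 .(4 * 1) 1 q 1 refl e _ _ _ = ⊥-elim (bad q e) where
 bad : ∀ q → 4 ≡ 6 * q → ⊥
 bad (suc q) e = lia (q ∷ []) ((κ 4 ≋ 6 ⊙ (κ 1 ⊹ ν0)) ∷ []) e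
mul12 .(4 * 1) 1 q 2 refl e _ _ _ = ⊥-elim (bad q e) where
 bad : ∀ q → 8 ≡ 6 * q → ⊥
 bad 1 ()
 bad (2+ q) e = lia (q ∷ []) ((κ 8 ≋ 6 ⊙ (κ 2 ⊹ ν0)) ∷ []) e
mul12 .(4 * 2) 2 q 1 refl e _ _ _ = ⊥-elim (bad q e) where
 bad : ∀ q → 8 ≡ 6 * q → ⊥
 bad 1 ()
 bad (2+ q) e = lia (q ∷ []) ((κ 8 ≋ 6 ⊙ (κ 2 ⊹ ν0)) ∷ []) e
mul12 .(4 * 2) 2 q 2 refl e _ _ _ = ⊥-elim (bad q e) where
 bad : ∀ q → 16 ≡ 6 * q → ⊥
 bad 1 ()
 bad 2 ()
 bad (3+ q) e = lia (q ∷ []) ((κ 16 ≋ 6 ⊙ (κ 3 ⊹ ν0)) ∷ []) e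
mul12 .(4 * 3+ m₊) (3+ m₊) q t refl e _ lt _ = lia (m₊ ∷ []) ((κ 1 ⊹ 4 ⊙ (κ 3 ⊹ ν0) ≼ κ 12) ∷ []) lt

Cases : Bool → Set
Cases b = (b ≡ true) ⊎ (b ≡ false)

β1 : ∀ {b} → b ≡ true → β b ≡ 1
β1 refl = refl

num12 : ∀ r q m → r ≡ 6 * q → r ≡ 4 * m → 1 ≤ r → r ≤ 12 → r ≡ 12
num12 _ 1 1 refl () _ _
num12 _ 1 (2+ m) refl e _ _ = lia (m ∷ []) ((κ 6 ≋ 4 ⊙ (κ 2 ⊹ ν0)) ∷ []) e
num12 _ 2 m refl e _ _ = refl
num12 _ (3+ q) m refl e _ l = lia (q ∷ []) ((6 ⊙ (κ 3 ⊹ ν0) ≼ κ 12) ∷ []) l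

num6q : ∀ a q → a ≡ 6 * q → 1 ≤ a → a ≤ 6 → a ≡ 6
num6q _ 1 refl _ _ = refl
num6q _ (2+ q) refl _ l = lia (q ∷ []) ((6 ⊙ (κ 2 ⊹ ν0) ≼ κ 6) ∷ []) l

*-pos : ∀ {a b} → 1 ≤ a → 1 ≤ b → 1 ≤ a * b
*-pos (s≤s _) (s≤s _) = z<s

-- Either `v = 1` and `r = 6`, against `r u ≤ 4`, or `v = 2`, `r = 3` and `u = 1`, where 3 is no
-- multiple of 4.
num36 : ∀ r v u q → r * v ≡ 6 → 2 * v ≤ 4 → r * u ≤ 4 → 1 ≤ u → r * u ≡ 4 * q → ⊥
num36 r zero u q e _ _ _ _ = 0≢1+n (sym (*-zeroʳ r) · e)
num36 r 1 u q e _ l p _ = 1+n≰n {4} (n≤1+n 5 » eq≤ (sym e · *-identityʳ r) » eq≥ (*-identityʳ r) » *-monoʳ-≤ r p » l)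
num36 0 2 u q () _ _ _ _
num36 1 2 u q () _ _ _ _
num36 2 2 u q () _ _ _ _
num36 3 2 1 1 e _ _ _ ()
num36 3 2 1 (2+ q) e _ _ _ f = lia (q ∷ []) ((κ 3 ≋ 4 ⊙ (κ 2 ⊹ ν0)) ∷ []) f
num36 3 2 (2+ u) q e _ l _ _ = lia (u ∷ []) ((3 ⊙ (κ 2 ⊹ ν0) ≼ κ 4) ∷ []) l
num36 (4+ r) 2 u q e _ _ _ _ = lia (r ∷ []) (((κ 8 ⊹ 2 ⊙ ν0) ≋ κ 6) ∷ []) (lem r · e) where
 lem : ∀ r → 8 + 2 * r ≡ (4 + r) * 2
 lem = solve-∀
num36 r (3+ v) u q _ l _ _ _ = lia (v ∷ []) ((2 ⊙ (κ 3 ⊹ ν0) ≼ κ 4) ∷ []) l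

-- Short lists of distinct vertices

NotIn : Fin n → Vec (Fin n) m → Set
NotIn x [] = ⊤
NotIn x (y ∷ ys) = x ≢ y × NotIn x ys

Distinct : Vec (Fin n) m → Set
Distinct [] = ⊤
Distinct (x ∷ xs) = NotIn x xs × Distinct xs

Inside : (Fin n → Bool) → Vec (Fin n) m → Set
Inside P [] = ⊤
Inside P (x ∷ xs) = P x ≡ true × Inside P xs

In : Fin n → Vec (Fin n) m → Set
In x [] = ⊥
In x (y ∷ ys) = x ≡ y ⊎ In x ys

private
 notIn : ∀ {x : Fin n} (xs : Vec (Fin n) m) → NotIn x xs → ∀ i → x ≢ lookup xs i
 notIn (y ∷ ys) (p , q) zero = p
 notIn (y ∷ ys) (p , q) (suc i) = notIn ys q i
 inj-Sets : (xs : Vec (Fin n) m) → Distinct xs → ∀ i j → lookup xs i ≡ lookup xs j → i ≡ j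
 inj-Sets (x ∷ xs) d zero zero e = refl
 inj-Sets (x ∷ xs) (p , d) zero (suc j) e = ⊥-elim (notIn xs p j e)
 inj-Sets (x ∷ xs) (p , d) (suc i) zero e = ⊥-elim (notIn xs p i (sym e))
 inj-Sets (x ∷ xs) (p , d) (suc i) (suc j) e = cong suc (inj-Sets xs d i j e)
 inside : ∀ {P : Fin n → Bool} (xs : Vec (Fin n) m) → Inside P xs → ∀ i → P (lookup xs i) ≡ true
 inside (x ∷ xs) (p , q) zero = p
 inside (x ∷ xs) (p , q) (suc i) = inside xs q i
 isIn-Sets : ∀ {x : Fin n} (xs : Vec (Fin n) m) i → lookup xs i ≡ x → In x xs
 isIn-Sets (y ∷ ys) zero e = inj₁ (sym e)
 isIn-Sets (y ∷ ys) (suc i) e = inj₂ (isIn-Sets ys i e)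

size≥ : ∀ {P : Fin n → Bool} (xs : Vec (Fin n) m) → Distinct xs → Inside P xs → m ≤ # P
size≥ {P = P} xs d h = inj≤# {P = P} (lookup xs) (inj-Sets xs d) (inside xs h)

member : ∀ {P : Fin n → Bool} (xs : Vec (Fin n) m) → Distinct xs → Inside P xs → # P ≤ m → ∀ {x} → P x ≡ true → In x xs
member {P = P} xs d h l {x} p = let (i , e) = covers {P = P} (lookup xs) (inj-Sets xs d) (inside xs h) l x p in isIn-Sets xs i e

#≤1 : ∀ {P : Fin n → Bool} → (∀ {a b} → P a ≡ true → P b ≡ true → a ≡ b) → # P ≤ 1
#≤1 {P = P} h with # P | enum P
... | 0 | _ = z≤n
... | 1 | _ = z<s
... | 2+ l | f , p , i , _ with i zero (suc zero) (h (p zero) (p (suc zero)))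
... | ()

third : ∀ {P : Fin n → Bool} {a b c} → # P ≡ 2 → P a ≡ true → P b ≡ true → P c ≡ true → a ≢ b → a ≢ c → b ≡ c
third {P = P} {a} {b} {c} e p q r ab ac with member {P = P} (a ∷ b ∷ []) ((ab , tt) , tt , tt) (p , q , tt) (eq≤ e) r
... | inj₁ x = ⊥-elim (ac (sym x))
... | in1 x = sym x

cover2 : ∀ (p q r : Fin n → Bool) → (∀ z → p z ≡ true → r z ≡ true) → (∀ z → q z ≡ true → r z ≡ true) → (∀ z → p z ≡ true → q z ≡ true → ⊥) →
         # r ≤ # p + # q → ∀ {z} → r z ≡ true → p z ≡ true ⊎ q z ≡ true
cover2 p q r h h' dis l {z} c = spl (p z) (#-sub≡ {P = λ z → p z ∨ q z} {Q = r} sub (l » eq≥ (∑-+ _ _) » (∑-mono λ z → aux (p z) (q z) (dis z))) z c) where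
 spl : ∀ a {b} → a ∨ b ≡ true → a ≡ true ⊎ b ≡ true
 spl true e = inj₁ refl
 spl false e = inj₂ e
 sub : ∀ z → p z ∨ q z ≡ true → r z ≡ true
 sub z e with spl (p z) e
 ... | inj₁ a = h z a
 ... | inj₂ b = h' z b
 aux : ∀ a b → (a ≡ true → b ≡ true → ⊥) → β a + β b ≤ β (a ∨ b)
 aux true true f = ⊥-elim (f refl refl)
 aux true false f = ≤-refl
 aux false b f = ≤-refl

memᵇ : Fin n → Vec (Fin n) m → Bool
memᵇ x [] = false
memᵇ x (y ∷ ys) = (x == y) ∨ memᵇ x ys

∉⇒NotIn : ∀ {x : Fin n} (ys : Vec (Fin n) m) → memᵇ x ys ≡ false → NotIn x ys
∉⇒NotIn [] _ = tt
∉⇒NotIn {x = x} (y ∷ ys) p with x F.≟ y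
... | no ne = ne , ∉⇒NotIn ys p

#memᵇ≤ : (ys : Vec (Fin n) m) → # (λ x → memᵇ x ys) ≤ m
#memᵇ≤ {n} [] = eq≤ (∑-0 {n})
#memᵇ≤ (y ∷ ys) = (∑-mono λ x → aux (x == y) (memᵇ x ys)) » eq≤ (∑-+ _ _) » +-mono-≤ (eq≤ ((∑-cong λ z → sym (*-identityʳ _)) · ∑-pick' y (λ _ → 1))) (#memᵇ≤ ys) where
 aux : ∀ a b → β (a ∨ b) ≤ β a + β b
 aux true b = z<s
 aux false b = ≤-refl

fresh : ∀ {P : Fin n → Bool} (ys : Vec (Fin n) m) → m < # P → ∃ λ x → P x ≡ true × NotIn x ys
fresh {m = m} {P = P} ys l with #∃ {P = λ x → P x ∧ not (memᵇ x ys)} (+-cancelˡ-≤ m 1 _ (eq≤ (+-comm m 1) » l » eq≤ (#-split P (λ x → memᵇ x ys)) » +-monoˡ-≤ _ ((#-mono {Q = λ x → memᵇ x ys} λ x → ∧-snd {P x}) » #memᵇ≤ ys)))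
... | x , p = x , ∧-fst {P x} p , ∉⇒NotIn ys (not-t (∧-snd {P x} p))

toEnum : ∀ {P : Fin n → Bool} (xs : Vec (Fin n) m) → Distinct xs → Inside P xs → # P ≤ m → Enum P m
toEnum {P = P} xs d h l = lookup xs , inside xs h , inj-Sets xs d , λ x p → covers {P = P} (lookup xs) (inj-Sets xs d) (inside xs h) l x p

-- Arithmetic and tables for girth three

div2 : ∀ p q → 2 ≤ p → q * p ≡ 2 + (3 + p) * p → p ≡ 2
div2 p q l e = ≤-antisym (∣⇒≤ (∣m+n∣m⇒∣n (divides q (+-comm _ 2 · sym e)) (divides (3 + p) refl))) l

-- With `k = 2 + p` and `c = p + f` the equation becomes `s = 1 + (1 + p) f`, which exceeds `k` as
-- soon as `f ≥ 2`.
last1 : ∀ k s c → 2 ≤ k → k + (k ∸ 1) * c ≡ (k ∸ 1) * (k ∸ 1) + s → 1 ≤ s → s ≤ k → k ∸ 2 ≤ c → (s ≡ 1 × c ≡ k ∸ 2) ⊎ (s ≡ k × c ≡ k ∸ 1)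
last1 (suc zero) s c (s≤s ()) e l u h
last1 (2+ p) s c _ e l u h with m≤n⇒∃[o]m+o≡n h
... | zero , refl = inj₁ (+-cancelˡ-≡ (suc p * suc p) _ _ (sym e · lem p) , +-identityʳ p) where
 lem : ∀ p → 2 + p + suc p * (p + 0) ≡ suc p * suc p + 1
 lem = solve-∀
... | suc zero , refl = inj₂ (+-cancelˡ-≡ (suc p * suc p) _ _ (sym e · lem p) , +-comm p 1) where
 lem : ∀ p → 2 + p + suc p * (p + 1) ≡ suc p * suc p + (2 + p)
 lem = solve-∀
... | 2+ f , refl = ⊥-elim (1+n≰n (s≤s u » lem' p » m≤m+n _ (p + (f + p * f)) » eq≥ (+-cancelˡ-≡ (suc p * suc p) _ _ (sym e · lem p f)))) where
 lem : ∀ p f → 2 + p + suc p * (p + 2+ f) ≡ suc p * suc p + (3 + p + (p + (f + p * f)))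
 lem = solve-∀
 lem' : ∀ p → suc (2 + p) ≤ 3 + p
 lem' p = ≤-refl

shifts : ∀ {l} m .{{_ : NonZero m}} → Vec ℕ l → Fin m → Vec (Fin m) l
shifts m S p = V.map (λ s → (toℕ p + s) mod m) S

Joined : ∀ {m l} → (Fin m → Vec (Fin m) l) → Fin m → Fin m → Set
Joined o p q = (∃ λ i → lookup (o p) i ≡ q) ⊎ ∃ λ i → ∃ λ j → lookup (o (lookup (o p) i)) j ≡ q

-- `o` lists the out-neighbours in a digraph on `m` points, and `R` is its blow-up in which every
-- point is replaced by `c` copies. All three clauses are decidable, so for the sporadic digraphs
-- they hold by evaluation.
Table : ∀ {m l} c → (Fin (c * m) → Fin (c * m) → Bool) → (Fin m → Vec (Fin m) l) → Set
Table {m} c R o = (∀ p i j → lookup (o p) i ≡ lookup (o p) j → i ≡ j) × (∀ p q → p ≡ q ⊎ Joined o p q ⊎ Joined o q p) ×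
 (∀ p q → R p q ≡ does (any? λ i → lookup (o (snd (remQuot {c} m p))) i F.≟ snd (remQuot {c} m q)))

table? : ∀ {m l} c R (o : Fin m → Vec (Fin m) l) → Dec (Table c R o)
table? {m} c R o = (all? λ p → all? λ i → all? λ j → (lookup (o p) i F.≟ lookup (o p) j) →-dec (i F.≟ j)) ×-dec (all? λ p → all? λ q → (p F.≟ q) ⊎-dec (jn p q ⊎-dec jn q p)) ×-dec
 (all? λ p → all? λ q → R p q 𝔹.≟ does (any? λ i → lookup (o (snd (remQuot {c} m p))) i F.≟ snd (remQuot {c} m q))) where
 jn : ∀ p q → Dec (Joined o p q)
 jn p q = (any? λ i → lookup (o p) i F.≟ q) ⊎-dec (any? λ i → any? λ j → lookup (o (lookup (o p) i)) j F.≟ q)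

outside2 : ∀ {n} (p q r : Fin n → Bool) → (∀ z → p z ≡ true → r z ≡ true) → (∀ z → q z ≡ true → r z ≡ true) → # r + # (λ z → p z ∧ q z) ≡ # p + # q + # (λ z → r z ∧ (not (p z) ∧ not (q z)))
outside2 p q r h h' = sym (∑-+ _ _) · (∑-cong λ z → aux (p z) (q z) (r z) (h z) (h' z)) · ∑-+ _ _ · cong (_+ # (λ z → r z ∧ (not (p z) ∧ not (q z)))) (∑-+ _ _) where
 aux : ∀ p q r → (p ≡ true → r ≡ true) → (q ≡ true → r ≡ true) → β r + β (p ∧ q) ≡ β p + β q + β (r ∧ (not p ∧ not q))
 aux true true true h h' = refl
 aux true true false h h' = t≢f (h refl) refl
 aux true false true h h' = refl
 aux true false false h h' = t≢f (h refl) refl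
 aux false true true h h' = refl
 aux false true false h h' = t≢f (h' refl) refl
 aux false false true h h' = refl
 aux false false false h h' = refl

disj2 : ∀ {n} (p q r : Fin n → Bool) → (∀ z → p z ≡ true → r z ≡ true) → (∀ z → q z ≡ true → r z ≡ true) → (∀ z → p z ≡ true → q z ≡ true → ⊥) → # p + # q ≤ # r
disj2 p q r h h' dis = eq≥ (∑-+ _ _) » (∑-mono λ z → aux (p z) (q z) (r z) (h z) (h' z) (dis z)) where
 aux : ∀ p q r → (p ≡ true → r ≡ true) → (q ≡ true → r ≡ true) → (p ≡ true → q ≡ true → ⊥) → β p + β q ≤ β r
 aux true true r h h' d = ⊥-elim (d refl refl)
 aux true false r h h' d rewrite h refl = ≤-refl
 aux false true r h h' d rewrite h' refl = ≤-refl
 aux false false r h h' d = z≤n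

-- The indices are `P = k − 2`, the common value `c` of `co` on siblings, and the sum σ of the
-- numbers of two-paths to the two non-returning ends over an arc. The digit in a constructor is
-- `k`.
data Param : ℕ → ℕ → ℕ → Set where
 v4 : Param 2 1 3
 v5 : Param 3 2 4
 v6 : Param 4 3 5
 v9 : Param 7 6 8
 u4 : Param 2 2 6

-- The first equation says `σ = (1 + p) δ` with `δ = c + 2 − p`, and the upper bound on σ leaves
-- `δ = 1` or `δ = 2`. Then the equation for `N` makes `c` a divisor of 6, respectively `p` a
-- divisor of 2.
param : ∀ p c σ N → 2 ≤ p → p ≤ 2 + c → 2 + p + suc p * c ≡ p * p + σ → 1 ≤ σ → σ ≤ 4 + 2 * p → N * c ≡ (2 + p) * (1 + p) → Param p c σ
param p c σ N l h e lo hi f = let (δ , eq) = m≤n⇒∃[o]m+o≡n h in pick δ (σ≡ δ eq) eq where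
 σ≡ : ∀ δ → p + δ ≡ 2 + c → σ ≡ suc p * δ
 σ≡ δ eq = +-cancelˡ-≡ (suc p * p + (2 + p)) _ _ (lem1 p σ · cong (_+ 2 * (1 + p)) (sym e) · lem2 p c · cong (λ u → suc p * u + (2 + p)) (sym eq) · lem3 p δ) where
  lem1 : ∀ p σ → suc p * p + (2 + p) + σ ≡ p * p + σ + 2 * (1 + p)
  lem1 = solve-∀
  lem2 : ∀ p c → 2 + p + suc p * c + 2 * (1 + p) ≡ suc p * (2 + c) + (2 + p)
  lem2 = solve-∀
  lem3 : ∀ p δ → suc p * (p + δ) + (2 + p) ≡ suc p * p + (2 + p) + suc p * δ
  lem3 = solve-∀
 pick : ∀ δ → σ ≡ suc p * δ → p + δ ≡ 2 + c → Param p c σ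
 pick 0 s _ = ⊥-elim (1+n≰n (lo » eq≤ (s · *-zeroʳ (suc p))))
 pick 1 s q = six p c σ (s · *-identityʳ (suc p)) (+-cancelˡ-≡ 1 p (suc c) (+-comm 1 p · q)) f l where
  six : ∀ p c σ → σ ≡ suc p → p ≡ suc c → N * c ≡ (2 + p) * (1 + p) → 2 ≤ p → Param p c σ
  six .(suc c) c .(2 + c) refl refl f l = div c (∣m+n∣m⇒∣n {c} {(5 + c) * c} {6} (divides N (lem c · sym f)) (divides (5 + c) refl)) l where
   lem : ∀ c → (5 + c) * c + 6 ≡ (3 + c) * (2 + c)
   lem = solve-∀
   div : ∀ c → c ∣ 6 → 2 ≤ suc c → Param (suc c) c (2 + c)
   div 0 _ (s≤s ())
   div 1 _ _ = v4
   div 2 _ _ = v5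
   div 3 _ _ = v6
   div 4 e _ = ⊥-elim (from-no (4 ∣? 6) e)
   div 5 e _ = ⊥-elim (from-no (5 ∣? 6) e)
   div 6 _ _ = v9
   div (7+ c) e _ = ⊥-elim (1+n≰n (≤7+ (z≤n {c}) » ∣⇒≤ e))
 pick 2 s q = two p c σ (s · *-comm (suc p) 2) (+-cancelˡ-≡ 2 p c (+-comm 2 p · q)) f l where
  two : ∀ p c σ → σ ≡ 2 * suc p → p ≡ c → N * c ≡ (2 + p) * (1 + p) → 2 ≤ p → Param p c σ
  two p .p .(2 * suc p) refl refl f l = div p (∣m+n∣m⇒∣n {p} {(3 + p) * p} {2} (divides N (lem p · sym f)) (divides (3 + p) refl)) l where
   lem : ∀ p → (3 + p) * p + 2 ≡ (2 + p) * (1 + p)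
   lem = solve-∀
   div : ∀ p → p ∣ 2 → 2 ≤ p → Param p p (2 * suc p)
   div p e l with ≤-antisym (∣⇒≤ e) l
   ... | refl = u4
 pick (3+ δ) s _ = lia (p ∷ suc p * δ ∷ σ ∷ []) ((ν2 ≋ κ 3 ⊹ 3 ⊙ ν0 ⊹ ν1) ∷ (ν2 ≼ κ 4 ⊹ 2 ⊙ ν0) ∷ (κ 2 ≼ ν0) ∷ []) (s · lem p δ , hi , l) where
  lem : ∀ p δ → suc p * 3+ δ ≡ 3 + 3 * p + suc p * δ
  lem = solve-∀

-- One class of vertices at distance two: its size N, its multiplicity e over an arc, its number s of
-- two-paths, and the number n₊ of out-neighbours of its members in the sibling class of size M.
record Dat (k M s e : ℕ) : Set where
 constructor dat
 field
  N t n₊ : ℕ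
  size1 : N * s ≡ k * e
  weight : M * t ≡ N * n₊
  lo : k ≤ 2 + n₊
  hi : n₊ ≤ k

private
 no24 : Dat 4 12 2 1 → ⊥
 no24 (dat N t n₊ e f lo hi) with *-cancelʳ-≡ N 2 2 e
 no24 (dat _ t 2 e f lo hi) | refl = from-no (12 ∣? 4) (divides t (sym f · *-comm 12 t))
 no24 (dat _ t 3 e f lo hi) | refl = from-no (12 ∣? 6) (divides t (sym f · *-comm 12 t))
 no24 (dat _ t 4 e f lo hi) | refl = from-no (12 ∣? 8) (divides t (sym f · *-comm 12 t))
 no24 (dat _ t 0 e f (≤2+ ()) hi) | refl
 no24 (dat _ t 1 e f (≤3+ ()) hi) | refl
 no24 (dat _ t (5+ n₊) e f lo (≤4+ ())) | refl
 no6 : Dat 6 10 2 1 → ⊥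
 no6 (dat N t n₊ e f lo hi) with *-cancelʳ-≡ N 3 2 e
 no6 (dat _ t 4 e f lo hi) | refl = from-no (10 ∣? 12) (divides t (sym f · *-comm 10 t))
 no6 (dat _ t 5 e f lo hi) | refl = from-no (10 ∣? 15) (divides t (sym f · *-comm 10 t))
 no6 (dat _ t 6 e f lo hi) | refl = from-no (10 ∣? 18) (divides t (sym f · *-comm 10 t))
 no6 (dat _ t 0 e f (≤2+ ()) hi) | refl
 no6 (dat _ t 1 e f (≤3+ ()) hi) | refl
 no6 (dat _ t 2 e f (≤4+ ()) hi) | refl
 no6 (dat _ t 3 e f (≤5+ ()) hi) | refl
 no6 (dat _ t (7+ n₊) e f lo (≤6+ ())) | refl
 no44 : Dat 4 6 4 1 → ⊥
 no44 (dat N t n₊ e f lo hi) with *-cancelʳ-≡ N 1 4 e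
 no44 (dat _ t 2 e f lo hi) | refl = from-no (6 ∣? 2) (divides t (sym f · *-comm 6 t))
 no44 (dat _ t 3 e f lo hi) | refl = from-no (6 ∣? 3) (divides t (sym f · *-comm 6 t))
 no44 (dat _ t 4 e f lo hi) | refl = from-no (6 ∣? 4) (divides t (sym f · *-comm 6 t))
 no44 (dat _ t 0 e f (≤2+ ()) hi) | refl
 no44 (dat _ t 1 e f (≤3+ ()) hi) | refl
 no44 (dat _ t (5+ n₊) e f lo (≤4+ ())) | refl
 nodat : ∀ {k M s e} → ¬ (s ∣ k * e) → Dat k M s e → ⊥
 nodat h D = h (divides (Dat.N D) (sym (Dat.size1 D)))
 no5 : (D : Dat 5 10 2 2) → Dat.n₊ D ≡ 5 → ⊥
 no5 (dat N t n₊ e f lo hi) refl with *-cancelʳ-≡ N 5 2 e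
 ... | refl = from-no (10 ∣? 25) (divides t (sym f · *-comm 10 t))
 half : ∀ s {m} → s + s ≡ m + m → s ≡ m
 half s {m} e = *-cancelʳ-≡ s m 2 (dbl s · e · sym (dbl m)) where
  dbl : ∀ a → a * 2 ≡ a + a
  dbl a = *-comm a 2 · cong (a +_) (+-identityʳ a)
 oddsum : ∀ s m → s + s ≡ suc (m + m) → ⊥
 oddsum zero m ()
 oddsum (suc s) zero e = 0≢1+n (sym (sym (+-suc s s) · suc-injective e))
 oddsum (suc s) (suc m) e = oddsum s m (suc-injective (sym (+-suc s s) · suc-injective e · cong suc (+-suc m m)))

-- Both ends lie in one class, so `s` is half of σ. Divisibility settles everything except `v5`,
-- where `n₊ = 4` would be consistent; there the geometric information `n₊ = 5` is required from the
-- caller.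
killSame : ∀ {p c σ} → Param p c σ → ∀ M s → M * c ≡ (2 + p) * (1 + p) → s + s ≡ σ → (D : Dat (2 + p) M s 2) → (s ≡ 2 → c ≡ 2 → p ≡ 3 → Dat.n₊ D ≡ 5) → ⊥
killSame v4 M s f e D h = oddsum s 1 e
killSame v5 M s f e D h with half s {2} e | *-cancelʳ-≡ M 10 2 f
... | refl | refl = no5 D (h refl refl refl)
killSame v6 M s f e D h = oddsum s 2 e
killSame v9 M s f e D h with half s {4} e
... | refl = nodat (from-no (4 ∣? 18)) D
killSame u4 M s f e D h with half s {3} e
... | refl = nodat (from-no (3 ∣? 8)) D

-- The ends lie in different classes, so each `s` divides `k`. Only the splittings treated by
-- `no24`, `no6` and `no44` survive this and need the weights.
killTwo : ∀ {p c σ} → Param p c σ → ∀ M s s' → M * c ≡ (2 + p) * (1 + p) → s + s' ≡ σ → 1 ≤ s → 1 ≤ s' → s ≤ 2 + p → s' ≤ 2 + p → Dat (2 + p) M s 1 → Dat (2 + p) M s' 1 → ⊥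
killTwo v4 M 1 2 f e _ _ _ _ D D' = no24 (subst (λ m → Dat 4 m 2 1) (sym (*-identityʳ M) · f) D')
killTwo v4 M 2 1 f e _ _ _ _ D D' = no24 (subst (λ m → Dat 4 m 2 1) (sym (*-identityʳ M) · f) D)
killTwo v4 M 3 (suc _) f () _ _ _ _ D D'
killTwo v5 M 1 3 f e _ _ _ _ D D' = nodat (from-no (3 ∣? 5)) D'
killTwo v5 M 2 2 f e _ _ _ _ D D' = nodat (from-no (2 ∣? 5)) D
killTwo v5 M 3 1 f e _ _ _ _ D D' = nodat (from-no (3 ∣? 5)) D
killTwo v5 M 4 (suc _) f () _ _ _ _ D D'
killTwo v6 M 1 4 f e _ _ _ _ D D' = nodat (from-no (4 ∣? 6)) D'
killTwo v6 M 2 3 f e _ _ _ _ D D' = no6 (subst (λ m → Dat 6 m 2 1) (*-cancelʳ-≡ M 10 3 f) D)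
killTwo v6 M 3 2 f e _ _ _ _ D D' = no6 (subst (λ m → Dat 6 m 2 1) (*-cancelʳ-≡ M 10 3 f) D')
killTwo v6 M 4 1 f e _ _ _ _ D D' = nodat (from-no (4 ∣? 6)) D
killTwo v6 M 5 (suc _) f () _ _ _ _ D D'
killTwo v9 M 1 7 f e _ _ _ _ D D' = nodat (from-no (7 ∣? 9)) D'
killTwo v9 M 2 6 f e _ _ _ _ D D' = nodat (from-no (2 ∣? 9)) D
killTwo v9 M 3 5 f e _ _ _ _ D D' = nodat (from-no (5 ∣? 9)) D'
killTwo v9 M 4 4 f e _ _ _ _ D D' = nodat (from-no (4 ∣? 9)) D
killTwo v9 M 5 3 f e _ _ _ _ D D' = nodat (from-no (5 ∣? 9)) D
killTwo v9 M 6 2 f e _ _ _ _ D D' = nodat (from-no (6 ∣? 9)) D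
killTwo v9 M 7 1 f e _ _ _ _ D D' = nodat (from-no (7 ∣? 9)) D
killTwo v9 M 8 (suc _) f () _ _ _ _ D D'
killTwo u4 M 2 4 f e _ _ _ _ D D' = no44 (subst (λ m → Dat 4 m 4 1) (*-cancelʳ-≡ M 6 2 f) D')
killTwo u4 M 3 3 f e _ _ _ _ D D' = nodat (from-no (3 ∣? 4)) D
killTwo u4 M 4 2 f e _ _ _ _ D D' = no44 (subst (λ m → Dat 4 m 4 1) (*-cancelʳ-≡ M 6 2 f) D)
killTwo u4 M 1 5 f e _ _ _ (≤4+ ()) D D'
killTwo u4 M 5 1 f e _ _ (≤4+ ()) _ D D'
killTwo u4 M (6+ s) (suc s') f e _ _ (≤4+ ()) _ D D'

data Sol : ℕ → ℕ → ℕ → ℕ → Set where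
 s11 : Sol 1 1 1 1
 s12 : Sol 1 2 1 2
 s21 : Sol 2 1 1 2
 s22 : Sol 2 2 2 2

sol : ∀ c e s n → c * e ≡ s * n → 1 ≤ s → s ≤ n → n ≤ 2 → 1 ≤ c → c ≤ 2 → 1 ≤ e → e ≤ 2 → Sol c e s n
sol 1 1 1 1 _ _ _ _ _ _ _ _ = s11
sol 1 2 1 2 _ _ _ _ _ _ _ _ = s12
sol 2 1 1 2 _ _ _ _ _ _ _ _ = s21
sol 2 2 2 2 _ _ _ _ _ _ _ _ = s22
sol c e (2+ _) 1 _ _ (s≤s ()) _ _ _ _ _
sol c e (3+ _) 2 _ _ (≤2+ ()) _ _ _ _ _
sol c e s (3+ _) _ _ _ (≤2+ ()) _ _ _ _
sol (3+ _) e s n _ _ _ _ _ (≤2+ ()) _ _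
sol c (3+ _) s n _ _ _ _ _ _ _ (≤2+ ())
sol 1 1 1 2 () _ _ _ _ _ _ _
sol 1 1 2 2 () _ _ _ _ _ _ _
sol 1 2 1 1 () _ _ _ _ _ _ _
sol 1 2 2 2 () _ _ _ _ _ _ _
sol 2 1 1 1 () _ _ _ _ _ _ _
sol 2 1 2 2 () _ _ _ _ _ _ _
sol 2 2 1 1 () _ _ _ _ _ _ _
sol 2 2 1 2 () _ _ _ _ _ _ _

-- Hypotheses, walks and distances

record Hyp {n : ℕ} (A : Rel n) (k g0 : ℕ) : Set where
 field
  loopless : ∀ x → A x x ≡ false
  strong : ∀ x y → ∃ λ m → walk A m x y ≡ true
  wdr : IsWeaklyDistanceRegular A
  commut : IsCommutative A
  valency : HasValency A k
  k>3 : 3 < k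
  -- The girth is `3 + g0`, so the distances g - 1 and g - 2 become `2 + g0` and `1 + g0` without
  -- truncated subtraction.
  acyclic : ∀ m x → 1 ≤ m → m < 3 + g0 → walk A m x x ≡ false
  types : ∀ u v → A u v ≡ true → dist A v u ≡ 2 + g0
  x₀ y₀ : Fin n
  d1 : dist A x₀ y₀ ≡ 2
  d₂ : dist A y₀ x₀ ≡ 1 + g0
  big : k ∸ 2 ≤ pcount A x₀ y₀ (1 , 2 + g0) (1 , 2 + g0)

module Theory {n : ℕ} {A : Rel n} {k g0 : ℕ} (H : Hyp A k g0) where
 open Hyp H public
 V : Set
 V = Fin n
 -- A wrapper around the Boolean test; it keeps the length and the ends inferable from the type of a
 -- walk.
 record W (m : ℕ) (x y : V) : Set where
  constructor wk
  field unwk : walk A m x y ≡ true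
 open W
 W-nil : ∀ {x} → W 0 x x
 W-nil {x} = wk (==-refl x)
 W-nil⁻¹ : ∀ {x y} → W 0 x y → x ≡ y
 W-nil⁻¹ (wk p) = ==⇒≡ p
 W-cons : ∀ {m x y z} → A x y ≡ true → W m y z → W (suc m) x z
 W-cons {m} {x} {y} {z} p (wk q) = wk (any-tab' (λ z' → A x z' ∧ walk A m z' z) id y (∧-intro p q))
 W-uncons : ∀ {m x z} → W (suc m) x z → ∃ λ y → A x y ≡ true × W m y z
 W-uncons {m} {x} {z} (wk p) with any-tab (λ z' → A x z' ∧ walk A m z' z) id p
 ... | y , q = y , ∧-fst q , wk (∧-snd {A x y} q)
 W-++ : ∀ {a b x y z} → W a x y → W b y z → W (a + b) x z
 W-++ {zero} {b} {z = z} p q = subst (λ u → W b u z) (sym (W-nil⁻¹ p)) q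
 W-++ {suc a} p q with W-uncons p
 ... | u , r , s = W-cons r (W-++ s q)
 W-split : ∀ a {b x z} → W (a + b) x z → ∃ λ y → W a x y × W b y z
 W-split zero {x = x} p = x , W-nil , p
 W-split (suc a) p with W-uncons p
 ... | u , r , s with W-split a s
 ... | y , s₁ , s₂ = y , W-cons r s₁ , s₂
 least≤ : ∀ (P : ℕ → Bool) b i → P i ≡ true → least A P b ≤ i
 least≤ P zero i p = z≤n
 least≤ P (suc b) i p with P zero in eq
 ... | true = z≤n
 least≤ P (suc b) zero p | false = t≢f p eq
 least≤ P (suc b) (suc i) p | false = s≤s (least≤ (P ∘ suc) b i p)
 least-true : ∀ (P : ℕ → Bool) b i → i < b → P i ≡ true → P (least A P b) ≡ true
 least-true P (suc b) i q p with P zero in eq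
 ... | true = eq
 least-true P (suc b) zero q p | false = t≢f p eq
 least-true P (suc b) (suc i) (s≤s q) p | false = least-true (P ∘ suc) b i q p
 -- Vertices met at different times on a shortest walk are different.
 short : ∀ {x y} m → W m x y → (∀ m' → W m' x y → m ≤ m') → m < n
 short {x} {y} m p min = injective⇒≤ {f = at} inj where
  pt : (i : Fin (suc m)) → ∃ λ z → W (toℕ i) x z × W (m ∸ toℕ i) z y
  pt i = W-split (toℕ i) (subst (λ l → W l x y) (sym (m+[n∸m]≡n (≤-pred (toℕ<n i)))) p)
  at : Fin (suc m) → V
  at i = fst (pt i)
  lt : ∀ i j → at i ≡ at j → toℕ j ≤ toℕ i
  lt i j e = +-cancelʳ-≤ (m ∸ toℕ j) _ _ (≤-trans (eq≤ (m+[n∸m]≡n (≤-pred (toℕ<n j))))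
   (min _ (W-++ (subst (W (toℕ i) x) e (fst (snd (pt i)))) (snd (snd (pt j))))))
  inj : ∀ {i j} → at i ≡ at j → i ≡ j
  inj {i} {j} e = toℕ-injective (≤-antisym (lt j i (sym e)) (lt i j e))
 opaque
  d : V → V → ℕ
  d = dist A
  d-both : ∀ x y → W (d x y) x y × d x y < n
  d-both x y with strong x y
  ... | m , p = wk (least-true P n m₀ m0<n pm0) , ≤-<-trans (least≤ P n m₀ pm0) m0<n where
   P : ℕ → Bool
   P = λ l → walk A l x y
   -- A search up to a known walk length finds the true minimum; `short` places it below `n`, so the
   -- bounded search inside `dist` finds it as well.
   m₀ : ℕ
   m₀ = least A P (suc m)
   pm0 : P m₀ ≡ true
   pm0 = least-true P (suc m) m ≤-refl p
   m0<n : m₀ < n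
   m0<n = short m₀ (wk pm0) λ m' q → least≤ P (suc m) m' (unwk q)
 d-walk : ∀ x y → W (d x y) x y
 d-walk x y = fst (d-both x y)
 d<n : ∀ x y → d x y < n
 d<n x y = snd (d-both x y)
 opaque
  unfolding d
  d-min : ∀ {m x y} → W m x y → d x y ≤ m
  d-min {m} {x} {y} p = least≤ (λ l → walk A l x y) n m (unwk p)
  d≡dist : ∀ x y → d x y ≡ dist A x y
  d≡dist x y = refl
 d-refl : ∀ x → d x x ≡ 0
 d-refl x = n≤0⇒n≡0 (d-min (W-nil {x}))
 d≡0 : ∀ {x y} → d x y ≡ 0 → x ≡ y
 d≡0 {x} {y} p = W-nil⁻¹ (subst (λ m → W m x y) p (d-walk x y))
 d-tri : ∀ x y z → d x z ≤ d x y + d y z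
 d-tri x y z = d-min (W-++ (d-walk x y) (d-walk y z))
 A⇒d : ∀ {x y} → A x y ≡ true → d x y ≡ 1
 A⇒d {x} {y} p with d x y in eq | d-min (W-cons p (W-nil {y}))
 ... | zero | _ = t≢f (subst (λ z → A x z ≡ true) (sym (d≡0 eq)) p) (loopless x)
 ... | suc zero | _ = refl
 ... | 2+ _ | s≤s ()
 d⇒A : ∀ {x y} → d x y ≡ 1 → A x y ≡ true
 d⇒A {x} {y} p with W-uncons (subst (λ m → W m x y) p (d-walk x y))
 ... | z , q , r = subst (λ u → A x u ≡ true) (W-nil⁻¹ r) q
 first-step : ∀ {x y m} → d x y ≡ suc m → ∃ λ z → A x z ≡ true × d z y ≡ m
 first-step {x} {y} {m} p with W-uncons (subst (λ l → W l x y) p (d-walk x y))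
 ... | z , q , r = z , q , ≤-antisym (d-min r) (≤-pred (subst₂ _≤_ p (cong (_+ d z y) (A⇒d q)) (d-tri x z y)))
 last-step : ∀ {x y m} → d x y ≡ suc m → ∃ λ z → d x z ≡ m × A z y ≡ true
 last-step {x} {y} {m} p with W-split m (subst (λ l → W l x y) (p · +-comm 1 m) (d-walk x y))
 ... | z , q , r = z , ≤-antisym (d-min q) (≤-pred (subst₂ _≤_ p (cong (d x z +_) (A⇒d e) · +-comm (d x z) 1) (d-tri x z y))) , e where
  e : A z y ≡ true
  e with W-uncons r
  ... | u , s , t = subst (λ w → A z w ≡ true) (W-nil⁻¹ t) s

 -- The commutative algebra of class functions

 Mat : Set
 Mat = V → V → ℕ
 Cl : Mat → Set
 Cl M = ∀ x y x' y' → d x y ≡ d x' y' → d y x ≡ d y' x' → M x y ≡ M x' y'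
 _⋆_ : Mat → Mat → Mat
 (M ⋆ N) x y = ∑ λ z → M x z * N z y
 private
  I : Set
  I = Fin n × Fin n
  ∑2 : (I → ℕ) → ℕ
  ∑2 f = ∑ λ i → ∑ λ j → f (i , j)
  ∑2-cong : {f h : I → ℕ} → (∀ p → f p ≡ h p) → ∑2 f ≡ ∑2 h
  ∑2-cong e = ∑-cong λ i → ∑-cong λ j → e (i , j)
  ∑2-*ˡ : ∀ c f → ∑2 (λ p → c * f p) ≡ c * ∑2 f
  ∑2-*ˡ c f = (∑-cong λ i → ∑-*ˡ c _) · ∑-*ˡ c _
  ∑2-*ʳ : ∀ c f → ∑2 (λ p → f p * c) ≡ ∑2 f * c
  ∑2-*ʳ c f = (∑-cong λ i → ∑-*ʳ c _) · ∑-*ʳ c _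
  ∑2-∑ : ∀ {m} (f : Fin m → I → ℕ) → ∑ (λ z → ∑2 (f z)) ≡ ∑2 (λ p → ∑ λ z → f z p)
  ∑2-∑ f = (∑-comm _) · (∑-cong λ i → ∑-comm _)
  ∑2-comm : (f : I → I → ℕ) → ∑2 (λ p → ∑2 (f p)) ≡ ∑2 (λ q → ∑2 λ p → f p q)
  ∑2-comm f = (∑-cong λ i → ∑2-∑ (λ j → f (i , j))) · ∑2-∑ (λ i q → ∑ λ j → f (i , j) q)
  -- Distances stay below `n`, so two-way distances can index a finite double sum; an index may be
  -- attained by no pair.
  δ2 : V → V → I
  δ2 x y = fromℕ< (d<n x y) , fromℕ< (d<n y x)
  hit2 : V → V → I → Bool
  hit2 x y (i , j) = (d x y ≡ᵇ toℕ i) ∧ (d y x ≡ᵇ toℕ j)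
  hit2-eq : ∀ x y i j → hit2 x y (i , j) ≡ ((fst (δ2 x y) == i) ∧ (snd (δ2 x y) == j))
  hit2-eq x y i j = cong₂ _∧_ (aux (d<n x y) i) (aux (d<n y x) j) where
   aux : ∀ {e} (p : e < n) (i : Fin n) → (e ≡ᵇ toℕ i) ≡ (fromℕ< p == i)
   aux {e} p i = iff (λ q → subst (λ u → fromℕ< p == u ≡ true) (toℕ-injective (toℕ-fromℕ< p · ≡ᵇ⇒ e (toℕ i) q)) (==-refl (fromℕ< p)))
                     (λ q → ≡⇒ᵇ (sym (toℕ-fromℕ< p) · cong toℕ (==⇒≡ q)))
  ∑2-hit22 : ∀ x y (h : I → ℕ) → ∑2 (λ p → β (hit2 x y p) * h p) ≡ h (δ2 x y)
  ∑2-hit22 x y h = (∑-cong λ i → (∑-cong λ j → cong (_* h (i , j)) (cong β (hit2-eq x y i j) · β-∧ (a == i) (b == j)) · (*-assoc (β (a == i)) _ _)) · (∑-*ˡ (β (a == i)) _) · cong (β (a == i) *_) (∑-pick b (λ j → h (i , j)))) · ∑-pick a (λ i → h (i , b))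
   where a = fst (δ2 x y)
         b = snd (δ2 x y)
  δ2-d : ∀ x y x' y' → δ2 x y ≡ δ2 x' y' → d x y ≡ d x' y' × d y x ≡ d y' x'
  δ2-d x y x' y' e =
   (sym (toℕ-fromℕ< (d<n x y)) · cong (toℕ ∘ fst) e · toℕ-fromℕ< (d<n x' y')) ,
   (sym (toℕ-fromℕ< (d<n y x)) · cong (toℕ ∘ snd) e · toℕ-fromℕ< (d<n y' x'))
  Att : I → Set
  Att p = ∃ λ x → ∃ λ y → δ2 x y ≡ p
  ≟I : (p q : I) → Dec (p ≡ q)
  ≟I (a , b) (c , e) with a F.≟ c | b F.≟ e
  ... | yes refl | yes refl = yes refl
  ... | no r | _ = no (r ∘ cong fst)
  ... | _ | no r = no (r ∘ cong snd)
  look : ∀ p → Dec (Att p)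
  look p = any? λ x → any? λ y → ≟I (δ2 x y) p
  -- The value 0 at an index that no pair attains is a dummy: `read-ok` refutes that branch.
  read : Mat → ∀ {p} → Dec (Att p) → ℕ
  read M (yes (x , y , _)) = M x y
  read M (no _) = 0
  read-ok : ∀ {M} → Cl M → ∀ x y {p} → δ2 x y ≡ p → (r : Dec (Att p)) → M x y ≡ read M r
  read-ok cl x y e (yes (x' , y' , e')) = let (p , q) = δ2-d x y x' y' (e · sym e') in cl x y x' y' p q
  read-ok cl x y e (no r) = ⊥-elim (r (x , y , e))
  factor : ∀ {M} → Cl M → ∃ λ f → ∀ x y → M x y ≡ f (δ2 x y)
  factor {M} cl = (λ p → read M (look p)) , λ x y → read-ok cl x y refl (look (δ2 x y))
  pc : V → V → I → I → ℕ
  pc x y (i , j) (i' , j') = pcount A x y (toℕ i , toℕ j) (toℕ i' , toℕ j')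
  opaque
   unfolding d
   pc-∑ : ∀ x y p q → pc x y p q ≡ ∑ (λ z → β (hit2 x z p) * β (hit2 z y q))
   pc-∑ x y p q = (countᵇ≡# A _) · (∑-cong λ z → β-∧ (hit2 x z p) (hit2 z y q))
   pc-cl : ∀ x y x' y' p q → d x y ≡ d x' y' → d y x ≡ d y' x' → pc x y p q ≡ pc x' y' p q
   pc-cl x y x' y' p q e f = wdr x y x' y' _ _ (cong₂ _,_ e f)
  -- The product expands in the intersection numbers `pc`. Regularity makes them class functions and
  -- commutativity makes them symmetric; `⋆-Cl` and `⋆-comm` follow by comparing expansions.
  expand : ∀ {M N} (cm : Cl M) (cn : Cl N) x y →
   (M ⋆ N) x y ≡ ∑2 λ p → ∑2 λ q → fst (factor cm) p * fst (factor cn) q * pc x y p q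
  expand {M} {N} cm cn x y = begin
   ∑ (λ z → M x z * N z y)
    ≡⟨ ∑-cong (λ z → cong₂ _*_ (snd (factor cm) x z · sym (∑2-hit22 x z f)) (snd (factor cn) z y · sym (∑2-hit22 z y h))) ⟩
   ∑ (λ z → ∑2 (λ p → β (hit2 x z p) * f p) * ∑2 (λ q → β (hit2 z y q) * h q))
    ≡⟨ ∑-cong (λ z → sym (∑2-*ʳ (∑2 (λ q → β (hit2 z y q) * h q)) (λ p → β (hit2 x z p) * f p))) ⟩
   ∑ (λ z → ∑2 (λ p → β (hit2 x z p) * f p * ∑2 (λ q → β (hit2 z y q) * h q)))
    ≡⟨ ∑2-∑ _ ⟩
   ∑2 (λ p → ∑ (λ z → β (hit2 x z p) * f p * ∑2 (λ q → β (hit2 z y q) * h q)))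
    ≡⟨ ∑2-cong (λ p → ∑-cong (λ z → sym (∑2-*ˡ (β (hit2 x z p) * f p) (λ q → β (hit2 z y q) * h q)))) ⟩
   ∑2 (λ p → ∑ (λ z → ∑2 (λ q → β (hit2 x z p) * f p * (β (hit2 z y q) * h q))))
    ≡⟨ ∑2-cong (λ p → ∑2-∑ _) ⟩
   ∑2 (λ p → ∑2 (λ q → ∑ (λ z → β (hit2 x z p) * f p * (β (hit2 z y q) * h q))))
    ≡⟨ ∑2-cong (λ p → ∑2-cong (λ q → (∑-cong λ z → re4 (β (hit2 x z p)) (f p) (β (hit2 z y q)) (h q)) · (∑-*ˡ (f p * h q) _) · cong (f p * h q *_) (sym (pc-∑ x y p q)))) ⟩
   ∑2 (λ p → ∑2 (λ q → f p * h q * pc x y p q)) ∎ where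
   open ≡-Reasoning
   f = fst (factor cm)
   h = fst (factor cn)
 ⋆-Cl : ∀ {M N} → Cl M → Cl N → Cl (M ⋆ N)
 ⋆-Cl cm cn x y x' y' e e' = expand cm cn x y · (trans
  (∑2-cong λ p → ∑2-cong λ q → cong (fst (factor cm) p * fst (factor cn) q *_) (pc-cl x y x' y' p q e e'))
  (sym (expand cm cn x' y')))
 ⋆-comm : ∀ {M N} → Cl M → Cl N → ∀ x y → (M ⋆ N) x y ≡ (N ⋆ M) x y
 ⋆-comm cm cn x y = expand cm cn x y · (∑2-comm _ · (trans
  (∑2-cong λ q → ∑2-cong λ p → cong₂ _*_ (*-comm (fst (factor cm) p) _) (commut x y _ _))
  (sym (expand cn cm x y))))
 infixl 7 _⊗_
 -- A syntax of matrices: the single recursion `cl` shows that every expression is a class function,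
 -- so any two expressions commute.
 data Ex : Set where
  Ax : Ex
  δ : (ℕ → ℕ → ℕ) → Ex
  _⊗_ : Ex → Ex → Ex
  pw : (ℕ → ℕ → ℕ) → Ex → Ex → Ex
  tr : Ex → Ex
 ⟦_⟧ : Ex → Mat
 ⟦ Ax ⟧ x y = β (A x y)
 ⟦ δ f ⟧ x y = f (d x y) (d y x)
 ⟦ M ⊗ N ⟧ x y = ∑ λ z → ⟦ M ⟧ x z * ⟦ N ⟧ z y
 ⟦ pw f M N ⟧ x y = f (⟦ M ⟧ x y) (⟦ N ⟧ x y)
 ⟦ tr M ⟧ x y = ⟦ M ⟧ y x
 cl : ∀ M → Cl ⟦ M ⟧
 cl Ax x y x' y' p q = cong β (iff (λ r → d⇒A (sym p · A⇒d r)) (λ r → d⇒A (p · A⇒d r)))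
 cl (δ f) x y x' y' p q = cong₂ f p q
 cl (M ⊗ N) = ⋆-Cl (cl M) (cl N)
 cl (pw f M N) x y x' y' p q = cong₂ f (cl M x y x' y' p q) (cl N x y x' y' p q)
 cl (tr M) x y x' y' p q = cl M y x y' x' q p
 comm : ∀ M N x y → ⟦ M ⊗ N ⟧ x y ≡ ⟦ N ⊗ M ⟧ x y
 comm M N = ⋆-comm (cl M) (cl N)
 assoc : ∀ M N L x y → ⟦ M ⊗ N ⊗ L ⟧ x y ≡ ⟦ M ⊗ (N ⊗ L) ⟧ x y
 assoc M N L x y = (∑-cong λ z → sym (∑-*ʳ _ _)) · ∑-comm _ · (∑-cong λ w → (∑-cong λ z → *-assoc (⟦ M ⟧ x w) _ _) · (∑-*ˡ (⟦ M ⟧ x w) _))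
 diag : ∀ M x y → ⟦ M ⟧ x x ≡ ⟦ M ⟧ y y
 diag M x y = cl M x x y y (d-refl x · sym (d-refl y)) (d-refl x · sym (d-refl y))
 ⟨_,_⟩ : Ex → Ex → V → ℕ
 ⟨ H , M ⟩ x = ∑ λ y → ⟦ H ⟧ x y * ⟦ M ⟧ x y
 -- The inner product is the diagonal of H Mᵗ, hence does not depend on the base vertex.
 ip-const : ∀ H M x y → ⟨ H , M ⟩ x ≡ ⟨ H , M ⟩ y
 ip-const H M = diag (H ⊗ tr M)
 ip-tr : ∀ H M x → ⟨ tr H , tr M ⟩ x ≡ ⟨ H , M ⟩ x
 ip-tr H M x = comm (tr H) M x x · (∑-cong λ z → *-comm (⟦ M ⟧ x z) _)
 -- Moving the right factor across as its transpose is the double count behind most equations below: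
 -- each side is then evaluated by `wsum`.
 adj : ∀ H M N x → ⟨ H , M ⊗ N ⟩ x ≡ ⟨ H ⊗ tr N , M ⟩ x
 adj H M N x = (∑-cong λ y → sym (∑-*ˡ (⟦ H ⟧ x y) _)) · ∑-comm _ · (∑-cong λ z → (∑-cong λ y → re3 (⟦ H ⟧ x y) (⟦ M ⟧ x z) (⟦ N ⟧ z y)) · (∑-*ʳ (⟦ M ⟧ x z) _))
 ip-comm : ∀ H M x → ⟨ H , M ⟩ x ≡ ⟨ M , H ⟩ x
 ip-comm H M x = ∑-cong λ y → *-comm (⟦ H ⟧ x y) _

 -- Arcs, valencies and the class T

 ty : ∀ u v → A u v ≡ true → d v u ≡ 2 + g0
 ty u v p = d≡dist v u · types u v p
 no-closed : ∀ {m x} → W (suc m) x x → 3 + g0 ≤ suc m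
 no-closed {m} {x} (wk p) with 3 + g0 ≤? suc m
 ... | yes q = q
 ... | no q = t≢f p (acyclic (suc m) x z<s (≰⇒> q))
 cycle : ∀ {x y m} → A x y ≡ true → d y x ≤ m → 2 + g0 ≤ m
 cycle {x} {y} p q = eq≥ (ty x y p) » q
 no2 : ∀ {x y} → A x y ≡ true → A y x ≡ true → ⊥
 no2 p q with cycle p (eq≤ (A⇒d q))
 ... | s≤s ()
 infix 4 _⟶_
 _⟶_ : V → V → Set
 x ⟶ y = A x y ≡ true
 d≤2 : ∀ {x y z} → x ⟶ y → y ⟶ z → d x z ≤ 2
 d≤2 p q = d-min (W-cons p (W-cons q W-nil))
 lft : ∀ {x y b} → A x y ∧ b ≡ true → x ⟶ y
 lft = ∧-fst
 rgt : ∀ {x y b} → A x y ∧ b ≡ true → b ≡ true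
 rgt {x} {y} = ∧-snd {A x y}
 and : ∀ {x y b} → x ⟶ y → b ≡ true → A x y ∧ b ≡ true
 and = ∧-intro
 A-irr : ∀ {x y} → x ⟶ y → x ≢ y
 A-irr p refl = t≢f p (loopless _)
 opaque
  hit : ℕ → ℕ → ℕ → ℕ → Bool
  hit a b i j = (i ≡ᵇ a) ∧ (j ≡ᵇ b)
  hit-comm : ∀ a b i j → hit a b i j ≡ hit b a j i
  hit-comm a b i j = ∧-comm (i ≡ᵇ a) (j ≡ᵇ b)
 cls : ℕ → ℕ → Ex
 cls a b = δ (λ i j → β (hit a b i j))
 Cb : ℕ → ℕ → V → V → Bool
 Cb a b x y = hit a b (d x y) (d y x)
 lftC : ∀ {a b i j c} → hit a b i j ∧ c ≡ true → hit a b i j ≡ true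
 lftC = ∧-fst
 rgtC : ∀ {a b i j c} → hit a b i j ∧ c ≡ true → c ≡ true
 rgtC {a} {b} {i} {j} = ∧-snd {hit a b i j}
 andC : ∀ {a b i j c} → hit a b i j ≡ true → c ≡ true → hit a b i j ∧ c ≡ true
 andC = ∧-intro
 opaque
  unfolding hit
  Cb-intro : ∀ {a b x y} → d x y ≡ a → d y x ≡ b → Cb a b x y ≡ true
  Cb-intro p q = ∧-intro (≡⇒ᵇ p) (≡⇒ᵇ q)
  Cb-fst : ∀ {a b x y} → Cb a b x y ≡ true → d x y ≡ a
  Cb-fst p = ≡ᵇ⇒ _ _ (∧-fst p)
  Cb-snd : ∀ {a b x y} → Cb a b x y ≡ true → d y x ≡ b
  Cb-snd {a} {b} {x} {y} p = ≡ᵇ⇒ _ _ (∧-snd {d x y ≡ᵇ a} p)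
 on : ∀ M {a b x y x' y'} → Cb a b x y ≡ true → Cb a b x' y' ≡ true → ⟦ M ⟧ x y ≡ ⟦ M ⟧ x' y'
 on M p q = cl M _ _ _ _ (Cb-fst p · sym (Cb-fst q)) (Cb-snd p · sym (Cb-snd q))
 onA : ∀ M {x y x' y'} → x ⟶ y → x' ⟶ y' → ⟦ M ⟧ x y ≡ ⟦ M ⟧ x' y'
 onA M {x} {y} {x'} {y'} p q = cl M _ _ _ _ (A⇒d p · sym (A⇒d q)) (ty x y p · sym (ty x' y' q))
 out : ∀ x → # (A x) ≡ k
 out x = sym (countᵇ≡# A (A x)) · valency x
 β² : ∀ b → β b * β b ≡ β b
 β² true = refl
 β² false = refl
 -- Commutativity makes A normal; the diagonals of Aᵗ A and A Aᵗ are the in-valencies and the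
 -- out-valencies.
 inn : ∀ x → # (λ z → A z x) ≡ k
 inn x = (∑-cong λ z → sym (β² (A z x))) · comm (tr Ax) Ax x x · (∑-cong λ z → β² (A x z)) · out x
 k>0 : 1 ≤ k
 k>0 = z<s » k>3
 opaque
  has-out : ∀ x → ∃ λ y → x ⟶ y
  has-out x = #∃ (k>0 » eq≥ (out x))
  has-in : ∀ x → ∃ λ y → y ⟶ x
  has-in x = #∃ (k>0 » eq≥ (inn x))
 cnt : (p q : V → Bool) → ∑ (λ z → β (p z) * β (q z)) ≡ # (λ z → p z ∧ q z)
 cnt p q = ∑-cong λ z → sym (β-∧ (p z) (q z))
 Mid Com : V → V → V → Bool
 Mid x y z = A x z ∧ A z y
 Com x y z = A x z ∧ A y z
 sq co : V → V → ℕ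
 sq x y = # (Mid x y)
 co x y = # (Com x y)
 sq≡ : ∀ x y → ⟦ Ax ⊗ Ax ⟧ x y ≡ sq x y
 sq≡ x y = cnt (A x) (λ z → A z y)
 co≡ : ∀ x y → ⟦ Ax ⊗ tr Ax ⟧ x y ≡ co x y
 co≡ x y = cnt (A x) (A y)
 co-cl : ∀ {x y x' y'} → d x y ≡ d x' y' → d y x ≡ d y' x' → co x y ≡ co x' y'
 co-cl p q = sym (co≡ _ _) · cl (Ax ⊗ tr Ax) _ _ _ _ p q · co≡ _ _
 -- Normality off the diagonal. It trades common out-neighbours for common in-neighbours throughout.
 co-in : ∀ x y → co x y ≡ # (λ z → A z x ∧ A z y)
 co-in x y = sym (co≡ x y) · comm Ax (tr Ax) x y · cnt (λ z → A z x) (λ z → A z y)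
 co-sym : ∀ x y → co x y ≡ co y x
 co-sym x y = #-cong λ z → ∧-comm (A x z) (A y z)
  where open import Data.Bool.Properties using (∧-comm)
 Tb : V → V → Bool
 Tb = Cb 2 (1 + g0)
 P : ℕ
 P = sq x₀ y₀
 infix 4 _⇉_
 _⇉_ : V → V → Set
 x ⇉ y = Tb x y ≡ true
 T0 : x₀ ⇉ y₀
 T0 = Cb-intro (d≡dist _ _ · d1) (d≡dist _ _ · d₂)
 sqT : ∀ {x y} → x ⇉ y → sq x y ≡ P
 sqT p = sym (sq≡ _ _) · on (Ax ⊗ Ax) p T0 · sq≡ _ _
 -- The closed walk through `x`, `y`, `z` has length at least the girth, so the return is exact; a
 -- return this short also rules out `x = z` and an arc from `x` to `z`.
 mkT : ∀ {x y z} → x ⟶ y → y ⟶ z → d z x ≤ 1 + g0 → x ⇉ z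
 mkT {x} {y} {z} p q r = Cb-intro e₁ (≤-antisym r e₂) where
  e₂ : 1 + g0 ≤ d z x
  e₂ = ≤-pred (≤-pred (no-closed (W-cons p (W-cons q (d-walk z x)))))
  e₁ : d x z ≡ 2
  e₁ with d x z in eq | d-min (W-cons p (W-cons q (W-nil {z})))
  ... | 0 | _ = ⊥-elim (no2 p (subst (y ⟶_) (sym (d≡0 eq)) q))
  ... | 1 | _ = ⊥-elim (1+n≰n (cycle (d⇒A eq) r))
  ... | 2 | _ = refl
  ... | 3+ _ | ≤2+ ()
 opaque
  extend : ∀ {x y} → x ⟶ y → ∃ λ z → y ⟶ z × x ⇉ z
  extend {x} {y} p with first-step {y} {x} (ty x y p)
  ... | z , q , r = z , q , mkT p q (eq≤ r)
  arc0 : ∃₂ λ x y → x ⟶ y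
  arc0 with has-out x₀
  ... | y , p = x₀ , y , p
  two : ∀ {x z} → x ⇉ z → ∃ λ y → x ⟶ y × y ⟶ z
  two {x} {z} p with first-step {x} {z} (Cb-fst p)
  ... | y , q , r = y , q , d⇒A r
 ax ay : V
 ax = fst arc0
 ay = fst (snd arc0)
 axy : ax ⟶ ay
 axy = snd (snd arc0)
 Pℓ : k ∸ 2 ≤ P
 Pℓ = big » eq≤ (countᵇ≡# A _) » #-mono λ z e → and (at (∧-fst {_==₂_ A (dist2 A x₀ z) (1 , 2 + g0)} e)) (at (∧-snd {_==₂_ A (dist2 A x₀ z) (1 , 2 + g0)} e)) where
  at : ∀ {x y b} → _==₂_ A (dist2 A x y) (1 , b) ≡ true → x ⟶ y
  at {x} {y} e = d⇒A (d≡dist x y · ≡ᵇ⇒ (dist A x y) 1 (∧-fst e))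
 one : Ex
 one = δ (λ _ _ → 1)
 size : ∀ (f : ℕ → ℕ → Bool) x y → # (λ z → f (d x z) (d z x)) ≡ # (λ z → f (d y z) (d z y))
 size f x y = (∑-cong λ z → sym (*-identityʳ _)) · ip-const (δ (λ i j → β (f i j))) one x y · (∑-cong λ z → *-identityʳ _)
 Tx : Ex
 Tx = cls 2 (1 + g0)
 t : ℕ
 t = # (Tb x₀)
 tsize : ∀ x → # (Tb x) ≡ t
 tsize x = size (hit 2 (1 + g0)) x x₀
 qT : ∀ {x y} → x ⟶ y → # (λ z → Tb x z ∧ A y z) ≡ # (λ z → Tb ax z ∧ A ay z)
 qT {x} {y} p = sym (cnt (Tb x) (A y)) · onA (Tx ⊗ tr Ax) p axy · cnt (Tb ax) (A ay)
 Qv : ℕ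
 Qv = # (λ z → Tb ax z ∧ A ay z)
 -- Paths `x₀ → y → z` with `z` in T(x₀) are counted once by `y` and once by `z`.
 kQ : k * Qv ≡ t * P
 kQ = begin
  k * Qv ≡⟨ cong (_* Qv) (out x₀) ⟨
  # (A x₀) * Qv ≡⟨ wsum (A x₀) _ Qv (λ y p → cnt (Tb x₀) (A y) · qT p) ⟨
  ⟨ Ax , Tx ⊗ tr Ax ⟩ x₀ ≡⟨ adj Ax Tx (tr Ax) x₀ ⟩
  ⟨ Ax ⊗ tr (tr Ax) , Tx ⟩ x₀ ≡⟨ ip-comm (Ax ⊗ tr (tr Ax)) Tx x₀ ⟩
  ⟨ Tx , Ax ⊗ tr (tr Ax) ⟩ x₀ ≡⟨ wsum (Tb x₀) _ P (λ y p → sq≡ x₀ y · sqT p) ⟩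
  t * P ∎
  where open ≡-Reasoning
 Q≤k : Qv ≤ k
 Q≤k = (#-mono λ z → rgtC) » eq≤ (out _)
 -- The two distances between distinct vertices add up to at least the girth, so upper bounds that
 -- add up to the girth are attained.
 tight : ∀ {x y a b} → x ≢ y → d x y ≤ a → d y x ≤ b → a + b ≡ 3 + g0 → Cb a b x y ≡ true
 tight {x} {y} {a} {b} ne p q e = Cb-intro
  (lia≡ (d x y ∷ d y x ∷ a ∷ b ∷ g0 ∷ []) ((ν0 ≼ ν2) ∷ (ν1 ≼ ν3) ∷ (ν2 ⊹ ν3 ≋ κ 3 ⊹ ν4) ∷ (κ 3 ⊹ ν4 ≼ ν0 ⊹ ν1) ∷ []) ν0 ν2 (p , q , e , cyc))
  (lia≡ (d x y ∷ d y x ∷ a ∷ b ∷ g0 ∷ []) ((ν0 ≼ ν2) ∷ (ν1 ≼ ν3) ∷ (ν2 ⊹ ν3 ≋ κ 3 ⊹ ν4) ∷ (κ 3 ⊹ ν4 ≼ ν0 ⊹ ν1) ∷ []) ν1 ν3 (p , q , e , cyc)) where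
  cyc : 3 + g0 ≤ d x y + d y x
  cyc with d x y in eq | d-walk x y
  ... | zero | _ = ⊥-elim (ne (d≡0 eq))
  ... | suc m | w = no-closed (W-++ w (d-walk y x))
 opaque
  -- The classes (i , g - i) are those met along a shortest cycle. Here `z` is the vertex before
  -- `v`, and each first step that is on course for `z` is also on course for `v`: the source of
  -- monotonicity.
  up : ∀ {i b x v} → Cb (2 + i) b x v ≡ true → (2 + i) + b ≡ 3 + g0 →
       ∃ λ z → Cb (1 + i) (1 + b) x z ≡ true × z ⟶ v ×
       (∀ y → x ⟶ y → Cb i (2 + b) y z ≡ true → Cb (1 + i) (1 + b) y v ≡ true)
  up {i} {b} {x} {v} p e with last-step {x} {v} (Cb-fst p)
  ... | z , q , r = z , tight x≢z (eq≤ q) zx (+-suc (1 + i) b · e) , r , next where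
   vx : d v x ≡ b
   vx = Cb-snd p
   zx : d z x ≤ 1 + b
   zx = d-tri z v x » eq≤ (+≡ (A⇒d r) vx)
   x≢z : x ≢ z
   x≢z x≡z with trans (sym (d-refl x)) (cong (d x) x≡z · q)
   ... | ()
   next : ∀ y → x ⟶ y → Cb i (2 + b) y z ≡ true → Cb (1 + i) (1 + b) y v ≡ true
   next y a c = tight (λ { refl → absurd (sym (A⇒d a) · Cb-fst p) })
    (d-tri y z v » eq≤ ((+≡ (Cb-fst c) (A⇒d r)) · +-comm i 1))
    (d-tri v x y » eq≤ ((+≡ vx (A⇒d a)) · +-comm b 1))
    (+-suc (1 + i) b · e) where
    absurd : 1 ≡ 2 + i → ⊥
    absurd ()
 -- A lower bound for the number of first steps is pushed forward along the cycle by `up` until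
 -- `b = 0`. There the pair is a reversed arc, and the number is `Qv`.
 propagate : ∀ b i c → (1 + i) + (1 + b) ≡ 3 + g0 →
  (∀ x v → Cb (1 + i) (1 + b) x v ≡ true → c ≤ # (λ y → A x y ∧ Cb i (2 + b) y v)) → c ≤ Qv
 propagate zero i c e h = ≤-trans (h x v (Cb-intro (ty v x p · sym i≡) (A⇒d p)))
       ((#-mono λ y q → andC (swap y (rgt q)) (lft q)) » eq≤ refl) where
  v x : V
  v = ax
  x = ay
  p : v ⟶ x
  p = axy
  i≡ : 1 + i ≡ 2 + g0
  i≡ = suc-injective (+-comm 1 (1 + i) · e)
  swap : ∀ y → Cb i 2 y v ≡ true → v ⇉ y
  swap y q = Cb-intro (Cb-snd q) (Cb-fst q · suc-injective i≡)
 propagate (suc b) i c e h = propagate b (suc i) c (sym (+-suc (1 + i) (1 + b)) · e) h' where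
  h' : ∀ x v → Cb (2 + i) (1 + b) x v ≡ true → c ≤ # (λ y → A x y ∧ Cb (1 + i) (2 + b) y v)
  h' x v p with up {i} {1 + b} p (sym (+-suc (1 + i) (1 + b)) · e)
  ... | z , q , r , s = h x z q » (#-mono λ y w → and (lft w) (s y (lft w) (rgt w)))
 arcC : ∀ {y v} → y ⟶ v → Cb 1 (2 + g0) y v ≡ true
 arcC p = Cb-intro (A⇒d p) (ty _ _ p)
 P≤Q : P ≤ Qv
 P≤Q = propagate g0 1 P refl λ x v p → eq≥ (sqT p) » (#-mono λ y q → and (lft q) (arcC (rgt q)))

 -- Common out-neighbours of siblings

 C : Ex
 C = Ax ⊗ tr Ax
 opaque
  hitF : ℕ → ℕ → ℕ → Bool
  hitF c u i = (u ≡ᵇ c) ∧ not (i ≡ᵇ 0)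
 -- A union of classes, none of which has to be known, and therefore still an expression; the test
 -- on the distance removes the diagonal.
 Fx : ℕ → Ex
 Fx c = pw (λ u i → β (hitF c u i)) C (δ (λ i j → i))
 Fb : ℕ → V → V → Bool
 Fb c x y = hitF c (⟦ C ⟧ x y) (d x y)
 andF : ∀ {a b i c} → hitF a b i ≡ true → c ≡ true → hitF a b i ∧ c ≡ true
 andF = ∧-intro
 opaque
  unfolding hitF
  Fb-intro : ∀ {c x y} → co x y ≡ c → x ≢ y → Fb c x y ≡ true
  Fb-intro {c} {x} {y} p q = ∧-intro (≡⇒ᵇ (co≡ x y · p)) (not-f (¬t λ e → q (d≡0 (≡ᵇ⇒ (d x y) 0 e))))
  Fb-co : ∀ {c x y} → Fb c x y ≡ true → co x y ≡ c
  Fb-co {c} {x} {y} p = sym (co≡ x y) · ≡ᵇ⇒ (⟦ C ⟧ x y) c (∧-fst p)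
  Fb-≢ : ∀ {c x y} → Fb c x y ≡ true → x ≢ y
  Fb-≢ {c} {x} p refl = t≢f (≡⇒ᵇ (d-refl x)) (not-t (∧-snd {⟦ C ⟧ x x ≡ᵇ c} p))
 Fb-sym : ∀ {c x y} → Fb c x y ≡ Fb c y x
 Fb-sym {c} {x} {y} = iff (λ p → Fb-intro (co-sym y x · Fb-co p) (Fb-≢ p ∘ sym)) (λ p → Fb-intro (co-sym x y · Fb-co p) (Fb-≢ p ∘ sym))
 F# : ℕ → ℕ
 F# c = # (Fb c x₀)
 F#≡ : ∀ c x → # (Fb c x) ≡ F# c
 F#≡ c x = (∑-cong λ z → sym (*-identityʳ _)) · ip-const (Fx c) one x x₀ · (∑-cong λ z → *-identityʳ _)
 sib : ℕ → V → V → ℕ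
 sib c x y = # (λ y' → A x y' ∧ Fb c y' y)
 m# : ℕ → ℕ
 m# c = sib c ax ay
 m≡ : ∀ c {x y} → x ⟶ y → sib c x y ≡ m# c
 m≡ c {x} {y} p = sym (cnt (A x) (λ z → Fb c z y)) · onA (Ax ⊗ Fx c) p axy · cnt (A _) (λ z → Fb c z _)
 -- Both sides count the pairs (y , y') of distinct out-neighbours of a vertex with co y y' = c.
 k*m : ∀ c → k * m# c ≡ c * F# c
 k*m c = begin
  k * m# c ≡⟨ cong (_* m# c) (out x₀) ⟨
  # (A x₀) * m# c ≡⟨ wsum (A x₀) _ (m# c) (λ y p → comm (Fx c) Ax x₀ y · cnt (A x₀) (λ z → Fb c z y) · m≡ c p) ⟨
  ⟨ Ax , Fx c ⊗ Ax ⟩ x₀ ≡⟨ adj Ax (Fx c) Ax x₀ ⟩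
  ⟨ C , Fx c ⟩ x₀ ≡⟨ ip-comm C (Fx c) x₀ ⟩
  ⟨ Fx c , C ⟩ x₀ ≡⟨ wsum (Fb c x₀) _ c (λ y p → co≡ x₀ y · Fb-co p) ⟩
  F# c * c ≡⟨ *-comm (F# c) c ⟩
  c * F# c ∎
  where open ≡-Reasoning
 co-self : ∀ y → co y y ≡ k
 co-self y = (#-cong λ z → idem (A y z)) · out y where
  idem : ∀ b → b ∧ b ≡ b
  idem true = refl
  idem false = refl
 co≤k : ∀ x y → co x y ≤ k
 co≤k x y = (#-mono λ z → lft) » eq≤ (out x)
 -- Both sides are the entry at (x , y) of A A Aᵗ, bracketed in the two ways.
 twoPaths : ∀ x y → ∑ (λ y' → β (A x y') * co y' y) ≡ ∑ (λ z → β (A y z) * sq x z)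
 twoPaths x y = (∑-cong λ y' → cong (β (A x y') *_) (sym (co≡ y' y))) · sym (assoc Ax Ax (tr Ax) x y) · (∑-cong λ z → *-comm _ (β (A y z)) · cong (β (A y z) *_) (sq≡ x z))
 Sib : V → V → V → Bool
 Sib x y y' = A x y' ∧ not (d y' y ≡ᵇ 0)
 Sib-intro : ∀ {x y y'} → x ⟶ y' → y' ≢ y → Sib x y y' ≡ true
 Sib-intro {x} {y} {y'} p q = and p (not-f (¬t λ e → q (d≡0 (≡ᵇ⇒ (d y' y) 0 e))))
 Sib-≢ : ∀ {x y y'} → Sib x y y' ≡ true → y' ≢ y
 Sib-≢ {x} {y} p refl = t≢f (≡⇒ᵇ (d-refl y)) (not-t (rgt p))
 self-split : ∀ {x y} → x ⟶ y → (h : V → ℕ) → ∑ (λ y' → β (A x y') * h y') ≡ h y + ∑ (λ y' → β (Sib x y y') * h y')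
 self-split {x} {y} p h = (∑-cong λ y' → aux y') · ∑-+ _ _ · cong (_+ ∑ (λ y' → β (Sib x y y') * h y')) (∑-pick' y h) where
  aux : ∀ y' → β (A x y') * h y' ≡ β (y' == y) * h y' + β (Sib x y y') * h y'
  aux y' with y' F.≟ y
  ... | yes refl rewrite p | d-refl y = sym (+-identityʳ _)
  ... | no q with d y' y ≡ᵇ 0 in e
  ... | true = ⊥-elim (q (d≡0 (≡ᵇ⇒ (d y' y) 0 e)))
  ... | false = cong (λ b → β b * h y') (sym (∧-id (A x y'))) where
   ∧-id : ∀ b → b ∧ true ≡ b
   ∧-id true = refl
   ∧-id false = refl
 Sib# : ∀ {x y} → x ⟶ y → suc (# (Sib x y)) ≡ k
 Sib# {x} p = cong suc (∑-cong λ z → sym (*-identityʳ _)) · sym (self-split p (λ _ → 1)) · (∑-cong λ z → *-identityʳ _) · out x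
 -- Siblings have a common in-neighbour, hence a common out-neighbour.
 sib-co : ∀ {x y y'} → x ⟶ y → x ⟶ y' → 1 ≤ co y y'
 sib-co {x} {y} {y'} p q = ∃# x (and p q) » eq≥ (co-in y y')
 mbin : ∀ {x y} c → x ⟶ y → # (λ y' → Sib x y y' ∧ (co y' y ≡ᵇ c)) ≡ m# c
 mbin {x} {y} c p = (#-cong λ y' → iff (to y') (from y')) · m≡ c p where
  to : ∀ y' → Sib x y y' ∧ (co y' y ≡ᵇ c) ≡ true → A x y' ∧ Fb c y' y ≡ true
  to y' q = and (lft (∧-fst {Sib x y y'} q)) (Fb-intro (≡ᵇ⇒ _ c (∧-snd {Sib x y y'} q)) (Sib-≢ {x} (∧-fst {Sib x y y'} q)))
  from : ∀ y' → A x y' ∧ Fb c y' y ≡ true → Sib x y y' ∧ (co y' y ≡ᵇ c) ≡ true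
  from y' q = ∧-intro {Sib x y y'} (Sib-intro (lft q) (Fb-≢ (rgt q))) (≡⇒ᵇ (Fb-co (rgt q)))
 prof0 : ∑ {suc k} (λ c → m# (toℕ c)) + 1 ≡ k
 prof0 = let (x , y , p) = arc0 in +-comm _ 1 · cong suc (sym ((∑-cong λ z → sym (*-identityʳ _)) · bins (Sib x y) (λ z → co z y) (suc k) (λ z _ → s≤s (co≤k z y)) (λ _ → 1) · (∑-cong λ c → (*-identityʳ _) · mbin (toℕ c) p))) · Sib# p
 -- The summand `k` is `y` compared with itself. Together with `prof0` this gives the size and the
 -- total of the sibling profile `m#`.
 prof1 : ∀ {x y} → x ⟶ y → k + ∑ {suc k} (λ c → m# (toℕ c) * toℕ c) ≡ ∑ (λ z → β (A y z) * sq x z)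
 prof1 {x} {y} p = sym (+≡ (co-self y) (bins (Sib x y) (λ z → co z y) (suc k) (λ z _ → s≤s (co≤k z y)) id · (∑-cong λ c → cong (_* toℕ c) (mbin (toℕ c) p)))) · sym (self-split p (λ z → co z y)) · twoPaths x y
 m0 : m# 0 ≡ 0
 m0 = n≤0⇒n≡0 (≤-pred (≰⇒> none)) where
  none : ¬ (1 ≤ m# 0)
  none q =
   let (x , y , p) = arc0
       (y' , e) = #∃ q
   in 1+n≰n (sib-co (lft e) p » eq≤ (Fb-co (rgt e)))

 -- Normality, twins and single classes

 private
  sq-sum : ∀ p e → p * (p + e) + p * (p + e) + e * e ≡ p * p + (p + e) * (p + e)
  sq-sum = solve-∀
  sq-ineq : ∀ p e → p * (p + e) + p * (p + e) ≤ p * p + (p + e) * (p + e)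
  sq-ineq p e = m≤m+n _ (e * e) » eq≤ (sq-sum p e)
  sq-eq : ∀ p e → p * (p + e) + p * (p + e) ≡ p * p + (p + e) * (p + e) → e ≡ 0
  sq-eq p e h with e * e in f | +-cancelˡ-≡ (p * (p + e) + p * (p + e)) (e * e) 0 (sq-sum p e · sym h · sym (+-identityʳ _))
  ... | .0 | refl with m*n≡0⇒m≡0∨n≡0 e f
  ... | inj₁ q = q
  ... | inj₂ q = q
  -- The equality case does the work of a vanishing norm without subtraction: rows whose two norms
  -- and inner product agree are equal.
  sqs : ∀ p q → p * q + p * q ≤ p * p + q * q × (p * q + p * q ≡ p * p + q * q → p ≡ q)
  sqs p q with ≤-total p q
  ... | inj₁ l with m≤n⇒∃[o]m+o≡n l
  ... | e , refl = sq-ineq p e , λ h → sym (cong (p +_) (sq-eq p e h) · +-identityʳ p)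
  sqs p q | inj₂ l with m≤n⇒∃[o]m+o≡n l
  ... | e , refl = subst₂ _≤_ (+≡ (*-comm q (q + e)) (*-comm q (q + e))) (+-comm (q * q) _) (sq-ineq q e) ,
                     λ h → cong (q +_) (sq-eq q e ((+≡ (*-comm q (q + e)) (*-comm q (q + e))) · h · +-comm _ (q * q))) · +-identityʳ q
 ⊗-congˡ : ∀ {M M'} N → (∀ x y → ⟦ M ⟧ x y ≡ ⟦ M' ⟧ x y) → ∀ x y → ⟦ M ⊗ N ⟧ x y ≡ ⟦ M' ⊗ N ⟧ x y
 ⊗-congˡ N h x y = ∑-cong λ z → cong (_* ⟦ N ⟧ z y) (h x z)
 -- `adj` moves one factor across and leaves Aᵗ A M, respectively A Aᵗ M, against N; these agree
 -- because A is normal.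
 norm : ∀ M N x → ⟨ tr Ax ⊗ M , tr Ax ⊗ N ⟩ x ≡ ⟨ Ax ⊗ M , Ax ⊗ N ⟩ x
 norm M N x = (∑-cong λ y → cong (⟦ tr Ax ⊗ M ⟧ x y *_) (comm (tr Ax) N x y)) · (trans (adj (tr Ax ⊗ M) N (tr Ax) x)
  ((∑-cong λ y → cong (_* ⟦ N ⟧ x y) (mid x y)) · sym ((∑-cong λ y → cong (⟦ Ax ⊗ M ⟧ x y *_) (comm Ax N x y)) · adj (Ax ⊗ M) N Ax x))) where
  mid : ∀ x y → ⟦ tr Ax ⊗ M ⊗ tr (tr Ax) ⟧ x y ≡ ⟦ Ax ⊗ M ⊗ tr Ax ⟧ x y
  mid x y = comm (tr Ax ⊗ M) Ax x y · sym (assoc Ax (tr Ax) M x y) · ⊗-congˡ {Ax ⊗ tr Ax} {tr Ax ⊗ Ax} M (comm Ax (tr Ax)) x y · assoc (tr Ax) Ax M x y · comm (tr Ax) (Ax ⊗ M) x y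
 -- A is normal, so A and its transpose have the same kernel.
 cancel : ∀ M N → (∀ x y → ⟦ Ax ⊗ M ⟧ x y ≡ ⟦ Ax ⊗ N ⟧ x y) → ∀ x y → ⟦ tr Ax ⊗ M ⟧ x y ≡ ⟦ tr Ax ⊗ N ⟧ x y
 cancel M N h x y = snd (sqs (p y) (q y)) (∑≥⇒≡ (λ z → fst (sqs (p z) (q z))) (eq≤ tot) y) where
  p q r : V → ℕ
  p = ⟦ tr Ax ⊗ M ⟧ x
  q = ⟦ tr Ax ⊗ N ⟧ x
  r = ⟦ Ax ⊗ N ⟧ x
  e₁ : ∑ (λ z → p z * q z) ≡ ∑ (λ z → r z * r z)
  e₁ = norm M N x · (∑-cong λ z → cong (_* r z) (h x z))
  e₂ : ∑ (λ z → p z * p z) ≡ ∑ (λ z → r z * r z)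
  e₂ = norm M M x · (∑-cong λ z → cong₂ _*_ (h x z) (h x z))
  tot : ∑ (λ z → p z * p z + q z * q z) ≡ ∑ (λ z → p z * q z + p z * q z)
  tot = (∑-+ _ _) · (+≡ (e₂ · sym e₁) (norm N N x · sym e₁)) · sym (∑-+ _ _)
 -- With `F# k = 1` twinning is an involution without fixed points, and `S` is closed under it.
 twin-even : F# k ≡ 1 → (S : V → Bool) → (∀ z z' → S z ≡ true → Fb k z z' ≡ true → S z' ≡ true) → ∃ λ h → # S ≡ h + h
 twin-even f1 S cl = fst ev , sym (∑-cong row) · snd ev where
  s : V → V → ℕ
  s z z' = β (S z) * (β (S z') * β (Fb k z z'))
  re : ∀ a b c → a * (b * c) ≡ b * (a * c)
  re = solve-∀
  sz : ∀ z → s z z ≡ 0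
  sz z with Fb k z z in e
  ... | true = ⊥-elim (Fb-≢ e refl)
  ... | false = cong (β (S z) *_) (*-zeroʳ (β (S z))) · *-zeroʳ (β (S z))
  ev : ∃ λ h → ∑ (λ z → ∑ (s z)) ≡ h + h
  ev = even s (λ z z' → re (β (S z)) (β (S z')) (β (Fb k z z')) · cong (λ b → β (S z') * (β (S z) * β b)) (Fb-sym)) sz
  row : ∀ z → ∑ (s z) ≡ β (S z)
  row z with S z in e
  ... | false = ∑-0 {n}
  ... | true = (∑-cong λ z' → (+-identityʳ _) · aux z') · F#≡ k z · f1 where
   aux : ∀ z' → β (S z') * β (Fb k z z') ≡ β (Fb k z z')
   aux z' with Fb k z z' in f
   ... | true = (*-identityʳ _) · cong β (cl z z' e f)
   ... | false = *-zeroʳ (β (S z'))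
 twin-out : ∀ {z z' w} → co z z' ≡ k → z ⟶ w → z' ⟶ w
 twin-out {z} {z'} {w} e p = rgt (#-sub≡ (λ u → lft) (eq≤ (out z · sym e)) w p)
 twin-in : ∀ {z z' w} → co z z' ≡ k → w ⟶ z → w ⟶ z'
 twin-in {z} {z'} {w} e p = rgt (#-sub≡ (λ u → lft) (eq≤ (inn z · sym e · co-in z z')) w p)
 co-even : F# k ≡ 1 → ∀ y y' → ∃ λ h → co y y' ≡ h + h
 co-even f1 y y' = twin-even f1 (λ z → A y z ∧ A y' z) λ z z' p f → and (twin-in (Fb-co f) (lft p)) (twin-in (Fb-co f) (rgt p))
 sq-even : F# k ≡ 1 → ∀ y y' → ∃ λ h → sq y y' ≡ h + h
 sq-even f1 y y' = twin-even f1 (λ z → A y z ∧ A z y') λ z z' p f → and (twin-in (Fb-co f) (lft p)) (twin-out (Fb-co f) (rgt p))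
 rowA : ∀ M x → ⟨ Ax , M ⟩ x ≡ k * ⟦ M ⟧ ax ay
 rowA M x = wsum (A x) (⟦ M ⟧ x) _ (λ z q → onA M q axy) · cong (_* _) (out x)
 row : Ex → V → ℕ
 row M x = ∑ (⟦ M ⟧ x)
 row-const : ∀ M x y → row M x ≡ row M y
 row-const M x y = (∑-cong λ z → sym (*-identityʳ _)) · ip-const M one x y · (∑-cong λ z → *-identityʳ _)
 row-tr : ∀ M x → row (tr M) x ≡ row M x
 row-tr M x = (∑-cong λ z → sym (*-identityʳ _)) · ip-tr M one x · (∑-cong λ z → *-identityʳ _)
 row-⊗ : ∀ M N x → row (M ⊗ N) x ≡ row M x * row N x
 row-⊗ M N x = (∑-comm _) · (∑-cong λ z → (∑-*ˡ (⟦ M ⟧ x z) _) · cong (⟦ M ⟧ x z *_) (row-const N z x)) · (∑-*ʳ (row N x) _)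
 factor≤ : ∀ M N x z y → ⟦ M ⟧ x z * ⟦ N ⟧ z y ≤ ⟦ M ⊗ N ⟧ x y
 factor≤ M N x z y = elem≤∑ (λ w → ⟦ M ⟧ x w * ⟦ N ⟧ w y) z
 factor∃ : ∀ M N x y → 1 ≤ ⟦ M ⊗ N ⟧ x y → ∃ λ z → 1 ≤ ⟦ M ⟧ x z × 1 ≤ ⟦ N ⟧ z y
 factor∃ M N x y p = let (z , q) = 1≤∑ (λ w → ⟦ M ⟧ x w * ⟦ N ⟧ w y) p in z , m*n≥1 (⟦ M ⟧ x z) (⟦ N ⟧ z y) q where
  m*n≥1 : ∀ a b → 1 ≤ a * b → 1 ≤ a × 1 ≤ b
  m*n≥1 (suc a) (suc b) _ = z<s , z<s
  m*n≥1 (suc a) zero q = ⊥-elim (1+n≰n (q » eq≤ (*-zeroʳ a)))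
 Rb : V → V → V → V → Bool
 Rb x y = Cb (d x y) (d y x)
 R0 : ∀ x y → Rb x y x y ≡ true
 R0 x y = Cb-intro refl refl
 R# : V → V → ℕ
 R# x y = # (Rb x y x)
 Rx : V → V → Ex
 Rx x y = cls (d x y) (d y x)
 onR : ∀ M {x y u v} → Rb x y u v ≡ true → ⟦ M ⟧ u v ≡ ⟦ M ⟧ x y
 onR M {x} {y} p = on M p (R0 x y)
 Rsize : ∀ x y u → # (Rb x y u) ≡ R# x y
 Rsize x y u = size (hit (d x y) (d y x)) u x
 Rval : ∀ M x y → ⟨ Rx x y , M ⟩ x ≡ R# x y * ⟦ M ⟧ x y
 Rval M x y = wsum (Rb x y x) (⟦ M ⟧ x) _ (λ z p → onR M p)
 R>0 : ∀ x y → 1 ≤ R# x y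
 R>0 x y = ∃# y (R0 x y)
 R≤row : ∀ M x y → R# x y * ⟦ M ⟧ x y ≤ row M x
 R≤row M x y = eq≥ (Rval M x y) » (∑-mono λ z → le (Rb x y x z) (⟦ M ⟧ x z)) where
  le : ∀ b m → β b * m ≤ m
  le true m = eq≤ (+-identityʳ m)
  le false m = z≤n
 -- A class that exhausts the row sum of `M` is its whole support. Any two pairs on which `M` is
 -- positive then have the same distances.
 R-full : ∀ M x y → row M x ≤ R# x y * ⟦ M ⟧ x y → ∀ u v → 1 ≤ ⟦ M ⟧ u v → Rb x y u v ≡ true
 R-full M x y h u v p = pick (cases (Rb x y u v)) where
  le : ∀ b m → β b * m ≤ m
  le true m = eq≤ (+-identityʳ m)
  le false m = z≤n
  eq : ∀ z → β (Rb x y u z) * ⟦ M ⟧ u z ≡ ⟦ M ⟧ u z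
  eq = ∑≥⇒≡ (λ z → le (Rb x y u z) (⟦ M ⟧ u z)) (eq≤ (row-const M u x) » h » eq≤ (cong (_* ⟦ M ⟧ x y) (sym (Rsize x y u)) · sym (wsum (Rb x y u) (⟦ M ⟧ u) _ (λ z p → onR M p))))
  pick : (Rb x y u v ≡ true) ⊎ (Rb x y u v ≡ false) → Rb x y u v ≡ true
  pick (inj₁ r) = r
  pick (inj₂ r) = ⊥-elim (1+n≰n (p » eq≤ (sym (eq v) · cong (λ b → β b * ⟦ M ⟧ u v) r)))
 Rmul : ∀ M N x y → R# x y * ⟦ M ⊗ N ⟧ x y ≡ ⟨ M , Rx x y ⊗ tr N ⟩ x
 Rmul M N x y = sym (Rval (M ⊗ N) x y) · adj (Rx x y) M N x · ip-comm (Rx x y ⊗ tr N) M x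
 -- Triples over the class of (x , y) are counted by their first arc, so `k` divides the class size
 -- times the entry.
 RmulA : ∀ N x y → ∃ λ q → R# x y * ⟦ Ax ⊗ N ⟧ x y ≡ k * q
 RmulA N x y = _ , Rmul Ax N x y · rowA (Rx x y ⊗ tr N) x
 RmulT : ∀ N x y → ∃ λ q → R# x y * ⟦ Tx ⊗ N ⟧ x y ≡ t * q
 RmulT N x y = _ , Rmul Tx N x y · wsum (Tb x) _ _ (λ z p → on (Rx x y ⊗ tr N) p T0) · cong (_* ⟦ Rx x y ⊗ tr N ⟧ x₀ y₀) (tsize x)
 𝟙 : Ex
 𝟙 = δ (λ i _ → β (i ≡ᵇ 0))
 𝟙⊗ : ∀ M x y → ⟦ 𝟙 ⊗ M ⟧ x y ≡ ⟦ M ⟧ x y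
 𝟙⊗ M x y = (∑-cong λ z → cong (λ b → β b * ⟦ M ⟧ z y) (iff (λ p → subst (λ u → x == u ≡ true) (d≡0 (≡ᵇ⇒ (d x z) 0 p)) (==-refl x)) (λ p → ≡⇒ᵇ (subst (λ u → d x u ≡ 0) (==⇒≡ p) (d-refl x))))) · ∑-pick x (λ z → ⟦ M ⟧ z y)
 𝟙-diag : ∀ x → ⟦ 𝟙 ⟧ x x ≡ 1
 𝟙-diag x = cong (λ i → β (i ≡ᵇ 0)) (d-refl x)
 𝟙-off : ∀ {x y} → x ≢ y → ⟦ 𝟙 ⟧ x y ≡ 0
 𝟙-off {x} {y} ne = cong β (¬t λ p → ne (d≡0 (≡ᵇ⇒ (d x y) 0 p)))

 -- `P = k`: the digraph (v)

 module Full (pk : P ≡ k) where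
  g : ℕ
  g = 3 + g0
  full1 : ∀ {x y z} → x ⇉ z → x ⟶ y → y ⟶ z
  full1 {x} {y} p q = rgt (#-sub≡ (λ _ → ∧-fst) (eq≤ (out x · sym (sqT p · pk))) y q)
  full2 : ∀ {x y z} → x ⇉ z → y ⟶ z → x ⟶ y
  full2 {x} {y} {z} p q = ∧-fst (#-sub≡ (λ u → rgt) (eq≤ (inn z · sym (sqT p · pk))) y q)
  Eq : V → V → Set
  Eq x y = ∀ z → x ⟶ z → y ⟶ z
  -- Let `z` and `w` continue a shortest cycle through `x` and `y`. Both siblings are in relation T
  -- to `w`, so an out-neighbour of `y` precedes `w` and hence follows `y'`.
  sib-Eq : ∀ {x y y'} → x ⟶ y → x ⟶ y' → Eq y y'
  sib-Eq {x} {y} {y'} p p' u a with extend p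
  ... | z , q , t with first-step {z} {x} (Cb-snd t)
  ... | w , r , e = full2 (tw p' (full1 t p')) (full1 (tw p q) a) where
   tw : ∀ {y} → x ⟶ y → y ⟶ z → y ⇉ w
   tw {y} p q = mkT q r (d-tri w x y » eq≤ ((+≡ e (A⇒d p)) · +-comm g0 1))
  unsnoc : ∀ {m x y} → W (suc m) x y → ∃ λ z → W m x z × z ⟶ y
  unsnoc {m} {x} {y} p with W-split m (subst (λ l → W l x y) (+-comm 1 m) p)
  ... | z , q , r with W-uncons r
  ... | u , s , t = z , q , subst (z ⟶_) (W-nil⁻¹ t) s
  same : ∀ m {x u v} → W (suc m) x u → W (suc m) x v → Eq u v
  same zero p q with unsnoc p | unsnoc q
  ... | a , pa , a→ | b , pb , b→ with W-nil⁻¹ pa | W-nil⁻¹ pb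
  ... | refl | refl = sib-Eq a→ b→
  same (suc m) p q with unsnoc p | unsnoc q
  ... | a , pa , a→ | b , pb , b→ = sib-Eq (same m pa pb _ a→) b→
  round : ∀ x → W g x x
  round x with has-out x
  ... | y , p = subst (λ l → W l x x) (cong suc (ty x y p)) (W-cons p (d-walk y x))
  rounds : ∀ q {x} → W (q * g) x x
  rounds zero = W-nil
  rounds (suc q) {x} = W-++ (round x) (rounds q)
  -- For a remainder `suc r`, cut the walk after `suc r` steps at `u`. The rest has length a
  -- multiple of `g`, so `u` leads to every out-neighbour `y` of `x`. Thus `y` is reached after
  -- `2 + r` steps, behaves like the vertex met then on a shortest cycle through `x`, and returns
  -- too early.
  divides₊ : ∀ m x → W m x x → m % g ≡ 0
  divides₊ m x w with m % g in eq
  ... | zero = refl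
  ... | suc r = ⊥-elim (impossible (m / g) refl) where
   r<g : suc r < g
   r<g = subst (_< g) eq (m%n<n m g)
   m≡1 : ∀ q → q ≡ m / g → m ≡ suc r + q * g
   m≡1 q e = m≡m%n+[m/n]*n m g · cong₂ (λ a b → a + b * g) eq (sym e)
   impossible : ∀ q → q ≡ m / g → ⊥
   impossible zero e = <⇒≱ r<g (no-closed (subst (λ l → W l x x) (m≡1 0 e · +-identityʳ _) w))
   impossible (suc q) e with W-split (suc r) (subst (λ l → W l x x) (m≡1 (suc q) e) w)
   ... | u , xu , ux with has-out x
   ... | y , p = go (W-split (2+ r) (subst (λ l → W l x x) (sym (m+[n∸m]≡n r<g)) (round x))) where
    uy : W (2+ r) x y
    uy = subst (λ l → W l x y) (+-comm (suc r) 1) (W-++ xu (W-cons (same _ ux (rounds (suc q)) y p) W-nil))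
    go : (∃ λ v → W (2+ r) x v × W (g ∸ 2+ r) v x) → ⊥
    go (v , xv , vx) with g ∸ 2+ r in e'
    ... | zero = t≢f (same _ xv uy y (subst (_⟶ y) (sym (W-nil⁻¹ vx)) p)) (loopless y)
    ... | suc l with W-uncons vx
    ... | v' , vv' , v'x = <⇒≱ short' (eq≥ (ty x y p) » d-min (W-cons (same _ xv uy v' vv') v'x)) where
     short' : suc l < 2 + g0
     short' = subst (_< 2 + g0) e' (s≤s (m∸n≤m (1 + g0) r))
  same-len : ∀ {m m' x y} → W m x y → W m' x y → m % g ≡ m' % g
  same-len {m} {m'} {x} {y} p q = %-match g m m' (d y x) (divides₊ _ x (W-++ p (d-walk y x))) (divides₊ _ x (W-++ q (d-walk y x)))
  lvl : V → ℕ
  lvl x = d x₀ x % g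
  lvl< : ∀ x → lvl x < g
  lvl< x = m%n<n (d x₀ x) g
  arc-lvl : ∀ {x y} → x ⟶ y → lvl y ≡ next-Iso g (lvl x)
  arc-lvl {x} {y} p = same-len (d-walk x₀ y) (subst (λ l → W l x₀ y) (+-comm (d x₀ x) 1) (W-++ (d-walk x₀ x) (W-cons p W-nil))) · %-suc g (d x₀ x)
  -- Full turns at the end make the two walks from `x₀` equally long, and `same` applies.
  lvl-Eq : ∀ x u → lvl x ≡ lvl u → Eq u x
  lvl-Eq x u e = same _ {x₀} (subst (λ l → W l x₀ u) (len (d x₀ u) (d x₀ x)) (W-++ (d-walk x₀ u) (rounds (suc (d x₀ x / g)))))
                        (subst (λ l → W l x₀ x) (len (d x₀ x) (d x₀ u) · eq) (W-++ (d-walk x₀ x) (rounds (suc (d x₀ u / g))))) where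
   sz : ℕ → ℕ → ℕ
   sz a b = 2 + g0 + (a % g + (a / g) * g + (b / g) * g)
   len : ∀ a b → a + suc (b / g) * g ≡ suc (sz a b)
   len a b = cong (_+ suc (b / g) * g) (m≡m%n+[m/n]*n a g) · lem (a % g) (a / g * g) (b / g * g) g0 where
    lem : ∀ r s t g0 → r + s + (3 + g0 + t) ≡ suc (2 + g0 + (r + s + t))
    lem = solve-∀
   eq : suc (sz (d x₀ x) (d x₀ u)) ≡ suc (sz (d x₀ u) (d x₀ x))
   eq = cong (λ w → suc (2 + g0 + w)) (cong (λ w → w + d x₀ x / g * g + d x₀ u / g * g) e · (lem (lvl u) _ _)) where
    lem : ∀ r s t → r + s + t ≡ r + t + s
    lem = solve-∀
  lvl-arc : ∀ x y → lvl y ≡ next-Iso g (lvl x) → x ⟶ y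
  lvl-arc x y e with has-in y
  ... | u , p = lvl-Eq x u (next-inj g _ _ (sym e · arc-lvl p) (lvl< x) (lvl< u)) y p
  lev : V → Fin g
  lev x = fromℕ< (lvl< x)
  lev≡ : ∀ x → toℕ (lev x) ≡ lvl x
  lev≡ x = toℕ-fromℕ< (lvl< x)
  reach : ∀ (i : Fin g) → ∃ λ y → lvl y ≡ toℕ i
  reach i with W-split (toℕ i) (subst (λ l → W l x₀ x₀) (sym (m+[n∸m]≡n (<⇒≤ (toℕ<n i)))) (round x₀))
  ... | y , p , _ = y , same-len (d-walk x₀ y) p · m<n⇒m%n≡m (toℕ<n i)
  lev-size : ∀ i → # (λ x → lev x == i) ≡ k
  lev-size i with reach i
  ... | y , e with has-in y
  ... | u , p = (#-cong λ x → iff (to x) (from x)) · out u where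
   to : ∀ x → (lev x == i) ≡ true → u ⟶ x
   to x q = lvl-arc u x (sym (lev≡ x) · cong toℕ (==⇒≡ q) · sym e · arc-lvl p)
   from : ∀ x → u ⟶ x → (lev x == i) ≡ true
   from x q = subst (λ j → lev x == j ≡ true) (toℕ-injective (lev≡ x · arc-lvl q · sym (arc-lvl p) · e)) (==-refl (lev x))
  open Levels lev (λ i → enum≡ (λ x → lev x == i) (lev-size i))
  sd : V → V → ℕ
  sd x y = subMod k (toℕ (idx y)) (toℕ (idx x))
  sg : V → V → ℕ
  sg x y = subMod g (toℕ (lev y)) (toℕ (lev x))
  sg-arc : ∀ x y → x ⟶ y → sg x y ≡ 1
  sg-arc x y p = cong (λ u → subMod g u (toℕ (lev x))) (lev≡ y · arc-lvl p · cong (next-Iso g) (sym (lev≡ x))) · next-subMod g (toℕ (lev x)) (≤2+ z≤n) (toℕ<n (lev x))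
  arc-sg : ∀ x y → sg x y ≡ 1 → x ⟶ y
  arc-sg x y p = lvl-arc x y (sym (lev≡ y) · subMod-next g (toℕ (lev x)) (toℕ (lev y)) (≤2+ z≤n) (toℕ<n (lev x)) (toℕ<n (lev y)) p · cong (next-Iso g) (lev≡ x))
  iso : IsomorphicTo A (Fin g × Fin k) (CayZ² g k (S-v k))
  iso = bij , λ x y → iff (to x y) (from x y) where
   to : ∀ x y → x ⟶ y → CayZ² g k (S-v k) (loc x) (loc y) ≡ true
   to x y p = elem2-intro k (sg x y) (sd x y) id (sd x y) (subMod< k _ _ (toℕ<n (idx x)) (toℕ<n (idx y))) (sg-arc x y p) refl
   from : ∀ x y → CayZ² g k (S-v k) (loc x) (loc y) ≡ true → x ⟶ y
   from x y p = arc-sg x y (fst (elem2-elim k (sg x y) (sd x y) id p))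
 module AllT (Qk : Qv ≡ k) where
  allT : ∀ {x y z} → x ⟶ y → y ⟶ z → x ⇉ z
  allT {x} {y} {z} p q = lftC (#-sub≡ (λ u → rgtC) (eq≤ (out y · sym (qT p · Qk))) z q)
  paths : ∀ {x y} → x ⟶ y → ∑ (λ z → β (A y z) * sq x z) ≡ k * P
  paths {x} {y} p = wsum (A y) (sq x) P (λ z q → sqT (allT p q)) · cong (_* P) (out y)
  sq≡T : ∀ x z → sq x z ≡ β (Tb x z) * P
  sq≡T x z with Tb x z in e
  ... | true = sqT e · sym (+-identityʳ P)
  ... | false = n≤0⇒n≡0 (≤-pred (≰⇒> λ q → let (y , f) = #∃ q in t≢f (allT (lft f) (rgt f)) e))

-- Girth at least four: the possible parameters

module Girth4 {n : ℕ} {A : Rel n} {k g₁ : ℕ} (H : Hyp A k (suc g₁)) where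
 open Theory H
 g0 : ℕ
 g0 = suc g₁
 Ub : V → V → Bool
 Ub = Cb 3 g0
 toU : ∀ {x z} → x ⇉ z → ∃ λ v → z ⟶ v × Ub x v ≡ true
 toU {x} {z} p =
  let (v , q , r) = first-step {z} {x} (Cb-snd p) in
  v , q , tight (x≢v r) (d-tri x z v » eq≤ (+≡ (Cb-fst p) (A⇒d q))) (eq≤ r) refl where
  x≢v : ∀ {v} → d v x ≡ g0 → x ≢ v
  x≢v r refl = 1+n≢0 (sym r · d-refl x)
 AT TA : V → V → ℕ
 AT x v = # (λ y → A x y ∧ Tb y v)
 TA x v = # (λ z → Tb x z ∧ A z v)
 AT≡ : ∀ x v → ⟦ Ax ⊗ Tx ⟧ x v ≡ AT x v
 AT≡ x v = cnt (A x) (λ y → Tb y v)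
 AT≡TA : ∀ x v → AT x v ≡ TA x v
 AT≡TA x v = sym (AT≡ x v) · comm Ax Tx x v · cnt (Tb x) (λ z → A z v)
 -- Around a shortest cycle through x, z, v every first step from x towards z also leads to v.
 stepT : ∀ {x y z v} → x ⟶ y → y ⟶ z → z ⟶ v → Ub x v ≡ true → y ⇉ v
 stepT {x} {y} {z} {v} p q r u = mkT q r (d-tri v x y » eq≤ ((+≡ (Cb-snd u) (A⇒d p)) · +-comm g0 1))
 backT : ∀ {x y z v} → x ⟶ y → y ⟶ z → z ⟶ v → Ub x v ≡ true → x ⇉ z
 backT {x} {y} {z} {v} p q r u = mkT p q (d-tri z v x » eq≤ (+≡ (A⇒d r) (Cb-snd u)))
 P≤AT : ∀ {x v} → Ub x v ≡ true → P ≤ AT x v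
 P≤AT u =
  let (z , q , r , s) = up {1} {g0} u refl in
  ≤-trans (eq≥ (sqT q)) (#-mono λ y w → and (lft w) (s y (lft w) (arcC (rgt w))))
 AT≤Q : ∀ {x v} → Ub x v ≡ true → AT x v ≤ Qv
 AT≤Q {x} {v} u = propagate g₁ 2 (AT x v) refl λ x' v' u' → eq≤ (sym (AT≡ x v) · on (Ax ⊗ Tx) u u' · AT≡ x' v')
 k≤P+2 : k ≤ 2 + P
 k≤P+2 = m≤n+m∸n k 2 » +-monoʳ-≤ 2 Pℓ
 u0 : ∃₂ λ x v → Ub x v ≡ true
 u0 = let (v , _ , u) = toU T0 in x₀ , v , u
 disjoint : (p q r : V → Bool) → (∀ z → p z ∧ q z ≡ true → p z ∧ r z ≡ true → ⊥) → # (λ z → p z ∧ q z) + # (λ z → p z ∧ r z) ≤ # p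
 disjoint p q r h = eq≥ (∑-+ _ _) » (∑-mono λ z → aux (p z) (q z) (r z) (h z)) where
  aux : ∀ p q r → (p ∧ q ≡ true → p ∧ r ≡ true → ⊥) → β (p ∧ q) + β (p ∧ r) ≤ β p
  aux false q r h = z≤n
  aux true false r h = β≤1 r
  aux true true false h = ≤-refl
  aux true true true h = ⊥-elim (h refl refl)
 module Eq (pq : P ≡ Qv) (p<k : P < k) where
  AT≡P : ∀ {x v} → Ub x v ≡ true → AT x v ≡ P
  AT≡P u = ≤-antisym (AT≤Q u » eq≥ pq) (P≤AT u)
  t≡k : t ≡ k
  t≡k = *-cancelʳ-≡ t k P {{>-nonZero (lia≤ (k ∷ P ∷ []) ((κ 4 ≼ ν0) ∷ (ν0 ≼ κ 2 ⊹ ν1) ∷ []) (κ 1) ν1 (k>3 , k≤P+2))}} (sym kQ · cong (k *_) (sym pq))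
  missing : ∀ {x v} → Ub x v ≡ true → ∃ λ y → A x y ∧ not (Tb y v) ≡ true
  missing {x} {v} u = #∃ (+-cancelˡ-≤ (AT x v) 1 _ (begin
   AT x v + 1 ≡⟨ cong (_+ 1) (AT≡P u) ⟩
   P + 1 ≡⟨ +-comm P 1 ⟩
   suc P ≤⟨ p<k ⟩
   k ≡⟨ out x ⟨
   # (A x) ≡⟨ #-split (A x) (λ y → Tb y v) ⟩
   AT x v + # (λ y → A x y ∧ not (Tb y v)) ∎))
   where open ≤-Reasoning
  -- Take a first step `y₁` that is off course for `v`. The `P` vertices of T(x) before `v` and the
  -- `Qv = P` vertices of T(x) after `y₁` are disjoint, and T(x) has `t = k` elements.
  twoP : P + P ≤ k
  twoP =
   let (x , v , u) = u0
       (y₁ , e) = missing u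
       xy = lft e
       miss : ∀ z → Tb x z ∧ A z v ≡ true → Tb x z ∧ A y₁ z ≡ true → ⊥
       miss = λ z p q → t≢f (stepT xy (rgtC q) (rgtC p) u) (not-t (rgt e))
   in eq≤ (+≡ (sym (sym (AT≡TA x v) · AT≡P u)) (pq · sym (qT xy))) » disjoint (Tb x) (λ z → A z v) (A y₁) miss » eq≤ (tsize x · t≡k)
  result : k ≡ 4 × P ≡ 2 × t ≡ 4
  result = k≡4 , lia≡ (k ∷ P ∷ []) ((κ 4 ≼ ν0) ∷ (ν0 ≼ κ 2 ⊹ ν1) ∷ (ν1 ⊹ ν1 ≼ ν0) ∷ []) ν1 (κ 2) (k>3 , k≤P+2 , twoP) , t≡k · k≡4 where
   k≡4 : k ≡ 4
   k≡4 = lia≡ (k ∷ P ∷ []) ((κ 4 ≼ ν0) ∷ (ν0 ≼ κ 2 ⊹ ν1) ∷ (ν1 ⊹ ν1 ≼ ν0) ∷ []) ν0 (κ 4) (k>3 , k≤P+2 , twoP)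
 data Outcome : Set where
  o2 : k ≡ 4 → P ≡ 2 → Qv ≡ 2 → t ≡ 4 → Outcome
  o3 : k ≡ 4 → P ≡ 2 → Qv ≡ 3 → t ≡ 6 → Outcome
  o4 : k ≡ 4 → P ≡ 2 → Qv ≡ 4 → t ≡ 8 → Outcome
  o6 : k ≡ 6 → P ≡ 4 → Qv ≡ 6 → t ≡ 9 → Outcome
 outcome : P < k → Outcome
 outcome p<k = aux (P ≟ Qv) where
  aux : Dec (P ≡ Qv) → Outcome
  aux (yes pq) = let (a , b , c) = Eq.result pq p<k in o2 a b (sym pq · b) c
  aux (no ne) = pack (numeric k P Qv t k>3 k≤P+2 p<k (≤∧≢⇒< P≤Q ne) Q≤k kQ) where
   pack : _ → Outcome
   pack (inj₁ (a , b , c , e)) = o3 a b c e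
   pack (inj₂ (inj₁ (a , b , c , e))) = o4 a b c e
   pack (inj₂ (inj₂ (a , b , c , e))) = o6 a b c e

-- Girth at least four, valency six

module Case6 {n : ℕ} {A : Rel n} {g0 : ℕ} (H : Hyp A 6 g0) (P4 : Theory.P H ≡ 4) (Q6 : Theory.Qv H ≡ 6) (t9 : Theory.t H ≡ 9) where
 open Theory H
 open AllT Q6
 -- Both out-neighbourhoods, of size 6, lie in T(x), which has 9 elements.
 co≥3 : ∀ {x y y'} → x ⟶ y → x ⟶ y' → 3 ≤ co y y'
 co≥3 {x} {y} {y'} p q = lia≤ (co y y' ∷ []) ((κ 12 ≼ κ 9 ⊹ ν0) ∷ []) (κ 3) ν0
  (subst₂ _≤_ (+≡ (out y) (out y')) (cong (_+ co y y') (tsize x · t9)) (incl (A y) (A y') (Tb x) (λ z → allT p) (λ z → allT q)))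
 small : ∀ c → c < 3 → m# c ≡ 0
 small c lt = n≤0⇒n≡0 (≤-pred (≰⇒> none)) where
  none : ¬ (1 ≤ m# c)
  none q =
   let (x , y , p) = arc0
       (y' , e) = #∃ q
   in <⇒≱ lt (co≥3 (lft e) p » eq≤ (Fb-co (rgt e)))
 e0 : m# 3 + (m# 4 + (m# 5 + m# 6)) ≡ 5
 e0 = lem m0 (small 1 (≤2+ z≤n)) (small 2 ≤-refl) (cong (_+ 1) (sym (∑7 _)) · prof0) where
  lem : ∀ {a b c r} → a ≡ 0 → b ≡ 0 → c ≡ 0 → a + (b + (c + r)) + 1 ≡ 6 → r ≡ 5
  lem {r = r} refl refl refl e = suc-injective (+-comm 1 r · e)
 e₁ : 3 * m# 3 + (4 * m# 4 + (5 * m# 5 + 6 * m# 6)) ≡ 18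
 e₁ = lem {a = m# 0} {m# 1} {m# 2} {m# 3} {m# 4} {m# 5} {m# 6} m0 (small 1 (≤2+ z≤n)) (small 2 ≤-refl)
          (cong (6 +_) (sym (∑7 _)) · prof1 axy · paths axy · cong (6 *_) P4) where
  swap : ∀ a b c e → 3 * a + (4 * b + (5 * c + 6 * e)) ≡ a * 3 + (b * 4 + (c * 5 + e * 6))
  swap = solve-∀
  lem : ∀ {a b c m₃ m₄ m₅ m₆} → a ≡ 0 → b ≡ 0 → c ≡ 0 → 6 + (a * 0 + (b * 1 + (c * 2 + (m₃ * 3 + (m₄ * 4 + (m₅ * 5 + m₆ * 6)))))) ≡ 24 → 3 * m₃ + (4 * m₄ + (5 * m₅ + 6 * m₆)) ≡ 18
  lem {m₃ = m₃} {m₄} {m₅} {m₆} refl refl refl e = swap m₃ m₄ m₅ m₆ · +-cancelˡ-≡ 6 _ 18 e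
 -- The profile consists of one twin and four siblings with three common out-neighbours. Three is
 -- odd, whereas twins pair up every common out-neighbourhood.
 absurd : ⊥
 absurd =
  let (m6 , m3) = num6 (m# 3) (m# 4) (m# 5) (m# 6) (F# 4) (F# 5) e0 e₁ (k*m 4) (k*m 5)
      (x , y , p) = arc0
      (y' , e) = #∃ (≥1 m3)
      F6≡1 = *-cancelˡ-≡ (F# 6) 1 6 (sym (k*m 6) · cong (6 *_) m6)
      (h , odd) = co-even F6≡1 y' y
  in no3 h (sym (Fb-co (rgt e)) · odd) where
  no3 : ∀ h → 3 ≡ h + h → ⊥
  no3 (2+ h) e = lia (h ∷ []) ((κ 3 ≋ κ 2 ⊹ ν0 ⊹ (κ 2 ⊹ ν0)) ∷ []) e
  no3 1 ()
  no3 0 ()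

-- Girth at least four, valency four

module Val4 {n : ℕ} {A : Rel n} {g₁ : ℕ} (H : Hyp A 4 (suc g₁)) (P2 : Theory.P H ≡ 2) where
 open Theory H
 open Girth4 H
 f0 : m# 1 + (m# 2 + (m# 3 + m# 4)) ≡ 3
 f0 = lem m0 (cong (_+ 1) (sym (∑5 _)) · prof0) where
  lem : ∀ {a r} → a ≡ 0 → a + r + 1 ≡ 4 → r ≡ 3
  lem {r = r} refl e = suc-injective (+-comm 1 r · e)
 f₁ : ∀ {x y s} → x ⟶ y → ∑ (λ z → β (A y z) * sq x z) ≡ 4 + s → m# 1 + (2 * m# 2 + (3 * m# 3 + 4 * m# 4)) ≡ s
 f₁ p e = lem {m# 0} {m# 1} {m# 2} {m# 3} {m# 4} m0 (cong (4 +_) (sym (∑5 _)) · prof1 p · e) where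
  swap : ∀ a b c e → a + (2 * b + (3 * c + 4 * e)) ≡ a * 1 + (b * 2 + (c * 3 + e * 4))
  swap = solve-∀
  lem : ∀ {a b c m₃ m₄ s} → a ≡ 0 → 4 + (a * 0 + (b * 1 + (c * 2 + (m₃ * 3 + m₄ * 4)))) ≡ 4 + s → b + (2 * c + (3 * m₃ + 4 * m₄)) ≡ s
  lem {b = b} {c} {m₃} {m₄} refl e = swap b c m₃ m₄ · +-cancelˡ-≡ 4 _ _ e
 module Case4 (Q4 : Qv ≡ 4) (t8 : t ≡ 8) where
  open AllT Q4
  ms : m# 2 ≡ 1 × m# 1 ≡ 2
  ms = num4 (m# 1) (m# 2) (m# 3) (m# 4) f0 (f₁ axy (paths axy · cong (4 *_) P2))
  F2 : F# 2 ≡ 2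
  F2 = *-cancelˡ-≡ (F# 2) 2 2 (sym (k*m 2) · cong (4 *_) (fst ms))
  partner : ∀ {y z} → y ⟶ z → ∃ λ z' → y ⟶ z' × Fb 2 z' z ≡ true
  partner p =
   let (z' , e) = #∃ (eq≥ (m≡ 2 p · fst ms))
   in z' , lft e , rgt e
  TF : V → V → ℕ
  TF x z = # (λ z' → Tb x z' ∧ Fb 2 z' z)
  opaque
   -- Siblings `y`, `y'` have a single common out-neighbour `z`; so the `F 2` partner of `z` after
   -- `y` differs from the one after `y'`, and both lie in T(x).
   good : ∃₂ λ x z → x ⇉ z × 2 ≤ TF x z
   good =
    let (x , y , xy) = arc0
        (y' , e) = #∃ (≥1 (snd ms))
        xy' = lft e
        c1 = Fb-co {1} {y'} {y} (rgt e)
        (z , w) = #∃ (eq≥ c1)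
        y'z = lft w
        yz = rgt w
        (z1 , yz1 , f₁) = partner yz
        (z₂ , y'z2 , f₂) = partner y'z
        ne : z1 ≢ z₂
        ne = λ eq → 1+n≰n (two≤ {P = λ u → A y' u ∧ A y u} {z} {z1} (and y'z yz) (and (subst (y' ⟶_) (sym eq) y'z2) yz1) (λ q → Fb-≢ f₁ (sym q)) » eq≤ c1)
    in x , z , allT xy yz , two≤ (andC (allT xy yz1) f₁) (andC (allT xy' y'z2) f₂) ne
  TF≡ : ∀ x z → ⟦ Tx ⊗ Fx 2 ⟧ x z ≡ TF x z
  TF≡ x z = cnt (Tb x) (λ z' → Fb 2 z' z)
  TF≥ : ∀ {x z} → x ⇉ z → 2 ≤ TF x z
  TF≥ {x} {z} p = let (x' , z' , q , r) = good in r » eq≤ (sym (TF≡ x' z') · on (Tx ⊗ Fx 2) q p · TF≡ x z)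
  -- Eight entries are at least 2 and the row sum is 16, so T F = 2 T, where F is `Fx 2`.
  TF-exact : ∀ x z → β (Tb x z) * 2 ≡ ⟦ Tx ⊗ Fx 2 ⟧ x z
  TF-exact x = ∑≥⇒≡ le (eq≤ (tot · sym (∑-*ʳ 2 (λ z → β (Tb x z)) · cong (_* 2) (tsize x · t8)))) where
   le : ∀ z → β (Tb x z) * 2 ≤ ⟦ Tx ⊗ Fx 2 ⟧ x z
   le z with Tb x z in e
   ... | true = TF≥ e » eq≥ (TF≡ x z)
   ... | false = z≤n
   tot : ∑ (⟦ Tx ⊗ Fx 2 ⟧ x) ≡ 16
   tot = (∑-comm _) · (∑-cong λ z' → (∑-*ˡ (β (Tb x z')) _) · cong (β (Tb x z') *_) (F#≡ 2 z' · F2)) · ∑-*ʳ 2 _ · cong (_* 2) (tsize x · t8)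
  2Ax : Ex
  2Ax = pw (λ a _ → 2 * a) Ax Ax
  -- Here A A = 2 T and T F = 2 T. After `cancel` has replaced the left factor by its transpose, the
  -- diagonal reads 4 on one side and 8 on the other.
  AG : ∀ x y → ⟦ Ax ⊗ (Ax ⊗ Fx 2) ⟧ x y ≡ ⟦ Ax ⊗ 2Ax ⟧ x y
  AG x y = begin
   ⟦ Ax ⊗ (Ax ⊗ Fx 2) ⟧ x y ≡⟨ assoc Ax Ax (Fx 2) x y ⟨
   ∑ (λ z → ⟦ Ax ⊗ Ax ⟧ x z * β (Fb 2 z y)) ≡⟨ ∑-cong (λ z → cong (_* β (Fb 2 z y)) (sq≡ x z · sq≡T x z · cong (β (Tb x z) *_) P2) · lem (β (Tb x z)) (β (Fb 2 z y))) ⟩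
   ∑ (λ z → 2 * (β (Tb x z) * β (Fb 2 z y))) ≡⟨ ∑-*ˡ 2 _ ⟩
   2 * ⟦ Tx ⊗ Fx 2 ⟧ x y ≡⟨ cong (2 *_) (TF-exact x y) ⟨
   2 * (β (Tb x y) * 2) ≡⟨ cong (2 *_) (sq≡T x y · cong (β (Tb x y) *_) P2) ⟨
   2 * sq x y ≡⟨ cong (2 *_) (sq≡ x y) ⟨
   2 * ⟦ Ax ⊗ Ax ⟧ x y ≡⟨ ∑-*ˡ 2 _ ⟨
   ∑ (λ z → 2 * (β (A x z) * β (A z y))) ≡⟨ ∑-cong (λ z → lem' (β (A x z)) (β (A z y))) ⟩
   ⟦ Ax ⊗ 2Ax ⟧ x y ∎ where
   open ≡-Reasoning
   lem : ∀ a b → a * 2 * b ≡ 2 * (a * b)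
   lem = solve-∀
   lem' : ∀ a b → 2 * (a * b) ≡ a * (2 * b)
   lem' = solve-∀
  absurd : ⊥
  absurd = four≢eight (sym l · cancel (Ax ⊗ Fx 2) 2Ax AG x₀ x₀ · r) where
   four≢eight : 4 ≡ 8 → ⊥
   four≢eight ()
   l : ⟦ tr Ax ⊗ (Ax ⊗ Fx 2) ⟧ x₀ x₀ ≡ 4
   l = wsum (λ y → A y x₀) _ 1 (λ y p → cnt (A y) (λ z → Fb 2 z x₀) · m≡ 2 p · fst ms) · *-identityʳ _ · inn x₀
   r : ⟦ tr Ax ⊗ 2Ax ⟧ x₀ x₀ ≡ 8
   r = wsum (λ y → A y x₀) _ 2 (λ y p → cong (λ b → 2 * β b) p) · cong (_* 2) (inn x₀)
 module Three (Q3 : Qv ≡ 3) (t6 : t ≡ 6) where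
  opaque
   stray : ∃ λ w → ay ⟶ w × Tb ax w ≡ false
   stray = let
       x = ax
       y = ay
       (w , e) = #∃ (+-cancelˡ-≤ 3 1 _ (eq≤ (sym (out y) · #-split (A y) (Tb x) · cong (_+ # (λ z → A y z ∧ not (Tb x z))) ((#-cong λ z → ∧-comm (A y z) (Tb x z)) · Q3))))
    in w , lft e , not-t (rgt e)
  xa ya wa : V
  xa = ax
  ya = ay
  wa = fst stray
  -- Over every arc from `x` to `y` three of the four out-neighbours of `y` lie in T(x). The class W
  -- of one exceptional pair meets the out-neighbours of `y` over each arc, hence catches all
  -- exceptions.
  Wx : Ex
  Wx = cls (d xa wa) (d wa xa)
  Wb : V → V → Bool
  Wb = Cb (d xa wa) (d wa xa)
  W0 : Wb xa wa ≡ true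
  W0 = Cb-intro refl refl
  onW : ∀ M {x y x' y'} → Wb x y ≡ true → Wb x' y' ≡ true → ⟦ M ⟧ x y ≡ ⟦ M ⟧ x' y'
  onW M = on M
  W⇒¬T : ∀ {x y} → Wb x y ≡ true → Tb x y ≡ false
  W⇒¬T p = ¬t λ q → t≢f (Cb-intro (sym (Cb-fst p) · Cb-fst q) (sym (Cb-snd p) · Cb-snd q)) (snd (snd stray))
  nonT# : ∀ {x y} → x ⟶ y → # (λ z → A y z ∧ not (Tb x z)) ≡ 1
  nonT# {x} {y} p = +-cancelˡ-≡ 3 _ 1 (cong (_+ # (λ z → A y z ∧ not (Tb x z))) (sym ((#-cong λ z → ∧-comm (A y z) (Tb x z)) · qT p · Q3)) · sym (#-split (A y) (Tb x)) · out y)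
  Wout : ∀ {x y} → x ⟶ y → # (λ z → Wb x z ∧ A y z) ≡ 1
  Wout {x} {y} p = ≤-antisym
   ((#-mono λ z q → and (rgtC q) (not-f (W⇒¬T (lftC q)))) » eq≤ (nonT# p))
   (∃# wa (andC W0 (fst (snd stray))) » eq≤ (sym (cnt (Wb xa) (A ya)) · onA (Wx ⊗ tr Ax) axy p · cnt (Wb x) (A y)))
  T-or-W : ∀ {x y z} → x ⟶ y → y ⟶ z → Tb x z ≡ false → Wb x z ≡ true
  T-or-W {x} {y} {z} p q r = lftC (#-sub≡
   (λ u e → and (rgtC e) (not-f (W⇒¬T (lftC e)))) (eq≤ (nonT# p · sym (Wout p))) z (and q (not-f r)))
  s : ℕ
  s = sq xa wa
  sqW : ∀ {x y} → Wb x y ≡ true → sq x y ≡ s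
  sqW p = sym (sq≡ _ _) · onW (Ax ⊗ Ax) p W0 · sq≡ _ _
  w# : ℕ
  w# = # (Wb x₀)
  Wsize : ∀ x → # (Wb x) ≡ w#
  Wsize x = size (hit (d xa wa) (d wa xa)) x x₀
  sW : s * w# ≡ 4
  sW = sym (begin
   4 ≡⟨ out x₀ ⟨
   # (A x₀) ≡⟨ *-identityʳ _ ⟨
   # (A x₀) * 1 ≡⟨ wsum (A x₀) _ 1 (λ y p → cnt (Wb x₀) (A y) · Wout p) ⟨
   ⟨ Ax , Wx ⊗ tr Ax ⟩ x₀ ≡⟨ adj Ax Wx (tr Ax) x₀ ⟩
   ⟨ Ax ⊗ tr (tr Ax) , Wx ⟩ x₀ ≡⟨ ip-comm (Ax ⊗ tr (tr Ax)) Wx x₀ ⟩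
   ⟨ Wx , Ax ⊗ tr (tr Ax) ⟩ x₀ ≡⟨ wsum (Wb x₀) _ s (λ y p → sq≡ x₀ y · sqW p) ⟩
   w# * s ≡⟨ *-comm w# s ⟩
   s * w# ∎)
   where open ≡-Reasoning
  paths : ∀ {x y} → x ⟶ y → ∑ (λ z → β (A y z) * sq x z) ≡ 6 + s
  paths {x} {y} p = (∑-cong λ z → split z) · (∑-+ _ _ · (cong₂ _+_
      (wsum (λ z → Tb x z ∧ A y z) (sq x) 2 (λ z e → sqT (lftC e) · P2) · cong (_* 2) (qT p · Q3))
      (wsum (λ z → A y z ∧ not (Tb x z)) (sq x) s (λ z e → sqW (T-or-W p (lft e) (not-t (rgt e)))) · cong (_* s) (nonT# p) · *-identityˡ s))) where
   aux : ∀ a b m → β a * m ≡ β (b ∧ a) * m + β (a ∧ not b) * m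
   aux true true m = sym (+-identityʳ _)
   aux true false m = refl
   aux false true m = refl
   aux false false m = refl
   split : ∀ z → β (A y z) * sq x z ≡ β (Tb x z ∧ A y z) * sq x z + β (A y z ∧ not (Tb x z)) * sq x z
   split z = aux (A y z) (Tb x z) (sq x z)
  sums : m# 1 + (2 * m# 2 + (3 * m# 3 + 4 * m# 4)) ≡ 2 + s
  sums = f₁ axy (paths axy)
  -- The inner product of A with T A counted by arcs and by T; it makes the value of `co` on T even.
  coT : ∀ {x z c} → x ⇉ z → co x z ≡ c → ∃ λ m → 4 * m ≡ 6 * c
  coT {x} {z} {c} p e = ⟦ Tx ⊗ Ax ⟧ xa ya , (begin
   4 * ⟦ Tx ⊗ Ax ⟧ xa ya ≡⟨ cong (_* ⟦ Tx ⊗ Ax ⟧ xa ya) (out x) ⟨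
   # (A x) * ⟦ Tx ⊗ Ax ⟧ xa ya ≡⟨ wsum (A x) _ _ (λ y q → onA (Tx ⊗ Ax) q axy) ⟨
   ⟨ Ax , Tx ⊗ Ax ⟩ x ≡⟨ adj Ax Tx Ax x ⟩
   ⟨ C , Tx ⟩ x ≡⟨ ip-comm C Tx x ⟩
   ⟨ Tx , C ⟩ x ≡⟨ wsum (Tb x) _ c (λ y q → on C q p · co≡ x z · e) ⟩
   # (Tb x) * c ≡⟨ cong (_* c) (tsize x · t6) ⟩
   6 * c ∎)
   where open ≡-Reasoning
  m1⇒co : m# 1 ≡ 3 → ∀ {x y y'} → x ⟶ y → x ⟶ y' → y' ≢ y → co y' y ≡ 1
  m1⇒co e {x} {y} {y'} p q ne = Fb-co (rgt (#-sub≡ (λ u f → Sib-intro (lft f) (Fb-≢ (rgt f)))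
   (eq≤ (suc-injective (Sib# p) · sym (m≡ 1 p · e))) y' (Sib-intro q ne)))
  -- Otherwise W is the arc relation, `s = 1`, and siblings share exactly one out-neighbour. Some
  -- siblings then form a pair in T, against the parity in `coT`.
  noTriangle : A xa wa ≡ false
  noTriangle = ¬t λ xw → bad xw where
   bad : xa ⟶ wa → ⊥
   bad xw =
    let onlyA : ∀ {u z} → Wb u z ≡ true → u ⟶ z
        onlyA = λ q → d⇒A (Cb-fst q · A⇒d xw)
        isW : ∀ {u z} → u ⟶ z → Wb u z ≡ true
        isW = λ q → Cb-intro (A⇒d q · sym (A⇒d xw)) (ty _ _ q · sym (ty _ _ xw))
        w4 : w# ≡ 4
        w4 = (#-cong λ z → iff onlyA isW) · out x₀
        s1 : s ≡ 1
        s1 = *-cancelʳ-≡ s 1 4 (cong (s *_) (sym w4) · sW)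
        one3 = ≡-sum (m# 1) (m# 2) (m# 3) (m# 4) f0 (sums · cong (2 +_) s1)
        xy = axy
        yw = fst (snd stray)
        (w₂ , e) = #∃ (eq≥ (Wout xw))
        xw2 = onlyA (lftC e)
        ww2 = rgtC e
        ¬yw2 : A ya w₂ ≡ false
        ¬yw2 = ¬t λ yw2 → 1+n≰n (two≤ {P = λ z → Wb xa z ∧ A ya z} {wa} {w₂} (andC W0 yw) (andC (isW xw2) yw2) (A-irr ww2) » eq≤ (Wout xy))
        Ty : ya ⇉ w₂
        Ty = elimʳ (λ f → t≢f (onlyA (T-or-W yw ww2 f)) ¬yw2) (cases (Tb ya w₂))
        (m , e4) = coT Ty (m1⇒co one3 xw2 xy (λ eq → no2 yw (subst (wa ⟶_) (sym eq) ww2)))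
    in no46 m e4
  W⇒¬A : ∀ {x y} → Wb x y ≡ true → A x y ≡ false
  W⇒¬A p = ¬t λ q → t≢f (d⇒A (sym (Cb-fst p) · A⇒d q)) noTriangle
  a0 : ∀ {x y z} → x ⟶ y → y ⟶ z → A x z ≡ false
  a0 {x} {y} {z} p q = [ (λ e → ¬t λ r → 0≢1+n (suc-injective (sym (A⇒d r) · Cb-fst e))) , (λ e → W⇒¬A (T-or-W p q e)) ]′ (cases (Tb x z))
  -- `F 2` links a vertex of W(x) to one of T(x), so W F is positive on the six vertices of T(x),
  -- but its row sum is 2 times 2.
  not2 : s ≡ 2 → ⊥
  not2 s2 = 1+n≰n {4} (≤5+ z≤n » six≤4) where
   ms = num4 (m# 1) (m# 2) (m# 3) (m# 4) f0 (sums · cong (2 +_) s2)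
   F2 : F# 2 ≡ 2
   F2 = *-cancelˡ-≡ (F# 2) 2 2 (sym (k*m 2) · cong (4 *_) (fst ms))
   w2 : w# ≡ 2
   w2 = *-cancelˡ-≡ w# 2 2 (cong (_* w#) (sym s2) · sW)
   opaque
    hitT : ∃ λ z → xa ⇉ z × Fb 2 wa z ≡ true
    hitT =
     let yw = fst (snd stray)
         xy = axy
         (z , e) = #∃ (eq≥ (m≡ 2 yw · fst ms))
         yz = lft e
         fz = rgt e
     in z , ¬f (λ f → 1+n≰n (two≤ {P = λ u → A ya u ∧ not (Tb xa u)} {z} {wa} (and yz (not-f f)) (and yw (not-f (snd (snd stray)))) (Fb-≢ fz) » eq≤ (nonT# xy))) , Fb-sym · fz where
     ¬f : ∀ {b} → (b ≡ false → ⊥) → b ≡ true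
     ¬f {true} h = refl
     ¬f {false} h = ⊥-elim (h refl)
   WF : ∀ z → xa ⇉ z → 1 ≤ ⟦ Wx ⊗ Fx 2 ⟧ xa z
   WF z p = let (z' , q , f) = hitT in
    ≤-trans (∃# wa (andC W0 f)) (eq≤ (sym (cnt (Wb xa) (λ u → Fb 2 u z')) · on (Wx ⊗ Fx 2) q p))
   six≤4 : 6 ≤ 4
   six≤4 = subst₂ _≤_ (tsize xa · t6) tot (∑-mono le) where
    le : ∀ z → β (Tb xa z) ≤ ⟦ Wx ⊗ Fx 2 ⟧ xa z
    le z with Tb xa z in e
    ... | true = WF z e
    ... | false = z≤n
    tot : ∑ (⟦ Wx ⊗ Fx 2 ⟧ xa) ≡ 4
    tot = (∑-comm _) · (∑-cong λ z' → (∑-*ˡ (β (Wb xa z')) _) · cong (β (Wb xa z') *_) (F#≡ 2 z' · F2)) · ∑-*ʳ 2 _ · cong (_* 2) (Wsize xa · w2)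
  τ : V → V → V → ℕ
  τ x y y' = # (λ z → Tb x z ∧ (A y z ∧ A y' z))
  Small : Set
  Small = (s ≡ 1 × m# 1 ≡ 3) ⊎ (s ≡ 4 × m# 2 ≡ 3)
  no1 : ∀ h → 1 ≡ h + h → ⊥
  no1 (2+ h) e = lia (h ∷ []) ((κ 1 ≋ κ 2 ⊹ ν0 ⊹ (κ 2 ⊹ ν0)) ∷ []) e
  no1 1 ()
  no1 0 ()
  noTwin : m# 4 ≡ 1 × m# 1 ≡ 2 → ⊥
  noTwin (m4 , m1) =
   let f1 = *-cancelˡ-≡ (F# 4) 1 4 (sym (k*m 4) · cong (4 *_) m4)
       (y' , e) = #∃ (≥1 m1)
       (h , odd) = co-even f1 y' ya
   in no1 h (sym (Fb-co (rgt e)) · odd)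
  small : Small
  small = [ (λ e → inj₁ (e , ≡-sum (m# 1) (m# 2) (m# 3) (m# 4) f0 (sums · cong (2 +_) e)))
          , [ (λ e → ⊥-elim (not2 e))
           , (λ e → [ (λ f → inj₂ (e , f)) , (λ r → ⊥-elim (noTwin r)) ]′ (num6s (m# 1) (m# 2) (m# 3) (m# 4) (F# 3) f0 (sums · cong (2 +_) e) (k*m 3))) ]′ ]′ (s-cases s w# sW)
  mall : ∀ c → m# c ≡ 3 → ∀ {x y y'} → x ⟶ y → x ⟶ y' → y' ≢ y → co y' y ≡ c
  mall c e {x} {y} {y'} p q ne = Fb-co (rgt (#-sub≡ (λ u f → Sib-intro (lft f) (Fb-≢ (rgt f)))
   (eq≤ (suc-injective (Sib# p) · sym (m≡ c p · e))) y' (Sib-intro q ne)))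
  σ : V → V → V → ℕ
  σ x y y' = # (λ z → (A y z ∧ A y' z) ∧ not (Tb x z))
  τσ : ∀ x y y' → co y y' ≡ τ x y y' + σ x y y'
  τσ x y y' = #-split (λ z → A y z ∧ A y' z) (Tb x) · cong (_+ σ x y y') (#-cong λ z → ∧-comm (A y z ∧ A y' z) (Tb x z))
  σ1 : s ≡ 1 → ∀ {x y y'} → x ⟶ y → x ⟶ y' → y' ≢ y → σ x y' y ≡ 0
  σ1 e {x} {y} {y'} p q ne = n≤0⇒n≡0 (≤-pred (≰⇒> none)) where
   none : ¬ (1 ≤ σ x y' y)
   none l =
    let (z , f) = #∃ l
        h = ∧-fst {A y' z ∧ A y z} f
        y'z = lft h
        yz = rgt h
        w = T-or-W p yz (not-t (∧-snd {A y' z ∧ A y z} f))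
    in 1+n≰n (two≤ {P = λ u → A x u ∧ A u z} {y'} {y} (and q y'z) (and p yz) ne » eq≤ (sqW w · e))
  fullW : s ≡ 4 → ∀ {x y z} → Wb x z ≡ true → x ⟶ y → y ⟶ z
  fullW e {x} {y} {z} w p = rgt (#-sub≡ (λ u → lft) (eq≤ (out x · sym (sqW w · e))) y p)
  σ4 : s ≡ 4 → ∀ {x y y'} → x ⟶ y → x ⟶ y' → σ x y' y ≡ 1
  σ4 e {x} {y} {y'} p q = (#-cong λ z → iff (to z) (from z)) · nonT# p where
   to : ∀ z → (A y' z ∧ A y z) ∧ not (Tb x z) ≡ true → A y z ∧ not (Tb x z) ≡ true
   to z f = and (rgt (∧-fst {A y' z ∧ A y z} f)) (∧-snd {A y' z ∧ A y z} f)
   from : ∀ z → A y z ∧ not (Tb x z) ≡ true → (A y' z ∧ A y z) ∧ not (Tb x z) ≡ true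
   from z f = ∧-intro {A y' z ∧ A y z} (and (fullW e (T-or-W p (lft f) (not-t (rgt f))) q) (lft f)) (rgt f)
  τ1 : ∀ {x y y'} → x ⟶ y → x ⟶ y' → y' ≢ y → τ x y' y ≡ 1
  τ1 {x} {y} {y'} p q ne = [ (λ { (e , m) → sym (+-identityʳ _) · cong (τ x y' y +_) (sym (σ1 e p q ne)) · sym (τσ x y' y) · mall 1 m p q ne })
   , (λ { (e , m) → +-cancelʳ-≡ 1 _ 1 (cong (τ x y' y +_) (sym (σ4 e p q)) · sym (τσ x y' y) · mall 2 m p q ne) }) ]′ small
  τ-uniq : ∀ {x y y' z z'} → x ⟶ y → x ⟶ y' → y' ≢ y → x ⇉ z → y' ⟶ z → y ⟶ z → x ⇉ z' → y' ⟶ z' → y ⟶ z' → z ≡ z'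
  τ-uniq p q ne a b c a' b' c' = unique (τ1 p q ne) (andC a (and b c)) (andC a' (and b' c'))
  -- If only two first steps were on course for `v`, both would lead to both vertices of T(x) before
  -- `v`, against `τ-uniq`.
  AT3 : ∀ {x v} → Ub x v ≡ true → AT x v ≡ 3
  AT3 {x} {v} u = pick (AT x v) refl (eq≥ P2 » P≤AT u) (AT≤Q u » eq≤ Q3) where
   not2' : AT x v ≡ 2 → ⊥
   not2' e =
    let (z1 , z₂ , h1 , h₂ , ne) = pair∃ (eq≥ (sym (AT≡TA x v) · e))
        (y₁ , y₂ , k1 , k2 , ne') = pair∃ (eq≥ e)
        to : ∀ {z y} → Tb x z ∧ A z v ≡ true → A x y ∧ Tb y v ≡ true → y ⟶ z
        to = λ {z} {y} h k → rgt (#-sub≡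
               (λ w f → and (lft f) (stepT (lft f) (rgt f) (rgtC h) u))
               (eq≤ (e · sym (sqT (lftC h) · P2))) y k)
    in ne (τ-uniq (lft k1) (lft k2) (ne' ∘ sym) (lftC h1) (to h1 k2) (to h1 k1) (lftC h₂) (to h₂ k2) (to h₂ k1))
   pick : ∀ a → AT x v ≡ a → 2 ≤ a → a ≤ 3 → AT x v ≡ 3
   pick 2 e _ _ = ⊥-elim (not2' e)
   pick 3 e _ _ = e
   pick 0 e () _
   pick 1 e (s≤s ()) _
   pick (4+ _) e _ (≤3+ ())
  U : Ex
  U = cls 3 g0
  u# : ℕ
  u# = # (Ub x₀)
  r# : V → V → ℕ
  r# x z = # (λ v → Ub x v ∧ A z v)
  -- A T = T A takes the value 3 on U. Counting it over U by the arc and by the T-pair out of the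
  -- base vertex gives the two equations of `r-two`.
  r≡ : ∀ {x z} → x ⇉ z → r# x z ≡ 2
  r≡ {x} {z} p = r-two (⟦ U ⊗ tr Tx ⟧ ax ay) (r# x z) u# qe re rle une where
   open ≡-Reasoning
   qe : 4 * ⟦ U ⊗ tr Tx ⟧ ax ay ≡ u# * 3
   qe = begin
    4 * ⟦ U ⊗ tr Tx ⟧ ax ay ≡⟨ cong (_* ⟦ U ⊗ tr Tx ⟧ ax ay) (out x₀) ⟨
    # (A x₀) * _ ≡⟨ wsum (A x₀) _ _ (λ y q → onA (U ⊗ tr Tx) q axy) ⟨
    ⟨ Ax , U ⊗ tr Tx ⟩ x₀ ≡⟨ adj Ax U (tr Tx) x₀ ⟩
    ⟨ Ax ⊗ tr (tr Tx) , U ⟩ x₀ ≡⟨ ip-comm (Ax ⊗ tr (tr Tx)) U x₀ ⟩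
    ⟨ U , Ax ⊗ tr (tr Tx) ⟩ x₀ ≡⟨ wsum (Ub x₀) _ 3 (λ v q → AT≡ x₀ v · AT3 q) ⟩
    u# * 3 ∎
   re : 6 * r# x z ≡ u# * 3
   re = begin
    6 * r# x z ≡⟨ cong (_* r# x z) (tsize x₀ · t6) ⟨
    # (Tb x₀) * r# x z ≡⟨ wsum (Tb x₀) _ _ (λ z' q → on (U ⊗ tr Ax) q p · cnt (Ub x) (A z)) ⟨
    ⟨ Tx , U ⊗ tr Ax ⟩ x₀ ≡⟨ adj Tx U (tr Ax) x₀ ⟩
    ⟨ Tx ⊗ tr (tr Ax) , U ⟩ x₀ ≡⟨ ip-comm (Tx ⊗ tr (tr Ax)) U x₀ ⟩
    ⟨ U , Tx ⊗ tr (tr Ax) ⟩ x₀ ≡⟨ wsum (Ub x₀) _ 3 (λ v q → cnt (Tb x₀) (λ w → A w v) · sym (AT≡TA x₀ v) · AT3 q) ⟩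
    u# * 3 ∎
   rle : r# x z ≤ 3
   rle = let (y , a , b) = two p in (#-mono λ v f → andC (stepT a b (∧-snd {Ub x v} f) (∧-fst {Ub x v} f)) (∧-snd {Ub x v} f)) » eq≤ (qT b · Q3)
   une : 1 ≤ u#
   une = let (v , _ , u) = toU T0 in ∃# v u

 -- Valency four with `Qv = 2`: straight continuations and turns

 module Two (Q2 : Qv ≡ 2) (t4 : t ≡ 4) where
  -- The straight continuations of an arc. The other two out-neighbours of `b` are its turns.
  Sg : V → V → V → Bool
  Sg a b c = Tb a c ∧ A b c
  Sg# : ∀ {a b} → a ⟶ b → # (Sg a b) ≡ 2
  Sg# p = qT p · Q2
  Turn# : ∀ {a b} → a ⟶ b → # (λ c → A b c ∧ not (Tb a c)) ≡ 2
  Turn# {a} {b} p = +-cancelˡ-≡ 2 _ 2 (cong (_+ # (λ c → A b c ∧ not (Tb a c))) (sym ((#-cong λ c → ∧-comm (A b c) (Tb a c)) · Sg# p)) · sym (#-split (A b) (Tb a)) · out b)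
  back# : ∀ {b c} → b ⟶ c → # (λ a → A a b ∧ Tb a c) ≡ 2
  back# {b} {c} p = sym (cnt (λ a → A a b) (λ a → Tb a c)) · comm (tr Ax) Tx b c · cnt (Tb b) (A c) · Sg# p
  mid# : ∀ {a c} → a ⇉ c → # (λ b → A a b ∧ A b c) ≡ 2
  mid# p = sqT p · P2
  AT2 : ∀ {x v} → Ub x v ≡ true → AT x v ≡ 2
  AT2 u = ≤-antisym (AT≤Q u » eq≤ Q2) (eq≥ P2 » P≤AT u)
  TA2 : ∀ {x v} → Ub x v ≡ true → TA x v ≡ 2
  TA2 u = sym (AT≡TA _ _) · AT2 u
  opaque
   -- By `stepT` the two midpoints of (a , z) are among the two first steps on course for `u`, hence
   -- are all of them.
   mids : ∀ {a z u} → a ⇉ z → z ⟶ u → Ub a u ≡ true → ∀ {b} → a ⟶ b → b ⇉ u → b ⟶ z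
   mids tz zu U {b} ab tb = rgt (#-sub≡
    (λ y e → and (lft e) (stepT (lft e) (rgt e) zu U)) (eq≤ (AT2 U · sym (mid# tz))) b (and ab tb))
   ahead : ∀ {b c v v' u} → b ⟶ c → Sg b c v ≡ true → v ⟶ u → Ub b u ≡ true → Sg b c v' ≡ true → v' ⟶ u
   ahead {b} {c} {v} {v'} {u} bc sv vu U sv' =
    let Z = λ z → Tb b z ∧ A z u
        (z1 , z₂ , p₁ , p₂ , ne) = pair∃ (eq≥ (TA2 U))
        tcu = stepT bc (rgtC sv) vu U
        toS : ∀ {z} → Z z ≡ true → Sg b c z ≡ true
        toS = λ {z} e → andC (lftC e) (mids (lftC e) (rgtC e) U bc tcu)
    in rgtC (#-sub≡ (λ z e → toS e) (eq≤ (Sg# bc · sym (TA2 U))) v' sv')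
   L1 : ∀ {a b b' c c'} → a ⟶ b → a ⟶ b' → Sg a b c ≡ true → b' ⟶ c → Sg a b c' ≡ true → b' ⟶ c'
   L1 ab ab' sc b'c sc' =
    let (u , cu , U) = toU (lftC sc)
    in mids (lftC sc') (ahead ab sc cu U sc') U ab' (stepT ab' b'c cu U)
   L2 : ∀ {a b z z'} → a ⟶ b → Sg a b z ≡ true → Sg a b z' ≡ true → ∃ λ u → Sg b z u ≡ true × z' ⟶ u
   L2 ab sz sz' =
    let (u , zu , U) = toU (lftC sz)
    in u , andC (stepT ab (rgtC sz) zu U) zu , ahead ab sz zu U sz'
   L1' : ∀ {a a' b b' c} → a ⇉ c → a' ⇉ c → a ⟶ b → a' ⟶ b → b ⟶ c → a ⟶ b' → b' ⟶ c → a' ⟶ b'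
   L1' {a} {a'} {b} {b'} {c} ta ta' ab a'b bc ab' b'c =
    let (u , r , s) = last-step {c} {a} (Cb-snd ta)
        U = tight (λ e → 0≢1+n (sym (d-refl c) · cong (d c) (sym e) · r)) (d-tri u a c » eq≤ (+≡ (A⇒d s) (Cb-fst ta))) (eq≤ r) refl
        Y = λ y → A u y ∧ Tb y c
        toB : ∀ {y} → Y y ≡ true → A y b ∧ Tb y c ≡ true
        toB = λ {y} e → and (midsR (lft e) (rgt e) U bc (backT s ab bc U)) (rgt e)
        ua' : Y a' ≡ true
        ua' = #-sub≡ (λ y e → toB e) (eq≤ (back# bc · sym (AT2 U))) a' (and a'b ta')
    in midsR (lft ua') ta' U b'c (backT s ab' b'c U) where
    midsR : ∀ {u a} → u ⟶ a → a ⇉ c → Ub u c ≡ true → ∀ {b} → b ⟶ c → u ⇉ b → a ⟶ b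
    midsR ua ta U {b} bc tb = lft (#-sub≡
     (λ y e → andC (backT ua (lft e) (rgt e) U) (rgt e)) (eq≤ (TA2 U · sym (mid# ta))) b (andC tb bc))
  -- Out-neighbours of `b` with the same straight continuations; those of each `b` fall into two
  -- pairs.
  Pair : V → V → V → Set
  Pair b z z' = ∀ v → Sg b z v ≡ true → z' ⟶ v
  opaque
   sg∃ : ∀ {b z} → b ⟶ z → ∃ λ v → Sg b z v ≡ true
   sg∃ p = #∃ (≥1 (Sg# p))
   pair : ∀ {b z z' v} → b ⟶ z → b ⟶ z' → Sg b z v ≡ true → z' ⟶ v → Pair b z z'
   pair p q s r v' s' = L1 p q s r s'
   straight-pair : ∀ {a b z z'} → a ⟶ b → Sg a b z ≡ true → Sg a b z' ≡ true → Pair b z z'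
   straight-pair p s s' = let (u , e , f) = L2 p s s' in pair (rgtC s) (rgtC s') e f
   pair? : ∀ {b z z'} → b ⟶ z → b ⟶ z' → Pair b z z' ⊎ (∀ v → Sg b z v ≡ true → A z' v ≡ false)
   pair? {b} {z} {z'} p q = let (v , s) = sg∃ p in go v s (cases (A z' v)) where
    go : ∀ v → Sg b z v ≡ true → (z' ⟶ v) ⊎ (A z' v ≡ false) → Pair b z z' ⊎ (∀ v → Sg b z v ≡ true → A z' v ≡ false)
    go v s (inj₁ r) = inj₁ (pair p q s r)
    go v s (inj₂ r) = inj₂ λ v' s' → ¬t λ r' → t≢f (pair p q s' r' v s) r
   pair-uniq : ∀ {b z z' z″} → b ⟶ z → b ⟶ z' → b ⟶ z″ → Pair b z z' → Pair b z z″ → z ≢ z' → z ≢ z″ → z' ≡ z″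
   pair-uniq a a' a″ p q ne ne' = let (v , s) = sg∃ a in
    third (mid# (lftC s)) (and a (rgtC s)) (and a' (p v s)) (and a″ (q v s)) ne ne'
   -- The midpoints of (b , v) and of (b , v') are disjoint sets of size two and exhaust the four
   -- out-neighbours of `b`.
   pair-cross : ∀ {b z q r} → b ⟶ z → b ⟶ q → b ⟶ r → (Pair b z q → ⊥) → (Pair b z r → ⊥) → Pair b q r
   pair-cross {b} {z} {q} {r} az aq ar nq nr = let
       (v , s) = sg∃ az
       (v' , s') = sg∃ aq
    in go s s' where
    go : ∀ {v v'} → Sg b z v ≡ true → Sg b q v' ≡ true → Pair b q r
    go {v} {v'} s s' = pick (cover2 (λ y → A b y ∧ A y v) (λ y → A b y ∧ A y v') (A b) (λ y → lft) (λ y → lft) dis (eq≤ (out b · sym (+≡ (mid# (lftC s)) (mid# (lftC s'))))) ar) where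
     dis : ∀ y → A b y ∧ A y v ≡ true → A b y ∧ A y v' ≡ true → ⊥
     dis y e f = nq (pair az aq s (pair (lft e) aq (andC (lftC s') (rgt f)) (rgtC s') v (andC (lftC s) (rgt e))))
     pick : A b r ∧ A r v ≡ true ⊎ A b r ∧ A r v' ≡ true → Pair b q r
     pick (inj₁ e) = ⊥-elim (nr (pair az ar s (rgt e)))
     pick (inj₂ e) = pair aq ar s' (rgt e)
   partner : ∀ {b z} → b ⟶ z → ∃ λ z' → b ⟶ z' × z ≢ z' × Pair b z z'
   partner {b} {z} az =
    let (v , s) = sg∃ az
        (y₁ , y₂ , p₁ , p₂ , ne) = pair∃ (eq≥ (mid# (lftC s)))
        mk : ∀ {y} → A b y ∧ A y v ≡ true → z ≢ y → ∃ λ z' → b ⟶ z' × z ≢ z' × Pair b z z'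
        mk = λ {y} e n → y , lft e , n , pair az (lft e) s (rgt e)
    in go y₁ y₂ (mk p₁) (mk p₂) ne (z F.≟ y₁) where
    go : ∀ y₁ y₂ {X : Set} → (z ≢ y₁ → X) → (z ≢ y₂ → X) → y₁ ≢ y₂ → Dec (z ≡ y₁) → X
    go y₁ y₂ f g ne (yes e) = g λ e' → ne (sym e · e')
    go y₁ y₂ f g ne (no e) = f e
   -- If the partner `w` of the turn `u` were straight, it would also be paired with the other
   -- straight continuation, which would then be `u`.
   turn-pair : ∀ {a b u u'} → a ⟶ b → b ⟶ u → b ⟶ u' → Tb a u ≡ false → Tb a u' ≡ false → Pair b u u'
   turn-pair {a} {b} {u} {u'} ab bu bu' tu tu' =
    let (w , bw , ne , pw') = partner bu in
    go w bw ne pw' (u F.≟ u') (cases (Tb a w)) where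
    go : ∀ w → b ⟶ w → u ≢ w → Pair b u w → Dec (u ≡ u') → (a ⇉ w) ⊎ (Tb a w ≡ false) → Pair b u u'
    go w bw ne pw' (yes refl) _ v s = rgtC s
    go w bw ne pw' (no n) (inj₂ f) = subst (Pair b u) (third (Turn# ab) (and bu (not-f tu)) (and bw (not-f f)) (and bu' (not-f tu')) ne n) pw'
    go w bw ne pw' (no n) (inj₁ t) = ⊥-elim (
     let (s₁ , s₂ , p₁ , p₂ , m) = pair∃ (eq≥ (Sg# ab))
         (v , s) = sg∃ bu
         wv : Sg b w v ≡ true
         wv = andC (lftC s) (pw' v s)
         wu : Pair b w u
         wu = pair bw bu wv (rgtC s)
         sw : Sg a b w ≡ true
         sw = andC t bw
         fin : ∀ s' → Sg a b s' ≡ true → w ≢ s' → ⊥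
         fin = λ s' p m' → t≢f (subst (λ x → a ⇉ x) (pair-uniq bw (rgtC p) bu (straight-pair ab sw p) wu m' (ne ∘ sym)) (lftC p)) tu
     in pk s₁ s₂ (fin s₁ p₁) (fin s₂ p₂) m (w F.≟ s₁)) where
     pk : ∀ s₁ s₂ → (w ≢ s₁ → ⊥) → (w ≢ s₂ → ⊥) → s₁ ≢ s₂ → Dec (w ≡ s₁) → ⊥
     pk s₁ s₂ f g m (yes e) = g λ e' → m (sym e · e')
     pk s₁ s₂ f g m (no e) = f e
   apart : ∀ {a a' b z e} → a ⟶ b → a' ⟶ b → Sg a' b e ≡ true → Tb a e ≡ false → Sg a b z ≡ true → Sg a' b z ≡ true → ⊥
   apart {a} {a'} {b} {z} {e} ab a'b se te sz sz' =
    let (f , bf , ne , pf) = partner (rgtC sz)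
        (s₁ , s₂ , p₁ , p₂ , m) = pair∃ (eq≥ (Sg# ab))
        bz = rgtC sz
        fin : ∀ s' → Sg a b s' ≡ true → z ≢ s' → ⊥
        fin = λ s' p m' → t≢f (subst (λ x → a ⇉ x) (pair-uniq bz (rgtC p) (rgtC se) (straight-pair ab sz p) (straight-pair a'b sz' se) m' (λ { refl → t≢f (lftC sz) te })) (lftC p)) te
    in pk s₁ s₂ (fin s₁ p₁) (fin s₂ p₂) m (z F.≟ s₁) where
    pk : ∀ s₁ s₂ → (z ≢ s₁ → ⊥) → (z ≢ s₂ → ⊥) → s₁ ≢ s₂ → Dec (z ≡ s₁) → ⊥
    pk s₁ s₂ f g m (yes e) = g λ e' → m (sym e · e')
    pk s₁ s₂ f g m (no e) = f e
  c≢ : ∀ {x u u'} → A x u ≡ false → x ⟶ u' → u ≢ u'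
  c≢ f q refl = t≢f q f
  module Corner {a b c w w' e : V} (ab : a ⟶ b) (bc : b ⟶ c) (tc : Tb a c ≡ false) (aw : a ⟶ w) (aw' : a ⟶ w')
   (nb : Pair a b w → ⊥) (nb' : Pair a b w' → ⊥) (ne : w ≢ w') (wc : A w c ≡ false) (wc' : A w' c ≡ false) (be : b ⟶ e) (we : w ⟶ e) where
   opaque
    offT : ∀ {x u} → a ⟶ x → (Pair a b x → ⊥) → b ⟶ u → x ⟶ u → Tb a u ≡ false
    offT ax nx bu xu = ¬t λ t' → nx (pair ab ax (andC t' bu) xu)
    te : Tb a e ≡ false
    te = offT aw nb be we
    only : ∀ {x u} → a ⟶ x → (Pair a b x → ⊥) → A x c ≡ false → b ⟶ u → x ⟶ u → u ≡ e
    only {x} ax nx xc bu xu = third (Turn# ab) (and bc (not-f tc)) (and bu (not-f (offT ax nx bu xu))) (and be (not-f te)) (c≢ {x} xc xu) (c≢ {w} wc we)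
    we' : w' ⟶ e
    we' = let (f , p) = #∃ (sib-co ab aw') in
     subst (w' ⟶_) (only aw' nb' wc' (lft p) (rgt p)) (rgt p)
   module C1 {a₁ : V} (a1b : a₁ ⟶ b) (t1e : a₁ ⇉ e) where
    opaque
     s1e : Sg a₁ b e ≡ true
     s1e = andC t1e be
     t1c : a₁ ⇉ c
     t1c = let (s₁ , s₂ , p₁ , p₂ , m) = pair∃ (eq≥ (Sg# a1b)) in
      pk s₁ s₂ p₁ p₂ m (e F.≟ s₁) where
      fin : ∀ s' → Sg a₁ b s' ≡ true → e ≢ s' → a₁ ⇉ c
      fin s' p m = subst (λ x → a₁ ⇉ x) (pair-uniq be (rgtC p) bc (straight-pair a1b s1e p) (turn-pair ab be bc te tc) m (c≢ {w} wc we ∘ sym)) (lftC p)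
      pk : ∀ s₁ s₂ → Sg a₁ b s₁ ≡ true → Sg a₁ b s₂ ≡ true → s₁ ≢ s₂ → Dec (e ≡ s₁) → a₁ ⇉ c
      pk s₁ s₂ f g m (yes q) = fin s₂ g λ q' → m (sym q · q')
      pk s₁ s₂ f g m (no q) = fin s₁ f q
     not1 : ∀ {x} → x ⟶ e → A x c ≡ false → a₁ ⟶ x → ⊥
     not1 xe xc q = t≢f (L1 a1b q s1e xe (andC t1c bc)) xc
    -- The in-neighbours of `e` are the midpoints of (a₁ , e) and of (a₂ , e), so `w'` follows `a₂`.
    -- The out-neighbours of `w` are its straight continuations from `a` and from `a₂`, and all of
    -- them follow `w'`.
    module C2 {a₂ : V} (a2w : a₂ ⟶ w) (t2e : a₂ ⇉ e) where
     opaque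
      a2w' : a₂ ⟶ w'
      a2w' = [ (λ q → ⊥-elim (not1 we' wc' (lft q))) , (λ q → lft q) ]′
       (cover2 (λ y → A a₁ y ∧ A y e) (λ y → A a₂ y ∧ A y e) (λ y → A y e) (λ y → rgt) (λ y → rgt)
        (λ y p q → not1 we wc (L1' t2e t1e (lft q) (lft p) (rgt p) a2w we))
        (eq≤ (inn e · sym (+≡ (mid# t1e) (mid# t2e)))) we')
      sub : ∀ u → w ⟶ u → w' ⟶ u
      sub u wu = [ (λ q → pair-cross ab aw aw' nb nb' u q) , (λ q → L1 a2w a2w' (andC t2e we) we' q) ]′
       (cover2 (Sg a w) (Sg a₂ w) (A w) (λ y → rgtC) (λ y → rgtC) (λ y p q → apart aw a2w (andC t2e we) te p q)
        (eq≤ (out w · sym (+≡ (Sg# aw) (Sg# a2w)))) wu)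
      co4 : co w w' ≡ 4
      co4 = (#-cong λ z → iff (lft) (λ q → and q (sub z q))) · out w
      m4 : 1 ≤ m# 4
      m4 = ∃# w (and aw (Fb-intro co4 ne)) » eq≤ (m≡ 4 aw')
      tw : ∀ {x} → Fb 4 x b ≡ true → Pair a b x
      tw {x} f u s = twin-out (co-sym b x · Fb-co f) (rgtC s)
      m4≤ : m# 4 ≤ 1
      m4≤ = eq≥ (m≡ 4 ab) » (#≤1 λ {x} {y} p q →
       pair-uniq ab (lft p) (lft q) (tw (rgt p)) (tw (rgt q)) (Fb-≢ (rgt p) ∘ sym) (Fb-≢ (rgt q) ∘ sym))
      f4 : F# 4 ≡ 1
      f4 = *-cancelˡ-≡ (F# 4) (m# 4) 4 (sym (k*m 4)) · ≤-antisym m4≤ m4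
      cobw : co b w ≡ 1
      cobw = ≤-antisym (#≤1 λ {x} {y} p q → only aw nb wc (lft p) (rgt p) · sym (only aw nb wc (lft q) (rgt q))) (sib-co ab aw)
      -- The pair w, w' are twins, yet b and w have a single common out-neighbour.
      contra : ⊥
      contra = let (h , q) = co-even f4 b w in odd h (sym q · cobw) where
       odd : ∀ h → h + h ≡ 1 → ⊥
       odd (suc h) q = 0≢1+n (sym (sym (+-suc h h) · suc-injective q))
  opaque
   -- A turn can be taken through the opposite pair as well; this is what allows walks with turns to
   -- be rerouted.
   corner : ∀ {a b c} → a ⟶ b → b ⟶ c → Tb a c ≡ false → ∃ λ b' → a ⟶ b' × b' ⟶ c × (Pair a b b' → ⊥)
   corner {a} {b} {c} ab bc tc =
    let (v , sv) = sg∃ ab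
        split2 : # (λ y → A a y ∧ not (A y v)) ≡ 2
        split2 = +-cancelˡ-≡ 2 _ 2 (cong (_+ # (λ y → A a y ∧ not (A y v))) (sym (mid# (lftC sv))) · sym (#-split (A a) (λ y → A y v)) · out a)
        (w , w' , p , p' , ne) = pair∃ (eq≥ split2)
    in go v sv w w' (lft p) (lft p') (not-t (rgt p)) (not-t (rgt p')) ne (cases (A w c)) (cases (A w' c)) where
    go : ∀ v → Sg a b v ≡ true → ∀ w w' → a ⟶ w → a ⟶ w' → A w v ≡ false → A w' v ≡ false → w ≢ w' →
         (w ⟶ c) ⊎ (A w c ≡ false) → (w' ⟶ c) ⊎ (A w' c ≡ false) → ∃ λ b' → a ⟶ b' × b' ⟶ c × (Pair a b b' → ⊥)
    go v sv w w' aw aw' wv wv' ne (inj₁ q) _ = w , aw , q , λ pr → t≢f (pr v sv) wv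
    go v sv w w' aw aw' wv wv' ne _ (inj₁ q) = w' , aw' , q , λ pr → t≢f (pr v sv) wv'
    go v sv w w' aw aw' wv wv' ne (inj₂ wc) (inj₂ wc') = ⊥-elim (
     let (e , p) = #∃ (sib-co ab aw)
         be = lft p
         we = rgt p
         (a₁ , p₁) = #∃ (≥1 (back# be))
         (a₂ , p₂) = #∃ (≥1 (back# we))
     in Corner.C1.C2.contra {e = e} ab bc tc aw aw' (λ pr → t≢f (pr v sv) wv) (λ pr → t≢f (pr v sv) wv') ne wc wc' be we {a₁} (lft p₁) (rgt p₁) {a₂} (lft p₂) (rgt p₂))
  no3 : ∀ {x y z} → x ⟶ y → y ⟶ z → z ⟶ x → ⊥
  no3 p q r = 1+n≰n (no-closed (W-cons p (W-cons q (W-cons r W-nil))) » ≤3+ (z≤n {g₁}))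
  opaque
   pair-co : ∀ {x y w} → x ⟶ y → Pair x y w → 2 ≤ co y w
   pair-co xy pr = eq≥ (Sg# xy) » (#-mono λ z s → and (rgtC s) (pr z s))
   T-A : ∀ {x y} → x ⇉ y → x ⟶ y → ⊥
   T-A t a = 0≢1+n (suc-injective (sym (A⇒d a) · Cb-fst t))
  -- A transitive triangle inside an out-neighbourhood would make that neighbourhood a directed four-cycle.
  module Cyc {x y₁ y₂ y₃ y₄ : V} (a₁ : x ⟶ y₁) (a₂ : x ⟶ y₂) (a₃ : x ⟶ y₃) (a4 : x ⟶ y₄)
             (r1 : y₁ ⟶ y₂) (r2 : y₂ ⟶ y₃) (r3 : y₃ ⟶ y₄) where
   opaque
    four : ∀ {z} → x ⟶ z → In z (y₁ ∷ y₂ ∷ y₃ ∷ y₄ ∷ [])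
    four = member (y₁ ∷ y₂ ∷ y₃ ∷ y₄ ∷ [])
     ((A-irr r1 , (λ { refl → no2 r1 r2 }) , (λ { refl → no3 r1 r2 r3 }) , tt) , (A-irr r2 , (λ { refl → no2 r2 r3 }) , tt) , (A-irr r3 , tt) , tt , tt)
     (a₁ , a₂ , a₃ , a4 , tt) (eq≤ (out x))
    aco : ∀ {u v u' v'} → u ⟶ v → u' ⟶ v' → co u v ≡ co u' v'
    aco {u} {v} {u'} {v'} p q = sym (co≡ u v) · onA C p q · co≡ u' v'
    r4 : y₄ ⟶ y₁
    r4 = let (z , e) = #∃ (∃# y₂ (and a₂ r1) » eq≤ (aco a₁ a4)) in
     go (four (lft e)) (rgt e) where
     go : ∀ {z} → In z (y₁ ∷ y₂ ∷ y₃ ∷ y₄ ∷ []) → y₄ ⟶ z → y₄ ⟶ y₁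
     go (inj₁ refl) e = e
     go (in1 refl) e = ⊥-elim (no3 r2 r3 e)
     go (in2 refl) e = ⊥-elim (no2 r3 e)
     go (in3 refl) e = ⊥-elim (A-irr e refl)
    T13 : y₁ ⇉ y₃
    T13 = mkT r1 r2 (d≤2 r3 r4 » ≤2+ z≤n)
    co1 : co x y₁ ≤ 1
    co1 = #≤1 λ {u} {v} p q → go (four (lft p)) (rgt p) · sym (go (four (lft q)) (rgt q)) where
     go : ∀ {z} → In z (y₁ ∷ y₂ ∷ y₃ ∷ y₄ ∷ []) → y₁ ⟶ z → z ≡ y₂
     go (inj₁ refl) e = ⊥-elim (A-irr e refl)
     go (in1 refl) e = refl
     go (in2 refl) e = ⊥-elim (T-A T13 e)
     go (in3 refl) e = ⊥-elim (no2 r4 e)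
    co13 : co y₁ y₃ ≤ 1
    co13 = *-cancelˡ-≤ 4 (begin
     4 * co y₁ y₃ ≡⟨ cong₂ _*_ (sym t4 · sym (tsize y₁) · cong₂ (λ a b → # (Cb a b y₁)) (sym (Cb-fst T13)) (sym (Cb-snd T13))) (sym (co≡ y₁ y₃)) ⟩
     R# y₁ y₃ * ⟦ C ⟧ y₁ y₃ ≡⟨ Rmul Ax (tr Ax) y₁ y₃ ⟩
     ⟨ Ax , Rx y₁ y₃ ⊗ tr (tr Ax) ⟩ y₁ ≡⟨ rowA (Rx y₁ y₃ ⊗ Ax) y₁ ⟩
     4 * ⟦ Rx y₁ y₃ ⊗ Ax ⟧ _ _ ≡⟨ cong (4 *_) (onA (Rx y₁ y₃ ⊗ Ax) axy a₃) ⟩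
     4 * ⟦ Rx y₁ y₃ ⊗ Ax ⟧ x y₃ ≡⟨ cong (4 *_) (comm (Rx y₁ y₃) Ax x y₃ · cnt (A x) (λ u → Rb y₁ y₃ u y₃)) ⟩
     4 * # (λ u → A x u ∧ Rb y₁ y₃ u y₃) ≤⟨ *-monoʳ-≤ 4 (#≤1 λ {u} {v} p q → go (four (lft p)) (toT (rgt p)) · sym (go (four (lft q)) (toT (rgt q)))) ⟩
     4 * 1 ∎) where
     open ≤-Reasoning
     toT : ∀ {u} → Rb y₁ y₃ u y₃ ≡ true → u ⇉ y₃
     toT r = Cb-intro (Cb-fst r · Cb-fst T13) (Cb-snd r · Cb-snd T13)
     go : ∀ {z} → In z (y₁ ∷ y₂ ∷ y₃ ∷ y₄ ∷ []) → z ⇉ y₃ → z ≡ y₁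
     go (inj₁ refl) e = refl
     go (in1 refl) e = ⊥-elim (T-A e r2)
     go (in2 refl) e = ⊥-elim (0≢1+n (sym (d-refl y₃) · Cb-fst e))
     go (in3 refl) e = ⊥-elim (1+n≰n (≤3+ z≤n » eq≥ (ty y₃ y₄ r3) » eq≤ (Cb-fst e)))
    absurdC : ⊥
    absurdC = let (q , xq , ne , pr) = partner a₁ in go q ne (pair-co a₁ pr) (four xq) where
     ac : ∀ {u v} → u ⟶ v → 2 ≤ co u v → ⊥
     ac r l = 1+n≰n (l » eq≤ (aco r a₁) » co1)
     go : ∀ q → y₁ ≢ q → 2 ≤ co y₁ q → In q (y₁ ∷ y₂ ∷ y₃ ∷ y₄ ∷ []) → ⊥
     go q ne l (inj₁ refl) = ne refl
     go q ne l (in1 refl) = ac r1 l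
     go q ne l (in2 refl) = 1+n≰n (l » co13)
     go q ne l (in3 refl) = ac r4 (l » eq≤ (co-sym y₁ y₄))
  opaque
   a0 : ∀ {x y z} → x ⟶ y → y ⟶ z → x ⟶ z → ⊥
   a0 {x} {y} {z} xy yz xz =
    let nx : ∀ {w} → x ⟶ w → ∃ λ v → x ⟶ v × w ⟶ v
        nx = λ {w} xw → let (v , e) = #∃ (∃# z (and xz yz) » eq≤ (sym (co≡ x y) · onA C xy xw · co≡ x w)) in v , lft e , rgt e
        (u , xu , zu) = nx xz
    in Cyc.absurdC xy xz xu (fst (snd (nx xu))) yz zu (snd (snd (nx xu)))
  -- Walks with visible vertices, so that `Straight` can recurse along them.
  data Path : ℕ → V → V → Set where
   nil : ∀ {x} → Path 0 x x
   _▸_ : ∀ {m x y z} → x ⟶ y → Path m y z → Path (suc m) x z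
  infixr 5 _▸_
  toW : ∀ {m x y} → Path m x y → W m x y
  toW nil = W-nil
  toW (a ▸ p) = W-cons a (toW p)
  fromD : ∀ m {x y} → d x y ≡ m → Path m x y
  fromD zero {x} e = subst (Path 0 x) (d≡0 e) nil
  fromD (suc m) {x} {y} e = let (z , p , q) = first-step {x} {y} e in p ▸ fromD m q
  snoc : ∀ {m x y z} → Path m x y → y ⟶ z → Path (suc m) x z
  snoc nil a = a ▸ nil
  snoc (b ▸ p) a = b ▸ snoc p a
  closed : ∀ {m x} → Path (suc m) x x → suc m < 3 + g0 → ⊥
  closed p l = 1+n≰n (l » no-closed (toW p))
  Straight : ∀ {m x y z} → x ⟶ y → Path m y z → Set
  Straight a nil = ⊤
  Straight {x = x} a (_▸_ {y = y₂} b q) = x ⇉ y₂ × Straight b q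
  opaque
   -- A walk with a turn can be rerouted to leave through the other pair.
   reroute : ∀ {m x y z} (a : x ⟶ y) (p : Path m y z) → Straight a p ⊎ (∃ λ y' → x ⟶ y' × Path m y' z × (Pair x y y' → ⊥))
   reroute a nil = inj₁ tt
   reroute {suc m} {x} {y} {z} a (_▸_ {y = y₂} b q) = go (cases (Tb x y₂)) (reroute b q) where
    go : (x ⇉ y₂) ⊎ (Tb x y₂ ≡ false) → Straight b q ⊎ (∃ λ y' → y ⟶ y' × Path m y' z × (Pair y y₂ y' → ⊥)) →
         Straight a (b ▸ q) ⊎ (∃ λ y' → x ⟶ y' × Path (suc m) y' z × (Pair x y y' → ⊥))
    go (inj₂ f) _ = let (y' , p , r , np) = corner a b f in inj₂ (y' , p , r ▸ q , np)
    go (inj₁ t') (inj₁ s) = inj₁ (t' , s)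
    go (inj₁ t') (inj₂ (y₃ , b' , q' , np)) =
     let (y' , p , r , np') = corner a b' (¬t λ t″ → np (straight-pair a (andC t' b) (andC t″ b'))) in inj₂ (y' , p , r ▸ q' , np')
   -- The vertex after `c` on a shortest way back to `o` is a straight continuation, and `ahead`
   -- lets every straight `v` follow on to the next vertex of that way.
   step : ∀ {o b c v} i r → b ⟶ c → Sg b c v ≡ true → d o b ≤ i → d c o ≤ 2 + r → i + r ≡ g0 → d v o ≤ 1 + r
   step {o} {b} {c} {v} i r bc sv ob co' e =
    let lo : 2 + r ≤ d c o
        lo = lia≤ (d c o ∷ d o b ∷ i ∷ r ∷ g0 ∷ []) ((κ 3 ⊹ ν4 ≼ κ 1 ⊹ (ν0 ⊹ ν1)) ∷ (ν1 ≼ ν2) ∷ (ν2 ⊹ ν3 ≋ ν4) ∷ []) (κ 2 ⊹ ν3) ν0 (no-closed (W-cons bc (W-++ (d-walk c o) (d-walk o b))) , ob , e)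
        (v' , cv' , p) = first-step {c} {o} (≤-antisym co' lo)
        (u , v'u , q) = first-step {v'} {o} p
        tv' : b ⇉ v'
        tv' = mkT bc cv' (d-tri v' o b » lia≤ (d v' o ∷ d o b ∷ i ∷ r ∷ g0 ∷ []) ((ν0 ≋ κ 1 ⊹ ν3) ∷ (ν1 ≼ ν2) ∷ (ν2 ⊹ ν3 ≋ ν4) ∷ []) (ν0 ⊹ ν1) (κ 1 ⊹ ν4) (p , ob , e))
        U : Ub b u ≡ true
        U = tight (λ b≡u → no3 bc cv' (subst (v' ⟶_) (sym b≡u) v'u)) (d-min (W-cons bc (W-cons cv' (W-cons v'u W-nil))))
              (d-tri u o b » lia≤ (d u o ∷ d o b ∷ i ∷ r ∷ g0 ∷ []) ((ν0 ≋ ν3) ∷ (ν1 ≼ ν2) ∷ (ν2 ⊹ ν3 ≋ ν4) ∷ []) (ν0 ⊹ ν1) ν4 (q , ob , e)) refl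
    in d-tri v u o » eq≤ (+≡ (A⇒d (ahead bc (andC tv' cv') v'u U sv)) q)
   level : ∀ {o b c z m} (a : b ⟶ c) (p : Path m c z) → Straight a p → ∀ i r → d o b ≤ i → d c o ≤ m + (1 + r) → i + (m + r) ≡ 1 + g0 → d z o ≤ 1 + r
   level a nil s i r ob co' e = co'
   level {o} {b} {c} {z} {suc m} a (_▸_ {y = y₂} b' q) (t' , s) i r ob co' e =
    level b' q s (suc i) r (d-tri o b c » +-mono-≤ ob (eq≤ (A⇒d a)) » eq≤ (+-comm i 1))
     (step i (m + r) a (andC t' b') ob (co' » eq≤ (cong suc (+-suc m r))) (suc-injective (sym (+-suc i (m + r)) · e)) » eq≥ (+-suc m r))
     (sym (+-suc i (m + r)) · e)
   straight-back : ∀ {x y z m} (a : x ⟶ y) (p : Path m y z) → Straight a p → ∀ r → m + r ≡ 1 + g0 → d z x ≤ 1 + r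
   straight-back {x} {y} {z} {m} a p s r e = level a p s 0 r (eq≤ (d-refl x)) (eq≤ (ty x y a) » eq≤ (cong suc (sym e) · sym (+-suc m r))) e
   fork : ∀ {m x y z} (a : x ⟶ y) (p : Path (suc m) y z) → Straight a p → ∃ λ z' → z ≢ z' × Σ (Path (suc m) y z') (Straight a)
   fork {zero} {x} {y} {z} a (b ▸ nil) (t' , _) = let (s₁ , s₂ , p₁ , p₂ , m) = pair∃ (eq≥ (Sg# a)) in go s₁ s₂ p₁ p₂ m (z F.≟ s₁) where
    mk : ∀ s' → Sg x y s' ≡ true → z ≢ s' → ∃ λ z' → z ≢ z' × Σ (Path 1 y z') (Straight a)
    mk s' p ne = s' , ne , (rgtC p ▸ nil) , lftC p , tt
    go : ∀ s₁ s₂ → Sg x y s₁ ≡ true → Sg x y s₂ ≡ true → s₁ ≢ s₂ → Dec (z ≡ s₁) → ∃ λ z' → z ≢ z' × Σ (Path 1 y z') (Straight a)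
    go s₁ s₂ p₁ p₂ m (yes e) = mk s₂ p₂ λ e' → m (sym e · e')
    go s₁ s₂ p₁ p₂ m (no e) = mk s₁ p₁ e
   fork {suc m} a (b ▸ q) (t' , s) = let (z' , ne , q' , s') = fork b q s in z' , ne , b ▸ q' , t' , s'
  module Claim {x y w y₁ : V} (xy : x ⟶ y) (xw : x ⟶ w) (pr : Pair x y w) (ne : y ≢ w) (yy1 : y ⟶ y₁) (ty1 : Tb x y₁ ≡ false) {m : ℕ} (m< : 2 + m < 3 + g0) where
   opaque
    common : ∀ {z} (p : Path (suc m) y₁ z) → Straight yy1 p → ∀ {v} → y ⟶ v → z ⟶ v → x ⇉ v
    common (_▸_ {y = y₂} b q) (t' , s) {v} yv zv = elimʳ (λ f → closed (turn-pair xy yy1 yv ty1 f y₂ (andC t' b) ▸ snoc q zv) m<) (cases (Tb x v))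
    co≤2 : ∀ {z} (p : Path (suc m) y₁ z) → Straight yy1 p → co y z ≤ 2
    co≤2 p s = (#-mono λ v e → andC (common p s (lft e) (rgt e)) (lft e)) » eq≤ (Sg# xy)
    class : ∀ {z} (p : Path (suc m) y₁ z) → Straight yy1 p → d y z ≡ 2 + m × d z y ≡ 3 + g0 ∸ (2 + m)
    class {z} p s = Cb-fst c , Cb-snd c where
     r : ℕ
     r = g0 ∸ m
     m≤ : m ≤ g0
     m≤ = ≤-pred (≤-pred (≤-pred m<))
     e : (suc m) + r ≡ 1 + g0
     e = cong suc (m+[n∸m]≡n m≤)
     back : d z y ≤ 1 + r
     back = straight-back yy1 p s r e
     c : Cb (2 + m) (3 + g0 ∸ (2 + m)) y z ≡ true
     c = tight (λ { refl → closed (yy1 ▸ p) m< }) (d-min (toW (yy1 ▸ p))) (back » eq≥ (+-∸-assoc 1 m≤)) (m+[n∸m]≡n (n≤1+n _ » m<))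
    -- `fork` gives a second end `w'` in the class of (y , w), so `y`, `w` and `w'` lead to both
    -- straight continuations of `y`. Those two are siblings with three common in-neighbours,
    -- whereas no sibling of `y` shares more than two out-neighbours with it.
    absurdS : (p : Path (suc m) y₁ w) → Straight yy1 p → ⊥
    absurdS p s =
     let (w' , ne' , p' , s') = fork yy1 p s
         (c₁ , c₂) = class p s
         (c₃ , c4) = class p' s'
         co2 : 2 ≤ co y w'
         co2 = pair-co xy pr » eq≤ (co-cl (c₁ · sym c₃) (c₂ · sym c4))
         onto : ∀ v → Sg x y v ≡ true → w' ⟶ v
         onto = λ v sv → rgt (#-sub≡ (λ u e → andC (common p' s' (lft e) (rgt e)) (lft e)) (eq≤ (Sg# xy) » co2) v sv)
         (v₁ , v2 , q1 , q2 , nv) = pair∃ (eq≥ (Sg# xy))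
         yv1 = rgtC q1
         yv2 = rgtC q2
         co3 : 3 ≤ co v2 v₁
         co3 = (size≥ {P = λ u → A u v2 ∧ A u v₁} (y ∷ w ∷ w' ∷ []) ((ne , (λ e → closed (subst (Path _ y) (sym e) (yy1 ▸ p')) m<) , tt) , (ne' , tt) , tt , tt)
                (and yv2 yv1 , and (pr v2 q2) (pr v₁ q1) , and (onto v2 q2) (onto v₁ q1) , tt)) » eq≥ (co-in v2 v₁)
         c = co v2 v₁
         (q , f) = #∃ (∃# v2 (and yv2 (Fb-intro refl (nv ∘ sym))) » eq≤ (m≡ c yv1 · sym (m≡ c xy)))
         xq = lft f
         coq : 3 ≤ co y q
         coq = co3 » eq≤ (sym (Fb-co (rgt f)) · co-sym q y)
     in [ (λ pq → 1+n≰n (subst (λ u → 3 ≤ co y u) (pair-uniq xy xq xw pq pr (Fb-≢ (rgt f) ∘ sym) ne) coq » co≤2 p s)) ,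
          (λ np → 1+n≰n (coq » (#-mono λ u e → and (lft e) (not-f (¬t λ tu → t≢f (rgt e) (np u (andC tu (lft e)))))) » eq≤ (Turn# xy))) ]′ (pair? xy xq)
  opaque
   claim1 : ∀ {x y w m} → x ⟶ y → x ⟶ w → Pair x y w → y ≢ w → Path m y w → m < 3 + g0 → ⊥
   claim1 xy xw pr ne nil l = ne refl
   claim1 {x} {y} {w} {suc m} xy xw pr ne (_▸_ {y = y₁} a p) l = go (cases (Tb x y₁)) where
    start : ∀ {v} → y ⟶ v → x ⇉ v → Path m v w → ⊥
    start {v} yv tv q = closed (pr v (andC tv yv) ▸ q) l
    str : Tb x y₁ ≡ false → ∀ {m} (p : Path m y₁ w) → suc m < 3 + g0 → Straight a p → ⊥
    str f nil l s = a0 xy a xw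
    str f p@(_ ▸ _) l s = Claim.absurdS xy xw pr ne a f l p s
    go : (x ⇉ y₁) ⊎ (Tb x y₁ ≡ false) → ⊥
    go (inj₁ t') = start a t' p
    go (inj₂ f) = [ str f p l , (λ (y' , b , q , np) → [ (λ t' → start b t' q) , (λ f' → np (turn-pair xy a b f f')) ]′ (cases (Tb x y'))) ]′ (reroute a p)
   -- For unpaired siblings a path with a turn is rerouted through the pair of `w`, where `claim1`
   -- applies; a straight path brings `w` back to `x` too early or next to `y`.
   claim2 : ∀ {x y w m} → x ⟶ y → x ⟶ w → y ≢ w → Path m y w → m < 3 + g0 → ⊥
   claim2 {x} {y} {w} {m} xy xw ne p l = [ (λ pr → claim1 xy xw pr ne p l) , (λ np → cross (λ pr → let (v , s) = sg∃ xy in t≢f (pr v s) (np v s))) ]′ (pair? xy xw) where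
    cross : (Pair x y w → ⊥) → ⊥
    cross np = [ str p l , (λ (y' , b , q , np') → other y' b q np' (y' F.≟ w)) ]′ (reroute xy p) where
     other : ∀ y' → x ⟶ y' → Path m y' w → (Pair x y y' → ⊥) → Dec (y' ≡ w) → ⊥
     other y' b q np' (no n) = claim1 b xw (pair-cross xy b xw np' np) n q l
     other y' b q np' (yes refl) = z q l p where
      z : ∀ {m} → Path m w w → m < 3 + g0 → Path m y w → ⊥
      z nil l nil = ne refl
      z q@(_ ▸ _) l _ = closed q l
     str : ∀ {m} (p : Path m y w) → m < 3 + g0 → Straight xy p → ⊥
     str nil l s = ne refl
     str {suc m} p@(a ▸ q) l s = fin (m ≟ 1 + g0) where
      fin : Dec (m ≡ 1 + g0) → ⊥
      fin (yes refl) = a0 xw (d⇒A (≤-antisym (straight-back a q (snd s) 0 (+-identityʳ m)) (pos (d w y) refl))) xy where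
       pos : ∀ e → d w y ≡ e → 1 ≤ d w y
       pos zero e = ⊥-elim (ne (sym (d≡0 e)))
       pos (suc e) f = ≥1 f
      fin (no n) = 1+n≰n (eq≤ (cong suc (sym (ty x w xw))) » (lia≤ (d w x ∷ m ∷ g0 ∷ g0 ∸ m ∷ []) ((ν0 ≼ κ 1 ⊹ ν3) ∷ (ν3 ⊹ ν1 ≋ ν2) ∷ []) (κ 1 ⊹ ν0) (κ 2 ⊹ ν2)
       (straight-back xy p s (g0 ∸ m) (cong suc (m+[n∸m]≡n m≤)) , m∸n+n≡m m≤))) where
       m≤ : m ≤ g0
       m≤ = ≤-pred (≤∧≢⇒< (≤-pred (≤-pred l)) n)
   sib-d : ∀ {x y w} → x ⟶ y → x ⟶ w → y ≢ w → d y w ≡ 3 + g0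
   sib-d {x} {y} {w} xy xw ne = ≤-antisym (d-tri y x w » eq≤ (+≡ (ty x y xy) (A⇒d xw)) » eq≤ (+-comm (2 + g0) 1))
    (≮⇒≥ λ l → claim2 xy xw ne (fromD (d y w) refl) l)
   -- All siblings are at distance (g , g), hence have equally many common out-neighbours.
   sib-const : ∀ {x y w x' y' w'} → x ⟶ y → x ⟶ w → y ≢ w → x' ⟶ y' → x' ⟶ w' → y' ≢ w' → co y w ≡ co y' w'
   sib-const {x} {y} {w} {x'} {y'} {w'} p q ne p' q' ne' = co-cl (sib-d p q ne · sym (sib-d p' q' ne')) (sib-d q p (ne ∘ sym) · sym (sib-d q' p' (ne' ∘ sym)))
  -- `sib-const` gives all siblings the same number of common out-neighbours, but the opposite pair
  -- `w`, `w'` would share four and `y`, `w` at most the two turns of `y`.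
  absurd : ⊥
  absurd =
   let (x , y , xy) = arc0
       (y* , xy* , ne , pr) = partner xy
       (v , sv) = sg∃ xy
       split2 : # (λ u → A x u ∧ not (A u v)) ≡ 2
       split2 = +-cancelˡ-≡ 2 _ 2 (cong (_+ # (λ u → A x u ∧ not (A u v))) (sym (mid# (lftC sv))) · sym (#-split (A x) (λ u → A u v)) · out x)
       (w , w' , p , p' , nw) = pair∃ (eq≥ split2)
       xw = lft p
       xw' = lft p'
       np : ∀ {u} → A u v ≡ false → Pair x y u → ⊥
       np = λ f pr' → t≢f (pr' v sv) f
       nyw = np (not-t (rgt p))
       nyw' = np (not-t (rgt p'))
       y≢ : ∀ {u} → (Pair x y u → ⊥) → y ≢ u
       y≢ = λ {u} f e → f (subst (Pair x y) e λ z s → rgtC s)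
       off : ∀ {u} → x ⟶ u → (Pair x y u → ⊥) → ∀ z → A y z ∧ A u z ≡ true → A y z ∧ not (Tb x z) ≡ true
       off = λ xu n z e → and (lft e) (not-f (¬t λ tz → n (pair xy xu (andC tz (lft e)) (rgt e))))
       two : ∀ {u} → x ⟶ u → y ≢ u → 2 ≤ co y u
       two = λ xu n → pair-co xy pr » eq≤ (sib-const xy xy* ne xy xu n)
       full : ∀ {u} → x ⟶ u → (n : Pair x y u → ⊥) → ∀ z → A y z ∧ not (Tb x z) ≡ true → u ⟶ z
       full = λ {u} xu n z e → rgt (#-sub≡ (off xu n) (eq≤ (Turn# xy) » two xu (y≢ n)) z e)
       -- Hence w and w' share both turns of y besides their straight continuations.
       ww : 4 ≤ co w w'
       ww = eq≥ (+≡ (Sg# xw) (Turn# xy)) » (eq≥ (∑-+ _ _) » (∑-mono λ z → aux (Sg x w z) (A y z ∧ not (Tb x z)) (A w z ∧ A w' z)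
              (λ s → and (rgtC s) (pair-cross xy xw xw' nyw nyw' z s)) (λ e → and (full xw nyw z e) (full xw' nyw' z e))
              (λ s e → t≢f (lftC s) (not-t (rgt e)))))
   in 1+n≰n (≤3+ (z≤n {1}) » ww » eq≤ (sib-const xw xw' nw xy xw (y≢ nyw)) » #-mono (off xw nyw) » eq≤ (Turn# xy)) where
   aux : ∀ p q r → (p ≡ true → r ≡ true) → (q ≡ true → r ≡ true) → (p ≡ true → q ≡ true → ⊥) → β p + β q ≤ β r
   aux true true r f g h = ⊥-elim (h refl refl)
   aux true false r f g h rewrite f refl = ≤-refl
   aux false true r f g h rewrite g refl = ≤-refl
   aux false false r f g h = z≤n

-- Valency four with `Qv = 3`, girth at least five

module Long {n : ℕ} {A : Rel n} {g2 : ℕ} (H : Hyp A 4 (2+ g2)) (P2 : Theory.P H ≡ 2) (Q3 : Theory.Qv H ≡ 3) (t6 : Theory.t H ≡ 6) where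
 open Theory H
 open Girth4 H
 open Val4 H P2
 open Three Q3 t6
 private
  g₁ : ℕ
  g₁ = suc g2
 -- The class (4 , g - 4) following U on a shortest cycle; here g - 4 is `g₁`, positive because the
 -- girth is at least five.
 Lb : V → V → Bool
 Lb = Cb 4 g₁
 UO : ∀ {x y v o} → x ⟶ y → y ⇉ v → v ⟶ o → Lb x o ≡ true → Ub y o ≡ true
 UO {x} {y} {v} {o} a b c l = tight ne (d-tri y v o » eq≤ (+≡ (Cb-fst b) (A⇒d c))) (d-tri o x y » eq≤ ((+≡ (Cb-snd l) (A⇒d a)) · +-comm g₁ 1)) refl where
  ne : y ≢ o
  ne refl = 0≢1+n (suc-injective (sym (A⇒d a) · Cb-fst l))
 AU : V → V → ℕ
 AU x o = # (λ y → A x y ∧ Ub y o)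
 AU≡ : ∀ x o → ⟦ Ax ⊗ U ⟧ x o ≡ AU x o
 AU≡ x o = cnt (A x) (λ y → Ub y o)
 -- Monotonicity squeezes this number between the value 3 on U and `Qv = 3`.
 AU3 : ∀ {x o} → Lb x o ≡ true → AU x o ≡ 3
 AU3 {x} {o} l = ≤-antisym
  ((propagate g2 3 (AU x o) refl λ x' o' l' → eq≤ (sym (AU≡ x o) · on (Ax ⊗ U) l l' · AU≡ x' o')) » eq≤ Q3)
  (let (v , u , vo , _) = up {2} {g₁} l refl in
   ≤-trans (eq≥ (AT3 u)) (#-mono λ y f → and (lft f) (UO (lft f) (rgt f) vo l)))
 -- By `r≡` only two vertices of U(x) follow `z`, but all three that precede `o` turn out to follow
 -- it.
 absurd : ⊥
 absurd =
  let (x , v , u) = u0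
      (o , vo , e) = first-step {v} {x} (Cb-snd u)
      l : Lb x o ≡ true
      l = tight (ne x v o u e) (d-tri x v o » eq≤ (+≡ (Cb-fst u) (A⇒d vo))) (eq≤ e) refl
      (z , zf) = #∃ (≥1 (sym (AT≡TA x v) · AT3 u))
      Tz = lftC zf
      zv = rgtC zf
      (y₁ , y₂ , k1 , k2 , ne') = pair∃ (eq≥ (sqT Tz · P2))
  in core x v o z y₁ y₂ u l vo Tz zv (lft k1) (rgt k1) (lft k2) (rgt k2) ne' where
  ne : ∀ x v o → Ub x v ≡ true → d o x ≡ g₁ → x ≢ o
  ne x v .x u e refl = 0≢1+n (sym (d-refl x) · e)
  core : ∀ x v o z y₁ y₂ → Ub x v ≡ true → Lb x o ≡ true → v ⟶ o → x ⇉ z → z ⟶ v → x ⟶ y₁ → y₁ ⟶ z → x ⟶ y₂ → y₂ ⟶ z → y₁ ≢ y₂ → ⊥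
  core x v o z y₁ y₂ u l vo Tz zv x1 1z x2 2z ne = 1+n≰n (eq≥ (sym (sym (AU≡ x o) · comm Ax U x o · cnt (Ub x) (λ w → A w o)) · AU3 l) » (#-mono λ v' f → ∧-intro {Ub x v'} (∧-fst {Ub x v'} f) (all v' (∧-fst {Ub x v'} f) (∧-snd {Ub x v'} f))) » eq≤ (r≡ Tz)) where
   T' : ∀ {y} v' → Ub x v' ≡ true → v' ⟶ o → x ⟶ y → y ⟶ z → y ⇉ v'
   T' {y} v' u' v'o xy yz = rgt (#-sub≡
    (λ w f → and (lft f) (UO (lft f) (rgt f) v'o l)) (eq≤ (AU3 l · sym (AT3 u'))) y
    (and xy (UO xy (stepT xy yz zv u) vo l)))
   all : ∀ v' → Ub x v' ≡ true → v' ⟶ o → z ⟶ v'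
   all v' u' v'o =
    let S = λ y w → A y w ∧ A w v'
        (z' , f) = #∃ (+-cancelˡ-≤ 3 1 _ (≤-trans (eq≥ (+≡ (sqT (T' v' u' v'o x1 1z) · P2) (sqT (T' v' u' v'o x2 2z) · P2)))
         (incl (S y₁) (S y₂) (λ w → Tb x w ∧ A w v') (inZ x1 u') (inZ x2 u') » eq≤ (cong (_+ # (λ w → (A y₁ w ∧ A w v') ∧ (A y₂ w ∧ A w v'))) (sym (AT≡TA x v') · AT3 u')))))
        f₁ = ∧-fst {A y₁ z' ∧ A z' v'} f
        f₂ = ∧-snd {A y₁ z' ∧ A z' v'} f
        a = lft f₁
        b = rgt f₁
        c = lft f₂
    in subst (_⟶ v') (τ-uniq x2 x1 ne (backT x1 a b u') a c Tz 1z 2z) b where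
    inZ : ∀ {y} → x ⟶ y → Ub x v' ≡ true → ∀ w → A y w ∧ A w v' ≡ true → Tb x w ∧ A w v' ≡ true
    inZ xy u″ w f = andC (backT xy (lft f) (rgt f) u″) (rgt f)

-- Valency four with `Qv = 3`, girth four

module Quad {n : ℕ} {A : Rel n} (H : Hyp A 4 1) (P2 : Theory.P H ≡ 2) (Q3 : Theory.Qv H ≡ 3) (t6 : Theory.t H ≡ 6) where
 open Theory H
 open Girth4 H
 open Val4 H P2
 open Three Q3 t6
 T-sym : ∀ {x z} → x ⇉ z → z ⇉ x
 T-sym p = Cb-intro (Cb-snd p) (Cb-fst p)
 T-irr : ∀ {u v} → u ⇉ v → u ≢ v
 T-irr {u} q refl = 0≢1+n (sym (d-refl u) · Cb-fst q)
 Wcol : ∀ x → # (λ z → Wb z x) ≡ w#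
 Wcol x = row-tr Wx x · Wsize x

 -- Girth four with `s = 4`: W is a permutation

 module ThinW (s4 : s ≡ 4) (m2 : m# 2 ≡ 3) where
  w1 : w# ≡ 1
  w1 = *-cancelˡ-≡ w# 1 4 (cong (_* w#) (sym s4) · sW)
  opaque
   ω∃ : ∀ x → ∃ λ z → Wb x z ≡ true
   ω∃ x = #∃ (eq≥ (Wsize x · w1))
   ω⁻∃ : ∀ x → ∃ λ z → Wb z x ≡ true
   ω⁻∃ x = #∃ (eq≥ (Wcol x · w1))
  ω ω⁻ : V → V
  ω x = fst (ω∃ x)
  ω⁻ x = fst (ω⁻∃ x)
  ωW : ∀ x → Wb x (ω x) ≡ true
  ωW x = snd (ω∃ x)
  ω⁻W : ∀ x → Wb (ω⁻ x) x ≡ true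
  ω⁻W x = snd (ω⁻∃ x)
  W⇒ω : ∀ {x z} → Wb x z ≡ true → z ≡ ω x
  W⇒ω {x} p = unique (Wsize x · w1) p (ωW x)
  W⇒ω⁻ : ∀ {x z} → Wb z x ≡ true → z ≡ ω⁻ x
  W⇒ω⁻ {x} p = unique (Wcol x · w1) p (ω⁻W x)
  ω⁻ω : ∀ x → ω⁻ (ω x) ≡ x
  ω⁻ω x = sym (W⇒ω⁻ (ωW x))
  ωω⁻ : ∀ x → ω (ω⁻ x) ≡ x
  ωω⁻ x = sym (W⇒ω (ω⁻W x))
  -- W is thin, so it acts by automorphisms of every class function.
  shift : ∀ M x y → ⟦ M ⟧ (ω x) y ≡ ⟦ M ⟧ x (ω⁻ y)
  shift M x y = sym l · comm Wx M x y · r where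
   l : ⟦ Wx ⊗ M ⟧ x y ≡ ⟦ M ⟧ (ω x) y
   l = (∑-cong λ z → cong (λ b → β b * ⟦ M ⟧ z y) (iff (λ p → subst (λ u → ω x == u ≡ true) (sym (W⇒ω p)) (==-refl (ω x))) (λ p → subst (λ u → Wb x u ≡ true) (==⇒≡ p) (ωW x)))) · ∑-pick (ω x) (λ z → ⟦ M ⟧ z y)
   r : ⟦ M ⊗ Wx ⟧ x y ≡ ⟦ M ⟧ x (ω⁻ y)
   r = (∑-cong λ z → (*-comm (⟦ M ⟧ x z) _) · cong (λ b → β b * ⟦ M ⟧ x z) (iff (λ p → subst (λ u → ω⁻ y == u ≡ true) (sym (W⇒ω⁻ p)) (==-refl (ω⁻ y))) (λ p → subst (λ u → Wb u y ≡ true) (==⇒≡ p) (ω⁻W y)))) · ∑-pick (ω⁻ y) (λ z → ⟦ M ⟧ x z)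
  dW : ∀ {x y} → Wb x y ≡ true → d x y ≡ 2 × d y x ≢ 2
  dW {x} {y} p = e , λ f → t≢f (Cb-intro e f) (W⇒¬T p) where
   yy = #∃ (≥1 (sqW p · s4))
   xu : x ⟶ fst yy
   xu = lft (snd yy)
   uy : fst yy ⟶ y
   uy = rgt (snd yy)
   e : d x y ≡ 2
   e = pick (d x y) refl (d≤2 xu uy) where
    pick : ∀ a → d x y ≡ a → a ≤ 2 → d x y ≡ 2
    pick 0 q _ = ⊥-elim (no2 xu (subst (λ z → fst yy ⟶ z) (sym (d≡0 q)) uy))
    pick 1 q _ = t≢f (d⇒A q) (W⇒¬A p)
    pick 2 q _ = q
    pick (3+ _) q (≤2+ ())
  into : ∀ {x y} → x ⟶ y → y ⟶ ω x
  into {x} p = fullW s4 (ωW x) p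
  from : ∀ {x y} → y ⟶ ω x → x ⟶ y
  from {x} {y} p = lft (#-sub≡ (λ u → rgt) (eq≤ (inn (ω x) · sym (sqW (ωW x) · s4))) y p)
  D : V → V → Bool
  D = Fb 2
  D6 : ∀ x → # (D x) ≡ 6
  D6 x = F#≡ 2 x · *-cancelˡ-≡ (F# 2) 6 2 (sym (k*m 2) · cong (4 *_) m2)
  co⇒D : ∀ {x y} → 1 ≤ co x y → x ≢ y → D x y ≡ true
  co⇒D {x} {y} p ne = let (u , e) = #∃ (p » eq≤ (co-in x y)) in
   Fb-intro (mall 2 m2 (rgt e) (lft e) ne) ne
  sibD : ∀ {x y y'} → x ⟶ y → x ⟶ y' → y' ≢ y → D y' y ≡ true
  sibD p q ne = Fb-intro (mall 2 m2 p q ne) ne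
  in-D : ∀ {x y y'} → y ⟶ x → y' ⟶ x → y ≢ y' → D y y' ≡ true
  in-D {x} {y} {y'} p q ne = co⇒D (∃# x (and p q)) ne
  -- The out-neighbours of `x` are the in-neighbours of `ω x`, so midpoints of (x , z) are common
  -- in-neighbours of `ω x` and `z`. Both sets have size six.
  TD : ∀ x z → Tb x z ≡ D (ω x) z
  TD x z = iff (to z) (#-sub≡ to (eq≤ (D6 (ω x) · sym (tsize x · t6))) z) where
   to : ∀ z → x ⇉ z → D (ω x) z ≡ true
   to z p = Fb-intro (co-in (ω x) z · (#-cong λ u → cong (_∧ A u z) (iff from into)) · sqT p · P2) λ e → t≢f p (cong (Tb x) (sym e) · W⇒¬T (ωW x))
  TD⁻ : ∀ x z → Tb x z ≡ D (ω⁻ x) z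
  TD⁻ x z = iff T-sym T-sym · TD z x · Fb-sym · iff (λ p → bool x (ω z) (ω⁻ x) z eq p) (λ p → bool (ω⁻ x) z x (ω z) (sym eq) p) · refl where
   eq : ⟦ Fx 2 ⟧ x (ω z) ≡ ⟦ Fx 2 ⟧ (ω⁻ x) z
   eq = cong (λ u → ⟦ Fx 2 ⟧ u (ω z)) (sym (ωω⁻ x)) · shift (Fx 2) (ω⁻ x) (ω z) · cong (⟦ Fx 2 ⟧ (ω⁻ x)) (ω⁻ω z)
   bool : ∀ a b c e → ⟦ Fx 2 ⟧ a b ≡ ⟦ Fx 2 ⟧ c e → D a b ≡ true → D c e ≡ true
   bool a b c e q p = 1≤β (D c e) (eq≤ (sym (cong β p) · q))
  ωω≢ : ∀ x → ω (ω x) ≢ x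
  ωω≢ x e = snd (dW (ωW x)) (cong (d (ω x)) (sym e) · fst (dW (ωW (ω x))))
  ω≢ω⁻ : ∀ x → ω x ≢ ω⁻ x
  ω≢ω⁻ x e = ωω≢ x (cong ω e · ωω⁻ x)
  D-shift : ∀ x z → D (ω (ω x)) z ≡ D x z
  D-shift x z = sym (TD (ω x) z) · TD⁻ (ω x) z · cong (λ u → D u z) (ω⁻ω x)
  -- Each of the two midpoints of (x , z) is followed by two further vertices of T(x), siblings of
  -- `z`; by `τ-uniq` the two pairs are disjoint.
  four : ∀ {x z} → x ⇉ z → 4 ≤ # (λ u → Tb x u ∧ D z u)
  four {x} {z} p =
   let (y₁ , y₂ , k1 , k2 , ne) = pair∃ (eq≥ (sqT p · P2))
   in go y₁ y₂ (lft k1) (rgt k1) (lft k2) (rgt k2) ne where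
   go : ∀ y₁ y₂ → x ⟶ y₁ → y₁ ⟶ z → x ⟶ y₂ → y₂ ⟶ z → y₁ ≢ y₂ → 4 ≤ # (λ u → Tb x u ∧ D z u)
   go y₁ y₂ x1 1z x2 2z ne = lia≤ (# (S y₁) ∷ # (S y₂) ∷ # (λ u → Tb x u ∧ D z u) ∷ # (λ u → S y₁ u ∧ S y₂ u) ∷ [])
       ((ν0 ≋ κ 2) ∷ (ν1 ≋ κ 2) ∷ (ν0 ⊹ ν1 ≼ ν2 ⊹ ν3) ∷ (ν3 ≋ κ 0) ∷ []) (κ 4) ν2
       (two-each x1 1z , two-each x2 2z , incl (S y₁) (S y₂) (λ u → Tb x u ∧ D z u) (inD 1z) (inD 2z) , none) where
    S : V → V → Bool
    S y u = (Tb x u ∧ A y u) ∧ not (z == u)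
    inD : ∀ {y} → y ⟶ z → ∀ u → S y u ≡ true → Tb x u ∧ D z u ≡ true
    inD {y} yz u f = let a = ∧-fst {Tb x u ∧ A y u} f in
     andC (lftC a) (sibD (rgtC a) yz (==-false (not-t (∧-snd {Tb x u ∧ A y u} f))))
    two-each : ∀ {y} → x ⟶ y → y ⟶ z → # (S y) ≡ 2
    two-each {y} xy yz = suc-injective (cong (_+ # (S y)) (sym one-z) · sym (#-split (λ u → Tb x u ∧ A y u) (z ==_)) · qT xy · Q3) where
     one-z : # (λ u → (Tb x u ∧ A y u) ∧ (z == u)) ≡ 1
     one-z = (∑-cong λ u → cong β (iff (λ f → ∧-snd {Tb x u ∧ A y u} f) (λ e → subst (λ w → (Tb x w ∧ A y w) ∧ (z == w) ≡ true) (==⇒≡ e) (∧-intro {Tb x z ∧ A y z} (andC p yz) (==-refl z))))) · (∑-cong λ u → sym (*-identityʳ _)) · ∑-pick z (λ _ → 1)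
    none : # (λ u → S y₁ u ∧ S y₂ u) ≡ 0
    none = n≤0⇒n≡0 (≤-pred (≰⇒> no-common)) where
     no-common : ¬ (1 ≤ # (λ u → S y₁ u ∧ S y₂ u))
     no-common l = let
         (u , f) = #∃ l
         f₁ = ∧-fst {S y₁ u} f
         a₁ = ∧-fst {Tb x u ∧ A y₁ u} f₁
         a₂ = ∧-fst {Tb x u ∧ A y₂ u} (∧-snd {S y₁ u} f)
      in ==-false (not-t (∧-snd {Tb x u ∧ A y₁ u} f₁)) (τ-uniq x2 x1 ne p 1z 2z (lftC a₁) (rgtC a₁) (rgtC a₂))
  ¬Dω : ∀ z → D z (ω z) ≡ false
  ¬Dω z = ¬t λ p → let (u , e) = #∃ (≥1 (Fb-co p)) in no2 (into (lft e)) (rgt e)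
  -- If T = D then ω z and ω⁻ z are both the antipode of z in T(x).
  not-D : (∀ {x z} → x ⇉ z → D x z ≡ true) → ⊥
  not-D sub = ω≢ω⁻ z (unique one-left
      (∧-intro {Tb x (ω z) ∧ not (D z (ω z))} (andC xωz (not-f (¬Dω z))) (not-f (≢⇒== λ e → irr (ωW z) e)))
      (∧-intro {Tb x (ω⁻ z) ∧ not (D z (ω⁻ z))} (andC xω⁻z (not-f (Fb-sym · cong (D (ω⁻ z)) (sym (ωω⁻ z)) · ¬Dω (ω⁻ z)))) (not-f (≢⇒== λ e → irr (ω⁻W z) (sym e))))) where
   x z : V
   x = x₀
   z = y₀
   irr : ∀ {a b} → Wb a b ≡ true → a ≢ b
   irr {a} w refl = 0≢1+n (sym (d-refl a) · fst (dW w))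
   T⇔D : ∀ x z → Tb x z ≡ D x z
   T⇔D x z = iff sub (#-sub≡ (λ _ → sub) (eq≤ (D6 x · sym (tsize x · t6))) z)
   xωz : Tb x (ω z) ≡ true
   xωz = T-sym (T⇔D (ω z) x · sym (TD z x) · T-sym T0)
   xω⁻z : Tb x (ω⁻ z) ≡ true
   xω⁻z = T-sym (T⇔D (ω⁻ z) x · sym (TD⁻ z x) · T-sym T0)
   one-left : # (λ u → (Tb x u ∧ not (D z u)) ∧ not (z == u)) ≡ 1
   one-left = ≤-antisym
    (lia≤ (# (λ u → Tb x u ∧ D z u) ∷ # (λ u → Tb x u ∧ not (D z u)) ∷ # (λ u → (Tb x u ∧ not (D z u)) ∧ (z == u)) ∷ # (λ u → (Tb x u ∧ not (D z u)) ∧ not (z == u)) ∷ [])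
     ((κ 4 ≼ ν0) ∷ (κ 6 ≋ ν0 ⊹ ν1) ∷ (ν1 ≋ ν2 ⊹ ν3) ∷ (κ 1 ≼ ν2) ∷ []) ν3 (κ 1)
     (four T0 , sym (tsize x · t6) · #-split (Tb x) (D z) , #-split (λ u → Tb x u ∧ not (D z u)) (z ==_) , ∃# z (∧-intro {Tb x z ∧ not (D z z)} (andC T0 (not-f (¬t λ q → Fb-≢ q refl))) (==-refl z))))
    (∃# (ω z) (∧-intro {Tb x (ω z) ∧ not (D z (ω z))} (andC xωz (not-f (¬Dω z))) (not-f (≢⇒== λ e → irr (ωW z) e))))
  co≤2 : ∀ {x y} → x ≢ y → co x y ≤ 2
  co≤2 {x} {y} ne = go (co x y) refl where
   go : ∀ c → co x y ≡ c → co x y ≤ 2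
   go 0 e = eq≤ e » z≤n
   go (suc c) e = eq≤ (Fb-co (co⇒D (≥1 e) ne))
  T∩D : ∀ {x z} → x ⇉ z → co x z ≡ 0
  T∩D {x} {z} p = let (m , e) = coT T0 refl in
      [ (λ c → sym (co≡ x z) · on C p T0 · co≡ x₀ y₀ · c)
      , (λ c → ⊥-elim (not-D λ {u} {v} q → Fb-intro (sym (co≡ u v) · on C q T0 · co≡ x₀ y₀ · c) (T-irr q))) ]′ (even46 m (co x₀ y₀) e (co≤2 (T-irr T0)))
  ττ : V → V
  ττ x = ω (ω x)
  ¬Dτ : ∀ x → D x (ττ x) ≡ false
  ¬Dτ x = ¬t λ p → Fb-≢ (D-shift x (ττ x) · p) refl
  co0 : ∀ {x y} → x ≢ y → D x y ≡ false → co x y ≡ 0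
  co0 ne f = n≤0⇒n≡0 (≤-pred (≰⇒> λ l → t≢f (co⇒D l ne) f))
  -- Otherwise a vertex of D(x) would share two out-neighbours with each of three vertices whose
  -- out-neighbourhoods are disjoint: six out of four.
  ττ-inv : ∀ x → ττ (ττ x) ≡ x
  ττ-inv x with ττ (ττ x) F.≟ x
  ... | yes e = e
  ... | no ne = ⊥-elim (three (#∃ (≥1 (D6 x)))) where
   three : (∃ λ u → D x u ≡ true) → ⊥
   three (u , p) = lia (co x u ∷ co (ττ x) u ∷ co (ττ (ττ x)) u ∷ [])
    ((ν0 ≋ κ 2) ∷ (ν1 ≋ κ 2) ∷ (ν2 ≋ κ 2) ∷ (ν0 ⊹ ν1 ⊹ ν2 ≼ κ 4) ∷ [])
    (Fb-co p , Fb-co p₁ , Fb-co p₂ , fits) where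
    p₁ : D (ττ x) u ≡ true
    p₁ = D-shift x u · p
    p₂ : D (ττ (ττ x)) u ≡ true
    p₂ = D-shift (ττ x) u · p₁
    z01 : co x (ττ x) ≡ 0
    z01 = co0 (λ e → ωω≢ x (sym e)) (¬Dτ x)
    z12 : co (ττ x) (ττ (ττ x)) ≡ 0
    z12 = co0 (λ e → ωω≢ (ττ x) (sym e)) (¬Dτ (ττ x))
    z02 : co x (ττ (ττ x)) ≡ 0
    z02 = co0 (ne ∘ sym) (sym (D-shift x (ττ (ττ x))) · ¬Dτ (ττ x))
    clash : ∀ {a b w} → co a b ≡ 0 → a ⟶ w → b ⟶ w → ⊥
    clash {a} {b} {w} e f g = 1+n≰n (∃# w (and f g) » eq≤ e)
    fits : co x u + co (ττ x) u + co (ττ (ττ x)) u ≤ 4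
    fits = eq≤ (cong (_+ co (ττ (ττ x)) u) (sym (∑-+ _ _)) · sym (∑-+ _ _)) » (∑-mono λ w → aux (A x w) (A (ττ x) w) (A (ττ (ττ x)) w) (A u w) (clash z01) (clash z12) (clash z02)) » eq≤ (out u) where
     aux : ∀ a b c e → (a ≡ true → b ≡ true → ⊥) → (b ≡ true → c ≡ true → ⊥) → (a ≡ true → c ≡ true → ⊥) → β (a ∧ e) + β (b ∧ e) + β (c ∧ e) ≤ β e
     aux true true c e p q r = ⊥-elim (p refl refl)
     aux true false true e p q r = ⊥-elim (r refl refl)
     aux true false false e p q r = eq≤ (+-identityʳ _ · +-identityʳ _)
     aux false true true e p q r = ⊥-elim (q refl refl)
     aux false true false e p q r = eq≤ (+-identityʳ _)
     aux false false true e p q r = ≤-refl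
     aux false false false e p q r = z≤n
  dτ : ∀ x → d x (ττ x) ≡ 4
  dτ x = pick (d x (ττ x)) refl (let
      (y , p) = has-out x
      (y' , q) = has-out (ω x) in d-min (W-cons p (W-cons (into p) (W-cons q (W-cons (into q) W-nil))))) where
   pick : ∀ a → d x (ττ x) ≡ a → a ≤ 4 → d x (ττ x) ≡ 4
   pick 0 e _ = ⊥-elim (ωω≢ x (sym (d≡0 e)))
   pick 1 e _ = let (y , p) = has-out x in ⊥-elim (1+n≰n (no-closed (W-cons p (W-cons (into p) (W-cons (from (d⇒A e)) W-nil)))))
   pick 2 e _ = let (y , p , q) = first-step {x} {ττ x} e in ⊥-elim (no2 (from (d⇒A q)) (into p))
   pick 3 e _ = let
       (y , p , q) = first-step {x} {ττ x} e
       (r , p' , q') = first-step {y} {ττ x} q in t≢f p' (a0 (into p) (from (d⇒A q')))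
   pick 4 e _ = e
   pick (5+ _) e (≤4+ ())
  -- Of the six vertices of D(z) at least four lie in T(x), and `ω x` and `ω⁻ x` are two outside.
  D-nbr : ∀ {x z v} → x ⇉ z → D z v ≡ true → x ⇉ v ⊎ v ≡ ω x ⊎ v ≡ ω⁻ x
  D-nbr {x} {z} {v} p q with cases (Tb x v)
  ... | inj₁ t = inj₁ t
  ... | inj₂ f with v F.≟ ω x | v F.≟ ω⁻ x
  ... | yes e | _ = in1 e
  ... | no _ | yes e = inj₂ (inj₂ e)
  ... | no e | no e' = lia (# (λ u → D z u ∧ Tb x u) ∷ # (λ u → D z u ∧ not (Tb x u)) ∷ [])
            ((κ 6 ≋ ν0 ⊹ ν1) ∷ (κ 4 ≼ ν0) ∷ (κ 3 ≼ ν1) ∷ [])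
            (sym (D6 z) · #-split (D z) (Tb x) , four p » eq≤ (#-cong λ u → ∧-comm (Tb x u) (D z u)) ,
             inj≤# {P = λ u → D z u ∧ not (Tb x u)} f3 inj3 inn3) where
   f3 : Fin 3 → V
   f3 0F = v
   f3 1F = ω x
   f3 2F = ω⁻ x
   inj3 : ∀ i j → f3 i ≡ f3 j → i ≡ j
   inj3 0F 0F _ = refl
   inj3 0F 1F q = ⊥-elim (e q)
   inj3 0F 2F q = ⊥-elim (e' q)
   inj3 1F 0F q = ⊥-elim (e (sym q))
   inj3 1F 1F _ = refl
   inj3 1F 2F q = ⊥-elim (ω≢ω⁻ x q)
   inj3 2F 0F q = ⊥-elim (e' (sym q))
   inj3 2F 1F q = ⊥-elim (ω≢ω⁻ x (sym q))
   inj3 2F 2F _ = refl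
   inn3 : ∀ i → D z (f3 i) ∧ not (Tb x (f3 i)) ≡ true
   inn3 0F = andF q (not-f f)
   inn3 1F = andF (Fb-sym · sym (TD x z) · p) (not-f (W⇒¬T (ωW x)))
   inn3 2F = andF (Fb-sym · sym (TD⁻ x z) · p) (not-f (¬t λ t → t≢f (T-sym t) (W⇒¬T (ω⁻W x))))
  dD : ∀ {x y} → D x y ≡ true → d x y ≡ 4
  dD {x} {y} p = pick (d x y) refl (let (u , e) = #∃ (≥1 (sym (co-in x y) · Fb-co p)) in
      ≤-trans (d-tri x u y) (eq≤ (+≡ (ty u x (lft e)) (A⇒d (rgt e))))) where
   pick : ∀ a → d x y ≡ a → a ≤ 4 → d x y ≡ 4
   pick 0 e _ = ⊥-elim (Fb-≢ p (d≡0 e))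
   pick 1 e _ = let (u , f) = #∃ (≥1 (Fb-co p)) in t≢f (lft f) (a0 (d⇒A e) (rgt f))
   pick 2 e _ = let (q , xq , qy) = first-step {x} {y} e in
    ⊥-elim ([ (λ t → 0≢1+n (sym (T∩D t) · Fb-co p)) , (λ f → t≢f (subst (λ u → D x u ≡ true) (W⇒ω (T-or-W xq (d⇒A qy) f)) p) (¬Dω x)) ]′ (cases (Tb x y)))
   pick 3 e _ = let
       (u , xu , uy) = first-step {x} {y} e
       (q , uq , qy) = first-step {u} {y} uy
       (v , f) = #∃ (≥1 (sym (co-in x y) · Fb-co p))
       vx = lft f
       vy = rgt f
       qv = in-D (d⇒A qy) vy (λ eq → 1+n≰n (no-closed (W-cons xu (W-cons uq (W-cons (subst (_⟶ x) (sym eq) vx) W-nil)))))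
       ¬T : x ⇉ v → ⊥
       ¬T = λ t → 0≢1+n (suc-injective (sym (A⇒d vx) · Cb-snd t))
    in ⊥-elim ([ (λ t → [ ¬T , [ (λ eq → 1+n≢n (sym (ty v x vx) · cong (d x) eq · fst (dW (ωW x)))) , (λ eq → 0≢1+n (suc-injective (sym (A⇒d vx) · cong (λ z → d z x) eq · fst (dW (ω⁻W x))))) ]′ ]′ (D-nbr t qv))
                          , (λ g → ¬T (TD x v · subst (λ z → D z v ≡ true) (W⇒ω (T-or-W xu uq g)) qv)) ]′ (cases (Tb x q)))
   pick 4 e _ = e
   pick (5+ _) e (≤4+ ())
  -- Pairs in D and pairs (x , ττ x) both lie at distance (4 , 4), but the first have two common
  -- out-neighbours and the second none.
  absurd : ⊥
  absurd =
   let x = x₀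
       (u , p) = #∃ (≥1 (D6 x))
       two≡0 = sym (Fb-co p) · co-cl (dD p · sym (dτ x)) (dD (Fb-sym · p) · sym (cong (d (ττ x)) (sym (ττ-inv x)) · dτ (ττ x))) · co0 (λ e → ωω≢ x (sym e)) (¬Dτ x)
   in 1+n≢0 two≡0

 -- Girth four with `s = 1`

 module Spread (s1 : s ≡ 1) (m1 : m# 1 ≡ 3) where
  opaque
   w4 : w# ≡ 4
   w4 = sym (*-identityˡ w#) · cong (_* w#) (sym s1) · sW
   dW : ∀ {x w} → Wb x w ≡ true → d x w ≡ 2 × 3 ≤ d w x
   dW {x} {w} p = let (u , e) = #∃ (eq≥ (sqW p · s1)) in go (lft e) (rgt e) where
    go : ∀ {u} → x ⟶ u → u ⟶ w → d x w ≡ 2 × 3 ≤ d w x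
    go {u} xu uw = e , back (d w x) refl where
     fwd : ∀ a → d x w ≡ a → a ≤ 2 → d x w ≡ 2
     fwd 0 q _ = ⊥-elim (no2 xu (subst (u ⟶_) (sym (d≡0 q)) uw))
     fwd 1 q _ = t≢f (d⇒A q) (W⇒¬A p)
     fwd 2 q _ = q
     fwd (3+ _) q (≤2+ ())
     e : d x w ≡ 2
     e = fwd (d x w) refl (d≤2 xu uw)
     back : ∀ a → d w x ≡ a → 3 ≤ d w x
     back 0 q = ⊥-elim (0≢1+n (sym (d-refl x) · cong (d x) (sym (d≡0 q)) · e))
     back 1 q = ⊥-elim (1+n≰n (no-closed (W-cons xu (W-cons uw (W-cons (d⇒A q) W-nil)))))
     back 2 q = t≢f (Cb-intro e q) (W⇒¬T p)
     back (3+ a) q = ≤3+ z≤n » eq≥ q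
   WT : ∀ {x z} → Wb x z ≡ true → x ⇉ z → ⊥
   WT p q = t≢f q (W⇒¬T p)
   sib1 : ∀ {x y y'} → x ⟶ y → x ⟶ y' → y ≢ y' → co y y' ≡ 1
   sib1 p q ne = mall 1 m1 q p ne
   co1 : ∀ {y y'} → 1 ≤ co y y' → y ≢ y' → co y y' ≡ 1
   co1 l ne = let (x , e) = #∃ (l » eq≤ (co-in _ _)) in sib1 (lft e) (rgt e) ne
   out! : ∀ {y y' z z'} → y ≢ y' → y ⟶ z → y' ⟶ z → y ⟶ z' → y' ⟶ z' → z ≡ z'
   out! ne a b c e = unique (co1 (∃# _ (and a b)) ne) (and a b) (and c e)
   meet : ∀ {x y y'} → x ⟶ y → x ⟶ y' → ∃ λ z → y ⟶ z × y' ⟶ z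
   meet p q = let (z , e) = #∃ (sib-co p q) in z , lft e , rgt e
   twoT : ∀ {x y y' z} → x ⟶ y → y ⟶ z → x ⟶ y' → y' ⟶ z → y ≢ y' → x ⇉ z
   twoT a b c e ne = elimʳ (λ f → 1+n≰n (two≤ (and a b) (and c e) ne » eq≤ (sqW (T-or-W a b f) · s1))) (cases _)
   other : ∀ {x y z} → x ⇉ z → ∃ λ y' → x ⟶ y' × y' ⟶ z × y' ≢ y
   other {y = y} t = let (y' , e , ne , _) = fresh (y ∷ []) (eq≥ (sqT t · P2)) in y' , lft e , rgt e , ne
   ω : ∀ {x y} → x ⟶ y → ∃ λ w → y ⟶ w × Wb x w ≡ true
   ω p = let (w , e) = #∃ (eq≥ (Wout p)) in w , rgtC e , lftC e
   ω! : ∀ {x y w w'} → x ⟶ y → y ⟶ w → Wb x w ≡ true → y ⟶ w' → Wb x w' ≡ true → w ≡ w'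
   ω! p a e b f = unique (Wout p) (andC e a) (andC f b)
   mid! : ∀ {x y y' w} → Wb x w ≡ true → x ⟶ y → y ⟶ w → x ⟶ y' → y' ⟶ w → y ≡ y'
   mid! p a b c e = unique (sqW p · s1) (and a b) (and c e)
   Win : ∀ {x y} → x ⟶ y → # (λ u → A u x ∧ Wb u y) ≡ 1
   Win {x} {y} p = sym (cnt (λ u → A u x) (λ u → Wb u y)) · comm (tr Ax) Wx x y · cnt (Wb x) (A y) · Wout p
   α : ∀ {x y} → x ⟶ y → ∃ λ u → u ⟶ x × Wb u y ≡ true
   α p = let (u , e) = #∃ (eq≥ (Win p)) in u , lft e , rgt e
   cyc : ∀ {x y z u} → x ⟶ y → y ⟶ z → z ⟶ u → u ⟶ x → y ⇉ u
   cyc xy yz zu ux = T-sym (mkT ux xy (d≤2 yz zu))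
   outs : ∀ {x z} → x ⇉ z → # (λ u → A z u ∧ A u x) ≡ 2
   outs t = sqT (T-sym t) · P2
   rest# : ∀ {x z} → x ⇉ z → # (λ p → A z p ∧ not (A p x)) ≡ 2
   rest# {x} {z} t = #-rest (A z) (λ u → A u x) (out z) (outs t)
   -- W matches N⁻(x) with N⁺(x), and z in T(x) reaches exactly the partners of the y not leading to z.
   compl : ∀ {x y z u} → x ⇉ z → x ⟶ y → u ⟶ x → Wb u y ≡ true → A y z ≡ false → z ⟶ u
   compl {x} {y} {z} {u} t xy ux uy yz = elimʳ bad (cases (A z u)) where
    rest : # (λ u → A u x ∧ not (A z u)) ≡ 2
    rest = #-rest (λ u → A u x) (A z) (inn x) ((#-cong λ u → ∧-comm (A u x) (A z u)) · outs t)
    off : ∀ {y' u'} → x ⟶ y' → y' ⟶ z → u' ⟶ x → Wb u' y' ≡ true → A u' x ∧ not (A z u') ≡ true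
    off a b c e = and c (not-f (¬t λ zu → WT e (T-sym (cyc a b zu c))))
    bad : A z u ≡ false → ⊥
    bad f = let
        (a , b , p , q , ab) = pair∃ (eq≥ (sqT t · P2))
        (i , ix , ia) = α (lft p)
        (j , jx , jb) = α (lft q)
        ny = λ {c} (cz : c ⟶ z) (e : c ≡ y) → t≢f (subst (_⟶ z) e cz) yz
     in ny (rgt q) (ω! ux (lft q) (subst (λ v → Wb v b ≡ true) (third rest (off (lft p) (rgt p) ix ia) (off (lft q) (rgt q) jx jb) (and ux (not-f f))
          (λ e → ab (ω! jx (lft p) (subst (λ v → Wb v a ≡ true) e ia) (lft q) jb))
          (λ e → ny (rgt p) (ω! ux (lft p) (subst (λ v → Wb v a ≡ true) e ia) xy uy))) jb) xy uy)
   T∩D : ∀ {x z} → x ⇉ z → 1 ≤ co x z → ⊥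
   T∩D t l = let (m , e) = coT t (co1 l (T-irr t)) in no46 m e
   T-sib : ∀ {x y z} → x ⇉ z → y ⟶ x → y ⟶ z → ⊥
   T-sib t a b = T∩D t (sib-co a b)
   -- As `z` and `z'` share the midpoint `y`, some out-neighbour `c` of `x` leads to neither;
   -- `compl` sends both to the W-partner of `c`.
   adj∃ : ∀ {x y z z'} → x ⇉ z → x ⇉ z' → x ⟶ y → y ⟶ z → y ⟶ z' → ∃ λ u → u ⟶ x × z ⟶ u × z' ⟶ u
   adj∃ {x} {y} t t' xy yz yz' = let
       (a , xa , az , ay) = other {y = y} t
       (b , xb , bz , by) = other {y = y} t'
       (c , xc , cy , ca , cb , _) = fresh (y ∷ a ∷ b ∷ []) (eq≥ (out x))
       (u , ux , uc) = α xc
    in u , ux , compl t xc ux uc (¬t λ cz → ca (sym (third (sqT t · P2) (and xy yz) (and xa az) (and xc cz) (ay ∘ sym) (cy ∘ sym))))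
             , compl t' xc ux uc (¬t λ cz → cb (sym (third (sqT t' · P2) (and xy yz') (and xb bz) (and xc cz) (by ∘ sym) (cy ∘ sym))))
  -- T A is 3 on reversed arcs (`TA3`), so the truncated subtraction is exact. What remains of the
  -- row sum 24 is 12.
  Ee : Ex
  Ee = pw (λ a b → a ∸ 3 * b) (Tx ⊗ Ax) (tr Ax)
  opaque
   TA≡ : ∀ x p → ⟦ Tx ⊗ Ax ⟧ x p ≡ TA x p
   TA≡ x p = cnt (Tb x) (λ z → A z p)
   TA3 : ∀ {x u} → u ⟶ x → TA x u ≡ 3
   TA3 {x} {u} p = sym (AT≡TA x u) · AT3 (Cb-intro (ty u x p) (A⇒d p))
   Ee≡ : ∀ {x p} → A p x ≡ false → ⟦ Ee ⟧ x p ≡ TA x p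
   Ee≡ {x} {p} f = cong (λ b → ⟦ Tx ⊗ Ax ⟧ x p ∸ 3 * β b) f · TA≡ x p
   Ee-in : ∀ {x u} → u ⟶ x → ⟦ Ee ⟧ x u ≡ 0
   Ee-in {x} {u} p = cong₂ (λ a b → a ∸ 3 * β b) (TA≡ x u · TA3 p) p
   rE : ∀ x → row Ee x ≡ 12
   rE x = +-cancelˡ-≡ 12 _ 12 (cong (_+ row Ee x) (sym (∑-*ˡ 3 _ · cong (3 *_) (inn x))) · sym (∑-+ _ _) · (∑-cong λ p → eq p (cases (A p x))) · row-⊗ Tx Ax x · cong₂ _*_ (tsize x · t6) (out x)) where
    eq : ∀ p → Cases (A p x) → 3 * β (A p x) + ⟦ Ee ⟧ x p ≡ ⟦ Tx ⊗ Ax ⟧ x p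
    eq p (inj₁ e) = cong₂ (λ a b → 3 * β a + b) e (Ee-in e) · sym (TA≡ x p · TA3 e)
    eq p (inj₂ e) = cong₂ (λ a b → 3 * β a + b) e (Ee≡ e) · sym (TA≡ x p)
   E-out : ∀ {x p} → 1 ≤ ⟦ Ee ⟧ x p → A p x ≡ false
   E-out l = ¬t λ a → 1+n≰n (l » eq≤ (Ee-in a))
   E-in : ∀ {x z p} → x ⇉ z → z ⟶ p → A p x ≡ false → 1 ≤ ⟦ Ee ⟧ x p
   E-in t zp f = ∃# _ (andC t zp) » eq≥ (Ee≡ f)
   -- The product is positive, a multiple of `t = 6` and of `k = 4`, and at most the row sum 12.
   -- Hence E is supported on a single class, which `E-full` records.
   E-size : ∀ {x p} → 1 ≤ ⟦ Ee ⟧ x p → R# x p * TA x p ≡ 12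
   E-size {x} {p} l = let
       (q , e) = RmulT Ax x p
       (m , f) = RmulA Tx x p
       c = cong (R# x p *_) (TA≡ x p)
       g = cong (R# x p *_) (Ee≡ (E-out l))
    in num12 _ q m (sym c · e · cong (_* q) t6) (sym c · cong (R# x p *_) (comm Tx Ax x p) · f) (*-pos (R>0 x p) l » eq≤ g) (eq≥ g » R≤row Ee x p » eq≤ (rE x))
   E-full : ∀ {x p u v} → 1 ≤ ⟦ Ee ⟧ x p → 1 ≤ ⟦ Ee ⟧ u v → Rb x p u v ≡ true
   E-full {x} {p} l l' = R-full Ee x p (eq≤ (rE x · sym (cong (R# x p *_) (Ee≡ (E-out l)) · E-size l))) _ _ l'
   -- By `apart` such `z`, `z'` share no midpoint over `x`. As E is one class, the other
   -- non-returning `p'` after `z` also has a second predecessor `z″` in T(x); the two midpoints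
   -- left over serve both `z'` and `z″`, which therefore coincide, and then `z`, `z'` share `p` and
   -- `p'`.
   E! : ∀ {x z z' p} → A p x ≡ false → x ⇉ z → z ⟶ p → x ⇉ z' → z' ⟶ p → z ≡ z'
   E! {x} {z} {z'} {p} px t zp t' zp' = go (z F.≟ z') where
    apart : ∀ {y z z' p} → A p x ≡ false → x ⇉ z → z ⟶ p → x ⇉ z' → z' ⟶ p → z ≢ z' → x ⟶ y → y ⟶ z → y ⟶ z' → ⊥
    apart px t zp t' zp' ne xy yz yz' = let (u , ux , a , b) = adj∃ t t' xy yz yz' in t≢f (subst (_⟶ x) (out! ne a b zp zp') ux) px
    go : Dec (z ≡ z') → z ≡ z'
    go (yes e) = e
    go (no ne) = let
        l = E-in t zp px
        (p' , e , pp , _) = fresh {P = λ p → A z p ∧ not (A p x)} (p ∷ []) (eq≥ (rest# t))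
        px' = not-t (rgt e)
        two = two≤ (andC t zp) (andC t' zp') ne » eq≤ (sym (TA≡ x p) · sym (onR (Tx ⊗ Ax) (E-full l (E-in t (lft e) px'))) · TA≡ x p')
        (z″ , f , nz , _) = fresh (z ∷ []) two
        sub = λ {y} {z1} {p₁} px1 zp1 (t1 : x ⇉ z1) zp1' n₁ (h : A x y ∧ A y z1 ≡ true) → and {b = not (A y z)} (lft h) (not-f (¬t λ yz → apart {p = p₁} px1 t zp1 t1 zp1' n₁ (lft h) yz (rgt h)))
        off : # (λ y → A x y ∧ not (A y z)) ≡ 2
        off = #-rest (A x) (λ y → A y z) (out x) (sqT t · P2)
        (c , c' , h , h' , cc) = pair∃ (eq≥ (sqT t' · P2))
        to : ∀ {y} → A x y ∧ A y z' ≡ true → y ⟶ z″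
        to h = rgt (#-sub≡ (λ y → sub px' (lft e) (lftC f) (rgtC f) (nz ∘ sym)) (eq≤ (off · sym (sqT (lftC f) · P2))) _ (sub px zp t' zp' ne h))
        same = out! cc (to h) (to h') (rgt h) (rgt h')
     in ⊥-elim (pp (out! ne (lft e) (subst (_⟶ p') same (rgtC f)) zp zp'))
   TA1 : ∀ {x p} → 1 ≤ ⟦ Ee ⟧ x p → TA x p ≡ 1
   TA1 l = ≤-antisym (#≤1 λ a b → E! (E-out l) (lftC a) (rgtC a) (lftC b) (rgtC b)) (l » eq≤ (Ee≡ (E-out l)))
   E12 : ∀ {x p} → 1 ≤ ⟦ Ee ⟧ x p → R# x p ≡ 12
   E12 {x} {p} l = sym (*-identityʳ _) · cong (R# x p *_) (sym (TA1 l)) · E-size l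
   W-out : ∀ {x w q} → Wb x w ≡ true → w ⟶ q → A q x ≡ false
   W-out W b = ¬t λ e → 1+n≰n (snd (dW W) » d≤2 b e)
   WA≡ : ∀ x p → ⟦ Wx ⊗ Ax ⟧ x p ≡ # (λ w → Wb x w ∧ A w p)
   WA≡ x p = cnt (Wb x) (λ w → A w p)
   rWA : ∀ x → row (Wx ⊗ Ax) x ≡ 16
   rWA x = row-⊗ Wx Ax x · cong₂ _*_ (Wsize x · w4) (out x)
   -- The common out-neighbour of z and w witnesses W A > 0 on E; as 12 ⋆ 2 exceeds the row sum 16, it is 1 there.
   WA1 : ∀ {x p} → 1 ≤ ⟦ Ee ⟧ x p → ⟦ Wx ⊗ Ax ⟧ x p ≡ 1
   WA1 l = let
       (y , xy , yz) = two T0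
       (w , yw , W) = ω xy
       (q , zq , wq) = meet yz yw
       l0 = E-in T0 zq (W-out W wq)
    in onR (Wx ⊗ Ax) (E-full l0 l) · one1 _ (∃# w (andC W wq) » eq≥ (WA≡ x₀ q)) (eq≥ (cong (_* ⟦ Wx ⊗ Ax ⟧ x₀ q) (E12 l0)) » R≤row (Wx ⊗ Ax) x₀ q » eq≤ (rWA x₀)) where
    one1 : ∀ c → 1 ≤ c → 12 * c ≤ 16 → c ≡ 1
    one1 1 _ _ = refl
    one1 (2+ c) _ h = lia (c ∷ []) ((12 ⊙ (κ 2 ⊹ ν0) ≼ κ 16) ∷ []) h
   -- Just two out-neighbours of `z` do not return to `x`. Seen from the midpoint `y'` one lies in
   -- T(y') and one in W(y'); the former is not `q` because W A is 1 on E.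
   cross : ∀ {x y z y' w q} → x ⟶ y → y ⟶ z → x ⟶ y' → y' ⟶ z → y ≢ y' → y ⟶ w → Wb x w ≡ true → z ⟶ q → w ⟶ q → Wb y' q ≡ true
   cross {x} {y} {z} {y'} xy yz xy' yz' ne yw W zq wq = let
       t = twoT xy yz xy' yz' ne
       l = E-in t zq (W-out W wq)
       (r , zr , Wr) = ω yz'
       (w' , yw' , W') = ω xy'
       (q' , zq' , wq') = meet yz' yw'
       t' = twoT yz' zq' yw' wq' λ e → WT W' (subst (λ v → x ⇉ v) e t)
       w≢ = λ e → ne (mid! W xy yw xy' (subst (y' ⟶_) (sym (unique (sym (WA≡ x _) · WA1 l) (andC W wq) (andC W' (subst (w' ⟶_) e wq')))) yw'))
    in subst (λ v → Wb y' v ≡ true) (third (rest# t) (and zq' (not-f (W-out W' wq'))) (and zr (not-f (¬t λ e → WT Wr (cyc xy' yz' zr e)))) (and zq (not-f (E-out l)))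
         (λ e → WT Wr (subst (λ v → y' ⇉ v) e t')) w≢) Wr
  -- `w` and `q'` are the W-continuations of the arcs `x → y` and `y → z`; `q` closes the square
  -- over `z`, `w`, and `v` the one over `q`, `q'`.
  record Frame (x y z : V) : Set where
   field
    {w q q' v} : V
    xy : x ⟶ y
    yz : y ⟶ z
    t1 : x ⇉ z
    yw : y ⟶ w
    Ww : Wb x w ≡ true
    zq : z ⟶ q
    wq : w ⟶ q
    zq' : z ⟶ q'
    Wq' : Wb y q' ≡ true
    qv : q ⟶ v
    qv' : q' ⟶ v
   opaque
    z≢w : z ≢ w
    z≢w e = WT Ww (subst (λ v → x ⇉ v) e t1)
    qx : A q x ≡ false
    qx = W-out Ww wq
    q'x : A q' x ≡ false
    q'x = ¬t λ e → WT Wq' (cyc xy yz zq' e)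
    Tyq : y ⇉ q
    Tyq = twoT yz zq yw wq z≢w
    Tzv : z ⇉ v
    Tzv = twoT zq qv zq' qv' λ e → WT Wq' (subst (λ v → y ⇉ v) e Tyq)
    Wwv : Wb w v ≡ true
    Wwv = cross yz zq yw wq z≢w zq' Wq' qv qv'
    lq : 1 ≤ ⟦ Ee ⟧ x q
    lq = E-in t1 zq qx
    x≢v : x ≢ v
    x≢v e = t≢f (subst (q ⟶_) (sym e) qv) qx
    mids : ∀ {p} → z ⟶ p → p ⟶ v → p ⟶ x → ⊥
    mids zp pv px = t≢f (subst (_⟶ x) (third (sqT Tzv · P2) (and zq qv) (and zp pv) (and zq' qv') (λ { refl → t≢f px qx }) λ e → WT Wq' (subst (λ v → y ⇉ v) e Tyq)) px) q'x
  opaque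
   frame : ∀ {x y z} → x ⟶ y → y ⟶ z → x ⇉ z → Frame x y z
   frame xy yz t = let
       (w , yw , W) = ω xy
       (q , zq , wq) = meet yz yw
       (q' , zq' , W') = ω yz
       (v , qv , qv') = meet zq zq'
    in record { xy = xy ; yz = yz ; t1 = t ; yw = yw ; Ww = W ; zq = zq ; wq = wq ; zq' = zq' ; Wq' = W' ; qv = qv ; qv' = qv' }
  -- The part of W A outside E: row sum 16 less 12.
  Ux : Ex
  Ux = pw _∸_ (Wx ⊗ Ax) Ee
  opaque
   E+U : ∀ x p → ⟦ Ee ⟧ x p + ⟦ Ux ⟧ x p ≡ ⟦ Wx ⊗ Ax ⟧ x p
   E+U x p = m+[n∸m]≡n (go (⟦ Ee ⟧ x p) refl) where
    go : ∀ a → ⟦ Ee ⟧ x p ≡ a → ⟦ Ee ⟧ x p ≤ ⟦ Wx ⊗ Ax ⟧ x p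
    go zero e = eq≤ e » z≤n
    go (suc a) e = let l = ≥1 e in eq≤ (Ee≡ (E-out l) · TA1 l · sym (WA1 l))
   rU : ∀ x → row Ux x ≡ 4
   rU x = +-cancelˡ-≡ 12 _ 4 (cong (_+ row Ux x) (sym (rE x)) · sym (∑-+ _ _) · ∑-cong (E+U x) · rWA x)
   U-E : ∀ {x p} → (1 ≤ ⟦ Ee ⟧ x p → ⊥) → ⟦ Ux ⟧ x p ≡ ⟦ Wx ⊗ Ax ⟧ x p
   U-E {x} {p} h = cong (⟦ Wx ⊗ Ax ⟧ x p ∸_) (n≤0⇒n≡0 (≤-pred (≰⇒> h)))
   RU : ∀ x p → ∃ λ q → R# x p * ⟦ Wx ⊗ Ax ⟧ x p ≡ 4 * q
   RU x p = let (q , e) = RmulA Wx x p in q , cong (R# x p *_) (comm Wx Ax x p) · e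
  D : V → V → Bool
  D = Fb 1
  Dx : Ex
  Dx = Fx 1
  tt₊ : V → V → ℕ
  tt₊ x y = # (λ z → Tb x z ∧ Tb z y)
  opaque
   D12 : ∀ x → # (D x) ≡ 12
   D12 x = F#≡ 1 x · sym (*-identityˡ (F# 1)) · sym (k*m 1) · cong (4 *_) m1
   co⇒D : ∀ {x y} → 1 ≤ co x y → x ≢ y → D x y ≡ true
   co⇒D l ne = Fb-intro (co1 l ne) ne
   tt≡ : ∀ x y → ⟦ Tx ⊗ Tx ⟧ x y ≡ tt₊ x y
   tt≡ x y = cnt (Tb x) (λ z → Tb z y)
   tt-self : ∀ x → tt₊ x x ≡ 6
   tt-self x = (#-cong λ z → iff lftC (λ p → andC p (T-sym p))) · tsize x · t6
   -- Among the four in-neighbours of `p` three lie in T(x) and three in T(v).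
   share : ∀ {p x v} → p ⟶ x → p ⟶ v → 2 ≤ # (λ u → A u p ∧ (Tb x u ∧ Tb u v))
   share {p} {x} {v} px pv = lia≤ (# (S x) ∷ # (S v) ∷ # (λ u → A u p) ∷ # (λ u → S x u ∧ S v u) ∷ # (λ u → A u p ∧ (Tb x u ∧ Tb u v)) ∷ [])
     ((ν0 ≋ κ 3) ∷ (ν1 ≋ κ 3) ∷ (ν2 ≋ κ 4) ∷ (ν0 ⊹ ν1 ≼ ν2 ⊹ ν3) ∷ (ν3 ≼ ν4) ∷ []) (κ 2) ν4
     (three px , three pv , inn p , incl (S x) (S v) (λ u → A u p) (λ u → lft) (λ u → lft) , #-mono λ u f → let a = ∧-fst {S x u} f in and (lft a) (andC (T-sym (rgt a)) (rgt (∧-snd {S x u} f)))) where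
    S : V → V → Bool
    S w u = A u p ∧ Tb u w
    three : ∀ {w} → p ⟶ w → # (S w) ≡ 3
    three {w} q = sym (cnt (λ u → A u p) (λ u → Tb u w)) · comm (tr Ax) Tx p w · cnt (Tb p) (A w) · qT q · Q3
   D⇒tt : ∀ {x v} → D x v ≡ true → 2 ≤ tt₊ x v
   D⇒tt {x} {v} p = let (u , e) = #∃ (eq≥ (sym (co-in x v) · Fb-co p)) in share (lft e) (rgt e) » #-mono λ u → rgt
   -- The row sum of T T is 36, of which 6 sits on the diagonal; a value of 3 on the twelve vertices
   -- of D(x) would need another 36.
   big0 : ∀ x → (∀ {z} → D x z ≡ true → 3 ≤ tt₊ x z) → ⊥
   big0 x h = 1+n≰n {36} (m≤m+n 37 5 » eq≥ (∑-+ _ _ · +≡ (∑-pick x (λ _ → 6)) (∑-*ʳ 3 _ · cong (_* 3) (D12 x))) » (∑-mono λ z → le z (x F.≟ z) (cases (D x z))) » eq≤ ((∑-cong λ y → sym (tt≡ x y)) · row-⊗ Tx Tx x · cong₂ _*_ (tsize x · t6) (tsize x · t6))) where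
    le : ∀ z → Dec (x ≡ z) → Cases (D x z) → β (x == z) * 6 + β (D x z) * 3 ≤ tt₊ x z
    le z (yes refl) _ = eq≤ (cong₂ (λ a b → β a * 6 + β b * 3) (==-refl x) (¬t λ q → Fb-≢ q refl)) » eq≥ (tt-self x)
    le z (no ne) (inj₁ e) = eq≤ (cong₂ (λ a b → β a * 6 + β b * 3) (≢⇒== ne) e) » h e
    le z (no ne) (inj₂ e) = eq≤ (cong₂ (λ a b → β a * 6 + β b * 3) (≢⇒== ne) e) » z≤n
   wD : ∀ {x y} → D x y ≡ true → ∀ {u v} → Rb x y u v ≡ true → D u v ≡ true
   wD p r = 1≤β _ (eq≥ (onR Dx r · cong β p))
   Rtt : ∀ x y → ∃ λ q → R# x y * tt₊ x y ≡ 6 * q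
   Rtt x y = let (q , e) = RmulT Tx x y in q , cong (R# x y *_) (sym (tt≡ x y)) · e · cong (_* q) t6
   R4 : ∀ {x y} → D x y ≡ true → ∃ λ m → R# x y ≡ 4 * m
   R4 {x} {y} p = let (q , e) = RmulA (tr Ax) x y in q , sym (*-identityʳ _) · cong (R# x y *_) (sym (co≡ x y · Fb-co p)) · e
   tt3 : ∀ {x z} → D x z ≡ true → R# x z < 12 → 3 ≤ tt₊ x z
   tt3 {x} {z} q l = let
       (m , e) = R4 q
       (r , f) = Rtt x z in mul12 (R# x z) m r (tt₊ x z) e f (z<s » D⇒tt q) l (R>0 x z)
   Rb⇒# : ∀ {a b u v} → Rb a b u v ≡ true → R# u v ≡ R# a b
   Rb⇒# {a} {b} {u} r = cong₂ (λ i j → # (Cb i j u)) (Cb-fst r) (Cb-snd r) · Rsize a b u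
   -- A class inside D smaller than D would make T² too large on all of D.
   D-single : ∀ {x y} → D x y ≡ true → R# x y ≡ 12
   D-single {x} {y} p = go (12 ≤? R# x y) where
    go : Dec (12 ≤ R# x y) → R# x y ≡ 12
    go (yes l) = ≤-antisym ((#-mono λ z → wD p) » eq≤ (D12 x)) l
    go (no l) = ⊥-elim (big0 x λ {z} q → tt3 q (R12 q (cases (Rb x y x z)))) where
     R12 : ∀ {z} → D x z ≡ true → Cases (Rb x y x z) → R# x z < 12
     R12 q (inj₁ r) = ≤-<-trans (eq≤ (Rb⇒# r)) (≰⇒> l)
     R12 {z} q (inj₂ f) = eq≤ (+-comm 1 (R# x z)) » +-monoʳ-≤ (R# x z) (R>0 x y) » disj2 (Rb x z x) (Rb x y x) (D x) (λ u → wD q) (λ u → wD p) (λ u a b → t≢f (Cb-intro (sym (Cb-fst a) · Cb-fst b) (sym (Cb-snd a) · Cb-snd b)) f) » eq≤ (D12 x)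
   D-class : ∀ {x y u v} → D x y ≡ true → D u v ≡ true → Rb x y u v ≡ true
   D-class {x} {y} {u} p q = #-sub≡ (λ z → wD p) (eq≤ (D12 u · sym (Rsize x y u · D-single p))) _ q
   tt-D : ∀ {x y} → D x y ≡ true → tt₊ x y ≡ 2
   tt-D {x} {y} p = ≤-antisym (≤-pred (≰⇒> λ l → big0 x λ {z} q → l » eq≤ (sym (tt≡ x y) · sym (onR (Tx ⊗ Tx) (D-class p q)) · tt≡ x z))) (D⇒tt p)
   W∩D : ∀ {x w} → Wb x w ≡ true → D x w ≡ true → ⊥
   W∩D {x} p q = lia (R# x _ ∷ # (Wb x) ∷ []) ((ν0 ≋ κ 12) ∷ (ν0 ≋ ν1) ∷ (ν1 ≋ κ 4) ∷ []) (D-single q , cong₂ (λ a b → # (Cb a b x)) (Cb-fst p) (Cb-snd p) , Wsize x · w4)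
   -- Otherwise z would be a third vertex of T(x) ∩ T(v).
   vD : ∀ {x y z} (F : Frame x y z) → D x (Frame.v F) ≡ false
   vD {x} {z = z} F = ¬t λ p → let (i , e) = #∃ (eq≥ (sym (co-in x v) · Fb-co p)) in bad p (lft e) (rgt e) where
    open Frame F
    bad : ∀ {i} → D x v ≡ true → i ⟶ x → i ⟶ v → ⊥
    bad {i} p ix iv = let (a , b , f , g , ab) = pair∃ (share ix iv) in
     1+n≰n (size≥ {P = λ u → Tb x u ∧ Tb u v} (z ∷ a ∷ b ∷ []) ((z≢ f , z≢ g , tt) , (ab , tt) , tt , tt) (andC t1 Tzv , rgt f , rgt g , tt) » eq≤ (tt-D p)) where
     z≢ : ∀ {u} → A u i ∧ (Tb x u ∧ Tb u v) ≡ true → z ≢ u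
     z≢ h refl = mids (lft h) iv ix
  -- T T is 6 on the diagonal and at least 2 on D; the excess V has row sum 6. By `V-size` it fills
  -- a single class, and whether that class is T separates the two final cases.
  Vx : Ex
  Vx = pw _∸_ (Tx ⊗ Tx) (pw (λ i c → 6 * i + 2 * c) 𝟙 Dx)
  opaque
   V+ : ∀ x y → 6 * ⟦ 𝟙 ⟧ x y + 2 * ⟦ Dx ⟧ x y + ⟦ Vx ⟧ x y ≡ ⟦ Tx ⊗ Tx ⟧ x y
   V+ x y = m+[n∸m]≡n (go (x F.≟ y) (cases (D x y)) » eq≥ (tt≡ x y)) where
    go : Dec (x ≡ y) → Cases (D x y) → 6 * ⟦ 𝟙 ⟧ x y + 2 * ⟦ Dx ⟧ x y ≤ tt₊ x y
    go (yes refl) _ = eq≤ (cong₂ (λ a b → 6 * a + 2 * β b) (𝟙-diag x) (¬t λ q → Fb-≢ q refl)) » eq≥ (tt-self x)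
    go (no ne) (inj₁ e) = eq≤ (cong₂ (λ a b → 6 * a + 2 * β b) (𝟙-off ne) e) » D⇒tt e
    go (no ne) (inj₂ e) = eq≤ (cong₂ (λ a b → 6 * a + 2 * β b) (𝟙-off ne) e) » z≤n
   rV : ∀ x → row Vx x ≡ 6
   rV x = +-cancelˡ-≡ 30 _ 6 (cong (_+ row Vx x) (sym (∑-+ _ _ · +≡ (∑-*ˡ 6 (⟦ 𝟙 ⟧ x) · cong (6 *_) ((∑-cong λ y → sym (*-identityʳ _)) · 𝟙⊗ one x x)) (∑-*ˡ 2 (⟦ Dx ⟧ x) · cong (2 *_) (D12 x)))) · sym (∑-+ _ _) · ∑-cong (V+ x) · row-⊗ Tx Tx x · cong₂ _*_ (tsize x · t6) (tsize x · t6))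
   Vtt : ∀ {x y} → x ≢ y → D x y ≡ false → ⟦ Vx ⟧ x y ≡ ⟦ Tx ⊗ Tx ⟧ x y
   Vtt {x} {y} ne f = cong (_+ ⟦ Vx ⟧ x y) (sym (cong₂ (λ a b → 6 * a + 2 * β b) (𝟙-off ne) f)) · V+ x y
   V-ne : ∀ {x y} → 1 ≤ ⟦ Vx ⟧ x y → x ≢ y
   V-ne {x} l refl = lia (⟦ 𝟙 ⟧ x x ∷ ⟦ Dx ⟧ x x ∷ ⟦ Vx ⟧ x x ∷ ⟦ Tx ⊗ Tx ⟧ x x ∷ []) ((6 ⊙ ν0 ⊹ 2 ⊙ ν1 ⊹ ν2 ≋ ν3) ∷ (ν0 ≋ κ 1) ∷ (ν3 ≋ κ 6) ∷ (κ 1 ≼ ν2) ∷ []) (V+ x x , 𝟙-diag x , tt≡ x x · tt-self x , l)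
   V-D : ∀ {x y} → 1 ≤ ⟦ Vx ⟧ x y → D x y ≡ false
   V-D {x} {y} l = ¬t λ p → lia (⟦ 𝟙 ⟧ x y ∷ ⟦ Dx ⟧ x y ∷ ⟦ Vx ⟧ x y ∷ ⟦ Tx ⊗ Tx ⟧ x y ∷ []) ((6 ⊙ ν0 ⊹ 2 ⊙ ν1 ⊹ ν2 ≋ ν3) ∷ (ν1 ≋ κ 1) ∷ (ν3 ≋ κ 2) ∷ (κ 1 ≼ ν2) ∷ []) (V+ x y , cong β p , tt≡ x y · tt-D p , l)
   V≡tt : ∀ {x y} → 1 ≤ ⟦ Vx ⟧ x y → ⟦ Vx ⟧ x y ≡ ⟦ Tx ⊗ Tx ⟧ x y
   V≡tt l = Vtt (V-ne l) (V-D l)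
   V-size : ∀ {x y} → 1 ≤ ⟦ Vx ⟧ x y → R# x y * ⟦ Vx ⟧ x y ≡ 6
   V-size {x} {y} l = let (q , e) = RmulT Tx x y in
    num6q _ q (cong (R# x y *_) (V≡tt l) · e · cong (_* q) t6) (*-pos (R>0 x y) l) (R≤row Vx x y » eq≤ (rV x))
   V-full : ∀ {x y u v} → 1 ≤ ⟦ Vx ⟧ x y → 1 ≤ ⟦ Vx ⟧ u v → Rb x y u v ≡ true
   V-full {x} {y} l l' = R-full Vx x y (eq≤ (rV x · sym (V-size l))) _ _ l'
   V-sym : ∀ {x y} → 1 ≤ ⟦ Vx ⟧ x y → d y x ≡ d x y
   V-sym {x} {y} l = Cb-fst (V-full l (l » eq≤ (V≡tt l · tt≡ x y · (#-cong λ z → iff (λ q → andC (T-sym (rgtC q)) (T-sym (lftC q))) (λ q → andC (T-sym (rgtC q)) (T-sym (lftC q)))) · sym (Vtt (V-ne l ∘ sym) (Fb-sym · V-D l) · tt≡ y x))))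
   Vv : ∀ {x y z} (F : Frame x y z) → 1 ≤ ⟦ Vx ⟧ x (Frame.v F)
   Vv {x} {z = z} F = let open Frame F in ∃# z (andC t1 Tzv) » eq≥ (Vtt x≢v (vD F) · tt≡ x v)
   far : ∀ {x p} → d x p ≡ 3 → A p x ≡ false → 1 ≤ ⟦ Ee ⟧ x p ⊎ (⟦ Ee ⟧ x p ≡ 0 × 1 ≤ ⟦ Ux ⟧ x p)
   far {x} {p} e a = let
       (z , f , zp) = last-step {x} {p} e
       (u , xu , uz) = first-step {x} {z} f
    in go zp xu (d⇒A uz) (cases (Tb x z)) (⟦ Ee ⟧ x p) refl where
    go : ∀ {u z} → z ⟶ p → x ⟶ u → u ⟶ z → Cases (Tb x z) → ∀ m → ⟦ Ee ⟧ x p ≡ m → 1 ≤ ⟦ Ee ⟧ x p ⊎ (⟦ Ee ⟧ x p ≡ 0 × 1 ≤ ⟦ Ux ⟧ x p)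
    go zp xu uz (inj₁ t) _ _ = inj₁ (E-in t zp a)
    go zp xu uz _ (suc m) f = inj₁ (≥1 f)
    go zp xu uz (inj₂ g) zero f = inj₂ (f , ∃# _ (andC (T-or-W xu uz g) zp) » eq≤ (sym (WA≡ x p) · sym (E+U x p) · cong (_+ ⟦ Ux ⟧ x p) f))
   E-d : ∀ {x p} → 1 ≤ ⟦ Ee ⟧ x p → d x p ≡ 3
   E-d {x} {p} l = let (z , e) = #∃ (eq≥ (TA1 l)) in go (lftC e) (rgtC e) (d x p) refl (d-tri x z p » eq≤ (+≡ (Cb-fst (lftC e)) (A⇒d (rgtC e)))) where
    go : ∀ {z} → x ⇉ z → z ⟶ p → ∀ a → d x p ≡ a → a ≤ 3 → d x p ≡ 3
    go t zp 0 e _ = ⊥-elim (0≢1+n (suc-injective (sym (A⇒d (subst (_ ⟶_) (sym (d≡0 e)) zp)) · Cb-snd t)))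
    go t zp 1 e _ = ⊥-elim (T∩D t (∃# p (and (d⇒A e) zp)))
    go t zp 2 e _ = let (u , xu , up) = first-step {x} {p} e in
     ⊥-elim ([ (λ f → lia (R# x p ∷ []) ((ν0 ≋ κ 12) ∷ (ν0 ≋ κ 6) ∷ []) (E12 l , cong₂ (λ a b → # (Cb a b x)) (Cb-fst f) (Cb-snd f) · tsize x · t6))
             , (λ f → let g = T-or-W xu (d⇒A up) f in lia (R# x p ∷ []) ((ν0 ≋ κ 12) ∷ (ν0 ≋ κ 4) ∷ []) (E12 l , cong₂ (λ a b → # (Cb a b x)) (Cb-fst g) (Cb-snd g) · Wsize x · w4)) ]′ (cases (Tb x p)))
    go t zp 3 e _ = e
    go t zp (4+ a) e (≤3+ ())
   F₀ : ∃₂ λ y z → Frame x₀ y z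
   F₀ = let (y , xy , yz) = two T0 in y , y₀ , frame xy yz T0
   sym-d : ∀ {x y} → d y x ≡ d x y → x ≢ y → Tb x y ≡ false → d x y ≤ 4 → (d x y ≡ 3 → ⊥) → d x y ≡ 4
   sym-d {x} {y} e ne nt l h = go (d x y) refl l where
    go : ∀ a → d x y ≡ a → a ≤ 4 → d x y ≡ 4
    go 0 f _ = ⊥-elim (ne (d≡0 f))
    go 1 f _ = ⊥-elim (no2 (d⇒A f) (d⇒A (e · f)))
    go 2 f _ = t≢f (Cb-intro f (e · f)) nt
    go 3 f _ = ⊥-elim (h f)
    go 4 f _ = f
    go (5+ a) f (≤4+ ())
  -- If V avoids T, then both V and D lie at distance (4 , 4), although they are disjoint.
  module Apart (v0 : ⟦ Vx ⟧ x₀ y₀ ≡ 0) where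
   opaque
    notT : ∀ {x y} → 1 ≤ ⟦ Vx ⟧ x y → Tb x y ≡ false
    notT l = ¬t λ q → 1+n≰n (l » eq≤ (on Vx q T0 · v0))
    -- If x were in E(q), the out-neighbours of q would be two in D(x) and two in T(x) or Wᵗ(x), none of which can be v.
    anti : ∀ {x y z} (F : Frame x y z) → d (Frame.q F) x ≡ d x (Frame.q F) → ⊥
    anti {x} {y} F e = let (t , g) = #∃ (eq≥ (TA1 (lq » eq≤ (cl Ee x q q x (sym e) e)))) in start (lftC g) (rgtC g) where
     open Frame F
     Side : V → Set
     Side a = x ⇉ a ⊎ Wb a x ≡ true
     side : ∀ {t a} → t ⟶ x → a ⟶ t → Side a
     side tx at = [ (λ f → inj₁ (T-sym f)) , (λ f → inj₂ (T-or-W at tx f)) ]′ (cases _)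
     sep : ∀ {n a} → D x n ≡ true → Side a → n ≢ a
     sep p (inj₁ f) refl = T∩D f (eq≥ (Fb-co p))
     sep p (inj₂ f) refl = W∩D f (Fb-sym · p)
     nv : Side v → ⊥
     nv (inj₁ f) = t≢f f (notT (Vv F))
     nv (inj₂ f) = 1+n≰n (snd (dW f) » eq≤ (sym (V-sym (Vv F)) · fst (dW f)))
     pick : ∀ {n₁ n₂ a a'} → D x n₁ ≡ true → D x n₂ ≡ true → Side a → Side a' → In v (n₁ ∷ n₂ ∷ a ∷ a' ∷ []) → ⊥
     pick p q _ _ (inj₁ refl) = t≢f p (vD F)
     pick p q _ _ (in1 refl) = t≢f q (vD F)
     pick p q s s' (in2 refl) = nv s
     pick p q s s' (in3 refl) = nv s'
     dn : ∀ {n} → A q n ∧ A n y ≡ true → D x n ≡ true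
     dn j = co⇒D (∃# y (and xy (rgt j))) (λ { refl → t≢f (lft j) qx })
     four : ∀ {n₁ n₂ a a'} → q ⟶ n₁ → q ⟶ n₂ → q ⟶ a → q ⟶ a' → n₁ ≢ n₂ → a ≢ a' → D x n₁ ≡ true → D x n₂ ≡ true → Side a → Side a' → ⊥
     four {n₁} {n₂} {a} {a'} i i' h h' nn na p p' s s' = pick p p' s s' (member {P = A q} (n₁ ∷ n₂ ∷ a ∷ a' ∷ []) ((nn , sep p s , sep p s' , tt) , (sep p' s , sep p' s' , tt) , (na , tt) , tt , tt) (i , i' , h , h' , tt) (eq≤ (out q)) qv)
     start : ∀ {t} → q ⇉ t → t ⟶ x → ⊥
     start tq tx = let
         (a , a' , h , h' , na) = pair∃ (eq≥ (sqT tq · P2))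
         (n₁ , n₂ , i , i' , nn) = pair∃ (eq≥ (sqT (T-sym Tyq) · P2))
      in four (lft i) (lft i') (lft h) (lft h') nn na (dn i) (dn i') (side tx (rgt h)) (side tx (rgt h'))
    noE : ∀ {x p} → 1 ≤ ⟦ Ee ⟧ x p → d p x ≡ d x p → ⊥
    noE l e = let
        (y , z , F) = F₀
        r = E-full l (Frame.lq F)
     in anti F (Cb-snd r · e · sym (Cb-fst r))
    U-fits : ∀ {x p} → d x p ≡ 3 → d p x ≡ d x p → R# x p * ⟦ Wx ⊗ Ax ⟧ x p ≤ 4 × 1 ≤ ⟦ Wx ⊗ Ax ⟧ x p
    U-fits {x} {p} e f = go (far e (¬t λ a → 1+n≰n {1} (≤2+ z≤n » eq≤ (sym e · sym f · A⇒d a)))) where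
     go : 1 ≤ ⟦ Ee ⟧ x p ⊎ (⟦ Ee ⟧ x p ≡ 0 × 1 ≤ ⟦ Ux ⟧ x p) → R# x p * ⟦ Wx ⊗ Ax ⟧ x p ≤ 4 × 1 ≤ ⟦ Wx ⊗ Ax ⟧ x p
     go (inj₁ l) = ⊥-elim (noE l f)
     go (inj₂ (g , l)) = eq≥ (cong (R# x p *_) u) » R≤row Ux x p » eq≤ (rU x) , l » eq≤ u where
      u : ⟦ Ux ⟧ x p ≡ ⟦ Wx ⊗ Ax ⟧ x p
      u = U-E λ h → 1+n≰n (h » eq≤ g)
    D4 : ∀ {x y} → D x y ≡ true → d x y ≡ 4
    D4 {x} {y} p = let (u , e) = #∃ (eq≥ (sym (co-in x y) · Fb-co p)) in
     sym-d sy (Fb-≢ p) (¬t λ q → T∩D q (eq≥ (Fb-co p))) (d-tri x u y » eq≤ (+≡ (ty u x (lft e)) (A⇒d (rgt e)))) bad where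
     sy : d y x ≡ d x y
     sy = Cb-fst (D-class p (Fb-sym · p))
     bad : d x y ≡ 3 → ⊥
     bad e = let (a , b) = U-fits e sy in 1+n≰n {4} (m≤m+n 5 7 » eq≥ (D-single p) » eq≥ (*-identityʳ _) » *-monoʳ-≤ (R# x y) b » a)
    V4 : ∀ {x y z} (F : Frame x y z) → d x (Frame.v F) ≡ 4
    V4 {x} F = sym-d (V-sym l) x≢v (notT l) (d-min (W-cons xy (W-cons yz (W-cons zq (W-cons qv W-nil))))) λ e → let
        (a , b) = U-fits e (V-sym l)
        (q , f) = RU x v
     in num36 (R# x v) (⟦ Vx ⟧ x v) (⟦ Wx ⊗ Ax ⟧ x v) q (V-size l) twice a b f where
     open Frame F
     l : 1 ≤ ⟦ Vx ⟧ x v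
     l = Vv F
     -- Each of the V(x , v) vertices of T(x) ∩ T(v) has two out-neighbours in N⁻(v), and no vertex there has two in-neighbours in T(x).
     twice : 2 * ⟦ Vx ⟧ x v ≤ 4
     twice = eq≤ (cong (2 *_) (V≡tt l) · sym (∑-*ˡ 2 _)) » (∑-mono λ z → le (⟦ Tx ⟧ x z) (cases (Tb z v))) » eq≤ (sym (assoc Tx Ax Ax x v)) » (∑-mono λ p → le' p (cases (A p v))) » eq≤ (inn v) where
      le : ∀ a {z} → Cases (Tb z v) → 2 * (a * ⟦ Tx ⟧ z v) ≤ a * ⟦ Ax ⊗ Ax ⟧ z v
      le a {z} (inj₁ f) = eq≤ (cong (λ b → 2 * (a * β b)) f · lem a · cong (a *_) (sym (sq≡ z v · sqT f · P2))) where
       lem : ∀ a → 2 * (a * 1) ≡ a * 2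
       lem = solve-∀
      le a (inj₂ f) = eq≤ (cong (λ b → 2 * (a * β b)) f · cong (2 *_) (*-zeroʳ a)) » z≤n
      le' : ∀ p → Cases (A p v) → ⟦ Tx ⊗ Ax ⟧ x p * β (A p v) ≤ β (A p v)
      le' p (inj₂ f) = eq≤ (cong (λ b → ⟦ Tx ⊗ Ax ⟧ x p * β b) f · *-zeroʳ (⟦ Tx ⊗ Ax ⟧ x p)) » z≤n
      le' p (inj₁ f) = *-monoˡ-≤ (β (A p v)) (eq≤ (TA≡ x p) » (#≤1 λ a b → E! (¬t λ px → t≢f (co⇒D (∃# p (and px f) » eq≥ (co-in x v)) x≢v) (vD F)) (lftC a) (rgtC a) (lftC b) (rgtC b))) » eq≤ (*-identityˡ _)
   absurd : ⊥
   absurd = let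
       (y , z , F) = F₀
       open Frame F
       (n₁ , p) = #∃ {P = D x₀} (≥1 (D12 x₀))
       l = Vv F
    in 1+n≰n (l » eq≤ (cl Vx x₀ v x₀ n₁ (V4 F · sym (D4 p)) (V-sym l · V4 F · sym (D4 (Fb-sym · p))) · n≤0⇒n≡0 (≤-pred (≰⇒> λ h → t≢f p (V-D h)))))
  -- If V is T, then U is a thin involution at distance (3 , 3), which is the place of E.
  module Within (v1 : 1 ≤ ⟦ Vx ⟧ x₀ y₀) where
   opaque
    Tv : ∀ {x y z} (F : Frame x y z) → Tb x (Frame.v F) ≡ true
    Tv F = let r = V-full v1 (Vv F) in Cb-intro (Cb-fst r · Cb-fst T0) (Cb-snd r · Cb-snd T0)
    v-out : ∀ {x y z u} (F : Frame x y z) → u ⟶ x → Wb u y ≡ true → Frame.v F ⟶ u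
    v-out F ux uy = let open Frame F in compl (Tv F) xy ux uy (¬t λ yv → T-sib Tzv yz yv)
    three : ∀ {x y w u} → x ⟶ y → y ⟶ w → Wb x w ≡ true → u ⟶ x → Wb u y ≡ true → 3 ≤ # (λ c → Wb w c ∧ A c u)
    three {x} {y} xy yw W ux uy = let
        (f , h , i , _) = enum≡ (λ z → Tb x z ∧ A y z) (qT xy · Q3)
        F = λ j → frame xy (rgtC (h j)) (lftC (h j))
        w≡ = λ j → ω! xy (Frame.yw (F j)) (Frame.Ww (F j)) yw W
     in inj≤# (λ j → Frame.v (F j)) (λ j l e → i j l (let
          q≡ = mid! (Frame.Wwv (F j)) (Frame.wq (F j)) (Frame.qv (F j)) (subst (_⟶ Frame.q (F l)) (w≡ l · sym (w≡ j)) (Frame.wq (F l))) (subst (Frame.q (F l) ⟶_) (sym e) (Frame.qv (F l)))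
          in E! (Frame.qx (F j)) (lftC (h j)) (Frame.zq (F j)) (lftC (h l)) (subst (f l ⟶_) (sym q≡) (Frame.zq (F l)))))
        λ j → andC (subst (λ c → Wb c (Frame.v (F j)) ≡ true) (w≡ j) (Frame.Wwv (F j))) (v-out (F j) ux uy)
    -- By `three` the entry of W A is at least 3, so the pair is outside E; class size times entry
    -- is a multiple of 4 and at most the row sum 4 of U.
    thin : ∀ {x y w u} → x ⟶ y → y ⟶ w → Wb x w ≡ true → u ⟶ x → Wb u y ≡ true → R# w u ≡ 1 × ⟦ Wx ⊗ Ax ⟧ w u ≡ 4 × ⟦ Ux ⟧ w u ≡ 4
    thin {w = w} {u} xy yw W ux uy = let
        l = three xy yw W ux uy » eq≥ (WA≡ w u)
        u≡ = U-E λ h → 1+n≰n (≤2+ z≤n » l » eq≤ (WA1 h))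
        (q , e) = RU w u
        (a , b) = num _ _ q (R>0 w u) l e (eq≥ (cong (R# w u *_) u≡) » R≤row Ux w u » eq≤ (rU w))
     in a , b , u≡ · b where
     num : ∀ r c q → 1 ≤ r → 3 ≤ c → r * c ≡ 4 * q → r * c ≤ 4 → r ≡ 1 × c ≡ 4
     num 1 3 0 _ _ () _
     num 1 3 (suc q) _ _ e _ = lia (q ∷ []) ((κ 3 ≋ 4 ⊙ (κ 1 ⊹ ν0)) ∷ []) e
     num 1 4 q _ _ _ _ = refl , refl
     num 1 (5+ c) q _ _ _ (≤4+ ())
     num 1 1 _ _ (s≤s ()) _ _
     num 1 2 _ _ (≤2+ ()) _ _
     num (2+ r) c q _ l e h = lia (c ∷ r * c ∷ []) ((κ 3 ≼ ν0) ∷ (ν0 ⊹ (ν0 ⊹ ν1) ≼ κ 4) ∷ []) (l , h)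
   absurd : ⊥
   absurd = let
       (y , z , F) = F₀
       open Frame F
       (u , ux , uy) = α xy
       (y' , xy' , _ , ny) = other {y = y} t1
       (w' , yw' , W') = ω xy'
       (u' , ux' , uy') = α xy'
       (R1 , WA4 , U4) = thin xy yw Ww ux uy
       (_ , _ , U4') = thin xy' yw' W' ux' uy'
       full : ∀ {a b} → 1 ≤ ⟦ Ux ⟧ a b → Rb w u a b ≡ true
       full = R-full Ux w u (eq≤ (rU w · sym (cong₂ _*_ R1 U4))) _ _
       (t , r) = #∃ {P = Rb w u x₀} (eq≥ (Rsize w u x₀ · R1))
       into : ∀ {c} → Wb x₀ c ≡ true → c ⟶ t
       into = λ Wc → rgtC (#-sub≡ (λ _ → lftC) (eq≤ (Wsize x₀ · w4 · sym (sym (WA≡ x₀ t) · onR (Wx ⊗ Ax) r · WA4))) _ Wc)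
       back : ∀ {w u} → ⟦ Ux ⟧ w u ≡ 4 → u ⟶ x₀ → ∃ λ c → w ⟶ c × 1 ≤ ⟦ Ux ⟧ c x₀
       back = λ {w} {u} e ux → let (c , a , b) = factor∃ Ax Ux w x₀ (*-pos (≥1 e) (eq≥ (cong β ux)) » factor≤ Ux Ax w u x₀ » eq≤ (comm Ux Ax w x₀)) in c , 1≤β _ a , b
       (c , wc , Uc) = back U4 ux
       (c' , wc' , Uc') = back U4' ux'
       c≡ : c ≡ c'
       c≡ = unique {P = λ c → Rb w u c x₀} (row-tr (Rx w u) x₀ · Rsize w u x₀ · R1) (full Uc) (full Uc')
       w≢ = λ e → ny (sym (mid! Ww xy yw xy' (subst (y' ⟶_) (sym e) yw')))
       c≡t = out! w≢ wc (subst (w' ⟶_) (sym c≡) wc') (into Ww) (into W')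
       r' = full (subst (λ v → 1 ≤ ⟦ Ux ⟧ v x₀) c≡t Uc)
    in fin F t (Cb-fst r' · sym (Cb-fst r)) (d-min (W-cons xy (W-cons yw (W-cons (into Ww) W-nil)))) (Rb⇒# r · R1) (into Ww) (d-min (W-cons qv (W-cons (v-out F ux uy) (W-cons ux W-nil)))) where
    fin : ∀ {y z} (F : Frame x₀ y z) t → d t x₀ ≡ d x₀ t → d x₀ t ≤ 3 → R# x₀ t ≡ 1 → Frame.w F ⟶ t → d (Frame.q F) x₀ ≤ 3 → ⊥
    fin F t e l R1 wt l' = go (d x₀ t) refl l where
     open Frame F
     dq : ∀ a → d q x₀ ≡ a → a ≤ 3 → d q x₀ ≡ 3
     dq 0 f _ = ⊥-elim (0≢1+n (sym (d-refl x₀) · cong (d x₀) (sym (d≡0 f)) · E-d lq))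
     dq 1 f _ = t≢f (d⇒A f) qx
     dq 2 f _ = let (m , qm , mx) = first-step {q} {x₀} f in
      ⊥-elim ([ (λ g → 1+n≢n (sym (E-d lq) · Cb-fst (T-sym g))) , (λ g → let W = T-or-W qm (d⇒A mx) g in
        1+n≰n {4} (m≤m+n 5 7 » eq≥ (E12 lq) » (#-mono λ p r → Cb-intro (Cb-snd r · Cb-fst W) (Cb-fst r · Cb-snd W)) » eq≤ (Wcol x₀ · w4))) ]′ (cases (Tb q x₀)))
     dq 3 f _ = f
     dq (4+ a) f (≤3+ ())
     go : ∀ a → d x₀ t ≡ a → a ≤ 3 → ⊥
     go 0 f _ = t≢f (subst (w ⟶_) (sym (d≡0 f)) wt) (¬t λ a → 1+n≰n {1} (≤2+ z≤n » snd (dW Ww) » eq≤ (A⇒d a)))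
     go 1 f _ = no2 (d⇒A f) (d⇒A (e · f))
     go 2 f _ = lia (R# x₀ t ∷ []) ((ν0 ≋ κ 1) ∷ (ν0 ≋ κ 6) ∷ []) (R1 , cong₂ (λ a b → # (Cb a b x₀)) f (e · f) · tsize x₀ · t6)
     go 3 f _ = lia (R# x₀ t ∷ []) ((ν0 ≋ κ 1) ∷ (ν0 ≋ κ 12) ∷ []) (R1 , cong₂ (λ a b → # (Cb a b x₀)) (f · sym (E-d lq)) (e · f · sym (dq (d q x₀) refl l')) · E12 lq)
     go (4+ a) f (≤3+ ())
  absurd : ⊥
  absurd = go (⟦ Vx ⟧ x₀ y₀) refl where
   go : ∀ a → ⟦ Vx ⟧ x₀ y₀ ≡ a → ⊥
   go zero e = Apart.absurd e
   go (suc a) e = Within.absurd (≥1 e)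

-- Girth three

module Girth3 {n : ℕ} {A : Rel n} {k : ℕ} (H : Hyp A k 0) where
 open Theory H
 toT : ∀ {x y} → x ⟶ y → y ⇉ x
 toT {x} {y} p = Cb-intro (ty x y p) (A⇒d p)
 tri : ∀ {x y} → x ⟶ y → # (λ z → A y z ∧ A z x) ≡ P
 tri p = sqT (toT p)
 a# : ℕ
 a# = co ax ay
 coA : ∀ {x y} → x ⟶ y → co x y ≡ a#
 coA {x} {y} p = sym (co≡ x y) · onA C p axy · co≡ _ _
 opaque
  -- `adj` equates the inner products of A with A A and with A Aᵗ, and all these factors are
  -- constant on arcs.
  sqA : ∀ {x y} → x ⟶ y → sq x y ≡ a#
  sqA {x} {y} p = *-cancelˡ-≡ (sq x y) a# k {{>-nonZero k>0}} (begin
   k * sq x y ≡⟨ cong (_* sq x y) (out x) ⟨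
   # (A x) * sq x y ≡⟨ wsum (A x) _ (sq x y) (λ z q → onA (Ax ⊗ Ax) q p · sq≡ x y) ⟨
   ⟨ Ax , Ax ⊗ Ax ⟩ x ≡⟨ adj Ax Ax Ax x ⟩
   ⟨ C , Ax ⟩ x ≡⟨ ip-comm C Ax x ⟩
   ⟨ Ax , C ⟩ x ≡⟨ wsum (A x) _ a# (λ z q → co≡ x z · coA q) ⟩
   # (A x) * a# ≡⟨ cong (_* a#) (out x) ⟩
   k * a# ∎)
   where open ≡-Reasoning
  odd# : ∀ {x y} → x ⟶ y → P + # (λ z → A y z ∧ not (A z x)) ≡ k
  odd# {x} {y} p = cong (_+ # (λ z → A y z ∧ not (A z x))) (sym (tri p)) · sym (#-split (A y) (λ z → A z x)) · out y
  a≤ : P + a# ≤ k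
  a≤ = let (x , y , p) = arc0 in +-monoʳ-≤ P (#-mono λ z q → and (rgt q) (not-f (¬t λ r → no2 r (lft q)))) » eq≤ (odd# p)
  sib≥ : ∀ {x y y'} → x ⟶ y → x ⟶ y' → P + P ≤ k + # (λ z → (A y z ∧ A z x) ∧ (A y' z ∧ A z x))
  sib≥ {x} {y} {y'} p q = eq≥ (+≡ (tri p) (tri q)) » incl (λ z → A y z ∧ A z x) (λ z → A y' z ∧ A z x) (λ z → A z x) (λ z → rgt) (λ z → rgt) » +-monoˡ-≤ _ (eq≤ (inn x))
  sib≥co : ∀ {x y y'} → x ⟶ y → x ⟶ y' → P + P ≤ k + co y y'
  sib≥co {x} {y} p q = sib≥ p q » +-monoʳ-≤ k (#-mono λ z e → and (lft (∧-fst {A y z ∧ A z x} e)) (lft (∧-snd {A y z ∧ A z x} e)))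
  sib≤3 : ∀ {x y y'} → x ⟶ y → x ⟶ y' → d y y' ≤ 3
  sib≤3 {x} {y} {y'} p q = d-tri y x y' » eq≤ (+≡ (ty x y p) (A⇒d q))
  parent : ∀ {y y'} → 1 ≤ co y y' → ∃ λ x → x ⟶ y × x ⟶ y'
  parent {y} {y'} l = let (x , e) = #∃ (l » eq≤ (co-in y y')) in x , lft e , rgt e
  reachW : ∀ {X : Set} (f : X → V) → (∀ p v → f p ⟶ v → ∃ λ q → f q ≡ v) → ∀ m p {v} → W m (f p) v → ∃ λ q → f q ≡ v
  reachW f cl zero p w = p , W-nil⁻¹ w
  reachW f cl (suc m) p {v} w = let
      (u , r , w') = W-uncons w
      (q , e) = cl p u r
   in reachW f cl m q (subst (λ z → W m z v) (sym e) w')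
 -- By strong connectivity an image closed under out-neighbours is everything, so the number of
 -- vertices never has to be computed.
 isoFrom : ∀ {X : Set} (R : X → X → Bool) (f : X → V) → X → (∀ p q → A (f p) (f q) ≡ R p q) → (∀ {p q} → f p ≡ f q → p ≡ q) →
           (∀ p v → f p ⟶ v → ∃ λ q → f q ≡ v) → IsomorphicTo A X R
 isoFrom {X} R f p₀ ad inj-Sets cl = mkBij g (λ {x} {y} e → sym (fg x) · cong f e · fg y) (λ p → f p , inj-Sets (fg (f p))) , λ x y → sym (cong₂ A (fg x) (fg y)) · ad (g x) (g y) where
  g : V → X
  g v = fst (reachW f cl (d (f p₀) v) p₀ (d-walk (f p₀) v))
  fg : ∀ v → f (g v) ≡ v
  fg v = snd (reachW f cl (d (f p₀) v) p₀ (d-walk (f p₀) v))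
 -- The images of distinct labels joined by a path of length at most two cannot be twins, so the arcs alone determine the blow-up.
 isoTable : ∀ {m l} c (R : Fin (c * m) → Fin (c * m) → Bool) (o : Fin m → Vec (Fin m) l) (f : Fin m → V) (t : Fin c → V → V) → Table c R o → c * l ≡ k → Fin (c * m) →
            (∀ i v → co v (t i v) ≡ k) → (∀ i j v → t i v ≡ t j v → i ≡ j) → (∀ p i → f p ⟶ f (lookup (o p) i)) → IsomorphicTo A (Fin (c * m)) R
 isoTable {m} {l} c R o f t (od , jn , rq) cl p₀ tk tj arcs = isoFrom R (F ∘ remQuot m) p₀ ad (λ {p} {q} e → sym (combine-remQuot {c} m p) · cong (uncurry F.combine) (F-inj e) · combine-remQuot {c} m q)
   (λ p v a → let (s , e) = cov (remQuot {c} m p) v a in F.combine (fst s) (lookup (o _) (snd s)) , cong F (remQuot-combine (fst s) (lookup (o _) (snd s))) · e) where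
  F : Fin c × Fin m → V
  F (i , a) = t i (f a)
  up1 : ∀ i {v z} → v ⟶ z → t i v ⟶ z
  up1 i {v} = twin-out (tk i v)
  dn : ∀ i {v z} → t i v ⟶ z → v ⟶ z
  dn i {v} = twin-out (co-sym _ v · tk i v)
  far : ∀ {a b} → Joined o a b → (∀ {z} → f a ⟶ z → f b ⟶ z) → ⊥
  far {a} (inj₁ (i , refl)) h = A-irr (h (arcs a i)) refl
  far {a} (inj₂ (i , j , refl)) h = no2 (h (arcs a i)) (arcs (lookup (o a) i) j)
  F-inj : ∀ {p q} → F p ≡ F q → p ≡ q
  F-inj {i , a} {j , b} e = go (jn a b) where
   go : a ≡ b ⊎ Joined o a b ⊎ Joined o b a → (i , a) ≡ (j , b)
   go (inj₁ refl) = cong (_, a) (tj i j (f a) e)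
   go (in1 r) = ⊥-elim (far r (λ q → dn j (subst (_⟶ _) e (up1 i q))))
   go (inj₂ (inj₂ r)) = ⊥-elim (far r (λ q → dn i (subst (_⟶ _) (sym e) (up1 j q))))
  cov : ∀ p v → F p ⟶ v → ∃ λ s → F (fst s , lookup (o (snd p)) (snd s)) ≡ v
  cov (i , a) v r = let
      (s , e) = covers {P = A (f a)} (G ∘ remQuot l) (λ p q e → sym (combine-remQuot {c} l p) · cong (uncurry F.combine) (G-inj e) · combine-remQuot {c} l q) (λ s → twin-in (tk (fst (remQuot {c} l s)) _) (arcs a (snd (remQuot {c} l s)))) (eq≤ (out (f a) · sym cl)) v (dn i r)
   in remQuot {c} l s , e where
   G : Fin c × Fin l → V
   G (j , s) = F (j , lookup (o a) s)
   G-inj : ∀ {p q} → G p ≡ G q → p ≡ q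
   G-inj {j , s} {j' , s'} e = let (e₁ , e₂) = ,-injective (F-inj e) in cong₂ _,_ e₁ (od a s s' e₂)
  ad : ∀ p q → A (F (remQuot {c} m p)) (F (remQuot {c} m q)) ≡ R p q
  ad p q = go (remQuot {c} m p) (remQuot {c} m q) · sym (rq p q) where
   yes⇒ : ∀ {X : Set} (x? : Dec X) → does x? ≡ true → X
   yes⇒ (yes x) _ = x
   go : ∀ p q → A (F p) (F q) ≡ does (any? λ i → lookup (o (snd p)) i F.≟ snd q)
   go p@(i , a) q@(j , b) = iff (λ r → let (s , e) = cov p (F q) r in dec-true (any? _) (snd s , snd (,-injective (F-inj e))))
    (λ r → let (s , e) = yes⇒ (any? (λ i → lookup (o a) i F.≟ b)) r in up1 i (twin-in (tk j (f b)) (subst (λ b → f a ⟶ f b) e (arcs a s))))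

 -- `P = k − 1`: the digraph (iv)

 module OneShort (P1 : suc P ≡ k) where
  opaque
   co≥ : ∀ {x y y'} → x ⟶ y → x ⟶ y' → k ≤ 2 + co y y'
   co≥ {x} {y} {y'} p q = lia≤ (P ∷ k ∷ co y y' ∷ []) ((κ 1 ⊹ ν0 ≋ ν1) ∷ (ν0 ⊹ ν0 ≼ ν1 ⊹ ν2) ∷ []) ν1 (κ 2 ⊹ ν2) (P1 , sib≥co p q)
   a0' : a# ≡ 0
   a0' = go a# refl where
    go : ∀ a → a# ≡ a → a# ≡ 0
    go zero e = e
    go (suc a) e = ⊥-elim (
     let (x , y , p) = arc0
         (z , q) = #∃ (≥1 e)
     in lia (P ∷ k ∷ a# ∷ co y z ∷ []) ((κ 1 ⊹ ν0 ≋ ν1) ∷ (ν0 ⊹ ν2 ≼ ν1) ∷ (ν1 ≼ κ 2 ⊹ ν3) ∷ (ν3 ≋ ν2) ∷ (κ 4 ≼ ν1) ∷ []) (P1 , a≤ , co≥ p (lft q) , coA (rgt q) , k>3))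
   a0 : ∀ {x y z} → x ⟶ y → y ⟶ z → x ⟶ z → ⊥
   a0 {x} {y} {z} p q r = 1+n≰n (∃# z (and r q) » eq≤ (coA p · a0'))
   odd1 : ∀ {x y} → x ⟶ y → # (λ z → A y z ∧ not (A z x)) ≡ 1
   odd1 p = +-cancelˡ-≡ P _ 1 (odd# p · sym P1 · +-comm 1 P)
   -- If `y → z → y'`, the `P` vertices between `y'` and `z` and the common out-neighbours of `y`
   -- and `y'`, at least k - 2, are disjoint among the out-neighbours of `y'`: too many for `k > 3`.
   sib-d : ∀ {x y y'} → x ⟶ y → x ⟶ y' → y ≢ y' → d y y' ≡ 3
   sib-d {x} {y} {y'} p q ne = go (d y y') refl (sib≤3 p q) where
    go : ∀ e → d y y' ≡ e → e ≤ 3 → d y y' ≡ 3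
    go 0 e _ = ⊥-elim (ne (d≡0 e))
    go 1 e _ = ⊥-elim (a0 p (d⇒A e) q)
    go 2 e _ = let (z , r , s) = first-step {y} {y'} e in
     lia (P ∷ k ∷ co y' y ∷ # (λ u → A y' u ∧ A u z) ∷ # (A y') ∷ # (λ u → (A y' u ∧ A u z) ∧ (A y' u ∧ A y u)) ∷ [])
      ((κ 1 ⊹ ν0 ≋ ν1) ∷ (ν1 ≼ κ 2 ⊹ ν2) ∷ (ν3 ≋ ν0) ∷ (ν4 ≋ ν1) ∷ (ν3 ⊹ ν2 ≼ ν4 ⊹ ν5) ∷ (ν5 ≋ κ 0) ∷ (κ 4 ≼ ν1) ∷ [])
      (P1 , co≥ q p , tri (d⇒A s) , out y' , incl (λ u → A y' u ∧ A u z) (λ u → A y' u ∧ A y u) (A y') (λ u → lft) (λ u → lft) , none r , k>3) where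
     none : ∀ {z} → y ⟶ z → # (λ u → (A y' u ∧ A u z) ∧ (A y' u ∧ A y u)) ≡ 0
     none {z} r = n≤0⇒n≡0 (≤-pred (≰⇒> λ l → let (u , f) = #∃ l in
      a0 (rgt (∧-snd {A y' u ∧ A u z} f)) (rgt (∧-fst {A y' u ∧ A u z} f)) r))
    go 3 e _ = e
    go (4+ _) e (≤3+ ())
   sib-const : ∀ {x y w x' y' w'} → x ⟶ y → x ⟶ w → y ≢ w → x' ⟶ y' → x' ⟶ w' → y' ≢ w' → co y w ≡ co y' w'
   sib-const {x} {y} {w} {x'} {y'} {w'} p q ne p' q' ne' = co-cl (sib-d p q ne · sym (sib-d p' q' ne')) (sib-d q p (ne ∘ sym) · sym (sib-d q' p' (ne' ∘ sym)))
   oddw : ∀ {x y} → x ⟶ y → ∃ λ w → y ⟶ w × A w x ≡ false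
   oddw p = let (w , e) = #∃ (eq≥ (odd1 p)) in w , lft e , not-t (rgt e)
   odd-uniq : ∀ {x y w w'} → x ⟶ y → y ⟶ w → A w x ≡ false → y ⟶ w' → A w' x ≡ false → w ≡ w'
   odd-uniq p q r q' r' = unique (odd1 p) (and q (not-f r)) (and q' (not-f r'))
   sib∃ : ∀ {x y} → x ⟶ y → ∃ λ y' → x ⟶ y' × y' ≢ y
   sib∃ {x} p = let (y' , e) = #∃ (≤-pred (≤2+ z≤n » k>3 » eq≥ (Sib# p))) in y' , lft e , Sib-≢ {x} e
  x₁ y₁ y₂ w₁ : V
  x₁ = ax
  y₁ = ay
  y₂ = fst (sib∃ axy)
  w₁ = fst (oddw axy)
  c# s# : ℕ
  c# = co y₁ y₂
  s# = sq x₁ w₁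
  opaque
   sib-c : ∀ {x y y'} → x ⟶ y → x ⟶ y' → y ≢ y' → co y y' ≡ c#
   sib-c p q ne = sib-const p q ne axy (fst (snd (sib∃ axy))) (snd (snd (sib∃ axy)) ∘ sym)
   paths : ∀ {x y w} → x ⟶ y → y ⟶ w → A w x ≡ false → ∑ (λ z → β (A y z) * sq x z) ≡ P * P + sq x w
   paths {x} {y} {w} p q r = begin
    ∑ (λ z → β (A y z) * sq x z)
     ≡⟨ (∑-cong λ z → β-split (A y z) (A z x) (sq x z)) · (∑-+ _ _) ⟩
    ∑ (λ z → β (A y z ∧ A z x) * sq x z) + ∑ (λ z → β (A y z ∧ not (A z x)) * sq x z)
     ≡⟨ +≡ (wsum (λ z → A y z ∧ A z x) (sq x) P (λ z e → tri (rgt e)) · cong (_* P) (tri p))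
                  (wsum (λ z → A y z ∧ not (A z x)) (sq x) (sq x w) (λ z e → cong (sq x) (odd-uniq p (lft e) (not-t (rgt e)) q r)) · cong (_* sq x w) (odd1 p) · +-identityʳ _) ⟩
    P * P + sq x w ∎ where
    open ≡-Reasoning
   sums : ∀ {x y w} → x ⟶ y → y ⟶ w → A w x ≡ false → k + P * c# ≡ P * P + sq x w
   sums {x} {y} p q r = trans (+≡ (sym (co-self y)) (sym (wsum (Sib x y) (λ y' → co y' y) c# (λ y' e → sib-c (lft e) p (Sib-≢ {x} e)) · cong (_* c#) (suc-injective (Sib# p · sym P1)))))
    (sym (self-split p (λ y' → co y' y)) · twoPaths x y · paths p q r)
   outcome : (∀ x y w → x ⟶ y → y ⟶ w → A w x ≡ false → sq x w ≡ 1) × c# ≡ k ∸ 2 ⊎ (∀ x y w → x ⟶ y → y ⟶ w → A w x ≡ false → sq x w ≡ k) × c# ≡ k ∸ 1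
   outcome = [ (λ (e , f) → inj₁ ((λ x y w p q r → sqc p q r · e) , f)) , (λ (e , f) → inj₂ ((λ x y w p q r → sqc p q r · e) , f)) ]′
    (last1 k s# c# (≤2+ z≤n » k>3) (subst (λ u → k + u * c# ≡ u * u + s#) (cong (_∸ 1) P1) (sums p₁ q1 r1)) (∃# y₁ (and p₁ q1))
     ((#-mono λ z → lft) » eq≤ (out x₁)) (m≤n+o⇒m∸n≤o k 2 (co≥ p₁ (fst (snd (sib∃ p₁)))))) where
    p₁ : x₁ ⟶ y₁
    p₁ = axy
    q1 : y₁ ⟶ w₁
    q1 = fst (snd (oddw p₁))
    r1 : A w₁ x₁ ≡ false
    r1 = snd (snd (oddw p₁))
    sqc : ∀ {x y w} → x ⟶ y → y ⟶ w → A w x ≡ false → sq x w ≡ s#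
    sqc p q r = +-cancelˡ-≡ (P * P) _ _ (sym (sums p q r) · sums p₁ q1 r1)
  module Anti (s1 : ∀ {x y w} → x ⟶ y → y ⟶ w → A w x ≡ false → sq x w ≡ 1) (c2 : c# ≡ k ∸ 2) where
   opaque
    mc : m# c# ≡ P
    mc = let (x , y , p) = arc0 in sym (m≡ c# p) · ((#-cong λ y' → iff (λ e → Sib-intro (lft e) (Fb-≢ (rgt e)))
           (λ e → and (lft e) (Fb-intro (sib-c (lft e) p (Sib-≢ {x} e)) (Sib-≢ {x} e)))) · suc-injective (Sib# p · sym P1))
    k≡4 : k ≡ 4
    k≡4 = sym e₁ · cong (2 +_) (div2 (k ∸ 2) (F# c#) (≤2+ z≤n » ∸-monoˡ-≤ 2 k>3) e₂) where
     e₁ : 2 + (k ∸ 2) ≡ k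
     e₁ = m+[n∸m]≡n (≤2+ z≤n » k>3)
     lem : ∀ p → (2 + p) * (1 + p) ≡ 2 + (3 + p) * p
     lem = solve-∀
     e₂ : F# c# * (k ∸ 2) ≡ 2 + (3 + (k ∸ 2)) * (k ∸ 2)
     e₂ = cong (F# c# *_) (sym c2) · *-comm (F# c#) c# · sym (k*m c#) · (cong₂ _*_ (sym e₁) (mc · suc-injective (P1 · sym e₁))) · lem (k ∸ 2)
    P3 : P ≡ 3
    P3 = suc-injective (P1 · k≡4)
    c≡2 : c# ≡ 2
    c≡2 = c2 · cong (_∸ 2) k≡4
   D : V → V → Bool
   D = Fb 2
   opaque
    toD : ∀ {x y y'} → x ⟶ y → x ⟶ y' → y ≢ y' → D y y' ≡ true
    toD p q ne = Fb-intro (sib-c p q ne · c≡2) ne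
    toD' : ∀ {y v u} → y ⟶ u → v ⟶ u → y ≢ v → D y v ≡ true
    toD' {y} {v} {u} p q ne = let (x , a , b) = parent (∃# u (and p q)) in toD a b ne
    D-d : ∀ {x y} → D x y ≡ true → d x y ≡ 3
    D-d p = let (z , a , b) = parent (≥1 (Fb-co p)) in sib-d a b (Fb-≢ p)
    ahead : ∀ {y u w v} → y ⟶ u → u ⟶ w → A w y ≡ false → v ⟶ u → y ≢ v → w ⟶ v
    ahead {y} {u} {w} {v} p q r s ne = elimʳ (λ f → ne (unique (#-rest (λ z → A z u) (A w) (inn u · k≡4) ((#-cong λ z → ∧-comm (A z u) (A w z)) · tri q · P3)) (and p (not-f r)) (and s (not-f f)))) (cases (A w v))
    w-≢ : ∀ {y u u' w w'} → y ⟶ u → u ⟶ w → A w y ≡ false → y ⟶ u' → u' ⟶ w' → u ≢ u' → w ≢ w'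
    w-≢ p q r p' q' ne refl = ne (unique (s1 p q r) (and p q) (and p' q'))
    -- Otherwise t has three in-neighbours of the form w besides its two in-neighbours in N⁻(y).
    over : ∀ {y u u' w w' t} → y ⟶ u → u ⟶ w → A w y ≡ false → y ⟶ u' → u' ⟶ w' → A w' y ≡ false → u ≢ u' → t ⟶ u → w' ⟶ t → y ≢ t → t ⟶ u'
    over {y} {u} {u'} {w} {w'} {t} yu uw wy yu' uw' wy' ne tu wt' nt = let
        (u1 , a , n₁ , _) = fresh (u ∷ []) (eq≥ (Fb-co (toD' yu tu nt)))
        (w₁ , uw₁ , wy1) = oddw (lft a)
        (z , z' , b , b' , nz) = pair∃ (eq≥ (sym (co-in y t) · Fb-co (toD' yu tu nt)))
     in go (lft a) (rgt a) (n₁ ∘ sym) uw₁ wy1 (lft b) (rgt b) (lft b') (rgt b') nz (u1 F.≟ u') where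
     go : ∀ {u1 w₁ z z'} → y ⟶ u1 → t ⟶ u1 → u ≢ u1 → u1 ⟶ w₁ → A w₁ y ≡ false → z ⟶ y → z ⟶ t → z' ⟶ y → z' ⟶ t → z ≢ z' → Dec (u1 ≡ u') → t ⟶ u'
     go a b n uw₁ wy1 zy zt zy' zt' nz (yes refl) = b
     go {u1} {w₁} {z} {z'} a b n uw₁ wy1 zy zt zy' zt' nz (no m) = ⊥-elim (1+n≰n (size≥ {P = λ v → A v t} (w ∷ w₁ ∷ w' ∷ z ∷ z' ∷ [])
       ((w-≢ yu uw wy a uw₁ n , w-≢ yu uw wy yu' uw' ne , off wy zy , off wy zy' , tt) , (w-≢ a uw₁ wy1 yu' uw' m , off wy1 zy , off wy1 zy' , tt) , (off wy' zy , off wy' zy' , tt) , (nz , tt) , tt , tt)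
       (ahead yu uw wy tu nt , ahead a uw₁ wy1 b nt , wt' , zt , zt' , tt) » eq≤ (inn t · k≡4))) where
      off : ∀ {v z} → A v y ≡ false → z ⟶ y → v ≢ z
      off f r refl = t≢f r f
    Ch : V → V → V → V → Set
    Ch y u w e = y ⟶ u × u ⟶ w × A w y ≡ false × w ⟶ e × A e u ≡ false
    chain : ∀ {y u} → y ⟶ u → ∃₂ λ w e → Ch y u w e
    chain yu = let
        (w , uw , wy) = oddw yu
        (e , we , eu) = oddw uw
     in w , e , yu , uw , wy , we , eu
    ch-≢ : ∀ {y u w e} → Ch y u w e → y ≢ e
    ch-≢ (yu , uw , wy , we , eu) refl = t≢f we wy
    -- `w` and `w'` share an out-neighbour `n` before both `u` and `u'`, and one more, `t`. By
    -- `over`, `t` cannot precede just one of `u`, `u'`, and `co = 2` leaves no room for it to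
    -- precede both; so `t` is the end of both chains.
    ch-same : ∀ {y u w e u' w' e'} → Ch y u w e → Ch y u' w' e' → e ≡ e'
    ch-same {y} {u} {w} {e} {u'} {w'} {e'} (yu , uw , wy , we , eu) (yu' , uw' , wy' , we' , eu') = go (u F.≟ u') where
     go : Dec (u ≡ u') → e ≡ e'
     go (yes refl) = odd-uniq uw we eu (subst (_⟶ e') (odd-uniq yu uw' wy' uw wy) we') eu'
     go (no ne) = let (n , a , yn , _) = fresh (y ∷ []) (eq≥ two2) in mid (lft a) (rgt a) (yn ∘ sym) where
      two2 : # (λ v → A v u ∧ A v u') ≡ 2
      two2 = sym (co-in u u') · sib-c yu yu' ne · c≡2
      fin : ∀ {t} → w ⟶ t → w' ⟶ t → (t ⟶ u → t ⟶ u' → ⊥) → y ≢ t → t ⟶ u ⊎ A t u ≡ false → t ⟶ u' ⊎ A t u' ≡ false → e ≡ e'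
      fin wt wt' nb nt (inj₁ p) _ = ⊥-elim (nb p (over yu uw wy yu' uw' wy' ne p wt' nt))
      fin wt wt' nb nt (inj₂ _) (inj₁ p) = ⊥-elim (nb (over yu' uw' wy' yu uw wy (ne ∘ sym) p wt nt) p)
      fin wt wt' nb nt (inj₂ p) (inj₂ q) = odd-uniq uw we eu wt p · odd-uniq uw' wt' q we' eu'
      mid : ∀ {n} → n ⟶ u → n ⟶ u' → y ≢ n → e ≡ e'
      mid {n} a a' yn = let (t , b , tn , _) = fresh (n ∷ []) (eq≥ (Fb-co (toD' (ahead yu uw wy a yn) (ahead yu' uw' wy' a' yn) (w-≢ yu uw wy yu' uw' ne)))) in last (lft b) (rgt b) (tn ∘ sym) where
       last : ∀ {t} → w ⟶ t → w' ⟶ t → n ≢ t → e ≡ e'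
       last {t} b b' tn = fin b b' (λ p q → tn (third two2 (and yu yu') (and a a') (and p q) yn yt)) yt (cases (A t u)) (cases (A t u')) where
        yt : y ≢ t
        yt refl = t≢f b wy
    -- The four out-neighbours of `y` start chains with distinct third vertices, all before `e`;
    -- these are all its in-neighbours.
    ch-in : ∀ {y u w e v} → Ch y u w e → v ⟶ e → ∃ λ u' → y ⟶ u' × u' ⟶ v × A v y ≡ false
    ch-in {y} {e = e} {v} c ve = go (enum≡ (A y) (out y · k≡4)) where
     go : Enum (A y) 4 → ∃ λ u' → y ⟶ u' × u' ⟶ v × A v y ≡ false
     go (f , yf , inj , _) = let (i , q) = covers {P = λ v → A v e} (λ i → fst (om i)) om-inj (λ i → snd (snd (snd (om i)))) (eq≤ (inn e · k≡4)) v ve in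
       f i , yf i , subst (f i ⟶_) q (fst (snd (om i))) , subst (λ v → A v y ≡ false) q (fst (snd (snd (om i)))) where
      opaque
       om : ∀ i → ∃ λ w → f i ⟶ w × A w y ≡ false × w ⟶ e
       om i = let (w , e' , c') = chain (yf i) in w , fst (snd c') , fst (snd (snd c')) , subst (w ⟶_) (ch-same c' c) (fst (snd (snd (snd c'))))
      om-inj : ∀ i j → fst (om i) ≡ fst (om j) → i ≡ j
      om-inj i j q = inj i j (unique (s1 (yf i) (fst (snd (om i))) (fst (snd (snd (om i))))) (and (yf i) (fst (snd (om i)))) (and (yf j) (subst (f j ⟶_) (sym q) (fst (snd (om j))))))
    ch-d : ∀ {y u w e} → Ch y u w e → d y e ≡ 3
    ch-d {y} {u} {w} {e} c@(yu , uw , wy , we , eu) = go (d y e) refl (d-min (W-cons yu (W-cons uw (W-cons we W-nil)))) where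
     go : ∀ m → d y e ≡ m → m ≤ 3 → d y e ≡ 3
     go 0 q _ = ⊥-elim (ch-≢ c (d≡0 q))
     go 1 q _ = ⊥-elim (1+n≰n (eq≥ (D-d (toD' (d⇒A q) we λ { refl → no2 yu uw })) » d≤2 yu uw))
     go 2 q _ = let
         (v , r , s) = first-step {y} {e} q
         (u' , a , b , _) = ch-in c (d⇒A s)
      in ⊥-elim (a0 a b r)
     go 3 q _ = q
     go (4+ _) q (≤3+ ())
    ch-back : ∀ {y u w e} → Ch y u w e → d e y ≡ 3
    ch-back {y} {u} {w} {e} c@(yu , uw , wy , we , eu) = go (d e y) refl le where
     le : d e y ≤ 3
     le = let (n , nu , yn , _) = fresh (y ∷ []) (≤2+ z≤n » eq≥ (inn u · k≡4)) in via nu (yn ∘ sym) where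
      via : ∀ {n} → n ⟶ u → y ≢ n → d e y ≤ 3
      via {n} nu yn = let (z , zy , zn) = parent (≥1 (Fb-co (toD' yu nu yn))) in reach zy zn where
       reach : ∀ {z} → z ⟶ y → z ⟶ n → d e y ≤ 3
       reach {z} zy zn = let (v , q) = #∃ (+-cancelˡ-≤ 4 1 _ (eq≤ (+≡ (sym (tri zn · P3)) (sym (Fb-co (toD (ahead yu uw wy nu yn) we λ { refl → t≢f nu eu })))) » incl (λ v → A n v ∧ A v z) (λ v → A n v ∧ A e v) (A n) (λ v → lft) (λ v → lft) » +-monoˡ-≤ _ (eq≤ (out n · k≡4))))
        in d-min (W-cons (rgt (∧-snd {A n v ∧ A v z} q)) (W-cons (rgt (∧-fst {A n v ∧ A v z} q)) (W-cons zy W-nil)))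
     tri∃ : ∀ {z} → e ⟶ z → ∃₂ λ v u' → z ⟶ v × y ⟶ u' × u' ⟶ v × A v y ≡ false
     tri∃ ez = let
         (v , b) = #∃ (≥1 (tri ez · P3))
         (u' , yu' , uv , vy) = ch-in c (rgt b)
      in v , u' , lft b , yu' , uv , vy
     go : ∀ m → d e y ≡ m → m ≤ 3 → d e y ≡ 3
     go 0 q _ = ⊥-elim (ch-≢ c (sym (d≡0 q)))
     go 1 q _ = let (v , u' , yv , yu' , uv , _) = tri∃ (d⇒A q) in ⊥-elim (a0 yu' uv yv)
     go 2 q _ = let (z , ez , r) = first-step {e} {y} q in ⊥-elim (two1 (d⇒A r) (tri∃ ez)) where
      two1 : ∀ {z} → z ⟶ y → (∃₂ λ v u' → z ⟶ v × y ⟶ u' × u' ⟶ v × A v y ≡ false) → ⊥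
      two1 zy (v , u' , zv , yu' , uv , vy) = 1+n≰n (eq≥ (sib-d zy zv λ { refl → no2 yu' uv }) » d≤2 yu' uv)
     go 3 q _ = q
     go (4+ _) q (≤3+ ())
   -- The ends of a chain have the distances of siblings, hence a common in-neighbour; yet every
   -- in-neighbour of `e` fails to precede `y`.
   absurd : ⊥
   absurd = let
       (w , e , c) = chain axy
       (b , p , ne) = sib∃ axy
       (z , q) = parent-of (co-cl (ch-d c · sym (sib-d axy p (ne ∘ sym))) (ch-back c · sym (sib-d p axy ne)) · sib-c axy p (ne ∘ sym) · c≡2)
       (u , _ , _ , f) = ch-in c (snd q)
    in t≢f (fst q) f where
    parent-of : ∀ {a b} → co a b ≡ 2 → ∃ λ z → z ⟶ a × z ⟶ b
    parent-of r = parent (≥1 r)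
  module Matching (sk : ∀ {x y w} → x ⟶ y → y ⟶ w → A w x ≡ false → sq x w ≡ k) (ck : c# ≡ k ∸ 1) where
   opaque
    -- The choices of out-neighbour are immaterial: `sq x w = k` says that all out-neighbours of `x`
    -- lead to the same non-returning vertex.
    ω : V → V
    ω x = fst (oddw (snd (has-out x)))
    ω-to : ∀ {x y} → x ⟶ y → y ⟶ ω x
    ω-to {x} {y} p = let
        (y' , p') = has-out x
        (w , q , r) = oddw p'
     in rgt (#-sub≡ (λ z → lft) (eq≤ (out x · sym (sk p' q r))) y p)
    ω-from : ∀ {x y} → y ⟶ ω x → x ⟶ y
    ω-from {x} {y} q = #-sub≡ (λ z → ω-to) (eq≤ (inn (ω x) · sym (out x))) y q
    ω-no : ∀ {x} → A (ω x) x ≡ false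
    ω-no {x} = snd (snd (oddw (snd (has-out x))))
    ω-or : ∀ {x y z} → x ⟶ y → y ⟶ z → z ⟶ x ⊎ z ≡ ω x
    ω-or {x} {y} {z} p q = [ inj₁ , (λ f → inj₂ (odd-uniq p q f (ω-to p) ω-no)) ]′ (cases (A z x))
    ω-inj : ∀ {x y} → ω x ≡ ω y → x ≡ y
    ω-inj {x} {y} e = go (x F.≟ y) where
     cok : co x y ≡ k
     cok = (#-cong λ z → iff (lft) (λ p → and p (ω-from (subst (z ⟶_) e (ω-to p))))) · out x
     go : Dec (x ≡ y) → x ≡ y
     go (yes p) = p
     go (no ne) = let (u , p , q) = parent (k>0 » eq≥ cok) in
      lia (k ∷ P ∷ c# ∷ []) ((κ 1 ⊹ ν1 ≋ ν0) ∷ (ν2 ≋ ν0) ∷ (ν2 ≋ ν1) ∷ []) (P1 , sym (sib-c p q ne) · cok , ck · cong (_∸ 1) (sym P1))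
   x* : V
   x* = x₀
   yE : Enum (A x*) k
   yE = enum≡ (A x*) (out x*)
   y : Fin k → V
   y = fst yE
   ya : ∀ i → x* ⟶ y i
   ya = fst (snd yE)
   opaque
    zE : ∀ i → ∃ λ z → z ⟶ x* × A (y i) z ≡ false
    zE i = let (z , e) = #∃ (+-cancelˡ-≤ P 1 _ (eq≤ (+-comm P 1 · P1 · sym (inn x*) · #-split (λ z → A z x*) (A (y i)) · cong (_+ # (λ z → A z x* ∧ not (A (y i) z))) ((#-cong λ z → ∧-comm (A z x*) (A (y i) z)) · tri (ya i)))))
           in z , lft e , not-t (rgt e)
   z : Fin k → V
   z i = fst (zE i)
   -- Three blocks of k + 1 vertices, arranged so that equal indices in consecutive blocks are
   -- exactly the missing arcs, as equal second coordinates are in (iv).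
   X Y Z : Fin (suc k) → V
   X zero = x*
   X (suc i) = ω (y i)
   Y zero = ω (ω x*)
   Y (suc i) = y i
   Z zero = ω x*
   Z (suc i) = z i
   opaque
    miss : ∀ {i u} → u ⟶ x* → A (y i) u ≡ false → u ≡ z i
    miss {i} p q = unique (+-cancelˡ-≡ P _ 1 (cong (_+ # (λ z → A z x* ∧ not (A (y i) z))) (sym ((#-cong λ z → ∧-comm (A z x*) (A (y i) z)) · tri (ya i))) · sym (#-split (λ z → A z x*) (A (y i))) · inn x* · sym P1 · +-comm 1 P))
     (and p (not-f q)) (and (fst (snd (zE i))) (not-f (snd (snd (zE i)))))
    hit₁ : ∀ {i j} → i ≢ j → y i ⟶ z j
    hit₁ {i} {j} ne = elimʳ (λ f → ne (fst (snd (snd yE)) i j (unique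
        (+-cancelˡ-≡ P _ 1 (cong (_+ # (λ u → A x* u ∧ not (A u (z j)))) (sym (tri (fst (snd (zE j))))) · sym (#-split (A x*) (λ u → A u (z j))) · out x* · sym P1 · +-comm 1 P))
        (and (ya i) (not-f f)) (and (ya j) (not-f (snd (snd (zE j)))))))) (cases (A (y i) (z j)))
    YZ1 : ∀ i j → suc i ≢ j → y i ⟶ Z j
    YZ1 i zero ne = ω-to (ya i)
    YZ1 i (suc j) ne = hit₁ (ne ∘ cong suc)
    YZ0 : ∀ i → A (y i) (z i) ≡ false
    YZ0 i = snd (snd (zE i))
    ZX : ∀ i j → i ≢ j → Z i ⟶ X j
    ZX zero zero ne = ⊥-elim (ne refl)
    ZX (suc i) zero ne = fst (snd (zE i))
    ZX i (suc j) ne = ω-to (YZ1 j i (ne ∘ sym))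
    ZX0 : ∀ i → A (Z i) (X i) ≡ false
    ZX0 zero = ω-no
    ZX0 (suc i) = ¬t λ p → t≢f (ω-from p) (YZ0 i)
    ωz : ∀ j → ω (z j) ≡ y j
    ωz j = let (l , e) = snd (snd (snd yE)) (ω (z j)) (ω-to (ZX (suc j) zero λ ())) in go l e (l F.≟ j) where
     go : ∀ l → y l ≡ ω (z j) → Dec (l ≡ j) → ω (z j) ≡ y j
     go l e (yes refl) = sym e
     go l e (no ne) = t≢f (subst (λ u → ω (y l) ⟶ u) (sym e) (ω-to (ZX (suc j) (suc l) λ f → ne (sym (FP.suc-injective f))))) ω-no
    XY : ∀ i j → i ≢ j → X i ⟶ Y j
    XY zero zero ne = ⊥-elim (ne refl)
    XY zero (suc j) ne = ya j
    XY (suc i) zero ne = ω-to (ZX zero (suc i) λ ())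
    XY (suc i) (suc j) ne = subst (λ u → X (suc i) ⟶ u) (ωz j) (ω-to (ZX (suc j) (suc i) (ne ∘ sym)))
    XY0 : ∀ i → A (X i) (Y i) ≡ false
    XY0 zero = ¬t λ p → t≢f (ω-from p) ω-no
    XY0 (suc i) = ω-no
    other : ∀ (i j : Fin (suc k)) → ∃ λ m → m ≢ i × m ≢ j × m ≢ zero
    other i j = let (m , e) = pickm i j k>3 in m , e where
     pickm : ∀ {k} (i j : Fin (suc k)) → 3 < k → ∃ λ m → m ≢ i × m ≢ j × m ≢ zero
     pickm {1} i j (s≤s ())
     pickm {2} i j (≤2+ ())
     pickm {3} i j (≤3+ ())
     pickm {4+ k} i j _ = go (1F F.≟ i) (1F F.≟ j) (2F F.≟ i) (2F F.≟ j) where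
      go : Dec (1F ≡ i) → Dec (1F ≡ j) → Dec (2F ≡ i) → Dec (2F ≡ j) → ∃ λ m → m ≢ i × m ≢ j × m ≢ zero
      go (no p) (no q) _ _ = 1F , p , q , λ ()
      go _ _ (no p) (no q) = 2F , p , q , λ ()
      go (yes refl) _ (yes ()) _
      go (yes refl) _ _ (yes refl) = 3F , (λ ()) , (λ ()) , λ ()
      go _ (yes refl) (yes refl) _ = 3F , (λ ()) , (λ ()) , λ ()
      go _ (yes refl) _ (yes ())
    ωX : ∀ j → ω (X (suc j)) ≡ z j
    ωX j = go (other (suc j) zero) where
     go : (∃ λ m → m ≢ suc j × m ≢ zero × m ≢ zero) → ω (X (suc j)) ≡ z j
     go (zero , _ , ne , _) = ⊥-elim (ne refl)
     go (suc a , ne , _) = miss (elimʳ (λ e → t≢f (subst (λ u → z j ⟶ u) (sym (ω-inj e)) (ZX (suc j) zero λ ())) (ZX0 (suc j))) (ω-or (ya a) (ω-to (XY (suc j) (suc a) (ne ∘ sym))))) (¬t λ p → t≢f (ω-from p) (XY0 (suc j)))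
    YZ : ∀ i j → i ≢ j → Y i ⟶ Z j
    YZ (suc i) j ne = YZ1 i j ne
    YZ zero zero ne = ⊥-elim (ne refl)
    YZ zero (suc j) ne = subst (λ u → Y zero ⟶ u) (ωX j) (ω-to (XY (suc j) zero λ ()))
    YZ0' : ∀ i → A (Y i) (Z i) ≡ false
    YZ0' zero = ω-no
    YZ0' (suc i) = YZ0 i
   f : Fin 3 × Fin (suc k) → V
   f (0F , i) = X i
   f (1F , i) = Y i
   f (2F , i) = Z i
   nx : Fin 3 → Fin 3
   nx 0F = 1F
   nx 1F = 2F
   nx 2F = 0F
   opaque
    fw : ∀ l i j → i ≢ j → f (l , i) ⟶ f (nx l , j)
    fw 0F = XY
    fw 1F = YZ
    fw 2F = ZX
    fw0 : ∀ l i → A (f (l , i)) (f (nx l , i)) ≡ false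
    fw0 0F = XY0
    fw0 1F = YZ0'
    fw0 2F = ZX0
    uuu : ∀ l → nx (nx (nx l)) ≡ l
    uuu 0F = refl
    uuu 1F = refl
    uuu 2F = refl
    same : ∀ l i j → A (f (l , i)) (f (l , j)) ≡ false
    same l i j = let (m , p , q , _) = other i j in
     ¬t λ e → a0 (subst (λ v → f (nx (nx l) , m) ⟶ f (v , i)) (uuu l) (fw (nx (nx l)) m i p)) e (subst (λ v → f (nx (nx l) , m) ⟶ f (v , j)) (uuu l) (fw (nx (nx l)) m j q))
    bk : ∀ l i j → A (f (l , i)) (f (nx (nx l) , j)) ≡ false
    bk l i j = let (m , p , q , _) = other i j in ¬t λ e → a0 (fw l i m (p ∘ sym)) (fw (nx l) m j q) e
   R : Fin 3 × Fin (suc k) → Fin 3 × Fin (suc k) → Bool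
   R = CayZ² 3 (suc k) (S-iv k)
   private
    cay1 : ∀ l i j → i ≢ j → R (l , i) (nx l , j) ≡ true
    cay1 l i j ne = go (subMod (suc k) (toℕ j) (toℕ i)) refl where
     lv : ∀ l → subMod 3 (toℕ (nx l)) (toℕ l) ≡ 1
     lv 0F = refl
     lv 1F = refl
     lv 2F = refl
     go : ∀ b → subMod (suc k) (toℕ j) (toℕ i) ≡ b → R (l , i) (nx l , j) ≡ true
     go zero e = ⊥-elim (ne (toℕ-injective (subMod-0 (suc k) (toℕ i) (toℕ j) (toℕ<n i) (toℕ<n j) e)))
     go (suc b) e = elem2-intro k _ _ suc b (≤-pred (subst (_< suc k) e (subMod< (suc k) (toℕ i) (toℕ j) (toℕ<n i) (toℕ<n j)))) (lv l) e
    cayS : ∀ l l' i j → R (l , i) (l' , j) ≡ true → subMod 3 (toℕ l') (toℕ l) ≡ 1 × i ≢ j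
    cayS l l' i j e = let (p , t , _ , q) = elem2-elim k (subMod 3 (toℕ l') (toℕ l)) (subMod (suc k) (toℕ j) (toℕ i)) suc e in p , λ { refl → 0≢1+n (sym (subMod-self (suc k) (toℕ i)) · q) }
    lvl : ∀ l l' → subMod 3 (toℕ l') (toℕ l) ≡ 1 → l' ≡ nx l
    lvl 0F 1F _ = refl
    lvl 1F 2F _ = refl
    lvl 2F 0F _ = refl
    lvl 0F 0F ()
    lvl 0F 2F ()
    lvl 1F 0F ()
    lvl 1F 1F ()
    lvl 2F 1F ()
    lvl 2F 2F ()
   opaque
    adjf : ∀ p q → A (f p) (f q) ≡ R p q
    adjf (l , i) (l' , j) = iff (to l l') (λ e → let (a , b) = cayS l l' i j e in subst (λ v → f (l , i) ⟶ f (v , j)) (sym (lvl l l' a)) (fw l i j b)) where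
     nxt : ∀ l → f (l , i) ⟶ f (nx l , j) → R (l , i) (nx l , j) ≡ true
     nxt l e = cay1 l i j λ { refl → t≢f e (fw0 l i) }
     to : ∀ l l' → f (l , i) ⟶ f (l' , j) → R (l , i) (l' , j) ≡ true
     to 0F 1F = nxt 0F
     to 1F 2F = nxt 1F
     to 2F 0F = nxt 2F
     to 0F 0F e = t≢f e (same 0F i j)
     to 1F 1F e = t≢f e (same 1F i j)
     to 2F 2F e = t≢f e (same 2F i j)
     to 0F 2F e = t≢f e (bk 0F i j)
     to 1F 0F e = t≢f e (bk 1F i j)
     to 2F 1F e = t≢f e (bk 2F i j)
    f-inj : ∀ {p q} → f p ≡ f q → p ≡ q
    f-inj {l , i} {l' , j} e = go (i F.≟ j) where
     lv : l' ≡ l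
     lv = let (m , p , q , _) = other i j in nx-inj (sym (lvl l' (nx l) (fst (cayS l' (nx l) j m (sym (adjf (l' , j) (nx l , m)) · cong (λ v → A v (f (nx l , m))) (sym e) · fw l i m (p ∘ sym)))))) where
      nx-inj : ∀ {a b} → nx a ≡ nx b → a ≡ b
      nx-inj {0F} {0F} _ = refl
      nx-inj {1F} {1F} _ = refl
      nx-inj {2F} {2F} _ = refl
      nx-inj {0F} {1F} ()
      nx-inj {0F} {2F} ()
      nx-inj {1F} {0F} ()
      nx-inj {1F} {2F} ()
      nx-inj {2F} {0F} ()
      nx-inj {2F} {1F} ()
     go : Dec (i ≡ j) → (l , i) ≡ (l' , j)
     go (yes refl) = cong (_, i) (sym lv)
     go (no ne) = t≢f (cong (λ v → A v (f (nx l , j))) (cong (λ v → f (v , j)) (sym lv) · sym e) · fw l i j ne) (fw0 l j)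
    closed : ∀ p v → f p ⟶ v → ∃ λ q → f q ≡ v
    closed (l , i) v e = let (j , q) = covers {P = A (f (l , i))} (λ j → f (nx l , punchIn i j)) (λ a b r → punchIn-injective i a b (cong snd (f-inj {nx l , punchIn i a} {nx l , punchIn i b} r)))
                                 (λ j → fw l i (punchIn i j) (punchInᵢ≢i i j ∘ sym)) (eq≤ (out (f (l , i)))) v e in (nx l , punchIn i j) , q
   iso : IsomorphicTo A (Fin 3 × Fin (suc k)) R
   iso = isoFrom R f (0F , zero) adjf f-inj closed
  result : IsomorphicTo A (Fin 3 × Fin (suc k)) (CayZ² 3 (suc k) (S-iv k))
  result = [ (λ (s , c) → ⊥-elim (Anti.absurd (λ {x} {y} {w} → s x y w) c)) , (λ (s , c) → Matching.iso (λ {x} {y} {w} → s x y w) c) ]′ outcome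

 -- `P = k − 2`: the sporadic digraphs

 module TwoShort (P2 : 2 + P ≡ k) where
  opaque
   co≥ : ∀ {x y y'} → x ⟶ y → x ⟶ y' → k ≤ 4 + co y y'
   co≥ {x} {y} {y'} p q = lia≤ (P ∷ k ∷ co y y' ∷ []) ((κ 2 ⊹ ν0 ≋ ν1) ∷ (ν0 ⊹ ν0 ≼ ν1 ⊹ ν2) ∷ []) ν1 (κ 4 ⊹ ν2) (P2 , sib≥co p q)
   odd2 : ∀ {x y} → x ⟶ y → # (λ z → A y z ∧ not (A z x)) ≡ 2
   odd2 p = +-cancelˡ-≡ P _ 2 (odd# p · sym P2 · +-comm 2 P)
   a≤2 : a# ≤ 2
   a≤2 = +-cancelˡ-≤ P a# 2 (a≤ » eq≤ (sym P2 · +-comm 2 P))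
  Oddᵇ : V → V → V → Bool
  Oddᵇ x y z = A y z ∧ (not (A z x) ∧ not (A x z))
  opaque
   -- Two out-neighbours of `y` do not return to `x`: those that follow `x` number `a#`, the others
   -- are odd.
   rest : ∀ {x y} → x ⟶ y → a# + # (Oddᵇ x y) ≡ 2
   rest {x} {y} p = sym ((∑-cong λ z → aux (A y z) (A z x) (A x z) (λ r s → no2 r s)) · ∑-+ _ _ · cong (_+ # (Oddᵇ x y)) (coA p)) · odd2 p where
    aux : ∀ a b c → (b ≡ true → c ≡ true → ⊥) → β (a ∧ not b) ≡ β (c ∧ a) + β (a ∧ (not b ∧ not c))
    aux true true true h = ⊥-elim (h refl refl)
    aux true true false h = refl
    aux true false true h = refl
    aux true false false h = refl
    aux false b true h = refl
    aux false b false h = refl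
   succ∃ : 1 ≤ a# → ∀ {x y} → x ⟶ y → ∃ λ y' → x ⟶ y' × y ⟶ y'
   succ∃ l {x} {y} p = let (y' , e) = #∃ (l » eq≥ (coA p)) in y' , lft e , rgt e
   pred∃ : 1 ≤ a# → ∀ {x y} → x ⟶ y → ∃ λ y' → x ⟶ y' × y' ⟶ y
   pred∃ l {x} {y} p = let (y' , e) = #∃ (l » eq≥ (sqA p)) in y' , lft e , rgt e
   k≤ : 1 ≤ a# → k ≤ 4 + a#
   k≤ l = let
       (x , y , p) = arc0
       (y' , q , r) = succ∃ l p
    in co≥ p q » eq≤ (cong (4 +_) (coA r))
  module One (a1 : a# ≡ 1) where
   opaque
    out-uniq : ∀ {x y u v} → x ⟶ y → x ⟶ u → y ⟶ u → x ⟶ v → y ⟶ v → u ≡ v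
    out-uniq p q r q' r' = unique (coA p · a1) (and q r) (and q' r')
    in-uniq : ∀ {x y u v} → x ⟶ y → x ⟶ u → u ⟶ y → x ⟶ v → v ⟶ y → u ≡ v
    in-uniq {x} {y} {u} {v} p q r q' r' = unique (sqA p · a1) (and q r) (and q' r')
    odd1 : ∀ {x y} → x ⟶ y → # (Oddᵇ x y) ≡ 1
    odd1 {x} {y} p = suc-injective (cong (_+ # (Oddᵇ x y)) (sym a1) · rest p)
    nxt : ∀ {x y} → x ⟶ y → ∃ λ y' → x ⟶ y' × y ⟶ y'
    nxt = succ∃ (eq≥ a1)
    -- Once a triangle is removed, the permutation has no fixed points or two-cycles on the rest.
    noTri : ∀ {x y₁ y₂ y₃} → x ⟶ y₁ → x ⟶ y₂ → x ⟶ y₃ → y₁ ⟶ y₂ → y₂ ⟶ y₃ → y₃ ⟶ y₁ → 3 < k → k ≤ 5 → ⊥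
    noTri {x} {y₁} {y₂} {y₃} p₁ p₂ p₃ r1 r2 r3 lo hi =
     let (u , pu , n₁ , n₂ , n₃ , _) = fresh (y₁ ∷ y₂ ∷ y₃ ∷ []) (lo » eq≥ (out x))
         (v , pv , uv) = nxt pu
         (w , pw' , vw) = nxt pv
         avoid : ∀ {s t} → x ⟶ s → x ⟶ t → s ⟶ t → NotIn s (y₁ ∷ y₂ ∷ y₃ ∷ []) → NotIn t (y₁ ∷ y₂ ∷ y₃ ∷ [])
         avoid = λ ps pt st (m₁ , m₂ , m₃ , _) → (λ { refl → m₃ (in-uniq pt ps st p₃ r3) }) , (λ { refl → m₁ (in-uniq pt ps st p₁ r1) }) , (λ { refl → m₂ (in-uniq pt ps st p₂ r2) }) , tt
         (v₁ , v2 , v3 , _) = avoid pu pv uv (n₁ , n₂ , n₃ , tt)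
         nw = avoid pv pw' vw (v₁ , v2 , v3 , tt)
     in six p₁ p₂ p₃ pu pv pw' (A-irr r1 , A-irr r3 ∘ sym , n₁ ∘ sym , v₁ ∘ sym , fst nw ∘ sym , tt) (A-irr r2 , n₂ ∘ sym , v2 ∘ sym , fst (snd nw) ∘ sym , tt) (n₃ ∘ sym , v3 ∘ sym , fst (snd (snd nw)) ∘ sym , tt)
          (A-irr uv , (λ e → no2 uv (subst (v ⟶_) (sym e) vw)) , tt) (A-irr vw , tt) where
     six : ∀ {y₁ y₂ y₃ u v w} → x ⟶ y₁ → x ⟶ y₂ → x ⟶ y₃ → x ⟶ u → x ⟶ v → x ⟶ w → NotIn y₁ (y₂ ∷ y₃ ∷ u ∷ v ∷ w ∷ []) → NotIn y₂ (y₃ ∷ u ∷ v ∷ w ∷ []) → NotIn y₃ (u ∷ v ∷ w ∷ []) → NotIn u (v ∷ w ∷ []) → NotIn v (w ∷ []) → ⊥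
     six {y₁} {y₂} {y₃} {u} {v} {w} a b c e f g h1 h₂ h₃ h4 h5 = 1+n≰n (size≥ {P = A x} (y₁ ∷ y₂ ∷ y₃ ∷ u ∷ v ∷ w ∷ []) (h1 , h₂ , h₃ , h4 , h5 , tt , tt) (a , b , c , e , f , g , tt) » eq≤ (out x) » hi)
    -- Of the three vertices after `y'` and before `y` at most one precedes `x` and at most one is
    -- odd; so one follows `x` and closes a triangle forbidden by `noTri`.
    absurd5 : k ≡ 5 → ⊥
    absurd5 k5 =
     let (x , y , p) = arc0
         (y' , q , r) = nxt p
         three : # (λ z → A y' z ∧ A z y) ≡ 3
         three = tri r · +-cancelˡ-≡ 2 P 3 (P2 · k5)
         le : # (λ z → A y' z ∧ A z y) ≤ # (λ z → A z x ∧ A z y) + (# (Oddᵇ x y') + # (λ z → (A y' z ∧ A z y) ∧ A x z))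
         le = (∑-mono λ z → aux (A y' z) (A z y) (A z x) (A x z)) » eq≤ (∑-+ _ _ · cong (# (λ z → A z x ∧ A z y) +_) (∑-+ _ _))
         (z , e) = #∃ (lia≤ (# (λ z → A y' z ∧ A z y) ∷ # (λ z → A z x ∧ A z y) ∷ # (Oddᵇ x y') ∷ # (λ z → (A y' z ∧ A z y) ∧ A x z) ∷ []) ((ν0 ≋ κ 3) ∷ (ν0 ≼ ν1 ⊹ (ν2 ⊹ ν3)) ∷ (ν1 ≋ κ 1) ∷ (ν2 ≋ κ 1) ∷ []) (κ 1) ν3
                  (three , le , sym (co-in x y) · coA p · a1 , odd1 q))
     in noTri p q (∧-snd {A y' z ∧ A z y} e) r (lft (∧-fst {A y' z ∧ A z y} e)) (rgt (∧-fst {A y' z ∧ A z y} e)) k>3 (eq≤ k5) where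
     aux : ∀ a b c e → β (a ∧ b) ≤ β (c ∧ b) + (β (a ∧ (not c ∧ not e)) + β ((a ∧ b) ∧ e))
     aux true true true e = z<s
     aux true true false true = z<s
     aux true true false false = z<s
     aux true false c e = z≤n
     aux false b c e = z≤n
   module Four (k4 : k ≡ 4) {x y y₂ y₃ y₄ w : V} (p : x ⟶ y) (p₂ : x ⟶ y₂) (p₃ : x ⟶ y₃) (p₄ : x ⟶ y₄)
               (r2 : y ⟶ y₂) (r3 : y₂ ⟶ y₃) (r4 : y₄ ⟶ y) (ow : Oddᵇ x y w ≡ true) where
    opaque
     P≡2 : P ≡ 2
     P≡2 = +-cancelˡ-≡ 2 P 2 (P2 · k4)
     ny3 : y₃ ≢ y
     ny3 refl = no2 r2 r3
     f₁ : A y y₃ ≡ false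
     f₁ = ¬t λ a → A-irr r3 (out-uniq p p₂ r2 p₃ a)
     f₂ : A y₃ y ≡ false
     f₂ = ¬t λ a → noTri p p₂ p₃ r2 r3 a k>3 (eq≤ k4 » n≤1+n 4)
     o₃ : Oddᵇ y y₂ y₃ ≡ true
     o₃ = and r3 (∧-intro {not (A y₃ y)} (not-f f₂) (not-f f₁))
     y34 : y₃ ≢ y₄
     y34 refl = t≢f r4 f₂
     y24 : y₂ ≢ y₄
     y24 refl = no2 r2 r4
     Rs : R# y y₃ * sq y y₃ ≤ 4
     Rs = ≤-trans (eq≤ (cong (R# y y₃ *_) (sym (sq≡ y y₃)) · Rmul Ax Ax y y₃ · rowA (Rx y y₃ ⊗ tr Ax) y · (cong₂ _*_ k4 (onA (Rx y y₃ ⊗ tr Ax) axy r2 · cnt (Rb y y₃ y) (A y₂)))))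
            (*-monoʳ-≤ 4 ((#-mono λ z e → and (rgtC e) (∧-intro {not (A z y)} (not-f (¬t λ a → t≢f (d⇒A (sym (Cb-snd (lftC e)) · A⇒d a)) f₂)) (not-f (¬t λ a → t≢f (d⇒A (sym (Cb-fst (lftC e)) · A⇒d a)) f₁)))) » eq≤ (odd1 r2)))
     Rc : 4 ≤ R# y y₃ * co y y₃
     Rc = *-monoʳ-≤ 4 (∃# y (and p (R0 y y₃))) » eq≥ (cong (R# y y₃ *_) (sym (co≡ y y₃)) · Rmul Ax (tr Ax) y y₃ · rowA (Rx y y₃ ⊗ Ax) y · (cong₂ _*_ k4 (onA (Rx y y₃ ⊗ Ax) axy p₃ · comm (Rx y y₃) Ax x y₃ · cnt (A x) (λ u → Rb y y₃ u y₃))))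
     ∑4 : (f : Fin 4 → ℕ) → ∑ f ≡ f 0F + (f 1F + (f 2F + f 3F))
     ∑4 f = ∑-suc f · cong (f 0F +_) (∑-suc _ · cong (f 1F +_) (∑-suc _ · cong (f 2F +_) (∑-suc _ · cong (f 3F +_) (∑-nil _) · +-identityʳ _)))
     lhs : ∑ (λ y' → β (A x y') * co y' y) ≡ 4 + (1 + (co y y₃ + 1))
     lhs = trans (∑-enum {P = A x} (toEnum {P = A x} (y ∷ y₂ ∷ y₃ ∷ y₄ ∷ []) ((A-irr r2 , ny3 ∘ sym , A-irr r4 ∘ sym , tt) , (A-irr r3 , y24 , tt) , (y34 , tt) , tt , tt) (p , p₂ , p₃ , p₄ , tt) (eq≤ (out x · k4))) (λ y' → co y' y))
             (∑4 _ · (+≡ (co-self y · k4) (+≡ (co-sym y₂ y · coA r2 · a1) (+≡ (co-sym y₃ y) (coA r4 · a1)))))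
     pc : ∀ x y → ∑ (λ y' → β (A x y') * co y' y) ≡ ⟦ Ax ⊗ C ⟧ x y
     pc x y = ∑-cong λ y' → cong (β (A x y') *_) (sym (co≡ y' y))
     paths : ∀ {x y w} → x ⟶ y → Oddᵇ x y w ≡ true → ∑ (λ z → β (A y z) * sq x z) ≡ P * P + a# * a# + sq x w
     paths {x} {y} {w} p ow = (∑-cong λ z → spl (A y z) (A z x) (A x z) (sq x z) (λ r s → no2 r s)) · (∑-+ _ _ · (+≡ (∑-+ _ _ · (cong₂ _+_
         (wsum (λ z → A y z ∧ A z x) (sq x) P (λ z e → tri (rgt e)) · cong (_* P) (tri p))
         (wsum (λ z → A x z ∧ A y z) (sq x) a# (λ z e → sqA (lft e)) · cong (_* a#) (coA p))))
         (wsum (Oddᵇ x y) (sq x) (sq x w) (λ z e → cong (sq x) (unique (odd1 p) e ow)) · cong (_* sq x w) (odd1 p) · +-identityʳ _))) where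
      spl : ∀ a b c m → (b ≡ true → c ≡ true → ⊥) → β a * m ≡ β (a ∧ b) * m + β (c ∧ a) * m + β (a ∧ (not b ∧ not c)) * m
      spl true true true m h = ⊥-elim (h refl refl)
      spl true true false m h = sym (+-identityʳ _ · +-identityʳ _)
      spl true false true m h = sym (+-identityʳ _)
      spl true false false m h = refl
      spl false b true m h = refl
      spl false b false m h = refl
     s' : sq x w ≡ sq y y₃
     s' = +-cancelˡ-≡ (P * P + a# * a#) _ _ (sym (paths p ow) · sym (twoPaths x y) · pc x y · onA (Ax ⊗ C) p r2 · sym (pc y y₂) · twoPaths y y₂ · paths r2 o₃)
     c+1 : suc (co y y₃) ≡ sq y y₃
     c+1 = lia≡ (co y y₃ ∷ sq y y₃ ∷ []) ((κ 4 ⊹ (κ 1 ⊹ (ν0 ⊹ κ 1)) ≋ κ 5 ⊹ ν1) ∷ []) (κ 1 ⊹ ν0) ν1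
      (sym lhs · twoPaths x y · paths p ow · (+≡ (+≡ (cong₂ _*_ P≡2 P≡2) (cong₂ _*_ a1 a1)) s'))
     -- The class of the opposite pair (y , y₃) has s = 4 / |R| ≤ c although s = c + 1.
     contra : ⊥
     contra = 1+n≰n (*-cancelˡ-≤ (R# y y₃) {{>-nonZero (R>0 y y₃)}} (eq≤ (cong (R# y y₃ *_) c+1) » Rs » Rc))
   absurd4 : k ≡ 4 → ⊥
   absurd4 k4 =
    let (x , y , p) = arc0
        (y₂ , p₂ , r2) = nxt p
        (y₃ , p₃ , r3) = nxt p₂
        (y₄ , p₄ , r4) = pred∃ (eq≥ a1) p
        (w , ow) = #∃ (eq≥ (odd1 p))
    in Four.contra k4 p p₂ p₃ p₄ r2 r3 r4 ow
  opaque
   a2⇒k : a# ≡ 2 → 5 ≤ k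
   a2⇒k a2 =
    let (x , y , p) = arc0
        (u , v , a , b , ne) = pair∃ (eq≥ (coA p · a2))
        (s , t' , c , e , ne') = pair∃ (eq≥ (sqA p · a2))
        yu = rgt a
        yv = rgt b
        sy = rgt c
        ty' = rgt e
        op : ∀ {a b} → y ⟶ a → b ⟶ y → a ≢ b
        op = λ { p q refl → no2 p q }
    in (size≥ {P = A x} (y ∷ u ∷ v ∷ s ∷ t' ∷ []) ((A-irr yu , A-irr yv , A-irr sy ∘ sym , A-irr ty' ∘ sym , tt) , (ne , op yu sy , op yu ty' , tt) , (op yv sy , op yv ty' , tt) , (ne' , tt) , tt , tt)
         (p , lft a , lft b , lft c , lft e , tt)) » eq≤ (out x)
   aCases : a# ≡ 0 ⊎ (a# ≡ 2 × k ≡ 5) ⊎ (a# ≡ 2 × k ≡ 6)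
   aCases = go a# refl a≤2 where
    go : ∀ a → a# ≡ a → a ≤ 2 → a# ≡ 0 ⊎ (a# ≡ 2 × k ≡ 5) ⊎ (a# ≡ 2 × k ≡ 6)
    go 0 e _ = inj₁ e
    go 1 e _ = ⊥-elim (lo k refl k>3 (k≤ (eq≥ e) » eq≤ (cong (4 +_) e))) where
     lo : ∀ m → k ≡ m → 3 < m → k ≤ 5 → ⊥
     lo 1 f (s≤s ()) _
     lo 2 f (≤2+ ()) _
     lo 3 f (≤3+ ()) _
     lo 4 f _ _ = One.absurd4 e f
     lo 5 f _ _ = One.absurd5 e f
     lo (6+ m) f _ h = 1+n≰n (≤6+ z≤n » eq≥ f » h)
    go 2 e _ = [ (λ f → inj₂ (inj₁ (e , ≤-antisym f (a2⇒k e)))) , (λ f → inj₂ (inj₂ (e , ≤-antisym (k≤ (≥1 e) » eq≤ (cong (4 +_) e)) f))) ]′ (≤-<-total k 5) where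
     ≤-<-total : ∀ a b → a ≤ b ⊎ b < a
     ≤-<-total a b = [ inj₁ , (λ l → h (a ≟ b) l) ]′ (≤-total a b) where
      h : Dec (a ≡ b) → b ≤ a → a ≤ b ⊎ b < a
      h (yes q) l = inj₁ (eq≤ q)
      h (no q) l = inj₂ (≤∧≢⇒< l (q ∘ sym))
    go (3+ a) e (≤2+ ())
  module Twins (k6 : k ≡ 6) (f1 : F# k ≡ 1) where
   tw : V → V
   tw v = fst (#∃ (eq≥ (F#≡ k v · f1)))
   tws : Fin 2 → V → V
   tws 0F v = v
   tws 1F v = tw v
   opaque
    P≡4 : P ≡ 4
    P≡4 = +-cancelˡ-≡ 2 P 4 (P2 · k6)
    tw-F : ∀ v → Fb k v (tw v) ≡ true
    tw-F v = snd (#∃ (eq≥ (F#≡ k v · f1)))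
    tw-co : ∀ v → co v (tw v) ≡ k
    tw-co v = Fb-co (tw-F v)
    2≢k : ∀ {m} → m ≡ 2 → m ≢ k
    2≢k refl e = 2≢6 (e · k6)
    -- A set of two elements that contains `b` and its twin contains nothing else.
    pin : ∀ {Q : V → Bool} {a b} → # Q ≡ 2 → Q b ≡ true → Q (tw b) ≡ true → Q a ≡ true → co b a ≡ k
    pin {Q} {a} {b} e p p' q = go (b F.≟ a) where
     go : Dec (b ≡ a) → co b a ≡ k
     go (yes refl) = co-self b
     go (no ne) = cong (co b) (third e p q p' ne (Fb-≢ (tw-F b))) · tw-co b
    co-pin : ∀ {x y a b} → co x y ≡ 2 → x ⟶ a → y ⟶ a → x ⟶ b → y ⟶ b → co a b ≡ k
    co-pin {a = a} e p p' q q' = pin e (and p p') (and (twin-in (tw-co a) p) (twin-in (tw-co a) p')) (and q q')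
    in-pin : ∀ {x y a b} → co x y ≡ 2 → a ⟶ x → a ⟶ y → b ⟶ x → b ⟶ y → co a b ≡ k
    in-pin {x} {y} {a} e p p' q q' = pin (sym (co-in x y) · e) (and p p') (and (twin-out (tw-co a) p) (twin-out (tw-co a) p')) (and q q')
    miss2 : ∀ {u w} → u ⟶ w → # (λ v → A v u ∧ not (A w v)) ≡ 2
    miss2 {u} {w} p = #-rest (λ v → A v u) (A w) (inn u · k6) ((#-cong λ v → ∧-comm (A v u) (A w v)) · tri p · P≡4)
    -- N⁻(u) ∖ N⁺(w) is a single pair of twins.
    into : ∀ {u w a b} → u ⟶ w → b ⟶ u → A w b ≡ false → a ⟶ u → co b a ≢ k → w ⟶ a
    into {u} {w} {a} {b} p q f r ne = elimʳ (λ g → ne (pin (miss2 p) (and q (not-f f)) (and (twin-out (tw-co b) q) (not-f (¬t λ e → t≢f (twin-in (co-sym (tw b) b · tw-co b) e) f))) (and r (not-f g)))) (cases (A w a))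
    missed : ∀ {x u} → x ⟶ u → ∃ λ z → z ⟶ x × A u z ≡ false
    missed p = let (z , e) = #∃ (≥1 (miss2 p)) in z , lft e , not-t (rgt e)
    -- Of the six in-neighbours of `x`, `a` and `b` lead to four each and share at most two, so
    -- together they reach all six.
    hitOr : ∀ {x a b z} → x ⟶ a → x ⟶ b → co a b ≡ 2 → z ⟶ x → A a z ≡ false → b ⟶ z
    hitOr {x} {a} {b} {z} p q c zx f = elimʳ (λ g → 1+n≰n (∃# z (and zx (∧-intro {not (A a z ∧ A z x)} (no₁ f) (no₁ g))) » none)) (cases (A b z)) where
     no₁ : ∀ {a b} → a ≡ false → not (a ∧ b) ≡ true
     no₁ refl = refl
     none : # (λ z → A z x ∧ (not (A a z ∧ A z x) ∧ not (A b z ∧ A z x))) ≤ 0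
     none = lia≤ (# (λ z → A z x) ∷ # (λ z → (A a z ∧ A z x) ∧ (A b z ∧ A z x)) ∷ # (λ z → A a z ∧ A z x) ∷ # (λ z → A b z ∧ A z x) ∷ # (λ z → A z x ∧ (not (A a z ∧ A z x) ∧ not (A b z ∧ A z x))) ∷ [])
      ((ν0 ⊹ ν1 ≋ ν2 ⊹ ν3 ⊹ ν4) ∷ (ν0 ≋ κ 6) ∷ (ν1 ≼ κ 2) ∷ (ν2 ≋ κ 4) ∷ (ν3 ≋ κ 4) ∷ []) ν4 (κ 0)
      (outside2 (λ z → A a z ∧ A z x) (λ z → A b z ∧ A z x) (λ z → A z x) (λ z → rgt) (λ z → rgt) , inn x · k6 ,
       (#-mono λ z e → and (lft (∧-fst {A a z ∧ A z x} e)) (lft (∧-snd {A a z ∧ A z x} e))) » eq≤ c , tri p · P≡4 , tri q · P≡4)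
   double : ∀ {m} (R : Fin (2 * m) → Fin (2 * m) → Bool) (o : Fin m → Vec (Fin m) 3) (f : Fin m → V) → Table 2 R o → Fin (2 * m) → (∀ p i → f p ⟶ f (lookup (o p) i)) → IsomorphicTo A (Fin (2 * m)) R
   double R o f tb p₀ arcs = isoTable 2 R o f tws tb (sym k6) p₀ (λ { 0F → co-self ; 1F → tw-co })
    (λ { 0F 0F v e → refl ; 1F 1F v e → refl ; 0F 1F v e → ⊥-elim (Fb-≢ (tw-F v) e) ; 1F 0F v e → ⊥-elim (Fb-≢ (tw-F v) (sym e)) }) arcs
  module Two (a2 : a# ≡ 2) where
   opaque
    op : ∀ {y a b} → y ⟶ a → b ⟶ y → a ≢ b
    op p q refl = no2 p q
    -- `a# = 2` exhausts `rest`, so no odd vertex is left.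
    io : ∀ {x y z} → x ⟶ y → y ⟶ z → z ⟶ x ⊎ x ⟶ z
    io {x} {y} {z} p q = [ inj₁ , (λ f → [ inj₂ , (λ g → ⊥-elim (none f g)) ]′ (cases (A x z))) ]′ (cases (A z x)) where
     none : A z x ≡ false → A x z ≡ false → ⊥
     none f g = 1+n≰n (∃# z (and q (∧-intro {not (A z x)} (not-f f) (not-f g))) » eq≤ (+-cancelˡ-≡ 2 (# (Oddᵇ x y)) 0 (cong (_+ # (Oddᵇ x y)) (sym a2) · rest p)))
   module Seven (k6 : k ≡ 6) where
    opaque
     paths : ∀ {x y} → x ⟶ y → ∑ (λ z → β (A y z) * sq x z) ≡ 20
     paths {x} {y} p = (∑-cong λ z → β-split (A y z) (A z x) (sq x z)) · ∑-+ _ _ · +≡ (wsum (λ z → A y z ∧ A z x) (sq x) 4 (λ z e → tri (rgt e) · P4) · cong (_* 4) (tri p · P4))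
       (wsum (λ z → A y z ∧ not (A z x)) (sq x) 2 (λ z e → [ (λ r → t≢f r (not-t (rgt e))) , (λ r → sqA r · a2) ]′ (io p (lft e))) · cong (_* 2) (odd2 p)) where
      P4 : P ≡ 4
      P4 = +-cancelˡ-≡ 2 P 4 (P2 · k6)
     -- The sibling of y adjacent to y in neither direction is a twin.
     m1 : m# k ≡ 1
     m1 = let
         (x , y , p) = arc0
         (o1 , o₂ , a , b , n₁) = pair∃ (eq≥ (coA p · a2))
         (i1 , i2 , c , e , n₂) = pair∃ (eq≥ (sqA p · a2))
         (v , pv , m₀ , m₁ , m₂ , m₃ , m₄ , _) = fresh (y ∷ o1 ∷ o₂ ∷ i1 ∷ i2 ∷ []) (eq≥ (out x · k6))
      in go p (lft a) (rgt a) (lft b) (rgt b) n₁ (lft c) (rgt c) (lft e) (rgt e) n₂ pv (m₀ ∘ sym) (m₁ ∘ sym) (m₂ ∘ sym) (m₃ ∘ sym) (m₄ ∘ sym) where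
      go : ∀ {x y o1 o₂ i1 i2 v} → x ⟶ y → x ⟶ o1 → y ⟶ o1 → x ⟶ o₂ → y ⟶ o₂ → o1 ≢ o₂ → x ⟶ i1 → i1 ⟶ y → x ⟶ i2 → i2 ⟶ y → i1 ≢ i2 → x ⟶ v → y ≢ v → o1 ≢ v → o₂ ≢ v → i1 ≢ v → i2 ≢ v → m# k ≡ 1
      go {x} {y} {o1} {o₂} {i1} {i2} {v} p a a' b b' n₁ c c' e e' n₂ pv m₀ m₁ m₂ m₃ m₄ = sym (m≡ k p) · ≤-antisym (#≤1 λ q r → only q · sym (only r)) (∃# v (and pv (Fb-intro cv (m₀ ∘ sym)))) where
       ds : Distinct (y ∷ o1 ∷ o₂ ∷ i1 ∷ i2 ∷ v ∷ [])
       ds = (A-irr a' , A-irr b' , A-irr c' ∘ sym , A-irr e' ∘ sym , m₀ , tt) , (n₁ , op a' c' , op a' e' , m₁ , tt) , (op b' c' , op b' e' , m₂ , tt) , (n₂ , m₃ , tt) , (m₄ , tt) , tt , tt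
       out1 : ∀ {u} → y ⟶ u → co u y ≡ 2
       out1 {u} r = co-sym u y · coA r · a2
       sum1 : 6 + (2 + (2 + (2 + (2 + co v y)))) ≡ 20
       sum1 = sym (∑-enum {P = A x} (toEnum {P = A x} (y ∷ o1 ∷ o₂ ∷ i1 ∷ i2 ∷ v ∷ []) ds (p , a , b , c , e , pv , tt) (eq≤ (out x · k6))) (λ u → co u y) · ∑6 _ ·
         +≡ (co-self y · k6) (+≡ (out1 a') (+≡ (out1 b') (+≡ (coA c' · a2) (cong (_+ co v y) (coA e' · a2)))))) · twoPaths x y · paths p
       cv : co v y ≡ k
       cv = +-cancelˡ-≡ 14 _ 6 sum1 · sym k6
       only : ∀ {u} → A x u ∧ Fb k u y ≡ true → u ≡ v
       only {u} q = pick (member {P = A x} (y ∷ o1 ∷ o₂ ∷ i1 ∷ i2 ∷ v ∷ []) ds (p , a , b , c , e , pv , tt) (eq≤ (out x · k6)) (lft q)) where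
        bad : ∀ {Z : Set} → co u y ≡ 2 → Z
        bad r = ⊥-elim (2≢6 (sym r · Fb-co (rgt q) · k6))
        pick : In u (y ∷ o1 ∷ o₂ ∷ i1 ∷ i2 ∷ v ∷ []) → u ≡ v
        pick (inj₁ r) = ⊥-elim (Fb-≢ (rgt q) r)
        pick (in1 refl) = bad (out1 a')
        pick (in2 refl) = bad (out1 b')
        pick (in3 refl) = bad (coA c' · a2)
        pick (in4 refl) = bad (coA e' · a2)
        pick (in5 r) = r
     f1 : F# k ≡ 1
     f1 = *-cancelˡ-≡ (F# k) 1 k {{>-nonZero k>0}} (sym (k*m k) · cong (k *_) m1)
    open Twins k6 f1
    -- A directed triangle among the out-neighbours of `x` and, for each of its vertices, a missed
    -- in-neighbour of `x`. With `x` these represent seven twin classes; `turn` rotates the indices,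
    -- so each kind of arc is proved once.
    record Tri (x y₀ y₁ y₂ z0 z1 z₂ : V) : Set where
     constructor trig
     field
      x0 : x ⟶ y₀
      x1 : x ⟶ y₁
      x2 : x ⟶ y₂
      y01 : y₀ ⟶ y₁
      y12 : y₁ ⟶ y₂
      y20 : y₂ ⟶ y₀
      z0x : z0 ⟶ x
      z1x : z1 ⟶ x
      z2x : z₂ ⟶ x
      miss0 : A y₀ z0 ≡ false
      m11 : A y₁ z1 ≡ false
      miss₂ : A y₂ z₂ ≡ false
    turn : ∀ {x y₀ y₁ y₂ z0 z1 z₂} → Tri x y₀ y₁ y₂ z0 z1 z₂ → Tri x y₁ y₂ y₀ z1 z₂ z0
    turn (trig a b c d' e f g h i j l m) = trig b c a e f d' h i g l m j
    opaque
     toNext : ∀ {x y₀ y₁ y₂ z0 z1 z₂} → Tri x y₀ y₁ y₂ z0 z1 z₂ → y₁ ⟶ z0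
     toNext T = hitOr x0 x1 (coA y01 · a2) z0x miss0 where open Tri T
     toPrev : ∀ {x y₀ y₁ y₂ z0 z1 z₂} → Tri x y₀ y₁ y₂ z0 z1 z₂ → y₂ ⟶ z0
     toPrev {y₀ = y₀} {y₂ = y₂} T = hitOr x0 x2 (co-sym y₀ y₂ · coA y20 · a2) z0x miss0 where open Tri T
     zy : ∀ {x y₀ y₁ y₂ z0 z1 z₂} → Tri x y₀ y₁ y₂ z0 z1 z₂ → z0 ⟶ y₀
     zy T = elimˡ (λ r → t≢f r miss0) (io z0x x0) where open Tri T
     zz : ∀ {x y₀ y₁ y₂ z0 z1 z₂} → Tri x y₀ y₁ y₂ z0 z1 z₂ → z0 ⟶ z₂
     zz {y₁ = y₁} {z₂ = z₂} T = elimˡ (λ r → no2 x2 (twin-out (co-sym _ _ · co-pin (coA y1z2 · a2) y12 (zy (turn (turn T))) (toNext T) r) z0x)) (io (zy T) (toNext (turn (turn T)))) where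
      open Tri T
      y1z2 : y₁ ⟶ z₂
      y1z2 = toPrev (turn (turn T))
     tri∃ : ∀ x → ∃ λ y₀ → ∃₂ λ y₁ y₂ → ∃ λ z0 → ∃₂ λ z1 z₂ → Tri x y₀ y₁ y₂ z0 z1 z₂
     tri∃ x = let
         (y₀ , x0) = has-out x
         (y₁ , x1 , y01) = succ∃ (≥1 a2) x0
         (y₂ , x2 , y12) = succ∃ (≥1 a2) x1
         (z0 , z0x , miss0) = missed x0
         (z1 , z1x , m11) = missed x1
         (z₂ , z2x , miss₂) = missed x2
         y20 = elimʳ (λ r → 2≢k (coA y12 · a2) (co-pin (coA x0 · a2) x1 y01 x2 r)) (io y01 y12)
      in y₀ , y₁ , y₂ , z0 , z1 , z₂ , trig x0 x1 x2 y01 y12 y20 z0x z1x z2x miss0 m11 miss₂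
    R14 : Fin 14 → Fin 14 → Bool
    R14 = CayZ 14 (1 ∷ 2 ∷ 4 ∷ 8 ∷ 9 ∷ 11 ∷ [])
    opaque
     result : IsomorphicTo A (Fin 14) R14
     result = go (snd (snd (snd (snd (snd (snd (tri∃ x₀))))))) where
      go : ∀ {x y₀ y₁ y₂ z0 z1 z₂} → Tri x y₀ y₁ y₂ z0 z1 z₂ → IsomorphicTo A (Fin 14) R14
      go {x} {y₀} {y₁} {y₂} {z0} {z1} {z₂} T = double R14 o f (from-yes (table? 2 R14 o)) 0F arcs where
       o : Fin 7 → Vec (Fin 7) 3
       o = shifts 7 (1 ∷ 2 ∷ 4 ∷ [])
       -- `turn` acts as multiplication by 2 on ℤ₇: the three `y` sit at 1, 2, 4 and each `z` at the
       -- negative of the `y` that misses it.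
       f : Fin 7 → V
       f = lookup (x ∷ y₀ ∷ y₁ ∷ z₂ ∷ y₂ ∷ z1 ∷ z0 ∷ [])
       T1 : Tri x y₁ y₂ y₀ z1 z₂ z0
       T1 = turn T
       T₂ : Tri x y₂ y₀ y₁ z₂ z0 z1
       T₂ = turn T1
       arcs : ∀ p i → f p ⟶ f (lookup (o p) i)
       arcs 0F 0F = Tri.x0 T
       arcs 0F 1F = Tri.x1 T
       arcs 0F 2F = Tri.x2 T
       arcs 1F 0F = Tri.y01 T
       arcs 1F 1F = toNext T₂
       arcs 1F 2F = toPrev T1
       arcs 2F 0F = toPrev T₂
       arcs 2F 1F = Tri.y12 T
       arcs 2F 2F = toNext T
       arcs 3F 0F = zy T₂
       arcs 3F 1F = zz T₂
       arcs 3F 2F = Tri.z2x T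
       arcs 4F 0F = toNext T1
       arcs 4F 1F = toPrev T
       arcs 4F 2F = Tri.y20 T
       arcs 5F 0F = zz T1
       arcs 5F 1F = Tri.z1x T
       arcs 5F 2F = zy T1
       arcs 6F 0F = Tri.z0x T
       arcs 6F 1F = zy T
       arcs 6F 2F = zz T
   module Eleven (k5 : k ≡ 5) where
    R11 : Fin 11 → Fin 11 → Bool
    R11 = CayZ 11 (1 ∷ 3 ∷ 4 ∷ 5 ∷ 9 ∷ [])
    o11 : Fin 11 → Vec (Fin 11) 5
    o11 = shifts 11 (1 ∷ 3 ∷ 4 ∷ 5 ∷ 9 ∷ [])
    P3 : P ≡ 3
    P3 = +-cancelˡ-≡ 2 P 3 (P2 · k5)
    opaque
     three : ∀ {x y u v w} → x ⟶ y → x ⟶ u → y ⟶ u → x ⟶ v → y ⟶ v → x ⟶ w → y ⟶ w → u ≢ v → u ≢ w → v ≢ w → ⊥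
     three {x} {y} {u} {v} {w} p a b c d' e f n₁ n₂ n₃ = 1+n≰n (size≥ {P = λ z → A x z ∧ A y z} (u ∷ v ∷ w ∷ []) ((n₁ , n₂ , tt) , (n₃ , tt) , tt , tt) (and a b , and c d' , and e f , tt) » eq≤ (coA p · a2))
     -- `u` has two out-neighbours and two in-neighbours among the five out-neighbours of `x`, which
     -- accounts for all of them.
     tourn : ∀ {x u v} → x ⟶ u → x ⟶ v → u ≢ v → u ⟶ v ⊎ v ⟶ u
     tourn {x} {u} {v} p q ne =
      let (o1 , o₂ , a , b , n₁) = pair∃ (eq≥ (coA p · a2))
          (i1 , i2 , c , e , n₂) = pair∃ (eq≥ (sqA p · a2))
          uo1 = rgt a
          uo2 = rgt b
          ui1 = rgt c
          ui2 = rgt e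
      in go uo1 uo2 ui1 ui2 (member {P = A x} (u ∷ o1 ∷ o₂ ∷ i1 ∷ i2 ∷ []) ((A-irr uo1 , A-irr uo2 , A-irr ui1 ∘ sym , A-irr ui2 ∘ sym , tt) , (n₁ , op uo1 ui1 , op uo1 ui2 , tt) , (op uo2 ui1 , op uo2 ui2 , tt) , (n₂ , tt) , tt , tt)
           (p , lft a , lft b , lft c , lft e , tt) (eq≤ (out x · k5)) q) where
      go : ∀ {o1 o₂ i1 i2} → u ⟶ o1 → u ⟶ o₂ → i1 ⟶ u → i2 ⟶ u → In v (u ∷ o1 ∷ o₂ ∷ i1 ∷ i2 ∷ []) → u ⟶ v ⊎ v ⟶ u
      go a b c e (inj₁ refl) = ⊥-elim (ne refl)
      go a b c e (in1 refl) = inj₁ a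
      go a b c e (in2 refl) = inj₁ b
      go a b c e (in3 refl) = inj₂ c
      go a b c e (in4 refl) = inj₂ e
    record Pent (x : V) : Set where
     constructor pentagon
     field
      y0 y1 y2 y3 y4 : V
      x0 : x ⟶ y0
      x1 : x ⟶ y1
      x2 : x ⟶ y2
      x3 : x ⟶ y3
      x4 : x ⟶ y4
      r01 : y0 ⟶ y1
      r12 : y1 ⟶ y2
      r23 : y2 ⟶ y3
      r34 : y3 ⟶ y4
      r40 : y4 ⟶ y0
      r02 : y0 ⟶ y2
      r13 : y1 ⟶ y3
      r24 : y2 ⟶ y4
      r30 : y3 ⟶ y0
      r41 : y4 ⟶ y1
    opaque
     pent : ∀ x → Pent x
     pent x =
      let (y0 , p0) = has-out x
          (u , v , a , b , n₁) = pair∃ (eq≥ (coA p0 · a2))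
          (s , t' , c , e , n₂) = pair∃ (eq≥ (sqA p0 · a2))
      in ord p0 (lft a) (rgt a) (lft b) (rgt b) (lft c) (rgt c) (lft e) (rgt e) n₁ n₂ where
      fin : ∀ {y0 y1 y2 y3 y4} → x ⟶ y0 → x ⟶ y1 → x ⟶ y2 → x ⟶ y3 → x ⟶ y4 → y0 ⟶ y1 → y0 ⟶ y2 → y3 ⟶ y0 → y4 ⟶ y0 → y1 ⟶ y2 → y3 ⟶ y4 → Pent x
      fin {y0} {y1} {y2} {y3} {y4} p0 p1 p2 p3 p4 r01 r02 r30 r40 r12 r34 = pentagon y0 y1 y2 y3 y4 p0 p1 p2 p3 p4 r01 r12 r23 r34 r40 r02 r13 r24 r30 r41 where
       r13 : y1 ⟶ y3
       r13 = elimʳ (λ q → three p3 p4 r34 p0 r30 p1 q (A-irr r40) (op r01 r40 ∘ sym) (A-irr r01)) (tourn p1 p3 (op r01 r30))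
       r41 : y4 ⟶ y1
       r41 = elimˡ (λ q → three p1 p2 r12 p3 r13 p4 q (op r02 r30) (op r02 r40) (A-irr r34)) (tourn p1 p4 (op r01 r40))
       r23 : y2 ⟶ y3
       r23 = elimʳ (λ q → three p3 p4 r34 p0 r30 p2 q (A-irr r40) (op r02 r40 ∘ sym) (A-irr r02)) (tourn p2 p3 (op r02 r30))
       r24 : y2 ⟶ y4
       r24 = elimʳ (λ q → three p4 p0 r40 p1 r41 p2 q (A-irr r01) (A-irr r02) (A-irr r12)) (tourn p2 p4 (op r02 r40))
      ord : ∀ {y0 u v s t} → x ⟶ y0 → x ⟶ u → y0 ⟶ u → x ⟶ v → y0 ⟶ v → x ⟶ s → s ⟶ y0 → x ⟶ t → t ⟶ y0 → u ≢ v → s ≢ t → Pent x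
      ord p0 pu ru pv rv ps rs pt rt n₁ n₂ = [ (λ uv → [ (λ st → fin p0 pu pv ps pt ru rv rs rt uv st) , (λ ts → fin p0 pu pv pt ps ru rv rt rs uv ts) ]′ (tourn ps pt n₂)) ,
       (λ vu → [ (λ st → fin p0 pv pu ps pt rv ru rs rt vu st) , (λ ts → fin p0 pv pu pt ps rv ru rt rs vu ts) ]′ (tourn ps pt n₂)) ]′ (tourn pu pv n₁)
    open Pent
    turn turn² turn³ turn⁴ : ∀ {x} → Pent x → Pent x
    turn (pentagon a b c d e f g h i j k l m n o p q r s t) = pentagon b c d e a g h i j f l m n o k q r s t p
    turn² T = turn (turn T)
    turn³ T = turn (turn² T)
    turn⁴ T = turn (turn³ T)
    opaque
     ally : ∀ {x t} (T : Pent x) → x ⟶ t → In t (y0 T ∷ y1 T ∷ y2 T ∷ y3 T ∷ y4 T ∷ [])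
     ally {x} T = member {P = A x} (y0 T ∷ y1 T ∷ y2 T ∷ y3 T ∷ y4 T ∷ []) ((A-irr (r01 T) , A-irr (r02 T) , A-irr (r30 T) ∘ sym , A-irr (r40 T) ∘ sym , tt) , (A-irr (r12 T) , A-irr (r13 T) , A-irr (r41 T) ∘ sym , tt) , (A-irr (r23 T) , A-irr (r24 T) , tt) , (A-irr (r34 T) , tt) , tt , tt)
      (x0 T , x1 T , x2 T , x3 T , x4 T , tt) (eq≤ (out x · k5))
     -- `y1` and `y4` each lead to three of the five in-neighbours of `x` and share two, so exactly
     -- one is missed by both.
     zed : ∀ {x} (T : Pent x) → ∃ λ z → z ⟶ x × A (y1 T) z ≡ false × A (y4 T) z ≡ false
     zed {x} T = let (z , e) = #∃ one1 in z , lft e , miss {A (y1 T) z} (lft e) (not-t (∧-snd {not (A (y4 T) z ∧ A z x)} (rgt e))) , miss {A (y4 T) z} (lft e) (not-t (∧-fst {not (A (y4 T) z ∧ A z x)} (rgt e))) where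
      miss : ∀ {a b} → b ≡ true → a ∧ b ≡ false → a ≡ false
      miss {false} _ _ = refl
      miss {true} refl ()
      low : ∀ {t} → y4 T ⟶ t → y1 T ⟶ t → t ⟶ x
      low p q = elimʳ (λ r → bad p q (ally T r)) (io (x4 T) p) where
       bad : ∀ {t} → y4 T ⟶ t → y1 T ⟶ t → In t (y0 T ∷ y1 T ∷ y2 T ∷ y3 T ∷ y4 T ∷ []) → ⊥
       bad p q (inj₁ refl) = no2 q (r01 T)
       bad p q (in1 refl) = A-irr q refl
       bad p q (in2 refl) = no2 p (r24 T)
       bad p q (in3 refl) = no2 p (r34 T)
       bad p q (in4 refl) = A-irr p refl
      two2 : # (λ z → (A (y4 T) z ∧ A z x) ∧ (A (y1 T) z ∧ A z x)) ≡ 2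
      two2 = (#-cong λ z → iff (λ e → and (lft (∧-fst {A (y4 T) z ∧ A z x} e)) (lft (∧-snd {A (y4 T) z ∧ A z x} e)))
        (λ e → let zx = low (lft e) (rgt e) in ∧-intro {A (y4 T) z ∧ A z x} (and (lft e) zx) (and (rgt e) zx))) · coA (r41 T) · a2
      one1 : 1 ≤ # (λ z → A z x ∧ (not (A (y4 T) z ∧ A z x) ∧ not (A (y1 T) z ∧ A z x)))
      one1 = lia≤ (# (λ z → A z x) ∷ # (λ z → (A (y4 T) z ∧ A z x) ∧ (A (y1 T) z ∧ A z x)) ∷ # (λ z → A (y4 T) z ∧ A z x) ∷ # (λ z → A (y1 T) z ∧ A z x) ∷ # (λ z → A z x ∧ (not (A (y4 T) z ∧ A z x) ∧ not (A (y1 T) z ∧ A z x))) ∷ [])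
       ((ν0 ⊹ ν1 ≋ ν2 ⊹ ν3 ⊹ ν4) ∷ (ν0 ≋ κ 5) ∷ (ν1 ≋ κ 2) ∷ (ν2 ≋ κ 3) ∷ (ν3 ≋ κ 3) ∷ []) (κ 1) ν4
       (outside2 (λ z → A (y4 T) z ∧ A z x) (λ z → A (y1 T) z ∧ A z x) (λ z → A z x) (λ z → rgt) (λ z → rgt) , inn x · k5 , two2 , tri (x4 T) · P3 , tri (x1 T) · P3)
    ζ : ∀ {x} → Pent x → V
    ζ T = fst (zed T)
    opaque
     zx : ∀ {x} (T : Pent x) → ζ T ⟶ x
     zx T = fst (snd (zed T))
     g1 : ∀ {x} (T : Pent x) → ζ T ⟶ y1 T
     g1 T = elimˡ (λ r → t≢f r (fst (snd (snd (zed T))))) (io (zx T) (x1 T))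
     g4 : ∀ {x} (T : Pent x) → ζ T ⟶ y4 T
     g4 T = elimˡ (λ r → t≢f r (snd (snd (snd (zed T))))) (io (zx T) (x4 T))
     hit0 : ∀ {x t} (T : Pent x) → x ⟶ t → y1 T ≢ t → y4 T ≢ t → t ⟶ ζ T
     hit0 T p n m = elimʳ (λ r → three (zx T) (g1 T) (x1 T) (g4 T) (x4 T) r p (op (r34 T) (r13 T) ∘ sym) n m) (io (zx T) p)
     h0 : ∀ {x} (T : Pent x) → y0 T ⟶ ζ T
     h0 T = hit0 T (x0 T) (A-irr (r01 T) ∘ sym) (A-irr (r40 T))
     h2 : ∀ {x} (T : Pent x) → y2 T ⟶ ζ T
     h2 T = hit0 T (x2 T) (A-irr (r12 T)) (A-irr (r24 T) ∘ sym)
     h3 : ∀ {x} (T : Pent x) → y3 T ⟶ ζ T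
     h3 T = hit0 T (x3 T) (A-irr (r13 T)) (A-irr (r34 T) ∘ sym)
     f2 : ∀ {x} (T : Pent x) → ζ T ⟶ ζ (turn² T) → ⊥
     f2 {x} T e = let (u , v , a , b , ne) = pair∃ (eq≥ (coA (g1 T) · a2)) in
       1+n≰n (size≥ {P = A (ζ T)} (x ∷ y1 T ∷ y4 T ∷ ζ (turn² T) ∷ u ∷ v ∷ []) ((A-irr (x1 T) , A-irr (x4 T) , A-irr (zx (turn² T)) ∘ sym , op' (x1 T) (rgt a) , op' (x1 T) (rgt b) , tt) ,
        (A-irr (r41 T) ∘ sym , op (x1 T) (zx (turn² T)) , A-irr (rgt a) , A-irr (rgt b) , tt) , (op (x4 T) (zx (turn² T)) , op' (r41 T) (rgt a) , op' (r41 T) (rgt b) , tt) , (op' (g4 (turn² T)) (rgt a) , op' (g4 (turn² T)) (rgt b) , tt) , (ne , tt) , tt , tt)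
        (zx T , g1 T , g4 T , e , lft a , lft b , tt) » eq≤ (out (ζ T) · k5)) where
      op' : ∀ {y a b} → a ⟶ y → y ⟶ b → a ≢ b
      op' p q refl = no2 p q
     z3 : ∀ {x} (T : Pent x) → ζ T ⟶ ζ (turn³ T)
     z3 T = let (t , e , n , _) = fresh (y1 T ∷ []) (eq≥ (coA (h0 T) · a2)) in go n (rgt e) (member {P = A (y0 T)} (y1 T ∷ y2 T ∷ ζ T ∷ ζ (turn² T) ∷ ζ (turn³ T) ∷ [])
       ((A-irr (r12 T) , op (x1 T) (zx T) , op (x1 T) (zx (turn² T)) , op (x1 T) (zx (turn³ T)) , tt) , (op (x2 T) (zx T) , op (x2 T) (zx (turn² T)) , op (x2 T) (zx (turn³ T)) , tt) ,
        (op (h2 (turn² T)) (g4 T) ∘ sym , op (h3 (turn³ T)) (g1 T) ∘ sym , tt) , (op (h0 (turn³ T)) (g1 (turn² T)) ∘ sym , tt) , tt , tt)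
       (r01 T , r02 T , h0 T , h3 (turn² T) , h2 (turn³ T) , tt) (eq≤ (out (y0 T) · k5)) (lft e)) where
      go : ∀ {t} → t ≢ y1 T → ζ T ⟶ t → In t (y1 T ∷ y2 T ∷ ζ T ∷ ζ (turn² T) ∷ ζ (turn³ T) ∷ []) → ζ T ⟶ ζ (turn³ T)
      go n e (inj₁ r) = ⊥-elim (n r)
      go n e (in1 refl) = ⊥-elim (no2 e (h2 T))
      go n e (in2 refl) = ⊥-elim (A-irr e refl)
      go n e (in3 refl) = ⊥-elim (f2 T e)
      go n e (in4 refl) = e
     f1 : ∀ {x} (T : Pent x) → ζ T ⟶ ζ (turn T) → ⊥
     f1 T e = three (h3 T) (r34 T) (g4 T) (h0 (turn³ T)) (z3 T) (h2 (turn T)) e (op (x4 T) (zx (turn³ T))) (op (x4 T) (zx (turn T))) (op (h2 (turn³ T)) (g4 (turn T)))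
     z4 : ∀ {x} (T : Pent x) → ζ T ⟶ ζ (turn⁴ T)
     z4 T = elimʳ (λ r → f1 (turn⁴ T) r) (io (g1 (turn⁴ T)) (h0 T))
     result : IsomorphicTo A (Fin 11) R11
     result = go (pent x₀) where
      go : ∀ {x} → Pent x → IsomorphicTo A (Fin 11) R11
      go {x} T = isoTable 1 R11 o11 f (λ _ v → v) (from-yes (table? 1 R11 o11)) (sym k5) 0F (λ _ → co-self) (λ { 0F 0F _ _ → refl }) arcs where
       T₁ T₂ T₃ T₄ : Pent x
       T₁ = turn T
       T₂ = turn² T
       T₃ = turn³ T
       T₄ = turn⁴ T
       -- `turn` acts as multiplication by 4 on ℤ₁₁: the pentagon sits at 1, 4, 5, 9, 3, and `ζ` of
       -- each rotation at the negative of the leading vertex of that rotation.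
       f : Fin 11 → V
       f = lookup (x ∷ y0 T ∷ ζ T₃ ∷ y4 T ∷ y1 T ∷ y2 T ∷ ζ T₂ ∷ ζ T₁ ∷ ζ T₄ ∷ y3 T ∷ ζ T ∷ [])
       arcs : ∀ p j → f p ⟶ f (lookup (o11 p) j)
       arcs 0F 0F = x0 T
       arcs 0F 1F = x4 T
       arcs 0F 2F = x1 T
       arcs 0F 3F = x2 T
       arcs 0F 4F = x3 T
       arcs 1F 0F = h2 T₃
       arcs 1F 1F = r01 T
       arcs 1F 2F = r02 T
       arcs 1F 3F = h3 T₂
       arcs 1F 4F = h0 T
       arcs 2F 0F = g1 T₃
       arcs 2F 1F = g4 T₃
       arcs 2F 2F = z4 T₃
       arcs 2F 3F = z3 T₃
       arcs 2F 4F = zx T₃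
       arcs 3F 0F = r41 T
       arcs 3F 1F = h2 T₂
       arcs 3F 2F = h3 T₁
       arcs 3F 3F = h0 T₄
       arcs 3F 4F = r40 T
       arcs 4F 0F = r12 T
       arcs 4F 1F = h0 T₁
       arcs 4F 2F = h2 T₄
       arcs 4F 3F = r13 T
       arcs 4F 4F = h3 T₃
       arcs 5F 0F = h0 T₂
       arcs 5F 1F = h3 T₄
       arcs 5F 2F = r23 T
       arcs 5F 3F = h2 T
       arcs 5F 4F = r24 T
       arcs 6F 0F = z4 T₂
       arcs 6F 1F = g1 T₂
       arcs 6F 2F = z3 T₂
       arcs 6F 3F = zx T₂
       arcs 6F 4F = g4 T₂
       arcs 7F 0F = z3 T₁
       arcs 7F 1F = z4 T₁
       arcs 7F 2F = zx T₁
       arcs 7F 3F = g4 T₁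
       arcs 7F 4F = g1 T₁
       arcs 8F 0F = g4 T₄
       arcs 8F 1F = zx T₄
       arcs 8F 2F = g1 T₄
       arcs 8F 3F = z4 T₄
       arcs 8F 4F = z3 T₄
       arcs 9F 0F = h3 T
       arcs 9F 1F = r30 T
       arcs 9F 2F = h0 T₃
       arcs 9F 3F = r34 T
       arcs 9F 4F = h2 T₁
       arcs (suc 9F) 0F = zx T
       arcs (suc 9F) 1F = z3 T
       arcs (suc 9F) 2F = g4 T
       arcs (suc 9F) 3F = g1 T
       arcs (suc 9F) 4F = z4 T

  -- No transitive triangles: siblings sorted by two-way distance

  module Zero (az : a# ≡ 0) where
   opaque
    a0 : ∀ {x y z} → x ⟶ y → y ⟶ z → x ⟶ z → ⊥
    a0 {x} {y} {z} p q r = 1+n≰n (∃# z (and r q) » eq≤ (coA p · az))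
   Odd : V → V → V → Bool
   Odd x y z = A y z ∧ not (A z x)
   opaque
    odd-d : ∀ {x y z} → x ⟶ y → Odd x y z ≡ true → d x z ≡ 2
    odd-d {x} {y} {z} p o = go (d x z) refl (d≤2 p (lft o)) where
     go : ∀ m → d x z ≡ m → m ≤ 2 → d x z ≡ 2
     go 0 e _ = ⊥-elim (no2 p (subst (y ⟶_) (sym (d≡0 e)) (lft o)))
     go 1 e _ = ⊥-elim (a0 p (lft o) (d⇒A e))
     go 2 e _ = e
     go (3+ _) e (≤2+ ())
    -- N⁺(z) contains the disjoint sets N⁺(y) ∩ N⁺(z), N⁺(z) ∩ N⁻(u) and N⁺(z) ∩ N⁻(y).
    co+sq : ∀ {y u z} → y ⟶ u → Odd y u z ≡ true → co y z + sq z y ≤ 2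
    co+sq {y} {u} {z} p o = +-cancelˡ-≤ P _ 2 (eq≥ (+-assoc P (co y z) (sq z y)) » ((≤-trans (+-monoˡ-≤ (sq z y) (eq≤ (cong (_+ co y z) (sym (tri uz))) » disj2 (λ v → A z v ∧ A v u) (λ v → A y v ∧ A z v) (λ v → A z v ∧ not (A v y)) h1 h₂ h₃))
        (disj2 (λ v → A z v ∧ not (A v y)) (λ v → A z v ∧ A v y) (A z) (λ v → lft) (λ v → lft) (λ v a b → t≢f (rgt b) (not-t (rgt a))))) » eq≤ (out z · sym P2 · +-comm 2 P))) where
     uz : u ⟶ z
     uz = lft o
     h1 : ∀ v → A z v ∧ A v u ≡ true → A z v ∧ not (A v y) ≡ true
     h1 v e = and (lft e) (not-f (¬t λ q → a0 q p (rgt e)))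
     h₂ : ∀ v → A y v ∧ A z v ≡ true → A z v ∧ not (A v y) ≡ true
     h₂ v e = and (rgt e) (not-f (¬t λ q → no2 q (lft e)))
     h₃ : ∀ v → A z v ∧ A v u ≡ true → A y v ∧ A z v ≡ true → ⊥
     h₃ v e f = a0 (lft f) (rgt e) p
    -- The `P` vertices between `u` and `v` either precede `y`, and are then common in-neighbours of
    -- `y` and `v`, or are odd over (y , u).
    rule : ∀ {y u v} → y ⟶ u → v ⟶ u → P ≤ co y v + # (λ z → Odd y u z ∧ A z v)
    rule {y} {u} {v} p q = eq≥ (tri q) » (∑-mono λ z → aux (A u z) (A z v) (A z y)) » eq≤ (∑-+ _ _) » +-monoˡ-≤ _ (eq≥ (co-in y v)) where
     aux : ∀ a b c → β (a ∧ b) ≤ β (c ∧ b) + β ((a ∧ not c) ∧ b)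
     aux true true true = z<s
     aux true true false = z<s
     aux true false c = z≤n
     aux false b c = z≤n
    -- With `co y z = 2`, every out-neighbour of `z` precedes `u` or follows `y`. The `P` vertices
    -- between `z` and `u'` cannot follow `y`, so they precede `u`, and so does `y`.
    twoMids : ∀ {y z u u'} → co y z ≡ 2 → y ⟶ u → Odd y u z ≡ true → y ⟶ u' → u' ⟶ z → suc P ≤ co u u'
    twoMids {y} {z} {u} {u'} c2 p o p' uz' = (eq≤ (+≡ (sym one1) (sym (tri uz'))) » (disj2 (λ v → v == y) (λ v → A z v ∧ A v u') (λ v → A v u ∧ A v u') (λ v e → subst (λ w → A w u ∧ A w u' ≡ true) (sym (==⇒≡ e)) (and p p')) h₂
        (λ v e f → t≢f (subst (z ⟶_) (==⇒≡ e) (lft f)) (not-t (rgt o))))) » eq≥ (co-in u u') where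
     one1 : # (λ v → v == y) ≡ 1
     one1 = (∑-cong λ z → sym (*-identityʳ _)) · ∑-pick' y (λ _ → 1)
     h₂ : ∀ v → A z v ∧ A v u' ≡ true → A v u ∧ A v u' ≡ true
     h₂ v e = and ([ (λ f → rgt f) , (λ f → ⊥-elim (a0 (lft f) (rgt e) p')) ]′
      (cover2 (λ v → A z v ∧ A v u) (λ v → A y v ∧ A z v) (A z) (λ v → lft) (λ v → rgt) (λ v a b → a0 (lft b) (rgt a) p)
       (eq≤ (out z · sym P2 · +-comm 2 P · sym (+≡ (tri (lft o)) c2))) (lft e))) (rgt e)
    sib-d : ∀ {x y y'} → x ⟶ y → x ⟶ y' → y ≢ y' → d y y' ≡ 2 ⊎ d y y' ≡ 3
    sib-d {x} {y} {y'} p q ne = go (d y y') refl (sib≤3 p q) where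
     go : ∀ m → d y y' ≡ m → m ≤ 3 → d y y' ≡ 2 ⊎ d y y' ≡ 3
     go 0 e _ = ⊥-elim (ne (d≡0 e))
     go 1 e _ = ⊥-elim (a0 p (d⇒A e) q)
     go 2 e _ = inj₁ e
     go 3 e _ = inj₂ e
     go (4+ _) e (≤3+ ())
    mid∃ : ∀ {x y v} → x ⟶ y → x ⟶ v → d y v ≡ 2 → ∃ λ m → y ⟶ m × Odd y m v ≡ true
    mid∃ {x} {y} {v} p q e = let (m , r , s) = first-step {y} {v} e in m , r , and (d⇒A s) (not-f (¬t λ a → a0 q a p))
   -- Siblings lie in the classes (2 , 2), (2 , 3), (3 , 2) and (3 , 3) by `sib-d`; this is their
   -- profile by class, as `m#` was by the value of `co`.
   n# : ℕ → ℕ → V → V → ℕ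
   n# a b x y = # (λ u → A x u ∧ Cb a b u y)
   e# : ℕ → V → V → ℕ
   e# b x y = # (λ z → Cb 2 b x z ∧ A y z)
   N# : ℕ → ℕ → ℕ
   N# a b = # (Cb a b x₀)
   nn : ℕ → ℕ → ℕ
   nn a b = n# a b ax ay
   ee : ℕ → ℕ
   ee b = e# b ax ay
   opaque
    n≡ : ∀ a b {x y} → x ⟶ y → n# a b x y ≡ nn a b
    n≡ a b {x} {y} p = sym (cnt (A x) (λ u → Cb a b u y)) · onA (Ax ⊗ cls a b) p axy · cnt (A _) (λ u → Cb a b u _)
    e≡ : ∀ b {x y} → x ⟶ y → e# b x y ≡ ee b
    e≡ b {x} {y} p = sym (cnt (Cb 2 b x) (A y)) · onA (cls 2 b ⊗ tr Ax) p axy · cnt (Cb 2 b _) (A _)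
    N≡ : ∀ a b x → # (Cb a b x) ≡ N# a b
    N≡ a b x = size (hit a b) x x₀
    kn : ∀ a b {p q} → Cb a b p q ≡ true → N# a b * co p q ≡ k * nn a b
    kn a b {p} {q} r = cong (_* co p q) (sym (N≡ a b p)) · sym (wsum (Cb a b p) (⟦ C ⟧ p) (co p q) (λ z s → on C s r · co≡ p q)) · ip-comm (cls a b) C p · sym (adj Ax (cls a b) Ax p) · rowA (cls a b ⊗ Ax) p · cong (k *_) ((comm (cls a b) Ax _ _) · cnt (A _) (λ u → Cb a b u _))
    ke : ∀ b {p q} → Cb 2 b p q ≡ true → N# 2 b * sq p q ≡ k * ee b
    ke b {p} {q} r = cong (_* sq p q) (sym (N≡ 2 b p)) · sym (wsum (Cb 2 b p) (⟦ Ax ⊗ Ax ⟧ p) (sq p q) (λ z s → on (Ax ⊗ Ax) s r · sq≡ p q)) · adj (cls 2 b) Ax Ax p · ip-comm (cls 2 b ⊗ tr Ax) Ax p · rowA (cls 2 b ⊗ tr Ax) p · cong (k *_) (cnt (Cb 2 b _) (A _))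
    -- A Aᵗ is symmetric, and transposition exchanges the two classes.
    n23≡n32 : nn 2 3 ≡ nn 3 2
    n23≡n32 = *-cancelˡ-≡ _ _ k {{>-nonZero k>0}} (sym (lhs 2 3) · mid · lhs 3 2) where
     lhs : ∀ a b → ⟨ C , cls a b ⟩ x₀ ≡ k * nn a b
     lhs a b = sym (adj Ax (cls a b) Ax x₀) · rowA (cls a b ⊗ Ax) x₀ · cong (k *_) ((comm (cls a b) Ax _ _) · cnt (A _) (λ u → Cb a b u _))
     mid : ⟨ C , cls 2 3 ⟩ x₀ ≡ ⟨ C , cls 3 2 ⟩ x₀
     mid = sym (ip-tr C (cls 2 3) x₀) · (∑-cong λ z → cong₂ _*_ (co≡ z x₀ · co-sym z x₀ · sym (co≡ x₀ z)) (cong β (hit-comm 2 3 (d z x₀) (d x₀ z))))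
   opaque
    unfolding hit
    part : ∀ {x y} → x ⟶ y → (h : V → ℕ) → ∑ (λ u → β (Sib x y u) * h u) ≡
           ∑ (λ u → β (A x u ∧ Cb 2 2 u y) * h u) + (∑ (λ u → β (A x u ∧ Cb 2 3 u y) * h u) + (∑ (λ u → β (A x u ∧ Cb 3 2 u y) * h u) + ∑ (λ u → β (A x u ∧ Cb 3 3 u y) * h u)))
    part {x} {y} p h = (∑-cong λ u → aux u (cases (A x u)) (u F.≟ y)) · ∑-+ _ _ · cong (∑ (λ u → β (A x u ∧ Cb 2 2 u y) * h u) +_) (∑-+ _ _ · cong (∑ (λ u → β (A x u ∧ Cb 2 3 u y) * h u) +_) (∑-+ _ _)) where
     val : ∀ a b c e (m : ℕ) → (c ≡ 2 ⊎ c ≡ 3) → (e ≡ 2 ⊎ e ≡ 3) → a ≡ c → b ≡ e → m ≡ β ((a ≡ᵇ 2) ∧ (b ≡ᵇ 2)) * m + (β ((a ≡ᵇ 2) ∧ (b ≡ᵇ 3)) * m + (β ((a ≡ᵇ 3) ∧ (b ≡ᵇ 2)) * m + β ((a ≡ᵇ 3) ∧ (b ≡ᵇ 3)) * m))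
     val _ _ _ _ m (inj₁ refl) (inj₁ refl) refl refl = sym (+-identityʳ _ · +-identityʳ _)
     val _ _ _ _ m (inj₁ refl) (inj₂ refl) refl refl = sym (+-identityʳ _ · +-identityʳ _)
     val _ _ _ _ m (inj₂ refl) (inj₁ refl) refl refl = sym (+-identityʳ _ · +-identityʳ _)
     val _ _ _ _ m (inj₂ refl) (inj₂ refl) refl refl = sym (+-identityʳ _)
     aux : ∀ u → (x ⟶ u) ⊎ (A x u ≡ false) → Dec (u ≡ y) → β (Sib x y u) * h u ≡ β (A x u ∧ Cb 2 2 u y) * h u + (β (A x u ∧ Cb 2 3 u y) * h u + (β (A x u ∧ Cb 3 2 u y) * h u + β (A x u ∧ Cb 3 3 u y) * h u))
     aux u (inj₂ f) _ rewrite f = refl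
     aux u (inj₁ t') (yes refl) rewrite t' | d-refl u = refl
     aux u (inj₁ t') (no ne) = cong (_* h u) (β1 (Sib-intro t' ne)) · +-identityʳ _ · val (d u y) (d y u) (d u y) (d y u) (h u) (sib-d t' p ne) (sib-d p t' (ne ∘ sym)) refl refl · cong (λ b → β (b ∧ Cb 2 2 u y) * h u + (β (b ∧ Cb 2 3 u y) * h u + (β (b ∧ Cb 3 2 u y) * h u + β (b ∧ Cb 3 3 u y) * h u))) (sym t')
   opaque
    n-sum : 1 + (nn 2 2 + (nn 2 3 + (nn 2 3 + nn 3 3))) ≡ k
    n-sum = let (x , y , p) = arc0 in cong suc (cong (λ m → nn 2 2 + (nn 2 3 + (m + nn 3 3))) n23≡n32 · sym ((∑-cong λ u → sym (*-identityʳ _)) · part p (λ _ → 1) · (+≡ (id1 2 2) (+≡ (id1 2 3) (+≡ (id1 3 2) (id1 3 3)))))) · Sib# p where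
     id1 : ∀ a b → ∑ (λ u → β (A ax u ∧ Cb a b u ay) * 1) ≡ nn a b
     id1 a b = ∑-cong λ u → *-identityʳ _
    -- Two-paths over an arc, sorted by the class of the sibling and by the class of the end.
    co-sum : ∀ {x y} → x ⟶ y → ∀ c22 c23 c33 → (∀ {p q} → Cb 2 2 p q ≡ true → co p q ≡ c22) → (∀ {p q} → Cb 2 3 p q ≡ true → co p q ≡ c23) → (∀ {p q} → Cb 3 3 p q ≡ true → 1 ≤ co p q → co p q ≡ c33) →
             k + (nn 2 2 * c22 + (nn 2 3 * c23 + (nn 2 3 * c23 + nn 3 3 * c33))) ≡ P * P + ∑ (λ z → β (Odd x y z) * sq x z)
    co-sum {x} {y} p c22 c23 c33 h22 h23 h33 = trans (+≡ (sym (co-self y)) (sym (part p (λ u → co u y) · (cong₂ _+_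
        (wsum (λ u → A x u ∧ Cb 2 2 u y) (λ u → co u y) c22 (λ u e → h22 (rgt e)) · cong (_* c22) (n≡ 2 2 p))
        (+≡ (wsum (λ u → A x u ∧ Cb 2 3 u y) (λ u → co u y) c23 (λ u e → h23 (rgt e)) · cong (_* c23) (n≡ 2 3 p))
        (+≡ (wsum (λ u → A x u ∧ Cb 3 2 u y) (λ u → co u y) c23 (λ u e → co-sym u y · h23 (flip1 u (rgt e))) · cong (_* c23) (n≡ 3 2 p · sym n23≡n32))
                   (wsum (λ u → A x u ∧ Cb 3 3 u y) (λ u → co u y) c33 (λ u e → h33 (rgt e) (sib-co (lft e) p)) · cong (_* c33) (n≡ 3 3 p))))))))
     (sym (self-split p (λ u → co u y)) · twoPaths x y · (∑-cong λ z → β-split (A y z) (A z x) (sq x z)) · ∑-+ _ _ · cong (_+ ∑ (λ z → β (Odd x y z) * sq x z)) (wsum (λ z → A y z ∧ A z x) (sq x) P (λ z e → tri (rgt e)) · cong (_* P) (tri p))) where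
     flip1 : ∀ u → Cb 3 2 u y ≡ true → Cb 2 3 y u ≡ true
     flip1 u e = Cb-intro (Cb-snd e) (Cb-fst e)
    -- A common out-neighbour u0 of y and z makes every midpoint of (y , z) a sibling of u0 at distance two.
    mids≤ : ∀ {y u z u0} → y ⟶ u → Odd y u z ≡ true → y ⟶ u0 → z ⟶ u0 → sq y z ≤ nn 2 2 + nn 2 3
    mids≤ {y} {u} {z} {u0} p o p₀ q0 = #-mono h » (∑-mono λ m → aux (A y m) (Cb 2 2 m u0) (Cb 2 3 m u0)) » eq≤ (∑-+ _ _ · (+≡ (n≡ 2 2 p₀) (n≡ 2 3 p₀))) where
     aux : ∀ a b c → β (a ∧ (b ∨ c)) ≤ β (a ∧ b) + β (a ∧ c)
     aux true true c = z<s
     aux true false c = ≤-refl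
     aux false b c = z≤n
     or1 : ∀ {a b} → a ≡ true → a ∨ b ≡ true
     or1 refl = refl
     or2 : ∀ a {b} → b ≡ true → a ∨ b ≡ true
     or2 true _ = refl
     or2 false r = r
     h : ∀ m → A y m ∧ A m z ≡ true → A y m ∧ (Cb 2 2 m u0 ∨ Cb 2 3 m u0) ≡ true
     h m e = and (lft e) (go (sib-d p₀ (lft e) (ne ∘ sym))) where
      ne : m ≢ u0
      ne refl = no2 q0 (rgt e)
      d2 : d m u0 ≡ 2
      d2 = elimʳ (λ f → 1+n≰n (eq≥ f » d≤2 (rgt e) q0)) (sib-d (lft e) p₀ ne)
      go : d u0 m ≡ 2 ⊎ d u0 m ≡ 3 → Cb 2 2 m u0 ∨ Cb 2 3 m u0 ≡ true
      go (inj₁ f) = or1 (Cb-intro d2 f)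
      go (inj₂ f) = or2 (Cb 2 2 m u0) (Cb-intro d2 f)
   opaque
    s≥1 : ∀ {x y z} → x ⟶ y → Odd x y z ≡ true → 1 ≤ sq x z
    s≥1 {x} {y} p o = ∃# y (and p (lft o))
    s≤k : ∀ x z → sq x z ≤ k
    s≤k x z = (#-mono λ u → lft) » eq≤ (out x)
    odd-C : ∀ {x y z} → x ⟶ y → Odd x y z ≡ true → Cb 2 (d z x) x z ≡ true
    odd-C p o = Cb-intro (odd-d p o) refl
    e-odd : ∀ {x y z b} → x ⟶ y → b ≢ 1 → Cb 2 b x z ∧ A y z ≡ true → Odd x y z ≡ true
    e-odd p ne e = and (rgtC e) (not-f (¬t λ a → ne (sym (Cb-snd (lftC e)) · A⇒d a)))
    odd-b : ∀ {x y z} → Odd x y z ≡ true → d z x ≢ 1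
    odd-b o e = t≢f (d⇒A e) (not-t (rgt o))
    odds : ∀ {x y} → x ⟶ y → ∃₂ λ z z' → Odd x y z ≡ true × Odd x y z' ≡ true × z ≢ z'
    odds p = pair∃ (eq≥ (odd2 p))
    odd-sum : ∀ {x y z z'} → x ⟶ y → Odd x y z ≡ true → Odd x y z' ≡ true → z ≢ z' → ∑ (λ v → β (Odd x y v) * sq x v) ≡ sq x z + sq x z'
    odd-sum {x} {y} {z} {z'} p o o' ne = ∑-enum {P = Odd x y} (toEnum {P = Odd x y} (z ∷ z' ∷ []) ((ne , tt) , tt , tt) (o , o' , tt) (eq≤ (odd2 p))) (sq x) · ∑-suc _ · cong (sq x z +_) (∑-suc _ · cong (sq x z' +_) (∑-nil _) · +-identityʳ _)
    e-same : ∀ {x y z z'} → x ⟶ y → Odd x y z ≡ true → Odd x y z' ≡ true → z ≢ z' → d z x ≡ d z' x → ee (d z x) ≡ 2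
    e-same {x} {y} {z} {z'} p o o' ne e = sym (e≡ (d z x) p) · (≤-antisym ((#-mono λ v q → e-odd p (odd-b o) q) » eq≤ (odd2 p))
     (size≥ {P = λ v → Cb 2 (d z x) x v ∧ A y v} (z ∷ z' ∷ []) ((ne , tt) , tt , tt) (andC (odd-C p o) (lft o) , andC (subst (λ b → Cb 2 b x z' ≡ true) (sym e) (odd-C p o')) (lft o') , tt)))
    e-diff : ∀ {x y z z'} → x ⟶ y → Odd x y z ≡ true → Odd x y z' ≡ true → z ≢ z' → d z x ≢ d z' x → ee (d z x) ≡ 1
    e-diff {x} {y} {z} {z'} p o o' ne e = sym (e≡ (d z x) p) · ≤-antisym (#≤1 λ {a} {b} q r → only a q · sym (only b r)) (∃# z (andC (odd-C p o) (lft o))) where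
     only : ∀ a → Cb 2 (d z x) x a ∧ A y a ≡ true → a ≡ z
     only a q = elimʳ (λ f → e (sym (Cb-snd (lftC q)) · cong (λ v → d v x) f)) (fl (member {P = Odd x y} (z ∷ z' ∷ []) ((ne , tt) , tt , tt) (o , o' , tt) (eq≤ (odd2 p)) (e-odd p (odd-b o) q))) where
      fl : In a (z ∷ z' ∷ []) → a ≡ z ⊎ a ≡ z'
      fl (inj₁ r) = inj₁ r
      fl (in1 r) = inj₂ r
    same-sq : ∀ {x z z'} → d x z ≡ d x z' → d z x ≡ d z' x → sq x z ≡ sq x z'
    same-sq {x} {z} {z'} e f = sym (sq≡ x z) · cl (Ax ⊗ Ax) x z x z' e f · sq≡ x z'
   -- All siblings lie in class (3 , 3), so `co` takes one value on them and the two-path count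
   -- becomes the equation solved by `param`.
   module NoNear (n22 : nn 2 2 ≡ 0) (n23 : nn 2 3 ≡ 0) where
    opaque
     sib33 : ∀ {x u v} → x ⟶ u → x ⟶ v → u ≢ v → Cb 3 3 u v ≡ true
     sib33 {x} {u} {v} p q ne = go (sib-d p q ne) (sib-d q p (ne ∘ sym)) where
      none : ∀ a b → nn a b ≡ 0 → Cb a b u v ≡ true → ⊥
      none a b e f = 1+n≰n (∃# u (and p f) » eq≤ (n≡ a b q · e))
      go : d u v ≡ 2 ⊎ d u v ≡ 3 → d v u ≡ 2 ⊎ d v u ≡ 3 → Cb 3 3 u v ≡ true
      go (inj₁ e) (inj₁ f) = ⊥-elim (none 2 2 n22 (Cb-intro e f))
      go (inj₁ e) (inj₂ f) = ⊥-elim (none 2 3 n23 (Cb-intro e f))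
      go (inj₂ e) (inj₁ f) = ⊥-elim (none 3 2 (sym n23≡n32 · n23) (Cb-intro e f))
      go (inj₂ e) (inj₂ f) = Cb-intro e f
     in33 : ∀ {u v w} → u ⟶ w → v ⟶ w → u ≢ v → Cb 3 3 u v ≡ true
     in33 {u} {v} {w} p q ne = let (x , a , b) = parent (∃# w (and p q)) in sib33 a b ne
     c≡0 : ∀ a b → nn a b ≡ 0 → ∀ {p q} → Cb a b p q ≡ true → co p q ≡ 0
     c≡0 a b e {p} {q} r = elimˡ (λ z → 1+n≰n (∃# q r » eq≤ (N≡ a b p · z))) (m*n≡0⇒m≡0∨n≡0 (N# a b) (kn a b r · cong (k *_) e · *-zeroʳ k))
    module At {x y v z z' : V} (p : x ⟶ y) (q : x ⟶ v) (ne : y ≢ v) (o : Odd x y z ≡ true) (o' : Odd x y z' ≡ true) (nz : z ≢ z') where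
     c : ℕ
     c = co y v
     opaque
      h33 : ∀ {a b} → Cb 3 3 a b ≡ true → co a b ≡ c
      h33 {a} {b} r = sym (co≡ a b) · on C r (sib33 p q ne) · co≡ y v
      n33 : nn 3 3 ≡ suc P
      n33 = suc-injective (cong₂ (λ s t → suc (s + (t + (t + nn 3 3)))) (sym n22) (sym n23) · n-sum · sym P2)
      M*c : N# 3 3 * c ≡ (2 + P) * (1 + P)
      M*c = kn 3 3 (sib33 p q ne) · (cong₂ _*_ (sym P2) n33)
      sums : 2 + P + suc P * c ≡ P * P + (sq x z + sq x z')
      sums = trans (+≡ P2 (cong (_* c) (sym n33) · cong₂ (λ s t → s * 0 + (t * 0 + (t * 0 + nn 3 3 * c))) (sym n22) (sym n23)))
       (co-sum p 0 0 c (c≡0 2 2 n22) (c≡0 2 3 n23) (λ r _ → h33 r) · cong (P * P +_) (odd-sum p o o' nz))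
      pm : Param P c (sq x z + sq x z')
      pm = param P c _ (N# 3 3) (≤-pred (≤-pred (k>3 » eq≥ P2))) (≤-pred (≤-pred (eq≤ P2 » co≥ p q))) sums (s≥1 p o » m≤m+n _ _)
       (+-mono-≤ (s≤k x z) (s≤k x z') » eq≤ ((+≡ (sym P2) (sym P2)) · lem P)) M*c where
       lem : ∀ p → 2 + p + (2 + p) ≡ 4 + 2 * p
       lem = solve-∀
      nw : V → ℕ
      nw w = # (λ u → Cb 3 3 x u ∧ A w u)
      -- `weight` counts arcs from the class of (x , w) into the class (3 , 3) around `x`. The `P`
      -- vertices between `w` and `y` share the out-neighbour `y` with `x`, hence lie in that class;
      -- this is the lower bound for `n₊`.
      data1 : ∀ {w} e → Odd x y w ≡ true → ee (d w x) ≡ e → Σ (Dat (2 + P) (N# 3 3) (sq x w) e) λ D → Dat.n₊ D ≡ nw w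
      data1 {w} e ow eq = dat (N# 2 b) (⟦ cls 2 b ⊗ Ax ⟧ y v) (nw w) (ke b (odd-C p ow) · (cong₂ _*_ (sym P2) eq)) wt (eq≤ (cong (2 +_) (sym (tri (lft ow)))) » ≤2+ (#-mono λ u r → andC (in33 p (rgt r) (λ f → t≢f (subst (w ⟶_) (sym f) (lft r)) (not-t (rgt ow)))) (lft r))) ((#-mono λ u → rgtC) » eq≤ (out w · sym P2)) , refl where
       b : ℕ
       b = d w x
       wt : N# 3 3 * ⟦ cls 2 b ⊗ Ax ⟧ y v ≡ N# 2 b * nw w
       wt = begin
        N# 3 3 * ⟦ cls 2 b ⊗ Ax ⟧ y v ≡⟨ cong (_* ⟦ cls 2 b ⊗ Ax ⟧ y v) (N≡ 3 3 x) ⟨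
        # (Cb 3 3 x) * ⟦ cls 2 b ⊗ Ax ⟧ y v ≡⟨ wsum (Cb 3 3 x) (⟦ cls 2 b ⊗ Ax ⟧ x) _ (λ u r → on (cls 2 b ⊗ Ax) r (sib33 p q ne)) ⟨
        ⟨ cls 3 3 , cls 2 b ⊗ Ax ⟩ x ≡⟨ adj (cls 3 3) (cls 2 b) Ax x ⟩
        ⟨ cls 3 3 ⊗ tr Ax , cls 2 b ⟩ x ≡⟨ ip-comm (cls 3 3 ⊗ tr Ax) (cls 2 b) x ⟩
        ⟨ cls 2 b , cls 3 3 ⊗ tr Ax ⟩ x ≡⟨ wsum (Cb 2 b x) (⟦ cls 3 3 ⊗ tr Ax ⟧ x) (nw w) (λ u r → on (cls 3 3 ⊗ tr Ax) r (odd-C p ow) · cnt (Cb 3 3 x) (A w)) ⟩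
        # (Cb 2 b x) * nw w ≡⟨ cong (_* nw w) (N≡ 2 b x) ⟩
        N# 2 b * nw w ∎
        where open ≡-Reasoning
      -- Two midpoints share a single in-neighbour besides x, so z reaches five siblings of x.
      five : sq x z ≡ 2 → c ≡ 2 → P ≡ 3 → nw z ≡ 5
      five s2 c2 P3 =
       let (m , m' , a , b , nm) = pair∃ (eq≥ s2)
           xm = lft a
           mz = rgt a
           xm' = lft b
           mz' = rgt b
           zx = not-t (rgt o)
           S = λ t u → A z u ∧ A u t
           inD : ∀ {t} → x ⟶ t → ∀ u → S t u ≡ true → Cb 3 3 x u ∧ A z u ≡ true
           inD = λ {t} xt u r → andC (in33 xt (rgt r) (λ f → t≢f (subst (z ⟶_) (sym f) (lft r)) zx)) (lft r)
           one1 : # (λ u → S m u ∧ S m' u) ≤ 1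
           one1 = #≤1 λ {g} {h} r s → third (sym (co-in m m') · h33 (sib33 xm xm' nm) · c2) (and xm xm')
                    (and (rgt (∧-fst {S m g} r)) (rgt (∧-snd {S m g} r))) (and (rgt (∧-fst {S m h} s)) (rgt (∧-snd {S m h} s)))
                    (λ f → t≢f (subst (z ⟶_) (sym f) (lft (∧-fst {S m g} r))) zx) (λ f → t≢f (subst (z ⟶_) (sym f) (lft (∧-fst {S m h} s))) zx)
       in ≤-antisym ((#-mono λ u → rgtC) » eq≤ (out z · sym P2 · cong (2 +_) P3))
            (lia≤ (# (S m) ∷ # (S m') ∷ # (λ u → S m u ∧ S m' u) ∷ nw z ∷ []) ((ν0 ≋ κ 3) ∷ (ν1 ≋ κ 3) ∷ (ν2 ≼ κ 1) ∷ (ν0 ⊹ ν1 ≼ ν3 ⊹ ν2) ∷ []) (κ 5) ν3 (tri mz · P3 , tri mz' · P3 , one1 , incl (S m) (S m') (λ u → Cb 3 3 x u ∧ A z u) (inD xm) (inD xm')))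
      contra : ⊥
      contra = go (d z x ≟ d z' x) where
       go : Dec (d z x ≡ d z' x) → ⊥
       go (yes e) = let (D , f) = data1 2 o (e-same p o o' nz e) in
        killSame pm (N# 3 3) (sq x z) M*c (cong (sq x z +_) (same-sq (odd-d p o · sym (odd-d p o')) e)) D (λ a b g → f · five a b g)
       go (no e) = killTwo pm (N# 3 3) (sq x z) (sq x z') M*c refl (s≥1 p o) (s≥1 p o') (s≤k x z » eq≥ P2) (s≤k x z' » eq≥ P2)
        (fst (data1 1 o (e-diff p o o' nz e))) (fst (data1 1 o' (e-diff p o' o (nz ∘ sym) (e ∘ sym))))
    absurd : ⊥
    absurd = let
        (x , y , p) = arc0
        (v , s) = #∃ (≤-pred (≤2+ z≤n » k>3 » eq≥ (Sib# p)))
        (z , z' , o , o' , nz) = odds p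
     in At.contra p (lft s) (Sib-≢ {x} s ∘ sym) o o' nz
   opaque
    wit : ∀ a b → 1 ≤ nn a b → ∃ λ x → ∃₂ λ p q → x ⟶ p × x ⟶ q × Cb a b p q ≡ true
    wit a b l = let
        (x , y , e) = arc0
        (u , f) = #∃ l
     in x , u , y , lft f , e , rgt f
    n-in : ∀ a b {y u} → y ⟶ u → # (λ v → Cb a b y v ∧ A v u) ≡ nn a b
    n-in a b {y} {u} p = sym (cnt (Cb a b y) (λ v → A v u)) · comm (cls a b) Ax y u · cnt (A y) (λ v → Cb a b v u) · n≡ a b p
    Cb-ne : ∀ {a b p q} → Cb (suc a) b p q ≡ true → p ≢ q
    Cb-ne {a} {b} {p} e refl = 0≢1+n (sym (d-refl p) · Cb-fst e)
    sq-pos : ∀ {p q} → d p q ≡ 2 → 1 ≤ sq p q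
    sq-pos {p} {q} e = let (m , r , s) = first-step {p} {q} e in ∃# m (and r (d⇒A s))
    on-co : ∀ a b {p q p' q'} → Cb a b p q ≡ true → Cb a b p' q' ≡ true → co p q ≡ co p' q'
    on-co a b {p} {q} {p'} {q'} r s = sym (co≡ p q) · on C r s · co≡ p' q'
    on-sq : ∀ a b {p q p' q'} → Cb a b p q ≡ true → Cb a b p' q' ≡ true → sq p q ≡ sq p' q'
    on-sq a b {p} {q} {p'} {q'} r s = sym (sq≡ p q) · on (Ax ⊗ Ax) r s · sq≡ p' q'
    N>0 : ∀ a b {p q} → Cb a b p q ≡ true → 1 ≤ N# a b
    N>0 a b {p} {q} r = ∃# q r » eq≤ (N≡ a b p)
   module Sb {b : ℕ} {x p q : V} (xp : x ⟶ p) (xq : x ⟶ q) (pq : Cb 2 b p q ≡ true) where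
    opaque
     c≥1 : 1 ≤ co p q
     c≥1 = sib-co xp xq
     md : ∃ λ m → p ⟶ m × Odd p m q ≡ true
     md = mid∃ xp xq (Cb-fst pq)
     c+s : co p q + sq q p ≤ 2
     c+s = let (m , r , o) = md in co+sq r o
     k≤4+c : k ≤ 4 + co p q
     k≤4+c = co≥ xp xq
     out∃ : ∃ λ u → p ⟶ u × q ⟶ u
     out∃ = let (u , e) = #∃ c≥1 in u , lft e , rgt e
     s≤n : sq p q ≤ nn 2 2 + nn 2 3
     s≤n = let
         (m , r , o) = md
         (u , a , b') = out∃
      in mids≤ r o a b'
     e≥1 : 1 ≤ ee b
     e≥1 = let (m , r , o) = md in ∃# q (andC pq (lft o)) » eq≤ (e≡ b r)
     -- c e = s n, both sides being N c s / k.
     ce : co p q * ee b ≡ sq p q * nn 2 b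
     ce = *-cancelˡ-≡ _ _ (N# 2 b) {{>-nonZero (N>0 2 b pq)}} (*-cancelˡ-≡ _ _ k {{>-nonZero k>0}} (begin
      k * (N# 2 b * (co p q * ee b)) ≡⟨ re1 k (N# 2 b) (co p q) (ee b) ⟩
      N# 2 b * co p q * (k * ee b) ≡⟨ cong₂ _*_ (kn 2 b pq) (sym (ke b pq)) ⟩
      k * nn 2 b * (N# 2 b * sq p q) ≡⟨ re2 k (N# 2 b) (nn 2 b) (sq p q) ⟩
      k * (N# 2 b * (sq p q * nn 2 b)) ∎)) where
      open ≡-Reasoning
      re1 : ∀ k N c e → k * (N * (c * e)) ≡ N * c * (k * e)
      re1 = solve-∀
      re2 : ∀ k N n s → k * n * (N * s) ≡ k * (N * (s * n))
      re2 = solve-∀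
   opaque
    -- `co` and the number of two-paths back are both positive and add up to at most 2 by `co+sq`.
    c22 : ∀ {x p q} → x ⟶ p → x ⟶ q → Cb 2 2 p q ≡ true → co p q ≡ 1
    c22 {x} {p} {q} xp xq r = ≤-antisym (+-cancelʳ-≤ 1 (co p q) 1 (+-monoʳ-≤ (co p q) (sq-pos (Cb-snd r)) » Sb.c+s xp xq r)) (Sb.c≥1 xp xq r)
    c23 : ∀ {x p q} → x ⟶ p → x ⟶ q → Cb 2 3 p q ≡ true → co p q ≤ 2
    c23 xp xq r = (m≤m+n _ _) » Sb.c+s xp xq r
    c≡0 : ∀ a b → nn a b ≡ 0 → ∀ {p q} → Cb a b p q ≡ true → co p q ≡ 0
    c≡0 a b e {p} {q} r = elimˡ (λ z → 1+n≰n (N>0 a b r » eq≤ z)) (m*n≡0⇒m≡0∨n≡0 (N# a b) (kn a b r · cong (k *_) e · *-zeroʳ k))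
    e≤2 : ∀ b → b ≢ 1 → ee b ≤ 2
    e≤2 b ne = let (x , y , p) = arc0 in (#-mono λ z → e-odd p ne) » eq≤ (odd2 p)
    e2+e3 : ee 2 + ee 3 ≤ 2
    e2+e3 = let (x , y , p) = arc0 in (disj2 (λ z → Cb 2 2 x z ∧ A y z) (λ z → Cb 2 3 x z ∧ A y z) (Odd x y) (λ z → e-odd p λ ()) (λ z → e-odd p λ ())
     (λ z a b → 2≢3 (sym (Cb-snd (lftC a)) · Cb-snd (lftC b)))) » eq≤ (odd2 p)
    σ2 : ∀ b → b ≢ 1 → ee b ≡ 2 → ∀ {x y s} → x ⟶ y → (∀ {p q} → Cb 2 b p q ≡ true → sq p q ≡ s) → ∑ (λ z → β (Odd x y z) * sq x z) ≡ s + s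
    σ2 b ne e {x} {y} {s} p h = (∑-cong λ z → cong (λ t → β t * sq x z) (iff (tob z) (λ q → e-odd p ne q))) · wsum (λ z → Cb 2 b x z ∧ A y z) (sq x) s (λ z q → h (lftC q)) · cong (_* s) (e≡ b p · e) · cong (s +_) (+-identityʳ s) where
     tob : ∀ z → Odd x y z ≡ true → Cb 2 b x z ∧ A y z ≡ true
     tob z o = #-sub≡ (λ z → e-odd p ne) (eq≤ (odd2 p · sym (e≡ b p · e))) z o
   -- The second odd vertex over an arc when just one of the two lies in class (2 , b); its own
   -- class has size k divided by its number of two-paths.
   record Other (b s : ℕ) (x y : V) : Set where
    field
     w : V
     ow : Odd x y w ≡ true
     db : d w x ≢ b
     sum1 : ∑ (λ z → β (Odd x y z) * sq x z) ≡ s + sq x w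
     size1 : N# 2 (d w x) * sq x w ≡ k
   opaque
    σ1 : ∀ b → b ≢ 1 → ee b ≡ 1 → ∀ {x y s} → x ⟶ y → (∀ {p q} → Cb 2 b p q ≡ true → sq p q ≡ s) → Other b s x y
    σ1 b ne e {x} {y} {s} p h =
     let (z , q) = #∃ (eq≥ (e≡ b p · e))
         (z1 , z₂ , o1 , o₂ , nz) = odds p
     in go (e-odd p ne q) (lftC q) o1 o₂ nz (z F.≟ z1) where
     mk : ∀ {z w} → Odd x y z ≡ true → Cb 2 b x z ≡ true → Odd x y w ≡ true → z ≢ w → Other b s x y
     mk {z} {w} oz bz ow n = record { w = w ; ow = ow ; db = db ; sum1 = odd-sum p oz ow n · cong (_+ sq x w) (h bz) ; size1 = ke (d w x) (odd-C p ow) · cong (k *_) (e-diff p ow oz (n ∘ sym) (λ f → db (f · Cb-snd bz))) · *-identityʳ k } where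
      db : d w x ≢ b
      db f = n (unique (e≡ b p · e) (andC bz (lft oz)) (andC (Cb-intro (odd-d p ow) f) (lft ow)))
     go : ∀ {z z1 z₂} → Odd x y z ≡ true → Cb 2 b x z ≡ true → Odd x y z1 ≡ true → Odd x y z₂ ≡ true → z1 ≢ z₂ → Dec (z ≡ z1) → Other b s x y
     go oz bz o1 o₂ nz (yes refl) = mk oz bz o₂ nz
     go oz bz o1 o₂ nz (no n) = mk oz bz o1 n
    back∃ : nn 2 3 ≡ 0 → ∀ {y u v m} → y ⟶ u → v ⟶ u → y ⟶ m → m ⟶ v → ∃ λ t → Odd y u t ≡ true × t ⟶ m
    back∃ n3 {y} {u} {v} {m} yu vu ym mv =
     let ne : m ≢ u
         ne = λ { refl → no2 vu mv }
         (t , ut , tm) = first-step {u} {m} (go ne (sib-d ym yu ne) (sib-d yu ym (ne ∘ sym)))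
     in t , and ut (not-f (¬t λ ty → a0 ty ym (d⇒A tm))) , d⇒A tm where
     go : m ≢ u → d m u ≡ 2 ⊎ d m u ≡ 3 → d u m ≡ 2 ⊎ d u m ≡ 3 → d u m ≡ 2
     go ne _ (inj₁ f) = f
     go ne (inj₂ e) (inj₂ f) = ⊥-elim (1+n≰n (eq≥ e » d≤2 mv vu))
     go ne (inj₁ e) (inj₂ f) = ⊥-elim (1+n≰n (∃# m (and ym (Cb-intro e f)) » eq≤ (n≡ 2 3 yu · n3)))
    -- `rule` makes both odd vertices over (y , u) precede `v`. One of them is `t` with `t → m → v`,
    -- which closes a transitive triangle.
    kill5 : k ≡ 5 → nn 2 3 ≡ 0 → 1 ≤ nn 2 2 → ⊥
    kill5 k5 n3 l =
     let (x , y , v , xy , xv , r) = wit 2 2 l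
         (u , yu , vu) = Sb.out∃ xy xv r
         (m , ym , om) = Sb.md xy xv r
         (t , ot , tm) = back∃ n3 yu vu ym (lft om)
         all : ∀ z → Odd y u z ≡ true → Odd y u z ∧ A z v ≡ true
         all = #-sub≡ (λ z → ∧-fst {Odd y u z}) (eq≤ (odd2 yu) » lia≤ (P ∷ co y v ∷ # (λ z → Odd y u z ∧ A z v) ∷ []) ((ν0 ≋ κ 3) ∷ (ν0 ≼ ν1 ⊹ ν2) ∷ (ν1 ≋ κ 1) ∷ []) (κ 2) ν2 (+-cancelˡ-≡ 2 P 3 (P2 · k5) , rule yu vu , c22 xy xv r))
     in a0 tm (lft om) (∧-snd {Odd y u t} (all t ot))
   -- What the arithmetic leaves of `k = 4` with siblings in class (2 , 2). Counting arcs from the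
   -- class of the other odd vertex into class (3 , 3) excludes it.
   module Kill4 (k4 : k ≡ 4) (n3 : nn 2 3 ≡ 0) (n2 : nn 2 2 ≡ 1) (e2 : ee 2 ≡ 1) where
    opaque
     P≡2 : P ≡ 2
     P≡2 = +-cancelˡ-≡ 2 P 2 (P2 · k4)
     n33 : nn 3 3 ≡ 2
     n33 = lia≡ (nn 2 2 ∷ nn 2 3 ∷ nn 3 3 ∷ k ∷ []) ((κ 1 ⊹ (ν0 ⊹ (ν1 ⊹ (ν1 ⊹ ν2))) ≋ ν3) ∷ (ν0 ≋ κ 1) ∷ (ν1 ≋ κ 0) ∷ (ν3 ≋ κ 4) ∷ []) ν2 (κ 2) (n-sum , n2 , n3 , k4)
     vv : ∀ {y u} → y ⟶ u → ∃ λ v → Cb 2 2 y v ≡ true × v ⟶ u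
     vv p = let (v , e) = #∃ (eq≥ (n-in 2 2 p · n2)) in v , lftC e , rgtC e
     co1 : ∀ {y v u} → y ⟶ u → v ⟶ u → Cb 2 2 y v ≡ true → co y v ≡ 1
     co1 {y} {v} {u} p q r = let (x , a , b) = parent (∃# u (and p q)) in c22 a b r
     dom : ∀ {y u v w} → y ⟶ u → v ⟶ u → Cb 2 2 y v ≡ true → Odd y u w ≡ true → d w y ≢ 2 → w ⟶ v
     dom {y} {u} {v} {w} yu vu r ow nw =
      let (m , ym , mv) = first-step {y} {v} (Cb-fst r)
          (t , ot , tm) = back∃ n3 yu vu ym (d⇒A mv)
          (s , e) = #∃ (lia≤ (P ∷ co y v ∷ # (λ z → Odd y u z ∧ A z v) ∷ []) ((ν0 ≋ κ 2) ∷ (ν0 ≼ ν1 ⊹ ν2) ∷ (ν1 ≋ κ 1) ∷ []) (κ 1) ν2 (P≡2 , rule yu vu , co1 yu vu r))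
          t≢w : t ≢ w
          t≢w = λ f → far (subst (_⟶ m) f tm) ym
          t≢s : t ≢ s
          t≢s = λ f → a0 tm (d⇒A mv) (subst (_⟶ v) (sym f) (∧-snd {Odd y u s} e))
      in subst (_⟶ v) (sym (third (odd2 yu) ot ow (∧-fst {Odd y u s} e) t≢w t≢s)) (∧-snd {Odd y u s} e) where
      far : ∀ {m} → w ⟶ m → y ⟶ m → ⊥
      far {m} wm ym = let (x , a , b) = parent (∃# m (and ym wm)) in go a b (sib-d b a (ne ∘ sym)) where
       ne : y ≢ w
       ne refl = 0≢1+n (sym (d-refl y) · odd-d yu ow)
       go : ∀ {x} → x ⟶ y → x ⟶ w → d w y ≡ 2 ⊎ d w y ≡ 3 → ⊥
       go a b (inj₁ f) = nw f
       go a b (inj₂ f) = 1+n≰n (∃# y (and a (Cb-intro (odd-d yu ow) f)) » eq≤ (n≡ 2 3 b · n3))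
    module At {x y w : V} (p : x ⟶ y) (ow : Odd x y w ≡ true) (nw : d w x ≢ 2) (sz : N# 2 (d w x) * sq x w ≡ k) where
     n₃ : ℕ
     n₃ = # (λ u → Cb 3 3 x u ∧ A w u)
     opaque
      wx : A w x ≡ false
      wx = not-t (rgt ow)
      odd-m : ∀ {m} → x ⟶ m → m ⟶ w → Odd x m w ≡ true
      odd-m a b = and b (not-f wx)
      -- Distinct midpoints give distinct out-neighbours of w in class (2 , 2).
      many : sq x w ≤ # (λ v → Cb 2 2 x v ∧ A w v)
      many = let
          E = enum (λ m → A x m ∧ A m w)
          xm = λ i → lft (fst (snd E) i)
          mw = λ i → rgt (fst (snd E) i)
          V' = λ i → vv (xm i)
       in inj≤# {P = λ v → Cb 2 2 x v ∧ A w v} (λ i → fst (V' i))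
                 (λ i j e → fst (snd (snd E)) i j (unique (co1 (xm i) (snd (snd (V' i))) (fst (snd (V' i)))) (and (xm i) (snd (snd (V' i)))) (and (xm j) (subst (λ v → v ⟶ fst E j) (sym e) (snd (snd (V' j)))))))
                 (λ i → andC (fst (snd (V' i))) (dom (xm i) (snd (snd (V' i))) (fst (snd (V' i))) (odd-m (xm i) (mw i)) nw))
      some : 1 ≤ n₃
      some = let (v , v' , a , b , ne) = pair∃ (eq≥ (tri (lft ow) · P≡2)) in
       go a b ne where
       cl3 : ∀ {v} → A w v ∧ A v y ≡ true → (Cb 2 2 x v ≡ true) ⊎ (Cb 3 3 x v ∧ A w v ≡ true)
       cl3 {v} e = pick (sib-d a' b' ne) (sib-d b' a' (ne ∘ sym)) where
        wv : w ⟶ v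
        wv = lft e
        vy : v ⟶ y
        vy = rgt e
        ne : x ≢ v
        ne f = t≢f (subst (w ⟶_) (sym f) wv) wx
        pr : ∃ λ z → z ⟶ x × z ⟶ v
        pr = parent (∃# y (and p vy))
        a' : fst pr ⟶ x
        a' = fst (snd pr)
        b' : fst pr ⟶ v
        b' = snd (snd pr)
        none : ∀ a b → nn a b ≡ 0 → Cb a b x v ≡ true → ⊥
        none a b q f = 1+n≰n (∃# x (and a' f) » eq≤ (n≡ a b b' · q))
        pick : d x v ≡ 2 ⊎ d x v ≡ 3 → d v x ≡ 2 ⊎ d v x ≡ 3 → (Cb 2 2 x v ≡ true) ⊎ (Cb 3 3 x v ∧ A w v ≡ true)
        pick (inj₁ f) (inj₁ g) = inj₁ (Cb-intro f g)
        pick (inj₁ f) (inj₂ g) = ⊥-elim (none 2 3 n3 (Cb-intro f g))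
        pick (inj₂ f) (inj₁ g) = ⊥-elim (none 3 2 (sym n23≡n32 · n3) (Cb-intro f g))
        pick (inj₂ f) (inj₂ g) = inj₂ (andC (Cb-intro f g) wv)
       go : ∀ {v v'} → A w v ∧ A v y ≡ true → A w v' ∧ A v' y ≡ true → v ≢ v' → 1 ≤ n₃
       go {v} {v'} a b ne = [ (λ f → [ (λ g → ⊥-elim (ne (unique (n-in 2 2 p · n2) (andC f (rgt a)) (andC g (rgt b))))) , (λ g → ∃# v' g) ]′ (cl3 b)) , (λ f → ∃# v f) ]′ (cl3 a)
      total : # (λ v → Cb 2 2 x v ∧ A w v) + n₃ ≤ 4
      total = disj2 (λ v → Cb 2 2 x v ∧ A w v) (λ v → Cb 3 3 x v ∧ A w v) (A w) (λ v → rgtC) (λ v → rgtC) (λ v a b → 2≢3 (sym (Cb-fst (lftC a)) · Cb-fst (lftC b))) » eq≤ (out w · k4)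
      weight : ∃ λ t → N# 3 3 * t ≡ N# 2 (d w x) * n₃
      weight = let (x' , a , b , xa , xb , r) = wit 3 3 (≥1 n33) in ⟦ cls 2 (d w x) ⊗ Ax ⟧ a b , (begin
          N# 3 3 * ⟦ cls 2 (d w x) ⊗ Ax ⟧ a b ≡⟨ cong (_* ⟦ cls 2 (d w x) ⊗ Ax ⟧ a b) (N≡ 3 3 x) ⟨
          # (Cb 3 3 x) * ⟦ cls 2 (d w x) ⊗ Ax ⟧ a b ≡⟨ wsum (Cb 3 3 x) (⟦ cls 2 (d w x) ⊗ Ax ⟧ x) _ (λ u s → on (cls 2 (d w x) ⊗ Ax) {3} {3} s r) ⟨
          ⟨ cls 3 3 , cls 2 (d w x) ⊗ Ax ⟩ x ≡⟨ adj (cls 3 3) (cls 2 (d w x)) Ax x ⟩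
          ⟨ cls 3 3 ⊗ tr Ax , cls 2 (d w x) ⟩ x ≡⟨ ip-comm (cls 3 3 ⊗ tr Ax) (cls 2 (d w x)) x ⟩
          ⟨ cls 2 (d w x) , cls 3 3 ⊗ tr Ax ⟩ x ≡⟨ wsum (Cb 2 (d w x) x) (⟦ cls 3 3 ⊗ tr Ax ⟧ x) n₃ (λ u s → on (cls 3 3 ⊗ tr Ax) s (odd-C p ow) · cnt (Cb 3 3 x) (A w)) ⟩
          # (Cb 2 (d w x) x) * n₃ ≡⟨ cong (_* n₃) (N≡ 2 (d w x) x) ⟩
          N# 2 (d w x) * n₃ ∎)
       where open ≡-Reasoning
      contra : ∀ {c} → 1 + 2 * c ≡ 1 + sq x w → N# 3 3 * c ≡ 8 → ⊥
      contra {c} e f = let (t , g) = weight in num c (sq x w) (N# 2 (d w x)) (N# 3 3) n₃ t (suc-injective e) (sz · k4) f g (+-monoˡ-≤ n₃ many » total) some where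
       num : ∀ c s N M m t → 2 * c ≡ s → N * s ≡ 4 → M * c ≡ 8 → M * t ≡ N * m → s + m ≤ 4 → 1 ≤ m → ⊥
       num 0 .0 N M m t refl a b _ _ _ = 0≢1+n (sym (*-zeroʳ N) · a)
       num 1 .2 N M m t refl a b g h l with *-cancelʳ-≡ N 2 2 a | trans (sym (*-identityʳ M)) b
       num 1 .2 _ _ 1 t refl a b g h l | refl | refl = from-no (8 ∣? 2) (divides t (sym g · *-comm 8 t))
       num 1 .2 _ _ 2 t refl a b g h l | refl | refl = from-no (8 ∣? 4) (divides t (sym g · *-comm 8 t))
       num 1 .2 _ _ (3+ m) t refl a b g (≤4+ ()) l | refl | refl
       num (2+ c) s N M (suc m) t r a b g h l = 1+n≰n (≤5+ z≤n » eq≤ (lem c m) » eq≤ (cong (_+ suc m) r) » h) where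
        lem : ∀ c m → 5 + (2 * c + m) ≡ 2 * 2+ c + suc m
        lem = solve-∀
   opaque
    -- The value 0 for a class without siblings is genuine: by `c≡0` such pairs have no common
    -- out-neighbour.
    val : ∀ a b → ∃ λ v → ∀ {p q} → Cb a b p q ≡ true → co p q ≡ v
    val a b = go (nn a b) refl where
     go : ∀ m → nn a b ≡ m → ∃ λ v → ∀ {p q} → Cb a b p q ≡ true → co p q ≡ v
     go zero e = 0 , c≡0 a b e
     go (suc m) e = let (x , p , q , _ , _ , r) = wit a b (≥1 e) in co p q , λ s → on-co a b s r
   C22 C23 C33 : ℕ
   C22 = fst (val 2 2)
   C23 = fst (val 2 3)
   C33 = fst (val 3 3)
   opaque
    NC33 : 1 ≤ nn 3 3 → N# 3 3 * C33 ≡ k * nn 3 3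
    NC33 l = let (x , p , q , xp , xq , r) = wit 3 3 l in cong (N# 3 3 *_) (sym (snd (val 3 3) r)) · kn 3 3 r
    C33≥1 : 1 ≤ nn 3 3 → 1 ≤ C33
    C33≥1 l = let (x , p , q , xp , xq , r) = wit 3 3 l in sib-co xp xq » eq≤ (snd (val 3 3) r)
    sums : ∀ {x y} → x ⟶ y → k + (nn 2 2 * C22 + (nn 2 3 * C23 + (nn 2 3 * C23 + nn 3 3 * C33))) ≡ P * P + ∑ (λ z → β (Odd x y z) * sq x z)
    sums p = co-sum p C22 C23 C33 (snd (val 2 2)) (snd (val 2 3)) (λ r _ → snd (val 3 3) r)
   module Has23 (l : 1 ≤ nn 2 3) where
    private
     Wt = wit 2 3 l
    x' p' q' : V
    x' = fst Wt
    p' = fst (snd Wt)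
    q' = fst (snd (snd Wt))
    S23 : ℕ
    S23 = sq p' q'
    opaque
     xp : x' ⟶ p'
     xp = fst (snd (snd (snd Wt)))
     xq : x' ⟶ q'
     xq = fst (snd (snd (snd (snd Wt))))
     pq : Cb 2 3 p' q' ≡ true
     pq = snd (snd (snd (snd (snd Wt))))
     cv : co p' q' ≡ C23
     cv = snd (val 2 3) pq
     S-val : ∀ {p q} → Cb 2 3 p q ≡ true → sq p q ≡ S23
     S-val r = on-sq 2 3 r pq
     S≥1 : 1 ≤ S23
     S≥1 = sq-pos (Cb-fst pq)
     C≥1 : 1 ≤ C23
     C≥1 = Sb.c≥1 xp xq pq » eq≤ cv
     C≤2 : C23 ≤ 2
     C≤2 = eq≥ cv » c23 xp xq pq
     k≤4+C : k ≤ 4 + C23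
     k≤4+C = Sb.k≤4+c xp xq pq » eq≤ (cong (4 +_) cv)
     ce3 : C23 * ee 3 ≡ S23 * nn 2 3
     ce3 = cong (_* ee 3) (sym cv) · Sb.ce xp xq pq
     e≥ : 1 ≤ ee 3
     e≥ = Sb.e≥1 xp xq pq
     s≤ : S23 ≤ nn 2 2 + nn 2 3
     s≤ = Sb.s≤n xp xq pq
     sol3 : nn 2 2 ≡ 0 → nn 2 3 ≤ 2 → Sol C23 (ee 3) S23 (nn 2 3)
     sol3 z h = sol C23 (ee 3) S23 (nn 2 3) ce3 S≥1 (s≤ » eq≤ (cong (_+ nn 2 3) z)) h C≥1 C≤2 e≥ (e≤2 3 λ ())
     bigSib : C23 ≡ 2 → 2 ≤ S23 → ∃ λ y → ∃₂ λ u v → y ⟶ u × y ⟶ v × u ≢ v × suc P ≤ co u v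
     bigSib c2 l2 = let
         (u , v , a , b , ne) = pair∃ l2
         (m , r , o) = Sb.md xp xq pq
      in p' , u , v , lft a , lft b , ne , twoMids (cv · c2) (lft a) (and (rgt a) (rgt o)) (lft b) (rgt b)
   record Vals (n₃ n₃₃ c s c₃₃ e : ℕ) : Set where
    field
     n2 : nn 2 2 ≡ 0
     n3 : nn 2 3 ≡ n₃
     n33 : nn 3 3 ≡ n₃₃
     e3 : ee 3 ≡ e
     c3 : ∀ {p q} → Cb 2 3 p q ≡ true → co p q ≡ c
     q3 : ∀ {p q} → Cb 2 3 p q ≡ true → sq p q ≡ s
     c33 : ∀ {p q} → Cb 3 3 p q ≡ true → co p q ≡ c₃₃
   -- The parameter sets that arithmetic cannot exclude. The first is realised by the doubled
   -- Cay(ℤ₁₃ , {1 , 3 , 9}); the other two fall to their local structure.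
   data Left : Set where
    left6 : k ≡ 6 → Vals 2 1 2 2 6 2 → F# 6 ≡ 1 → Left
    left5 : k ≡ 5 → Vals 1 2 1 1 2 1 → (∀ {x y} → x ⟶ y → Σ (Other 3 1 x y) λ O → sq x (Other.w O) ≡ 1) → Left
    left4 : k ≡ 4 → Vals 1 1 1 1 1 1 → (∀ {x y} → x ⟶ y → Σ (Other 3 1 x y) λ O → sq x (Other.w O) ≡ 2) → Left
   mkVals : ∀ {n₃ n₃₃ c s c₃₃ e} (l : 1 ≤ nn 2 3) → nn 2 2 ≡ 0 → nn 2 3 ≡ n₃ → nn 3 3 ≡ n₃₃ → ee 3 ≡ e → C23 ≡ c → Has23.S23 l ≡ s → C33 ≡ c₃₃ → Vals n₃ n₃₃ c s c₃₃ e
   mkVals l a b f e c s g = record { n2 = a ; n3 = b ; n33 = f ; e3 = e ; c3 = λ r → snd (val 2 3) r · c ; q3 = λ r → Has23.S-val l r · s ; c33 = λ r → snd (val 3 3) r · g }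
   private
    P≡ : ∀ {m} → k ≡ 2 + m → P ≡ m
    P≡ e = +-cancelˡ-≡ 2 P _ (P2 · e)
    count : ∀ {m a b} → k ≡ m → nn 2 2 ≡ a → nn 2 3 ≡ b → 1 + (a + (b + (b + nn 3 3))) ≡ m
    count e f g = cong₂ (λ a b → 1 + (a + (b + (b + nn 3 3)))) (sym f) (sym g) · n-sum · e
    eqn : ∀ {x y m a b h c e} → x ⟶ y → k ≡ 2 + m → nn 2 2 ≡ a → nn 2 3 ≡ b → nn 3 3 ≡ h → C22 ≡ c → C23 ≡ e → 2 + m + (a * c + (b * e + (b * e + h * C33))) ≡ m * m + ∑ (λ z → β (Odd x y z) * sq x z)
    eqn {x} {y} p refl' f g i j l' = (+≡ (sym refl') (+≡ (cong₂ _*_ (sym f) (sym j)) (+≡ (cong₂ _*_ (sym g) (sym l')) (+≡ (cong₂ _*_ (sym g) (sym l')) (cong (_* C33) (sym i)))))) · sums p · cong (_+ ∑ (λ z → β (Odd x y z) * sq x z)) (cong₂ _*_ (P≡ refl') (P≡ refl'))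
   module Only23 (z2 : nn 2 2 ≡ 0) (l : 1 ≤ nn 2 3) where
    open Has23 l
    opaque
     twin1 : k ≡ 6 → C33 ≡ 6 → nn 3 3 ≡ 1 → C23 ≡ 2 → F# 6 ≡ 1
     twin1 k6 c6 h c2 = ≤-antisym ((#-mono λ v f → to v f) » eq≤ N1) (eq≥ N1 » (#-mono λ v f → Fb-intro (snd (val 3 3) f · c6) (Cb-ne {2} {3} f))) where
      N1 : # (Cb 3 3 x₀) ≡ 1
      N1 = *-cancelʳ-≡ (N# 3 3) 1 6 (cong (N# 3 3 *_) (sym c6) · NC33 (eq≥ h) · cong₂ _*_ k6 h)
      to : ∀ v → Fb 6 x₀ v ≡ true → Cb 3 3 x₀ v ≡ true
      to v f = let (y , a , b) = parent (≥1 (Fb-co f)) in go (sib-d a b (Fb-≢ f)) (sib-d b a (Fb-≢ f ∘ sym)) where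
       go : d x₀ v ≡ 2 ⊎ d x₀ v ≡ 3 → d v x₀ ≡ 2 ⊎ d v x₀ ≡ 3 → Cb 3 3 x₀ v ≡ true
       go (inj₁ e) (inj₁ g) = ⊥-elim (0≢1+n (sym (c≡0 2 2 z2 (Cb-intro e g)) · Fb-co f))
       go (inj₁ e) (inj₂ g) = ⊥-elim (2≢6 (sym (snd (val 2 3) (Cb-intro e g) · c2) · Fb-co f))
       go (inj₂ e) (inj₁ g) = ⊥-elim (2≢6 (sym (snd (val 2 3) (Cb-intro g e) · c2) · co-sym v x₀ · Fb-co f))
       go (inj₂ e) (inj₂ g) = Cb-intro e g
     -- `C23 = 1` contradicts `k ≤ 4 + C23`. The solution `s21` forces `C33 = 6`, hence unique
     -- twins, and dies because its number of two-paths is odd.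
     case6 : k ≡ 6 → Left
     case6 k6 = go C23 (ee 3) S23 (nn 2 3) refl refl refl refl (sol3 z2 n≤2) where
      n≤2 : nn 2 3 ≤ 2
      n≤2 = ≤-pred (≰⇒> λ h → lia (nn 2 3 ∷ nn 3 3 ∷ []) ((κ 1 ⊹ (κ 0 ⊹ (ν0 ⊹ (ν0 ⊹ ν1))) ≋ κ 6) ∷ (κ 3 ≼ ν0) ∷ []) (count k6 z2 refl , h))
      c≢1 : C23 ≡ 1 → ⊥
      c≢1 e = 1+n≰n {5} (eq≥ k6 » k≤4+C » eq≤ (cong (4 +_) e))
      go : ∀ c e s m → C23 ≡ c → ee 3 ≡ e → S23 ≡ s → nn 2 3 ≡ m → Sol c e s m → Left
      go _ _ _ _ a b c f s11 = ⊥-elim (c≢1 a)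
      go _ _ _ _ a b c f s12 = ⊥-elim (c≢1 a)
      go _ _ _ _ a b c f s22 = left6 k6 (mkVals l z2 f h b a c c6) (twin1 k6 c6 h a) where
       h : nn 3 3 ≡ 1
       h = +-cancelˡ-≡ 5 _ 1 (count k6 z2 f)
       c6 : C33 ≡ 6
       c6 = lia≡ (C33 ∷ []) ((κ 6 ⊹ (κ 0 ⊹ (κ 4 ⊹ (κ 4 ⊹ 1 ⊙ ν0))) ≋ κ 16 ⊹ κ 4) ∷ []) ν0 (κ 6) (eqn axy k6 z2 f h refl a · cong (16 +_) (σ2 3 (λ ()) b axy S-val · +≡ c c))
      go _ _ _ _ a b c f s21 = ⊥-elim (odd₁ (sq-even (cong F# k6 · twin1 k6 c6 h a) p' q')) where
       h : nn 3 3 ≡ 1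
       h = +-cancelˡ-≡ 5 _ 1 (count k6 z2 f)
       O : Other 3 1 ax ay
       O = σ1 3 (λ ()) b axy (λ r → S-val r · c)
       s₂ : ℕ
       s₂ = sq ax (Other.w O)
       c6' : C33 ≡ 3 + s₂
       c6' = lia≡ (C33 ∷ s₂ ∷ []) ((κ 6 ⊹ (κ 0 ⊹ (κ 4 ⊹ (κ 4 ⊹ 1 ⊙ ν0))) ≋ κ 16 ⊹ (κ 1 ⊹ ν1)) ∷ []) ν0 (κ 3 ⊹ ν1) (eqn axy k6 z2 f h refl a · cong (16 +_) (Other.sum1 O))
       c6 : C33 ≡ 6
       c6 = pick s₂ c6' (s≥1 axy (Other.ow O)) (NC33 (eq≥ h) · cong₂ _*_ k6 h) where
        pick : ∀ s → C33 ≡ 3 + s → 1 ≤ s → N# 3 3 * C33 ≡ 6 → C33 ≡ 6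
        pick 1 e _ g = ⊥-elim (from-no (4 ∣? 6) (divides (N# 3 3) (sym g · cong (N# 3 3 *_) e)))
        pick 2 e _ g = ⊥-elim (from-no (5 ∣? 6) (divides (N# 3 3) (sym g · cong (N# 3 3 *_) e)))
        pick 3 e _ g = e
        pick (4+ s) e _ g = ⊥-elim (1+n≰n (≤7+ (z≤n {s}) » eq≥ e » ∣⇒≤ (divides (N# 3 3) (sym g))))
       odd₁ : (∃ λ t → sq p' q' ≡ t + t) → ⊥
       odd₁ (t , e) = no1 t (sym c · e) where
        no1 : ∀ t → 1 ≡ t + t → ⊥
        no1 (suc t) e = 0≢1+n (suc-injective e · +-suc t t)
     case5 : k ≡ 5 → Left
     case5 k5 = go C23 (ee 3) S23 (nn 2 3) refl refl refl refl (sol3 z2 n≤2) where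
      n≤2 : nn 2 3 ≤ 2
      n≤2 = ≤-pred (≰⇒> λ h → lia (nn 2 3 ∷ nn 3 3 ∷ []) ((κ 1 ⊹ (κ 0 ⊹ (ν0 ⊹ (ν0 ⊹ ν1))) ≋ κ 5) ∷ (κ 3 ≼ ν0) ∷ []) (count k5 z2 refl , h))
      go : ∀ c e s m → C23 ≡ c → ee 3 ≡ e → S23 ≡ s → nn 2 3 ≡ m → Sol c e s m → Left
      go _ _ _ _ a b c f s11 = left5 k5 (mkVals l z2 f h b a c c2) (λ p → O p , one1 p) where
       h : nn 3 3 ≡ 2
       h = +-cancelˡ-≡ 3 _ 2 (count k5 z2 f)
       O : ∀ {x y} → x ⟶ y → Other 3 1 x y
       O p = σ1 3 (λ ()) b p (λ r → S-val r · c)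
       rel : ∀ {x y} (p : x ⟶ y) → 2 * C33 ≡ 3 + sq x (Other.w (O p))
       rel {x} p = lia≡ (C33 ∷ sq x (Other.w (O p)) ∷ []) ((κ 5 ⊹ (κ 0 ⊹ (κ 1 ⊹ (κ 1 ⊹ 2 ⊙ ν0))) ≋ κ 9 ⊹ (κ 1 ⊹ ν1)) ∷ []) (2 ⊙ ν0) (κ 3 ⊹ ν1) (eqn p k5 z2 f h refl a · cong (9 +_) (Other.sum1 (O p)))
       both : ∀ {x y} (p : x ⟶ y) → sq x (Other.w (O p)) ≡ 1 × C33 ≡ 2
       both {x} p = pick (sq x (Other.w (O p))) refl C33 refl (rel p) (s≥1 p (Other.ow (O p))) (Other.size1 (O p) · k5) (NC33 (≥1 h) · cong₂ _*_ k5 h) where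
        pick : ∀ s → sq x (Other.w (O p)) ≡ s → ∀ g → C33 ≡ g → 2 * g ≡ 3 + s → 1 ≤ s → N# 2 (d (Other.w (O p)) x) * s ≡ 5 → N# 3 3 * g ≡ 10 → sq x (Other.w (O p)) ≡ 1 × C33 ≡ 2
        pick 1 e g e' r _ _ _ = e , e' · *-cancelˡ-≡ g 2 2 r
        pick 2 e g e' r _ q _ = ⊥-elim (from-no (2 ∣? 5) (divides (N# 2 (d (Other.w (O p)) x)) (sym q)))
        pick 3 e g e' r _ q _ = ⊥-elim (from-no (3 ∣? 5) (divides (N# 2 (d (Other.w (O p)) x)) (sym q)))
        pick 4 e g e' r _ q _ = ⊥-elim (from-no (4 ∣? 5) (divides (N# 2 (d (Other.w (O p)) x)) (sym q)))
        pick 5 e g e' r _ q t with *-cancelˡ-≡ g 4 2 r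
        ... | refl = ⊥-elim (from-no (4 ∣? 10) (divides (N# 3 3) (sym t)))
        pick (6+ s) e g e' r _ q _ = ⊥-elim (1+n≰n (≤6+ (z≤n {s}) » ∣⇒≤ (divides (N# 2 (d (Other.w (O p)) x)) (sym q))))
       one1 : ∀ {x y} (p : x ⟶ y) → sq x (Other.w (O p)) ≡ 1
       one1 p = fst (both p)
       c2 : C33 ≡ 2
       c2 = snd (both axy)
      go _ _ _ _ a b c f s12 = lia (∑ (λ z → β (Odd _ _ z) * sq ax z) ∷ C33 ∷ []) ((κ 5 ⊹ (κ 0 ⊹ (κ 2 ⊹ (κ 2 ⊹ κ 0))) ≋ κ 9 ⊹ ν0) ∷ (ν0 ≋ κ 2) ∷ [])
       (eqn axy k5 z2 f (+-cancelˡ-≡ 5 _ 0 (count k5 z2 f)) refl a , σ2 3 (λ ()) b axy S-val · +≡ c c)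
      go _ _ _ _ a b c f s21 = ⊥-elim (from-no (3 ∣? 5) (divides (N# 2 (d (Other.w O) ax)) (sym (cong (N# 2 (d (Other.w O) ax) *_) (sym s3) · Other.size1 O · k5)))) where
       O : Other 3 1 ax ay
       O = σ1 3 (λ ()) b axy (λ r → S-val r · c)
       s3 : sq ax (Other.w O) ≡ 3
       s3 = lia≡ (sq ax (Other.w O) ∷ []) ((κ 5 ⊹ (κ 0 ⊹ (κ 4 ⊹ (κ 4 ⊹ κ 0))) ≋ κ 9 ⊹ (κ 1 ⊹ ν0)) ∷ []) ν0 (κ 3) (eqn axy k5 z2 f (+-cancelˡ-≡ 5 _ 0 (count k5 z2 f)) refl a · cong (9 +_) (Other.sum1 O))
      go _ _ _ _ a b c f s22 = let (y , u , v , yu , yv , ne , g) = bigSib a (eq≥ c) in ⊥-elim (bad yu yv ne (eq≤ (cong suc (sym (P≡ k5))) » g)) where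
       h : nn 3 3 ≡ 0
       h = +-cancelˡ-≡ 5 _ 0 (count k5 z2 f)
       bad : ∀ {y u v} → y ⟶ u → y ⟶ v → u ≢ v → 4 ≤ co u v → ⊥
       bad {y} {u} {v} yu yv ne g = pk (sib-d yu yv ne) (sib-d yv yu (ne ∘ sym)) where
        sm : ∀ {m} → co u v ≡ m → m ≤ 2 → ⊥
        sm e l' = 1+n≰n {2} (n≤1+n 3 » g » eq≤ e » l')
        pk : d u v ≡ 2 ⊎ d u v ≡ 3 → d v u ≡ 2 ⊎ d v u ≡ 3 → ⊥
        pk (inj₁ e) (inj₁ i) = sm (c≡0 2 2 z2 (Cb-intro e i)) z≤n
        pk (inj₁ e) (inj₂ i) = sm (snd (val 2 3) (Cb-intro e i) · a) ≤-refl
        pk (inj₂ e) (inj₁ i) = sm (co-sym u v · snd (val 2 3) (Cb-intro i e) · a) ≤-refl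
        pk (inj₂ e) (inj₂ i) = sm (c≡0 3 3 h (Cb-intro e i)) z≤n
     case4 : k ≡ 4 → Left
     case4 k4 = go C23 (ee 3) S23 (nn 2 3) refl refl refl refl (sol3 z2 (n≤1 » z<s)) where
      n≤1 : nn 2 3 ≤ 1
      n≤1 = ≤-pred (≰⇒> λ h → lia (nn 2 3 ∷ nn 3 3 ∷ []) ((κ 1 ⊹ (κ 0 ⊹ (ν0 ⊹ (ν0 ⊹ ν1))) ≋ κ 4) ∷ (κ 2 ≼ ν0) ∷ []) (count k4 z2 refl , h))
      n≢2 : nn 2 3 ≡ 2 → ⊥
      n≢2 e = 1+n≰n (eq≥ e » n≤1)
      go : ∀ c e s m → C23 ≡ c → ee 3 ≡ e → S23 ≡ s → nn 2 3 ≡ m → Sol c e s m → Left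
      go _ _ _ _ a b c f s12 = ⊥-elim (n≢2 f)
      go _ _ _ _ a b c f s21 = ⊥-elim (n≢2 f)
      go _ _ _ _ a b c f s22 = ⊥-elim (n≢2 f)
      go _ _ _ _ a b c f s11 = left4 k4 (mkVals l z2 f h b a c (snd (both axy))) (λ p → O p , fst (both p)) where
       h : nn 3 3 ≡ 1
       h = +-cancelˡ-≡ 3 _ 1 (count k4 z2 f)
       O : ∀ {x y} → x ⟶ y → Other 3 1 x y
       O p = σ1 3 (λ ()) b p (λ r → S-val r · c)
       rel : ∀ {x y} (p : x ⟶ y) → 1 + C33 ≡ sq x (Other.w (O p))
       rel {x} p = lia≡ (C33 ∷ sq x (Other.w (O p)) ∷ []) ((κ 4 ⊹ (κ 0 ⊹ (κ 1 ⊹ (κ 1 ⊹ 1 ⊙ ν0))) ≋ κ 4 ⊹ (κ 1 ⊹ ν1)) ∷ []) (κ 1 ⊹ ν0) ν1 (eqn p k4 z2 f h refl a · cong (4 +_) (Other.sum1 (O p)))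
       both : ∀ {x y} (p : x ⟶ y) → sq x (Other.w (O p)) ≡ 2 × C33 ≡ 1
       both {x} p = pick C33 refl (rel p) (C33≥1 (eq≥ h)) (Other.size1 (O p) · k4) where
        pick : ∀ g → C33 ≡ g → 1 + g ≡ sq x (Other.w (O p)) → 1 ≤ g → N# 2 (d (Other.w (O p)) x) * sq x (Other.w (O p)) ≡ 4 → sq x (Other.w (O p)) ≡ 2 × C33 ≡ 1
        pick 1 e r _ _ = sym r , e
        pick 2 e r _ q = ⊥-elim (from-no (3 ∣? 4) (divides (N# 2 (d (Other.w (O p)) x)) (sym (cong (N# 2 (d (Other.w (O p)) x) *_) r · q))))
        pick 3 e r _ q = ⊥-elim (from-no (3 ∣? 4) (divides (N# 3 3) (sym (NC33 (eq≥ h) · cong₂ _*_ k4 h) · cong (N# 3 3 *_) e)))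
        pick (4+ g) e r _ q = ⊥-elim (1+n≰n (≤5+ (z≤n {g}) » ∣⇒≤ {m = 5 + g} (divides (N# 2 (d (Other.w (O p)) x)) (sym (cong (N# 2 (d (Other.w (O p)) x) *_) r · q)))))
   module Has22 (l : 1 ≤ nn 2 2) where
    private
     Wt = wit 2 2 l
    opaque
     C≡1 : C22 ≡ 1
     C≡1 = let (x , p , q , xp , xq , r) = Wt in sym (snd (val 2 2) r) · c22 xp xq r
     k≤5 : k ≤ 5
     k≤5 = let (x , p , q , xp , xq , r) = Wt in Sb.k≤4+c xp xq r » eq≤ (cong (4 +_) (c22 xp xq r))
    S22 : ℕ
    S22 = sq (fst (snd Wt)) (fst (snd (snd Wt)))
    opaque
     S-val : ∀ {p q} → Cb 2 2 p q ≡ true → sq p q ≡ S22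
     S-val r = let (_ , _ , _ , _ , _ , r') = Wt in on-sq 2 2 r r'
     S≥1 : 1 ≤ S22
     S≥1 = let (_ , _ , _ , _ , _ , r') = Wt in sq-pos (Cb-fst r')
     es : ee 2 ≡ S22 * nn 2 2
     es = let (x , p , q , xp , xq , r) = Wt in sym (+-identityʳ _) · cong (_* ee 2) (sym (c22 xp xq r)) · Sb.ce xp xq r
     e≥ : 1 ≤ ee 2
     e≥ = let (x , p , q , xp , xq , r) = Wt in Sb.e≥1 xp xq r
     both : 1 ≤ nn 2 3 → k ≡ 4 ⊎ k ≡ 5 → ⊥
     both l3 kk = go (nn 2 2) (nn 2 3) refl refl l l3 kk where
      e1 : ee 2 ≡ 1 × ee 3 ≡ 1
      e1 = lia≡ (ee 2 ∷ ee 3 ∷ []) ((κ 1 ≼ ν0) ∷ (κ 1 ≼ ν1) ∷ (ν0 ⊹ ν1 ≼ κ 2) ∷ []) ν0 (κ 1) (e≥ , Has23.e≥ l3 , e2+e3) , lia≡ (ee 2 ∷ ee 3 ∷ []) ((κ 1 ≼ ν0) ∷ (κ 1 ≼ ν1) ∷ (ν0 ⊹ ν1 ≼ κ 2) ∷ []) ν1 (κ 1) (e≥ , Has23.e≥ l3 , e2+e3)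
      S1 : S22 ≡ 1
      S1 = m*n≡1⇒m≡1 S22 (nn 2 2) (sym es · fst e1)
      go : ∀ a b → nn 2 2 ≡ a → nn 2 3 ≡ b → 1 ≤ a → 1 ≤ b → k ≡ 4 ⊎ k ≡ 5 → ⊥
      go (2+ a) b e f _ _ _ = 1+n≢0 (suc-injective (sym e · m*n≡1⇒n≡1 S22 (nn 2 2) (sym es · fst e1)))
      go 1 (2+ b) e f _ _ kk = lia (k ∷ b ∷ nn 3 3 ∷ []) ((κ 1 ⊹ (κ 1 ⊹ (κ 2 ⊹ ν1 ⊹ (κ 2 ⊹ ν1 ⊹ ν2))) ≋ ν0) ∷ (ν0 ≼ κ 5) ∷ []) (count refl e f , [ (λ q → eq≤ q » n≤1+n 4) , eq≤ ]′ kk)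
      go 1 1 e f _ _ kk = num kk where
       O : Other 2 1 ax ay
       O = σ1 2 (λ ()) (fst e1) axy (λ r → S-val r · S1)
       w3 : sq ax (Other.w O) ≡ C23
       w3 = Has23.S-val l3 (Cb-intro (odd-d axy (Other.ow O)) d3) · sym (sym (*-identityʳ C23) · cong (C23 *_) (sym (snd e1)) · Has23.ce3 l3 · cong (Has23.S23 l3 *_) f · *-identityʳ _) where
        p₀ : ax ⟶ ay
        p₀ = axy
        d3 : d (Other.w O) ax ≡ 3
        d3 = let
            (z , q) = #∃ (eq≥ (snd e1))
            (y , r) = #∃ (eq≥ (fst e1))
            yz : y ≢ z
            yz = λ g → 2≢3 (sym (Cb-snd (lftC r)) · cong (λ v → d v ax) g · Cb-snd (lftC q))
            yw : y ≢ Other.w O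
            yw = λ g → Other.db O (cong (λ v → d v ax) (sym g) · Cb-snd (lftC r))
         in cong (λ v → d v ax) (third (odd2 p₀) (e-odd p₀ (λ ()) r) (Other.ow O) (e-odd p₀ (λ ()) q) yw yz) · Cb-snd (lftC q)
       num : k ≡ 4 ⊎ k ≡ 5 → ⊥
       num (inj₁ k4) = lia (C23 ∷ sq ax (Other.w O) ∷ []) ((κ 4 ⊹ (κ 1 ⊹ (1 ⊙ ν0 ⊹ (1 ⊙ ν0 ⊹ κ 0))) ≋ κ 4 ⊹ (κ 1 ⊹ ν1)) ∷ (ν1 ≋ ν0) ∷ (κ 1 ≼ ν0) ∷ [])
        (eqn axy k4 e f (+-cancelˡ-≡ 4 _ 0 (count k4 e f)) C≡1 refl · cong (4 +_) (Other.sum1 O) , w3 , Has23.C≥1 l3)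
       num (inj₂ k5) = pick C23 refl (lia≡ (C23 ∷ sq ax (Other.w O) ∷ C33 ∷ []) ((κ 5 ⊹ (κ 1 ⊹ (1 ⊙ ν0 ⊹ (1 ⊙ ν0 ⊹ 1 ⊙ ν2))) ≋ κ 9 ⊹ (κ 1 ⊹ ν1)) ∷ (ν1 ≋ ν0) ∷ []) (ν0 ⊹ ν2) (κ 4)
        (eqn axy k5 e f h C≡1 refl · cong (9 +_) (Other.sum1 O) , w3)) (Has23.C≥1 l3) (Has23.C≤2 l3) where
        h : nn 3 3 ≡ 1
        h = +-cancelˡ-≡ 4 _ 1 (count k5 e f)
        N5 : N# 3 3 * C33 ≡ 5
        N5 = NC33 (eq≥ h) · cong₂ _*_ k5 h
        pick : ∀ c → C23 ≡ c → C23 + C33 ≡ 4 → 1 ≤ C23 → C23 ≤ 2 → ⊥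
        pick 0 q g l' _ = 1+n≰n (l' » eq≤ q)
        pick 1 q g _ _ = from-no (3 ∣? 5) (divides (N# 3 3) (sym N5 · cong (N# 3 3 *_) (suc-injective (cong (_+ C33) (sym q) · g))))
        pick 2 q g _ _ = from-no (2 ∣? 5) (divides (N# 3 3) (sym N5 · cong (N# 3 3 *_) (+-cancelˡ-≡ 2 C33 2 (cong (_+ C33) (sym q) · g))))
        pick (3+ c) q g _ l' = 1+n≰n (≤3+ (z≤n {c}) » eq≥ q » l')
     alone4 : nn 2 3 ≡ 0 → k ≡ 4 → ⊥
     alone4 z3 k4 = go (ee 2) refl (nn 2 2) refl e≥ (e≤2 2 λ ()) l where
      go : ∀ e → ee 2 ≡ e → ∀ a → nn 2 2 ≡ a → 1 ≤ e → e ≤ 2 → 1 ≤ a → ⊥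
      go 1 q a r _ _ _ = Kill4.At.contra k4 z3 n1 q {w = Other.w O} axy (Other.ow O) (Other.db O) (Other.size1 O) {C33}
          (lia≡ (C33 ∷ sq ax (Other.w O) ∷ []) ((κ 4 ⊹ (κ 1 ⊹ (κ 0 ⊹ (κ 0 ⊹ 2 ⊙ ν0))) ≋ κ 4 ⊹ (κ 1 ⊹ ν1)) ∷ []) (κ 1 ⊹ 2 ⊙ ν0) (κ 1 ⊹ ν1) (eqn {e = C23} axy k4 n1 z3 h C≡1 refl · cong (4 +_) (Other.sum1 O)))
          (NC33 (≥1 h) · cong₂ _*_ k4 h) where
       S1 : S22 ≡ 1
       S1 = m*n≡1⇒m≡1 S22 (nn 2 2) (sym es · q)
       n1 : nn 2 2 ≡ 1
       n1 = m*n≡1⇒n≡1 S22 (nn 2 2) (sym es · q)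
       h : nn 3 3 ≡ 2
       h = +-cancelˡ-≡ 2 _ 2 (count k4 n1 z3)
       O : Other 2 1 ax ay
       O = σ1 2 (λ ()) q axy (λ r → S-val r · S1)
      go 2 q 1 r _ _ _ = par C33 (lia≡ (C33 ∷ S22 ∷ []) ((κ 4 ⊹ (κ 1 ⊹ (κ 0 ⊹ (κ 0 ⊹ 2 ⊙ ν0))) ≋ κ 4 ⊹ (ν1 ⊹ ν1)) ∷ (ν1 ≋ κ 2) ∷ []) (2 ⊙ ν0) (κ 3)
          (eqn {e = C23} axy k4 r z3 (+-cancelˡ-≡ 2 _ 2 (count k4 r z3)) C≡1 refl · cong (4 +_) (σ2 2 (λ ()) q axy S-val) , sym (*-identityʳ S22) · cong (S22 *_) (sym r) · sym es · q)) where
       par : ∀ c → 2 * c ≡ 3 → ⊥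
       par c e = from-no (2 ∣? 3) (divides c (sym e · *-comm 2 c))
      go 2 q 2 r _ _ _ = lia (C33 ∷ S22 ∷ []) ((κ 4 ⊹ (κ 2 ⊹ (κ 0 ⊹ (κ 0 ⊹ 1 ⊙ ν0))) ≋ κ 4 ⊹ (ν1 ⊹ ν1)) ∷ (2 ⊙ ν1 ≋ κ 2) ∷ (κ 1 ≼ ν0) ∷ [])
          (eqn {e = C23} axy k4 r z3 h C≡1 refl · cong (4 +_) (σ2 2 (λ ()) q axy S-val) , *-comm 2 S22 · cong (S22 *_) (sym r) · sym es · q , C33≥1 (eq≥ h)) where
       h : nn 3 3 ≡ 1
       h = +-cancelˡ-≡ 3 _ 1 (count k4 r z3)
      go 2 q (3+ a) r _ _ _ = 1+n≰n (≤3+ (z≤n {a}) » eq≥ r » m≤n*m (nn 2 2) S22 {{>-nonZero S≥1}} » eq≤ (sym es · q))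
      go (3+ e) q a r _ (≤2+ ()) _
   classify : Left
   classify = go (nn 2 2) refl (nn 2 3) refl where
    small : ∀ m → k ≡ m → m ≤ 6 → k ≡ 4 ⊎ k ≡ 5 ⊎ k ≡ 6
    small 0 e _ = ⊥-elim (1+n≰n (z<s » k>3 » eq≤ e))
    small 1 e _ = ⊥-elim (1+n≰n (≤2+ z≤n » k>3 » eq≤ e))
    small 2 e _ = ⊥-elim (1+n≰n (≤3+ z≤n » k>3 » eq≤ e))
    small 3 e _ = ⊥-elim (1+n≰n (k>3 » eq≤ e))
    small 4 e _ = inj₁ e
    small 5 e _ = in1 e
    small 6 e _ = inj₂ (inj₂ e)
    small (7+ m) e (≤6+ ())
    go : ∀ a → nn 2 2 ≡ a → ∀ b → nn 2 3 ≡ b → Left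
    go 0 e 0 f = ⊥-elim (NoNear.absurd e f)
    go 0 e (suc b) f = [ Only23.case4 e l , [ Only23.case5 e l , Only23.case6 e l ]′ ]′ (small k refl (Has23.k≤4+C l » +-monoʳ-≤ 4 (Has23.C≤2 l))) where
     l : 1 ≤ nn 2 3
     l = ≥1 f
    go (suc a) e b f = ⊥-elim (fin b f (small k refl (Has22.k≤5 l » n≤1+n 5))) where
     l : 1 ≤ nn 2 2
     l = ≥1 e
     fin : ∀ b → nn 2 3 ≡ b → k ≡ 4 ⊎ k ≡ 5 ⊎ k ≡ 6 → ⊥
     fin b f (inj₂ (inj₂ k6)) = 1+n≰n (eq≥ k6 » Has22.k≤5 l)
     fin 0 f (inj₁ k4) = Has22.alone4 l f k4
     fin 0 f (in1 k5) = kill5 k5 f l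
     fin (suc b) f (inj₁ k4) = Has22.both l (≥1 f) (inj₁ k4)
     fin (suc b) f (in1 k5) = Has22.both l (≥1 f) (inj₂ k5)

   -- The remaining parameters with `k = 4` and `k = 5`

   module Single {m c : ℕ} (Vl : Vals 1 m 1 1 c 1) (oth : ∀ {x y} → x ⟶ y → Other 3 1 x y) where
    open Vals Vl public
    -- As `nn 2 3 = 1`, this class acts as a permutation on the out-neighbours of every vertex
    -- (`next`, `prev!`, `next!`).
    S : V → V → Set
    S x y = Cb 2 3 x y ≡ true
    data Kind (a b : V) : Set where
     kS : S a b → Kind a b
     kT : S b a → Kind a b
     kB : Cb 3 3 a b ≡ true → Kind a b
    opaque
     kind : ∀ {x a b} → x ⟶ a → x ⟶ b → a ≢ b → Kind a b
     kind {x} {a} {b} p q ne = go (sib-d p q ne) (sib-d q p (ne ∘ sym)) where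
      go : d a b ≡ 2 ⊎ d a b ≡ 3 → d b a ≡ 2 ⊎ d b a ≡ 3 → Kind a b
      go (inj₁ e) (inj₁ f) = ⊥-elim (1+n≰n (sib-co p q » eq≤ (c≡0 2 2 n2 (Cb-intro e f))))
      go (inj₁ e) (inj₂ f) = kS (Cb-intro e f)
      go (inj₂ e) (inj₁ f) = kT (Cb-intro f e)
      go (inj₂ e) (inj₂ f) = kB (Cb-intro e f)
     co-pos : ∀ {a b c} → a ⟶ c → b ⟶ c → 1 ≤ co a b
     co-pos {a} {b} {c} p q = ∃# c (and p q)
     kind' : ∀ {a b c} → a ⟶ c → b ⟶ c → a ≢ b → Kind a b
     kind' p q ne = let (x , a , b) = parent (co-pos p q) in kind a b ne
     S-irr : ∀ {a b} → S a b → a ≢ b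
     S-irr = Cb-ne {1} {3}
     S-asym : ∀ {a b} → S a b → S b a → ⊥
     S-asym p q = 2≢3 (sym (Cb-fst p) · Cb-snd q)
     S¬B : ∀ {a b} → S a b → Cb 3 3 a b ≡ true → ⊥
     S¬B p q = 2≢3 (sym (Cb-fst p) · Cb-fst q)
     far : ∀ {a b c} → S a b ⊎ Cb 3 3 a b ≡ true → b ⟶ c → c ⟶ a → ⊥
     far s p q = 1+n≰n (eq≥ ([ Cb-snd , Cb-snd ]′ s) » d≤2 p q)
     toS : ∀ {x a b t} → x ⟶ a → x ⟶ b → a ⟶ t → t ⟶ b → S a b
     toS {x} {a} {b} xa xb at tb = go (kind xa xb λ { refl → no2 at tb }) where
      lt : d a b ≡ 3 → ⊥
      lt e = 1+n≰n (eq≥ e » d≤2 at tb)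
      go : Kind a b → S a b
      go (kS s) = s
      go (kT s) = ⊥-elim (lt (Cb-snd s))
      go (kB s) = ⊥-elim (lt (Cb-fst s))
     mid : ∀ {x z} → S x z → ∃ λ u → x ⟶ u × u ⟶ z
     mid {x} {z} s = let (u , p , q) = first-step {x} {z} (Cb-fst s) in u , p , d⇒A q
     mid! : ∀ {x z u v} → S x z → x ⟶ u → u ⟶ z → x ⟶ v → v ⟶ z → u ≡ v
     mid! s a b a' b' = unique (q3 s) (and a b) (and a' b')
     out! : ∀ {x z u v} → S x z → x ⟶ u → z ⟶ u → x ⟶ v → z ⟶ v → u ≡ v
     out! s a b a' b' = unique (c3 s) (and a b) (and a' b')
     common : ∀ {x z} → S x z → ∃ λ u → x ⟶ u × z ⟶ u
     common s = let (u , e) = #∃ (eq≥ (c3 s)) in u , lft e , rgt e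
     above : ∀ {x u} → x ⟶ u → ∃ λ z → u ⟶ z × S x z
     above p = let (z , e) = #∃ (eq≥ (e≡ 3 p · e3)) in z , rgtC e , lftC e
     above! : ∀ {x u z z'} → x ⟶ u → u ⟶ z → S x z → u ⟶ z' → S x z' → z ≡ z'
     above! p a s a' s' = unique (e≡ 3 p · e3) (andC s a) (andC s' a')
     S-odd : ∀ {x u z} → x ⟶ u → u ⟶ z → S x z → Odd x u z ≡ true
     S-odd p q s = e-odd p (λ ()) (andC s q)
     next : ∀ {x u} → x ⟶ u → ∃ λ v → x ⟶ v × S u v
     next p = let (v , e) = #∃ (eq≥ (n≡ 3 2 p · sym n23≡n32 · n3)) in v , lft e , Cb-intro (Cb-snd (rgt e)) (Cb-fst (rgt e))
     prev! : ∀ {x u u' v} → x ⟶ v → x ⟶ u → S u v → x ⟶ u' → S u' v → u ≡ u'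
     prev! p a s a' s' = unique (n≡ 2 3 p · n3) (and a s) (and a' s')
     next! : ∀ {x u v v'} → x ⟶ u → x ⟶ v → S u v → x ⟶ v' → S u v' → v ≡ v'
     next! p a s a' s' = unique (n≡ 3 2 p · sym n23≡n32 · n3) (and a (tw s)) (and a' (tw s')) where
      tw : ∀ {a b} → S a b → Cb 3 2 b a ≡ true
      tw r = Cb-intro (Cb-snd r) (Cb-fst r)
     inS! : ∀ {x u v v'} → x ⟶ u → v ⟶ u → S x v → v' ⟶ u → S x v' → v ≡ v'
     inS! p a s a' s' = unique (n-in 2 3 p · n3) (andC s a) (andC s' a')
     inT : ∀ {x u} → x ⟶ u → ∃ λ v → v ⟶ u × S v x
     inT p = let (v , e) = #∃ (eq≥ (n-in 3 2 p · sym n23≡n32 · n3)) in v , rgtC e , Cb-intro (Cb-snd (lftC e)) (Cb-fst (lftC e))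
     -- The vertex of S(x) above u is the midpoint of u and its successor.
     frame : ∀ {x u v} → x ⟶ u → x ⟶ v → S u v → ∃ λ z → u ⟶ z × S x z × z ⟶ v
     frame p q s = let
         (z , uz , sz) = above p
         (v' , xv' , zv') = common sz
      in z , uz , sz , subst (z ⟶_) (next! p xv' (toS p xv' uz zv') q s) zv'
    -- The odd vertex over (x , u) that is not in S(x).
    record Wide (x u w : V) : Set where
     constructor wide
     field
      xu : x ⟶ u
      ow : Odd x u w ≡ true
      nS : d w x ≢ 3
     uw : u ⟶ w
     uw = lft ow
    opaque
     wide∃ : ∀ {x u} → x ⟶ u → ∃ λ w → Wide x u w
     wide∃ p = Other.w (oth p) , wide p (Other.ow (oth p)) (Other.db (oth p))
     odd-or : ∀ {x u z w t} → u ⟶ z → S x z → Wide x u w → Odd x u t ≡ true → t ≡ z ⊎ t ≡ w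
     odd-or {x} {u} {z} {w} {t} uz s W1 o with t F.≟ z
     ... | yes e = inj₁ e
     ... | no ne = inj₂ (third (odd2 (Wide.xu W1)) (S-odd (Wide.xu W1) uz s) o (Wide.ow W1) (ne ∘ sym) λ { refl → Wide.nS W1 (Cb-snd s) })
     wide! : ∀ {x u w w'} → Wide x u w → Wide x u w' → w ≡ w'
     wide! {x} W1 W2 = let (z , uz , s) = above (Wide.xu W1) in elimˡ (λ e → Wide.nS W1 (cong (λ v → d v x) e · Cb-snd s)) (odd-or uz s W2 (Wide.ow W1))
     not-back : ∀ {x u w} → Wide x u w → w ⟶ x → ⊥
     not-back W1 r = t≢f r (not-t (rgt (Wide.ow W1)))

   module Left4 (k4 : k ≡ 4) (Vl : Vals 1 1 1 1 1 1) (oth : ∀ {x y} → x ⟶ y → Σ (Other 3 1 x y) λ O → sq x (Other.w O) ≡ 2) where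
    open Single Vl (λ p → fst (oth p))
    opaque
     P≡2 : P ≡ 2
     P≡2 = +-cancelˡ-≡ 2 P 2 (P2 · k4)
     co1 : ∀ {a b c} → a ⟶ c → b ⟶ c → a ≢ b → co a b ≡ 1
     co1 {a} {b} p q ne = go (kind' p q ne) where
      go : Kind a b → co a b ≡ 1
      go (kS s) = c3 s
      go (kT s) = co-sym a b · c3 s
      go (kB s) = c33 s
     uout : ∀ {a b c c'} → a ≢ b → a ⟶ c → b ⟶ c → a ⟶ c' → b ⟶ c' → c ≡ c'
     uout ne p q p' q' = unique (co1 p q ne) (and p q) (and p' q')
     uin : ∀ {a b c c'} → a ≢ b → c ⟶ a → c ⟶ b → c' ⟶ a → c' ⟶ b → c ≡ c'
     uin {a} {b} ne p q p' q' = let (e , r) = #∃ (sib-co p q) in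
      unique (sym (co-in a b) · co1 (lft r) (rgt r) ne) (and p q) (and p' q')
     sq2 : ∀ {x u w} → Wide x u w → sq x w ≡ 2
     sq2 {x} W1 = cong (sq x) (wide! W1 (wide (Wide.xu W1) (Other.ow (fst (oth (Wide.xu W1)))) (Other.db (fst (oth (Wide.xu W1)))))) · snd (oth (Wide.xu W1))
     other : ∀ {x u w} → Wide x u w → ∃ λ v → v ≢ u × Wide x v w
     other {x} {u} W1 = let (v , e , ne , _) = fresh (u ∷ []) (eq≥ (sq2 W1)) in
      v , ne , wide (lft e) (and (rgt e) (rgt (Wide.ow W1))) (Wide.nS W1)
     down : ∀ {x u v w t} → Wide x u w → Wide x v w → v ≢ u → w ⟶ t → t ⟶ u ⊎ t ⟶ v
     down {x} {u} {v} {w} {t} W1 W2 ne r = [ inj₁ ∘ rgt , inj₂ ∘ rgt ]′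
      (cover2 (λ t → A w t ∧ A t u) (λ t → A w t ∧ A t v) (A w) (λ t → lft) (λ t → lft)
       (λ t a b → not-back W1 (subst (w ⟶_) (uin (ne ∘ sym) (rgt a) (rgt b) (Wide.xu W1) (Wide.xu W2)) (lft a)))
       (eq≤ (out w · k4 · sym (+≡ (tri (Wide.uw W1) · P≡2) (tri (Wide.uw W2) · P≡2)))) r)
     wide-d : ∀ {x u w t} → Wide x u w → w ⟶ t → S t x → ⊥
     wide-d {x} {u} {w} {t} W1 r s = go (d w x) refl (d-min (W-cons r (subst (λ m → W m t x) (Cb-fst s) (d-walk t x)))) where
      go : ∀ m → d w x ≡ m → m ≤ 3 → ⊥
      go 0 e _ = 0≢1+n (sym (d-refl x) · subst (λ v → d x v ≡ 2) (d≡0 e) (odd-d (Wide.xu W1) (Wide.ow W1)))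
      go 1 e _ = not-back W1 (d⇒A e)
      go 2 e _ = let
          (v , ne , W2) = other W1
          (y , p , q) = first-step {w} {x} e
       in [ (λ a → a0 (d⇒A q) (Wide.xu W1) a) , (λ a → a0 (d⇒A q) (Wide.xu W2) a) ]′ (down W1 W2 ne p)
      go 3 e _ = Wide.nS W1 e
      go (4+ _) e (≤3+ ())
     downKind : ∀ {x u w t} → Wide x u w → w ⟶ t → t ⟶ u → S x t ⊎ Cb 3 3 x t ≡ true
     downKind {x} {u} {w} {t} W1 r a = go (kind' (Wide.xu W1) a λ { refl → not-back W1 r }) where
      go : Kind x t → S x t ⊎ Cb 3 3 x t ≡ true
      go (kS s) = inj₁ s
      go (kT s) = ⊥-elim (wide-d W1 r s)
      go (kB s) = inj₂ s
     -- Two vertices after `w` precede `u`. Each lies in S(x) or in class (3 , 3), and the latter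
     -- offers only one place; so one of them is the unique vertex of S(x) before `u`.
     wS : ∀ {x u w v} → Wide x u w → v ⟶ u → S x v → w ⟶ v
     wS {x} {u} {w} {v} W1 p s =
      let (t , t' , a , b , ne) = pair∃ (eq≥ (tri (Wide.uw W1) · P≡2))
      in go (lft a) (rgt a) (lft b) (rgt b) ne where
      go : ∀ {t t'} → w ⟶ t → t ⟶ u → w ⟶ t' → t' ⟶ u → t ≢ t' → w ⟶ v
      go a a' b b' ne = [ (λ r → subst (w ⟶_) (inS! (Wide.xu W1) a' r p s) a) , (λ r → [ (λ r' → subst (w ⟶_) (inS! (Wide.xu W1) b' r' p s) b) , (λ r' → ⊥-elim (ne (unique (n-in 3 3 (Wide.xu W1) · n33) (andC r a') (andC r' b')))) ]′ (downKind W1 b b')) ]′ (downKind W1 a a')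
     B-sym : ∀ {a b} → Cb 3 3 a b ≡ true → Cb 3 3 b a ≡ true
     B-sym s = Cb-intro (Cb-snd s) (Cb-fst s)
     -- The vertex `z` of S(x) between `u` and `v` follows `w` by `wS`, and `u → w → z` with `u → z`
     -- is a transitive triangle.
     R : ∀ {x u v w} → Wide x u w → Wide x v w → S u v → ⊥
     R W1 W2 s = let (z , uz , sz , zv) = frame (Wide.xu W1) (Wide.xu W2) s in a0 (Wide.uw W1) (wS W2 zv sz) uz
     opp : ∀ {x u} → x ⟶ u → ∃ λ v → x ⟶ v × Cb 3 3 u v ≡ true × ∃ λ w → Wide x u w × Wide x v w
     opp {x} {u} p = let
         (w , W1) = wide∃ p
         (v , ne , W2) = other W1
      in v , Wide.xu W2 , go W1 W2 (kind p (Wide.xu W2) (ne ∘ sym)) , w , W1 , W2 where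
      go : ∀ {v w} → Wide x u w → Wide x v w → Kind u v → Cb 3 3 u v ≡ true
      go W1 W2 (kS s) = ⊥-elim (R W1 W2 s)
      go W1 W2 (kT s) = ⊥-elim (R W2 W1 s)
      go W1 W2 (kB s) = s
     opp! : ∀ {x u v v'} → x ⟶ u → x ⟶ v → x ⟶ v' → Cb 3 3 u v ≡ true → Cb 3 3 u v' ≡ true → v ≡ v'
     opp! p a a' s s' = unique (n≡ 3 3 p · n33) (and a (B-sym s)) (and a' (B-sym s'))
     back¬B : ∀ {x u v t} → x ⟶ u → x ⟶ v → u ⟶ t → v ⟶ t → t ⟶ x → Cb 3 3 u v ≡ true → ⊥
     back¬B p q a b r s = let (v' , xv' , s' , w , W1 , W2) = opp p in
      not-back W1 (subst (_⟶ _) (uout (Cb-ne {2} {3} s) a b (Wide.uw W1) (subst (_⟶ w) (opp! p xv' q s' s) (Wide.uw W2))) r)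
    record Orbit (x u0 : V) : Set where
     constructor orb
     field
      {u1 u2 u3} : V
      x0 : x ⟶ u0
      x1 : x ⟶ u1
      x2 : x ⟶ u2
      x3 : x ⟶ u3
      s0 : S u0 u1
      s1 : S u1 u2
      s2 : S u2 u3
      s3 : S u3 u0
     opaque
      n02 : u0 ≢ u2
      n02 e = S-asym s0 (subst (S u1) (sym e) s1)
      n13 : u1 ≢ u3
      n13 e = S-asym s1 (subst (S u2) (sym e) s2)
      all : ∀ {t} → x ⟶ t → In t (u0 ∷ u1 ∷ u2 ∷ u3 ∷ [])
      all = member {P = A x} (u0 ∷ u1 ∷ u2 ∷ u3 ∷ []) ((S-irr s0 , n02 , S-irr s3 ∘ sym , tt) , (S-irr s1 , n13 , tt) , (S-irr s2 , tt) , tt , tt) (x0 , x1 , x2 , x3 , tt) (eq≤ (out x · k4))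
      b02 : Cb 3 3 u0 u2 ≡ true
      b02 = go (kind x0 x2 n02) where
       go : Kind u0 u2 → Cb 3 3 u0 u2 ≡ true
       go (kS s) = ⊥-elim (S-irr s1 (next! x0 x1 s0 x2 s))
       go (kT s) = ⊥-elim (S-irr s3 (sym (next! x2 x0 s x3 s2)))
       go (kB s) = s
    turn : ∀ {x u} (O : Orbit x u) → Orbit x (Orbit.u1 O)
    turn (orb x0 x1 x2 x3 s0 s1 s2 s3) = orb x1 x2 x3 x0 s1 s2 s3 s0
    opaque
     orbit : ∀ {x u} → x ⟶ u → Orbit x u
     orbit {x} {u} p =
      let (u1 , x1 , s0) = next p
          (u2 , x2 , s1) = next x1
          (u3 , x3 , s2) = next x2
          (v , xv , b , _) = opp p
          (v₁ , xv1 , b₁ , _) = opp x1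
      in close x1 x2 x3 s0 s1 s2 xv b xv1 b₁ where
      close : ∀ {u1 u2 u3 v v₁} → x ⟶ u1 → x ⟶ u2 → x ⟶ u3 → S u u1 → S u1 u2 → S u2 u3 → x ⟶ v → Cb 3 3 u v ≡ true → x ⟶ v₁ → Cb 3 3 u1 v₁ ≡ true → Orbit x u
      close {u1} {u2} {u3} {v} {v₁} x1 x2 x3 s0 s1 s2 xv b xv1 b₁ = fin (next x3) (u3 F.≟ u) where
       n02 : u ≢ u2
       n02 refl = S-asym s0 s1
       n13 : u1 ≢ u3
       n13 refl = S-asym s1 s2
       fin : (∃ λ t → x ⟶ t × S u3 t) → Dec (u3 ≡ u) → Orbit x u
       fin _ (yes refl) = ⊥-elim (S-irr s0 (opp! xv p x1 (B-sym b) (subst (λ t → Cb 3 3 t u1 ≡ true) (same (member {P = A x} (u ∷ u1 ∷ u2 ∷ v ∷ []) ((S-irr s0 , n02 , Cb-ne {2} {3} b , tt) , (S-irr s1 , (λ { refl → S¬B s0 b }) , tt) , ((λ { refl → S¬B s2 (B-sym b) }) , tt) , tt , tt) (p , x1 , x2 , xv , tt) (eq≤ (out x · k4)) xv1)) (B-sym b₁)))) where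
        same : In v₁ (u ∷ u1 ∷ u2 ∷ v ∷ []) → v₁ ≡ v
        same (inj₁ refl) = ⊥-elim (S¬B s0 (B-sym b₁))
        same (in1 refl) = ⊥-elim (Cb-ne {2} {3} b₁ refl)
        same (in2 refl) = ⊥-elim (S¬B s1 b₁)
        same (in3 e) = e
       fin (t , xt , s) (no n3) = go (member {P = A x} (u ∷ u1 ∷ u2 ∷ u3 ∷ []) ((S-irr s0 , n02 , n3 ∘ sym , tt) , (S-irr s1 , n13 , tt) , (S-irr s2 , tt) , tt , tt) (p , x1 , x2 , x3 , tt) (eq≤ (out x · k4)) xt) where
        go : In t (u ∷ u1 ∷ u2 ∷ u3 ∷ []) → Orbit x u
        go (inj₁ refl) = orb p x1 x2 x3 s0 s1 s2 s
        go (in1 refl) = ⊥-elim (n3 (prev! x1 x3 s p s0))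
        go (in2 refl) = ⊥-elim (S-asym s s2)
        go (in3 refl) = ⊥-elim (S-irr s refl)
     -- With base u the successors run z, t, p, w, where t is the common out-neighbour of u and v; hence z⁺ lies in S(u) above w.
     stepz : ∀ {x u v z z⁺} → x ⟶ u → x ⟶ v → S u v → u ⟶ z → S x z → z ⟶ v → v ⟶ z⁺ → S x z⁺ → z⁺ ⟶ z
     stepz {x} {u} {v} {z} {z⁺} p q s uz sz zv vz⁺ sz⁺ =
      let O = orbit p
          (t , ut , vt) = common s
          (w , W1) = wide∃ p
      in go W1 ut vt (orbit uz) where
      go : ∀ {w t} → Wide x u w → u ⟶ t → v ⟶ t → Orbit u z → z⁺ ⟶ z
      go {w} {t} W1 ut vt O' = fin (kd w≡3) where
       open Orbit O'
       szt : S z t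
       szt = toS uz ut zv vt
       t≡1 : u1 ≡ t
       t≡1 = next! uz x1 s0 ut szt
       W2 : Wide x (Orbit.u2 (orbit p)) w
       W2 = let (v' , xv' , b , w' , W3 , W4) = opp p in subst (λ v → Wide x v w) (opp! p xv' (Orbit.x2 (orbit p)) b (Orbit.b02 (orbit p))) (subst (Wide x v') (wide! W3 W1) W4)
       v≡ : Orbit.u1 (orbit p) ≡ v
       v≡ = next! p (Orbit.x1 (orbit p)) (Orbit.s0 (orbit p)) q s
       wz⁺ : w ⟶ z⁺
       wz⁺ = let
           (z' , vz' , sz' , z'u) = frame q (Orbit.x2 (orbit p)) (subst (λ v → S v (Orbit.u2 (orbit p))) v≡ (Orbit.s1 (orbit p)))
        in wS W2 (subst (_⟶ _) (above! q vz' sz' vz⁺ sz⁺) z'u) sz⁺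
       tx : t ⟶ x
       tx = elimʳ (λ f → [ (λ e → S-irr szt (sym e)) , (λ e → R W1 (wide q (and (subst (v ⟶_) e vt) (rgt (Wide.ow W1))) (Wide.nS W1)) s) ]′ (odd-or uz sz W1 (and ut (not-f f)))) (cases (A t x))
       w≡3 : w ≡ u3
       w≡3 = pick (all (Wide.uw W1)) where
        pick : In w (z ∷ u1 ∷ u2 ∷ u3 ∷ []) → w ≡ u3
        pick (inj₁ refl) = ⊥-elim (Wide.nS W1 (Cb-snd sz))
        pick (in1 refl) = ⊥-elim (not-back W1 (subst (_⟶ x) (sym t≡1) tx))
        pick (in2 refl) = ⊥-elim (back¬B ut x3 tx (elimʳ (λ f → [ (λ e → S-irr s3 e) , S-irr s2 ∘ sym ]′ (odd-or uz sz W1 (and x3 (not-f f)))) (cases (A u3 x))) p (subst (λ t → Cb 3 3 t u3 ≡ true) t≡1 (Orbit.b02 (turn O'))))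
        pick (in3 e) = e
       kd : w ≡ u3 → S u z⁺ ⊎ Wide u w z⁺
       kd e = dec (d z⁺ u ≟ 3) where
        o : Odd u w z⁺ ≡ true
        o = and wz⁺ (not-f (¬t λ r → far (inj₁ s) vz⁺ r))
        dec : Dec (d z⁺ u ≡ 3) → S u z⁺ ⊎ Wide u w z⁺
        dec (yes f) = inj₁ (Cb-intro (odd-d (Wide.uw W1) o) f)
        dec (no f) = inj₂ (wide (Wide.uw W1) o f)
       fin : S u z⁺ ⊎ Wide u w z⁺ → z⁺ ⟶ z
       fin (inj₁ r) = let (y , wy , sy , yz) = frame (Wide.uw W1) uz (subst (λ w → S w z) (sym w≡3) s3) in subst (_⟶ z) (above! (Wide.uw W1) wy sy wz⁺ r) yz
       fin (inj₂ W3) = let (m , ne , W4) = other W3 in ⊥-elim (bad W4 ne (all (Wide.xu W4))) where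
        bad : ∀ {m} → Wide u m z⁺ → m ≢ w → In m (z ∷ u1 ∷ u2 ∷ u3 ∷ []) → ⊥
        bad W4 ne (inj₁ refl) = a0 zv vz⁺ (Wide.uw W4)
        bad W4 ne (in1 refl) = a0 vt (subst (_⟶ z⁺) t≡1 (Wide.uw W4)) vz⁺
        bad W4 ne (in2 refl) = R W4 W3 (subst (S u2) (sym w≡3) s2)
        bad W4 ne (in3 refl) = ne (sym w≡3)
     -- The vertices of S(x) above the orbit form a directed four-cycle by `stepz`. Two opposite
     -- ones follow `w`, so they are in relation S in both directions.
     absurd : ⊥
     absurd = let
         (x , u , p) = arc0
      in go (orbit p) where
      go : ∀ {x u} → Orbit x u → ⊥
      go O = let
          (z0 , a0 , b0 , c0) = frame x0 x1 s0
          (z1 , a1 , b1 , c1) = frame x1 x2 s1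
          (z₂ , a2 , b2 , c2) = frame x2 x3 s2
          (z₃ , a3 , b3 , c3) = frame x3 x0 s3
          (v , xv , b , w , W1 , W2) = opp x0
          W3 = subst (λ v → Wide _ v w) (opp! x0 xv x2 b b02) W2
          w3 = wS W1 c3 b3
          w1 = wS W3 c1 b1
          r10 = stepz x0 x1 s0 a0 b0 c0 a1 b1
          r21 = stepz x1 x2 s1 a1 b1 c1 a2 b2
          r32 = stepz x2 x3 s2 a2 b2 c2 a3 b3
          r03 = stepz x3 x0 s3 a3 b3 c3 a0 b0
       in S-asym (toS w1 w3 r10 r03) (toS w3 w1 r32 r21) where
       open Orbit O

   module Left5 (k5 : k ≡ 5) (Vl : Vals 1 2 1 1 2 1) (oth : ∀ {x y} → x ⟶ y → Σ (Other 3 1 x y) λ O → sq x (Other.w O) ≡ 1) where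
    open Single Vl (λ p → fst (oth p))
    record Cyc (x u0 : V) : Set where
     constructor cyc
     field
      {u1 u2 u3 u₄} : V
      x0 : x ⟶ u0
      x1 : x ⟶ u1
      x2 : x ⟶ u2
      x3 : x ⟶ u3
      x4 : x ⟶ u₄
      s0 : S u0 u1
      s1 : S u1 u2
      s2 : S u2 u3
      s3 : S u3 u₄
      s4 : S u₄ u0
    turn : ∀ {x u} (O : Cyc x u) → Cyc x (Cyc.u1 O)
    turn (cyc x0 x1 x2 x3 x4 s0 s1 s2 s3 s4) = cyc x1 x2 x3 x4 x0 s1 s2 s3 s4 s0
    opaque
     P≡3 : P ≡ 3
     P≡3 = +-cancelˡ-≡ 2 P 3 (P2 · k5)
     out5 : ∀ x → # (A x) ≤ 5
     out5 x = eq≤ (out x · k5)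
     S-skip : ∀ {a b c} → S a b → S b c → a ≢ c
     S-skip s r e = S-asym s (subst (S _) (sym e) r)
     cyc∃ : ∀ {x u} → x ⟶ u → Cyc x u
     cyc∃ {x} {u} p =
      let (u1 , x1 , s0) = next p
          (u2 , x2 , s1) = next x1
          (u3 , x3 , s2) = next x2
          (u₄ , x4 , s3) = next x3
      in four x1 x2 x3 x4 s0 s1 s2 s3 (u3 F.≟ u) (u₄ F.≟ u) where
      four : ∀ {u1 u2 u3 u₄} → x ⟶ u1 → x ⟶ u2 → x ⟶ u3 → x ⟶ u₄ → S u u1 → S u1 u2 → S u2 u3 → S u3 u₄ → Dec (u3 ≡ u) → Dec (u₄ ≡ u) → Cyc x u
      four {u1} {u2} x1 x2 x3 x4 s0 s1 s2 s3 (yes refl) _ = let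
          (v , xv , n , n₁ , n₂ , _) = fresh (u ∷ u1 ∷ u2 ∷ []) (≤4+ z≤n » eq≥ (out x · k5))
          (v₁ , xv1 , r) = next xv
          (v2 , xv2 , r1) = next xv1
          m = λ e → n₂ (prev! p xv (subst (S v) (sym e) r) x2 s2)
          m₁ = λ e → n (prev! x1 xv (subst (S v) (sym e) r) p s0)
          m₂ = λ e → n₁ (prev! x2 xv (subst (S v) (sym e) r) x1 s1)
       in ⊥-elim (1+n≰n (size≥ {P = A x} (u ∷ u1 ∷ u2 ∷ v ∷ v₁ ∷ v2 ∷ [])
          ((S-irr s0 , S-skip s0 s1 , n ∘ sym , m , (λ e → m₂ (sym (prev! p xv1 (subst (S v₁) (sym e) r1) x2 s2))) , tt) ,
           (S-irr s1 , n₁ ∘ sym , m₁ , (λ e → m (sym (prev! x1 xv1 (subst (S v₁) (sym e) r1) p s0))) , tt) ,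
           (n₂ ∘ sym , m₂ , (λ e → m₁ (sym (prev! x2 xv1 (subst (S v₁) (sym e) r1) x1 s1))) , tt) , (S-irr r , S-skip r r1 , tt) , (S-irr r1 , tt) , tt , tt) (p , x1 , x2 , xv , xv1 , xv2 , tt) » out5 x))
      four {u1} {u2} {u3} x1 x2 x3 x4 s0 s1 s2 s3 (no n3) (yes refl) = let
          (v , xv , n , n₁ , n₂ , n₃ , _) = fresh (u ∷ u1 ∷ u2 ∷ u3 ∷ []) (eq≥ (out x · k5))
          (v₁ , xv1 , r) = next xv
       in ⊥-elim (1+n≰n (size≥ {P = A x} (u ∷ u1 ∷ u2 ∷ u3 ∷ v ∷ v₁ ∷ [])
          ((S-irr s0 , S-skip s0 s1 , n3 ∘ sym , n ∘ sym , (λ e → n₃ (prev! p xv (subst (S v) (sym e) r) x3 s3)) , tt) , (S-irr s1 , S-skip s1 s2 , n₁ ∘ sym , (λ e → n (prev! x1 xv (subst (S v) (sym e) r) p s0)) , tt) ,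
           (S-irr s2 , n₂ ∘ sym , (λ e → n₁ (prev! x2 xv (subst (S v) (sym e) r) x1 s1)) , tt) , (n₃ ∘ sym , (λ e → n₂ (prev! x3 xv (subst (S v) (sym e) r) x2 s2)) , tt) , (S-irr r , tt) , tt , tt) (p , x1 , x2 , x3 , xv , xv1 , tt) » out5 x))
      four {u1} {u2} {u3} {u₄} x1 x2 x3 x4 s0 s1 s2 s3 (no n3) (no n4) = fin (next x4) where
       n14 : u1 ≢ u₄
       n14 e = n3 (prev! x1 x3 (subst (S u3) (sym e) s3) p s0)
       fin : (∃ λ t → x ⟶ t × S u₄ t) → Cyc x u
       fin (t , xt , s) = go (member {P = A x} (u ∷ u1 ∷ u2 ∷ u3 ∷ u₄ ∷ []) ((S-irr s0 , S-skip s0 s1 , n3 ∘ sym , n4 ∘ sym , tt) , (S-irr s1 , S-skip s1 s2 , n14 , tt) , (S-irr s2 , S-skip s2 s3 , tt) , (S-irr s3 , tt) , tt , tt) (p , x1 , x2 , x3 , x4 , tt) (out5 x) xt) where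
        go : In t (u ∷ u1 ∷ u2 ∷ u3 ∷ u₄ ∷ []) → Cyc x u
        go (inj₁ refl) = cyc p x1 x2 x3 x4 s0 s1 s2 s3 s
        go (in1 refl) = ⊥-elim (n4 (prev! x1 x4 s p s0))
        go (in2 refl) = ⊥-elim (n14 (sym (prev! x2 x4 s x1 s1)))
        go (in3 refl) = ⊥-elim (S-asym s s3)
        go (in4 refl) = ⊥-elim (S-irr s refl)
     co≤2 : ∀ {a b c} → a ⟶ c → b ⟶ c → a ≢ b → co a b ≤ 2
     co≤2 {a} {b} p q ne = go (kind' p q ne) where
      go : Kind a b → co a b ≤ 2
      go (kS s) = eq≤ (c3 s) » n≤1+n 1
      go (kT s) = eq≤ (co-sym a b · c3 s) » n≤1+n 1
      go (kB s) = eq≤ (c33 s)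
     odd! : ∀ {x u t v} → x ⟶ u → Odd x u t ≡ true → x ⟶ v → v ⟶ t → u ≡ v
     odd! {x} {u} {t} p o q r = unique s1₁ (and p (lft o)) (and q r) where
      s1₁ : sq x t ≡ 1
      s1₁ = let
          (z , uz , s) = above p
          O = oth p
       in [ (λ e → cong (sq x) e · q3 s) , (λ e → cong (sq x) e · snd O) ]′ (odd-or uz s (wide p (Other.ow (fst O)) (Other.db (fst O))) o)
     back : ∀ {x u v t} → x ⟶ u → x ⟶ v → u ≢ v → u ⟶ t → v ⟶ t → t ⟶ x
     back {x} {u} {v} {t} p q ne a b = elimʳ (λ f → ne (odd! p (and a (not-f f)) q b)) (cases (A t x))
     -- Of the five out-neighbours of `t` three precede `a` and three precede `b`, and only `x`
     -- precedes both.
     iso : ∀ {x a b t v} → x ⟶ a → x ⟶ b → a ⟶ t → b ⟶ t → co a b ≡ 1 → t ⟶ v → v ⟶ a ⊎ v ⟶ b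
     iso {x} {a} {b} {t} {v} p q at bt c1 tv = [ inj₁ ∘ rgt , inj₂ ∘ lft ∘ rgt ]′ (cover2 (λ v → A t v ∧ A v a) (λ v → A t v ∧ (A v b ∧ not (A v a))) (A t) (λ v → lft) (λ v → lft)
       (λ v e f → t≢f (rgt e) (not-t (rgt (rgt f)))) (eq≤ (out t · k5 · +≡ (sym (tri at · P≡3)) (sym two1))) tv) where
      two1 : # (λ v → A t v ∧ (A v b ∧ not (A v a))) ≡ 2
      two1 = (∑-cong λ v → cong β (sym (𝔹.∧-assoc (A t v) _ _))) · #-rest (λ v → A t v ∧ A v b) (λ v → A v a) (tri bt · P≡3) (≤-antisym ((#-mono λ v e → and (∧-snd {A t v ∧ A v b} e) (rgt (∧-fst {A t v ∧ A v b} e))) » eq≤ (sym (co-in a b) · c1))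
        (∃# x (∧-intro {A t x ∧ A x b} (and (back p q (λ { refl → 1≢5 (sym c1 · co-self a · k5) }) at bt) q) p)))
     tc : ∀ {x a b f t c} → x ⟶ a → x ⟶ b → x ⟶ f → a ⟶ t → b ⟶ t → f ⟶ t → co a b ≡ 1 → co a f ≡ 2 → co b f ≡ 2 → c ⟶ a → c ⟶ f → x ≢ c → t ⟶ c
     tc {x} {a} {b} {f} {t} {c} xa xb xf at bt ft c1 caf cbf ca cf xc = let
         (v , e , n , _) = fresh (x ∷ []) (≤2+ z≤n » eq≥ (tri ft · P≡3))
         (v' , e' , n' , m , _) = fresh (x ∷ v ∷ []) (eq≥ (tri ft · P≡3))
      in go (n ∘ sym) (n' ∘ sym) (m ∘ sym) e e' (iso xa xb at bt c1 (lft e)) (iso xa xb at bt c1 (lft e')) where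
      hit₁ : ∀ {v} → x ≢ v → A t v ∧ A v f ≡ true → v ⟶ a → t ⟶ c
      hit₁ n e va = subst (t ⟶_) (third (sym (co-in a f) · caf) (and xa xf) (and va (rgt e)) (and ca cf) n xc) (lft e)
      go : ∀ {v v'} → x ≢ v → x ≢ v' → v ≢ v' → A t v ∧ A v f ≡ true → A t v' ∧ A v' f ≡ true → v ⟶ a ⊎ v ⟶ b → v' ⟶ a ⊎ v' ⟶ b → t ⟶ c
      go n n' m e e' (inj₁ r) _ = hit₁ n e r
      go n n' m e e' (inj₂ _) (inj₁ r) = hit₁ n' e' r
      go n n' m e e' (inj₂ r) (inj₂ r') = ⊥-elim (m (third (sym (co-in b f) · cbf) (and xb xf) (and r (rgt e)) (and r' (rgt e')) n n'))
     both : ∀ {x c u v} → x ⟶ u → c ⟶ u → x ⟶ v → c ⟶ v → u ≢ v → co x c ≡ 1 → ⊥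
     both p q p' q' ne e = ne (unique e (and p q) (and p' q'))
    module At {x u0 : V} (O : Cyc x u0) where
     open Cyc O public
     opaque
      n03 : u0 ≢ u3
      n03 e = S-skip s3 s4 (sym e)
      b02 : co u0 u2 ≡ 2
      b02 = go (kind x0 x2 (S-skip s0 s1)) where
       go : Kind u0 u2 → co u0 u2 ≡ 2
       go (kS s) = ⊥-elim (S-irr s1 (next! x0 x1 s0 x2 s))
       go (kT s) = ⊥-elim (n03 (next! x2 x0 s x3 s2))
       go (kB s) = c33 s
      b03 : co u0 u3 ≡ 2
      b03 = go (kind x0 x3 n03) where
       go : Kind u0 u3 → co u0 u3 ≡ 2
       go (kS s) = ⊥-elim (S-skip s1 s2 (next! x0 x1 s0 x3 s))
       go (kT s) = ⊥-elim (S-irr s4 (sym (next! x3 x0 s x4 s3)))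
       go (kB s) = c33 s
    opaque
     -- u1 would share its remaining two out-neighbours in N⁻(x) with both u3 and u₄.
     mid3 : ∀ {x u0 t} (O : Cyc x u0) → u0 ⟶ t → Cyc.u1 O ⟶ t → Cyc.u2 O ⟶ t → ⊥
     mid3 {x} {u0} {t} O a₀ a₁ a₂ = let
         (a , b , e , f , ne) = pair∃ (eq≥ (At.b02 (turn O)))
         (a' , b' , e' , f' , ne') = pair∃ (eq≥ (At.b03 (turn O)))
      in go ne e f ne' e' f' where
      open At O
      tx : t ⟶ x
      tx = back x0 x1 (S-irr s0) a₀ a₁
      far1 : ∀ {v w} → x ⟶ v → v ⟶ w → u0 ≢ v → u1 ≢ v → u2 ≢ v → t ≢ w
      far1 {v} xv vw m₀ m₁ m₂ refl = 1+n≰n (size≥ {P = λ u → A x u ∧ A u t} (u0 ∷ u1 ∷ u2 ∷ v ∷ []) ((S-irr s0 , S-skip s0 s1 , m₀ , tt) , (S-irr s1 , m₁ , tt) , (m₂ , tt) , tt , tt) (and x0 a₀ , and x1 a₁ , and x2 a₂ , and xv vw , tt) » eq≤ (tri tx · P≡3))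
      go : ∀ {a b a' b'} → a ≢ b → A u1 a ∧ A u3 a ≡ true → A u1 b ∧ A u3 b ≡ true → a' ≢ b' → A u1 a' ∧ A u₄ a' ≡ true → A u1 b' ∧ A u₄ b' ≡ true → ⊥
      go {a} {b} ne e f ne' e' f' = both (hits e') (rgt e') (hits f') (rgt f') ne' (c3 s3) where
       b₃ : ∀ {v} → A u1 v ∧ A u3 v ≡ true → v ⟶ x
       b₃ e = back x1 x3 (S-skip s1 s2) (lft e) (rgt e)
       f₃ : ∀ {v} → A u1 v ∧ A u3 v ≡ true → t ≢ v
       f₃ e = far1 x3 (rgt e) n03 (S-skip s1 s2) (S-irr s2)
       hits : ∀ {v} → A u1 v ∧ A u₄ v ≡ true → u3 ⟶ v
       hits {v} q = pick (member {P = λ v → A u1 v ∧ A v x} (t ∷ a ∷ b ∷ []) ((f₃ e , f₃ f , tt) , (ne , tt) , tt , tt) (and a₁ tx , and (lft e) (b₃ e) , and (lft f) (b₃ f) , tt) (eq≤ (tri x1 · P≡3)) (and (lft q) (back x1 x4 (S-skip s4 s0 ∘ sym) (lft q) (rgt q)))) where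
        pick : In v (t ∷ a ∷ b ∷ []) → u3 ⟶ v
        pick (inj₁ r) = ⊥-elim (far1 x4 (rgt q) (S-irr s4 ∘ sym) (S-skip s4 s0 ∘ sym) (S-skip s2 s3) (sym r))
        pick (in1 refl) = rgt e
        pick (in2 refl) = rgt f
     -- `t` returns to `x`, so three out-neighbours of `x` precede it; `mid3` excludes the two
     -- cyclic neighbours of the pair, which leaves the opposite one.
     across : ∀ {x u0 t} (O : Cyc x u0) → u0 ⟶ t → Cyc.u1 O ⟶ t → Cyc.u3 O ⟶ t
     across {x} {u0} {t} O a₀ a₁ = let (v , e , n , m , _) = fresh (u0 ∷ u1 ∷ []) (eq≥ (tri (back x0 x1 (S-irr s0) a₀ a₁) · P≡3)) in
       go (rgt e) n m (member {P = A x} (u0 ∷ u1 ∷ u2 ∷ u3 ∷ u₄ ∷ []) ((S-irr s0 , S-skip s0 s1 , n03 , S-irr s4 ∘ sym , tt) , (S-irr s1 , S-skip s1 s2 , S-skip s4 s0 ∘ sym , tt) , (S-irr s2 , S-skip s2 s3 , tt) , (S-irr s3 , tt) , tt , tt) (x0 , x1 , x2 , x3 , x4 , tt) (out5 x) (lft e)) where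
      open At O
      go : ∀ {v} → v ⟶ t → v ≢ u0 → v ≢ u1 → In v (u0 ∷ u1 ∷ u2 ∷ u3 ∷ u₄ ∷ []) → u3 ⟶ t
      go r n m (inj₁ e) = ⊥-elim (n e)
      go r n m (in1 e) = ⊥-elim (m e)
      go r n m (in2 refl) = ⊥-elim (mid3 O a₀ a₁ r)
      go r n m (in3 refl) = r
      go r n m (in4 refl) = ⊥-elim (mid3 (turn (turn (turn (turn O)))) r a₀ a₁)
     sole : ∀ {x u0 t z s} (O : Cyc x u0) → u0 ⟶ t → Cyc.u1 O ⟶ t → Cyc.u₄ O ⟶ z → S x z → z ⟶ u0 → u0 ⟶ s → s ⟶ z → s ≡ t ⊎ Odd x u0 s ≡ true
     sole {x} {u0} {t} {z} {s} O a₀ a₁ uz sz zu0 us sz' = let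
         (t₄ , b4 , b₀) = common s4
         (t2 , c₂ , c₃) = common s2
      in go b4 b₀ c₂ c₃ (across (turn (turn O)) c₂ c₃) (cases (A s x)) where
      open At O
      go : ∀ {t₄ t2} → u₄ ⟶ t₄ → u0 ⟶ t₄ → u2 ⟶ t2 → u3 ⟶ t2 → u0 ⟶ t2 → s ⟶ x ⊎ A s x ≡ false → s ≡ t ⊎ Odd x u0 s ≡ true
      go b4 b₀ c₂ c₃ c₀ (inj₂ f) = inj₂ (and us (not-f f))
      go {t₄} {t2} b4 b₀ c₂ c₃ c₀ (inj₁ r) = inj₁ (pick (member {P = λ v → A u0 v ∧ A v x} (t ∷ t₄ ∷ t2 ∷ [])
         (((λ { refl → mid3 (turn (turn (turn (turn O)))) b4 a₀ a₁ }) , (λ { refl → mid3 O a₀ a₁ c₂ }) , tt) , ((λ { refl → mid3 (turn (turn O)) c₂ c₃ b4 }) , tt) , tt , tt)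
         (and a₀ (back x0 x1 (S-irr s0) a₀ a₁) , and b₀ (back x4 x0 (S-irr s4) b4 b₀) , and c₀ (back x2 x3 (S-irr s2) c₂ c₃) , tt) (eq≤ (tri x0 · P≡3)) (and us r))) where
       pick : In s (t ∷ t₄ ∷ t2 ∷ []) → s ≡ t
       pick (inj₁ e) = e
       pick (in1 refl) = ⊥-elim (a0 b4 sz' uz)
       pick (in2 refl) = ⊥-elim ([ (λ q → both x0 zu0 x2 q (S-skip s0 s1) (c3 sz)) , (λ q → both x0 zu0 x3 q n03 (c3 sz)) ]′ (iso x2 x3 c₂ c₃ (c3 s2) sz'))
     tz : ∀ {x u0 t z} (O : Cyc x u0) → u0 ⟶ t → Cyc.u1 O ⟶ t → Cyc.u₄ O ⟶ z → S x z → z ⟶ u0 → t ⟶ z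
     tz {x} {u0} {t} {z} O a₀ a₁ uz sz zu0 = let
         (z0 , b , sz0) = above (Cyc.x0 O)
         (w0 , W1) = wide∃ (Cyc.x0 O)
         (s , e , n , m , _) = fresh (z0 ∷ w0 ∷ []) (eq≥ (tri zu0 · P≡3))
      in [ (λ q → subst (_⟶ z) q (rgt e)) , (λ o → ⊥-elim ([ n , m ]′ (odd-or b sz0 W1 o))) ]′ (sole O a₀ a₁ uz sz zu0 (lft e) (rgt e))
     zz : ∀ {x u0 z z0} (O : Cyc x u0) → Cyc.u₄ O ⟶ z → S x z → z ⟶ u0 → u0 ⟶ z0 → S x z0 → z0 ⟶ z
     zz {x} {u0} {z} O uz sz zu0 b sz0 = let
         (t , a₀ , a₁) = common (Cyc.s0 O)
         (w0 , W1) = wide∃ (Cyc.x0 O)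
         (s , e , n , m , _) = fresh (t ∷ w0 ∷ []) (eq≥ (tri zu0 · P≡3))
      in [ ⊥-elim ∘ n , (λ o → [ (λ q → subst (_⟶ z) q (rgt e)) , ⊥-elim ∘ m ]′ (odd-or b sz0 W1 o)) ]′ (sole O a₀ a₁ uz sz zu0 (lft e) (rgt e))
     zc : ∀ {x u0 z0 c} (O : Cyc x u0) → u0 ⟶ z0 → S x z0 → z0 ⟶ Cyc.u1 O → c ⟶ u0 → c ⟶ Cyc.u2 O → x ≢ c → z0 ⟶ c
     zc {x} {u0} {z0} {c} O b sz0 zu1 cu0 cu2 xc = let
         (t , a₀ , a₁) = common s0
         (z , uz , sz , zu0) = frame x4 x0 s4
         (y , yu0 , sy) = inT x0
         (c' , e , n , _) = fresh (x ∷ []) (eq≥ (sym (co-in u0 u3) · b03))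
         (s , e' , n₁ , n₂ , _) = fresh (z ∷ y ∷ []) (eq≥ (tri b · P≡3))
      in go a₀ a₁ uz sz zu0 yu0 sy (lft e) (rgt e) (n ∘ sym) (lft e') (rgt e') n₁ n₂ where
      open At O
      go : ∀ {t z y c' s} → u0 ⟶ t → u1 ⟶ t → u₄ ⟶ z → S x z → z ⟶ u0 → y ⟶ u0 → S y x → c' ⟶ u0 → c' ⟶ u3 → x ≢ c' → z0 ⟶ s → s ⟶ u0 → s ≢ z → s ≢ y → z0 ⟶ c
      go {t} {z} {y} {c'} {s} a₀ a₁ uz sz zu0 yu0 sy cu0' cu3' xc' zs su0 nz ny = pick (member {P = λ v → A v u0} (x ∷ z ∷ y ∷ c ∷ c' ∷ [])
         ((S-irr sz , S-irr sy ∘ sym , xc , xc' , tt) , ((λ { refl → S-asym sz sy }) , (λ { refl → both x0 cu0 x2 cu2 (S-skip s0 s1) (c3 sz) }) , (λ { refl → both x0 cu0' x3 cu3' n03 (c3 sz) }) , tt) ,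
          ((λ { refl → both x0 cu0 x2 cu2 (S-skip s0 s1) (co-sym x y · c3 sy) }) , (λ { refl → both x0 cu0' x3 cu3' n03 (co-sym x y · c3 sy) }) , tt) ,
          ((λ { refl → 1+n≰n (size≥ {P = λ v → A x v ∧ A c v} (u0 ∷ u2 ∷ u3 ∷ []) ((S-skip s0 s1 , n03 , tt) , (S-irr s2 , tt) , tt , tt) (and x0 cu0 , and x2 cu2 , and x3 cu3' , tt) » co≤2 x0 cu0 xc) }) , tt) , tt , tt)
         (x0 , zu0 , yu0 , cu0 , cu0' , tt) (eq≤ (inn u0 · k5)) su0) where
       pick : In s (x ∷ z ∷ y ∷ c ∷ c' ∷ []) → z0 ⟶ c
       pick (inj₁ refl) = t≢f zs (not-t (rgt (S-odd x0 b sz0)))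
       pick (in1 e) = ⊥-elim (nz e)
       pick (in2 e) = ⊥-elim (ny e)
       pick (in3 refl) = zs
       pick (in4 refl) = ⊥-elim (both x0 cu0' x3 cu3' n03 (subst (λ v → co x v ≡ 1) (out! (toS b a₀ zu1 a₁) (zz O uz sz zu0 b sz0) (tz O a₀ a₁ uz sz zu0) zs
          (tc x0 x1 x3 a₀ a₁ (across O a₀ a₁) (c3 s0) b03 (At.b02 (turn O)) cu0' cu3' xc')) (c3 sz)))
     -- Rebased at `u3`, the vertices `t`, `z₃`, `t3` are consecutive in its cycle. There `zc`
     -- yields `z4 → u1`, so `z4` and `x` share `u0` and `u1`, although pairs in S have one common
     -- out-neighbour.
     absurd : ⊥
     absurd = let (x , u , p) = arc0 in go (cyc∃ p) where
      go : ∀ {x u} → Cyc x u → ⊥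
      go {x} {u0} O = let
          (t , a₀ , a₁) = common s0
          (t3 , b₃ , b4) = common s3
          b₁ = across (turn (turn (turn O))) b₃ b4
          (z₃ , c₃ , sz3 , zu4) = frame x3 x4 s3
          (z4 , c4 , sz4 , zu0) = frame x4 x0 s4
          a₃ = across O a₀ a₁
          z43 = zz (turn (turn (turn (turn O)))) c₃ sz3 zu4 c4 sz4
          t4 = tz O a₀ a₁ c4 sz4 zu0
       in fin (cyc∃ a₃) c₃ b₃ (toS a₃ c₃ t4 z43) (toS c₃ b₃ zu4 b4) t4 z43 a₁ b₁ zu0 sz4 where
       open At O
       fin : ∀ {t t3 z₃ z4} (O' : Cyc u3 t) → u3 ⟶ z₃ → u3 ⟶ t3 → S t z₃ → S z₃ t3 → t ⟶ z4 → z4 ⟶ z₃ → u1 ⟶ t → u1 ⟶ t3 → z4 ⟶ u0 → S x z4 → ⊥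
       fin {t} {t3} {z₃} {z4} O' q r s s' tz4 z43 a₁ b₁ zu0 sz4 = both x0 zu0 x1 (zc O' tz4 sζ (subst (z4 ⟶_) (sym e₁) z43) a₁ (subst (u1 ⟶_) (sym e₂) b₁) (S-skip s1 s2 ∘ sym)) (S-irr s0) (c3 sz4) where
        e₁ : Cyc.u1 O' ≡ z₃
        e₁ = next! (Cyc.x0 O') (Cyc.x1 O') (Cyc.s0 O') q s
        e₂ : Cyc.u2 O' ≡ t3
        e₂ = next! (Cyc.x1 O') (Cyc.x2 O') (Cyc.s1 O') r (subst (λ v → S v t3) (sym e₁) s')
        sζ : S u3 z4
        sζ = let (ζ , a , b , c) = frame (Cyc.x0 O') q s in subst (S u3) (mid! s a c tz4 z43) b

   -- The doubled Cayley digraph on ℤ₁₃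

   module Thirteen (k6 : k ≡ 6) (Vl : Vals 2 1 2 2 6 2) (f6 : F# 6 ≡ 1) where
    open Vals Vl
    open Twins k6 (cong F# k6 · f6)
    opaque
     -- `ee 3 = 2` puts both odd vertices over an arc in class (2 , 3), where `co` is 2.
     oddS : ∀ {x u w} → x ⟶ u → u ⟶ w → A w x ≡ false → co x w ≡ 2
     oddS {x} {u} {w} p q f = c3 (lftC (#-sub≡ {P = λ z → Cb 2 3 x z ∧ A u z} {Q = Odd x u} (λ z → e-odd p (λ ())) (eq≤ (odd2 p · sym (e≡ 3 p · e3))) w (and q (not-f f))))
     near : ∀ {x a b m} → x ⟶ a → x ⟶ b → a ⟶ m → m ⟶ b → d a b ≡ 2
     near p q r s = elimʳ (λ e → 1+n≰n (eq≥ e » d≤2 r s)) (sib-d p q λ { refl → no2 r s })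
     asym : ∀ {x a b m m'} → x ⟶ a → x ⟶ b → a ⟶ m → m ⟶ b → b ⟶ m' → m' ⟶ a → ⊥
     asym p q r s r' s' = 1+n≰n (sib-co p q » eq≤ (c≡0 2 2 n2 (Cb-intro (near p q r s) (near q p r' s'))))
     mids : ∀ {x a b m} → x ⟶ a → x ⟶ b → a ⟶ m → m ⟶ b → co a b ≡ 2
     mids {x} {a} {b} p q r s = [ (λ e → let (m' , r' , s') = first-step {b} {a} e in ⊥-elim (asym p q r s r' (d⇒A s'))) , (λ e → c3 (Cb-intro (near p q r s) e)) ]′ (sib-d q p λ { refl → no2 r s })
     adj1 : ∀ {x a b} → x ⟶ a → x ⟶ b → co a b ≢ k → (∃ λ m → a ⟶ m × m ⟶ b) ⊎ ∃ λ m → b ⟶ m × m ⟶ a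
     adj1 {x} {a} {b} p q ne = go (sib-d p q nab) (sib-d q p (nab ∘ sym)) where
      nab : a ≢ b
      nab refl = ne (co-self a)
      go : d a b ≡ 2 ⊎ d a b ≡ 3 → d b a ≡ 2 ⊎ d b a ≡ 3 → (∃ λ m → a ⟶ m × m ⟶ b) ⊎ ∃ λ m → b ⟶ m × m ⟶ a
      go (inj₁ e) _ = let (m , r , s) = first-step {a} {b} e in inj₁ (m , r , d⇒A s)
      go (inj₂ _) (inj₁ e) = let (m , r , s) = first-step {b} {a} e in inj₂ (m , r , d⇒A s)
      go (inj₂ e) (inj₂ f) = ⊥-elim (ne (c33 (Cb-intro e f) · sym k6))
     step : ∀ {x a b w m} → x ⟶ a → x ⟶ b → a ⟶ w → A w x ≡ false → a ⟶ m → m ⟶ b → w ⟶ b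
     step {x} {a} {b} {w} {m} p q r f am mb = twin-out (co-sym m w · pin (odd2 p) (and r (not-f f)) (and (twin-in (tw-co w) r) (not-f (¬t λ e → t≢f (twin-out (co-sym (tw w) w · tw-co w) e) f))) (and am (not-f (¬t λ e → a0 e q mb)))) mb
    -- `x` and four orbits of length three under `turn` represent the thirteen twin classes.
    record Frame (x : V) : Set where
     constructor frame
     field
      u0 u1 u2 w0 w₁ w₂ z0 z1 z₂ q0 q1 q2 : V
      xu0 : x ⟶ u0
      xu1 : x ⟶ u1
      xu2 : x ⟶ u2
      uw0 : u0 ⟶ w0
      uw1 : u1 ⟶ w₁
      uw2 : u2 ⟶ w₂
      wx0 : A w0 x ≡ false
      wx1 : A w₁ x ≡ false
      wx2 : A w₂ x ≡ false
      wu0 : w0 ⟶ u1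
      wu1 : w₁ ⟶ u2
      wu2 : w₂ ⟶ u0
      zx0 : z0 ⟶ x
      zx1 : z1 ⟶ x
      zx2 : z₂ ⟶ x
      uz0 : A u0 z0 ≡ false
      uz1 : A u1 z1 ≡ false
      uz2 : A u2 z₂ ≡ false
      qu0 : q0 ⟶ u0
      qu1 : q1 ⟶ u1
      qu2 : q2 ⟶ u2
      qS0 : Cb 2 3 q0 x ≡ true
      qS1 : Cb 2 3 q1 x ≡ true
      qS2 : Cb 2 3 q2 x ≡ true
    open Frame
    turn : ∀ {x} → Frame x → Frame x
    turn (frame a b c d e f g h i j k l m n o p q r s t u v w x y z a' b' c' d' e' f' g' h' i' j') = frame b c a e f d h i g k l j n o m q r p t u s w x v z a' y c' d' b' f' g' e' i' j' h'
    opaque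
     frame1 : ∀ x → Frame x
     frame1 x = let
         (u0 , xu0) = has-out x
         (w0 , uw0 , wx0) = odd∃ xu0
         (u1 , xu1 , wu0) = out∃ xu0 uw0 wx0
         (w₁ , uw1 , wx1) = odd∃ xu1
         (u2 , xu2 , wu1) = out∃ xu1 uw1 wx1
         (w₂ , uw2 , wx2) = odd∃ xu2
         wu2 = [ (λ (m , r , s) → ⊥-elim (2≢k (mids xu1 xu2 uw1 wu1) (co-pin (oddS xu0 uw0 wx0) xu1 wu0 xu2 (step xu0 xu2 uw0 wx0 r s)))) , (λ (m , r , s) → step xu2 xu0 uw2 wx2 r s) ]′
          (adj1 xu0 xu2 λ e → asym xu1 xu2 uw1 wu1 (twin-out e uw0) wu0)
         (z0 , zx0 , uz0) = missed xu0
         (z1 , zx1 , uz1) = missed xu1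
         (z₂ , zx2 , uz2) = missed xu2
         (q0 , qu0 , qS0) = in∃ xu0
         (q1 , qu1 , qS1) = in∃ xu1
         (q2 , qu2 , qS2) = in∃ xu2
      in frame u0 u1 u2 w0 w₁ w₂ z0 z1 z₂ q0 q1 q2 xu0 xu1 xu2 uw0 uw1 uw2 wx0 wx1 wx2 wu0 wu1 wu2 zx0 zx1 zx2 uz0 uz1 uz2 qu0 qu1 qu2 qS0 qS1 qS2 where
      odd∃ : ∀ {u} → x ⟶ u → ∃ λ w → u ⟶ w × A w x ≡ false
      odd∃ p = let (w , e) = #∃ (≥1 (odd2 p)) in w , lft e , not-t (rgt e)
      out∃ : ∀ {u w} → x ⟶ u → u ⟶ w → A w x ≡ false → ∃ λ v → x ⟶ v × w ⟶ v
      out∃ p q f = let (v , e) = #∃ (≥1 (oddS p q f)) in v , lft e , rgt e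
      in∃ : ∀ {u} → x ⟶ u → ∃ λ q → q ⟶ u × Cb 2 3 q x ≡ true
      in∃ p = let (q , e) = #∃ (≥1 (n-in 3 2 p · sym n23≡n32 · n3)) in q , rgtC e , Cb-intro (Cb-snd (lftC e)) (Cb-fst (lftC e))
     cxq : ∀ {x} (T : Frame x) → co x (q0 T) ≡ 2
     cxq {x} T = co-sym x (q0 T) · c3 (qS0 T)
     c02 : ∀ {x} (T : Frame x) → co (u0 T) (u2 T) ≡ 2
     c02 T = co-sym _ (u2 T) · mids (xu2 T) (xu0 T) (uw2 T) (wu2 T)
     toNext : ∀ {x} (T : Frame x) → u1 T ⟶ z0 T
     toNext T = hitOr (xu0 T) (xu1 T) (mids (xu0 T) (xu1 T) (uw0 T) (wu0 T)) (zx0 T) (uz0 T)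
     toPrev : ∀ {x} (T : Frame x) → u2 T ⟶ z0 T
     toPrev T = hitOr (xu0 T) (xu2 T) (c02 T) (zx0 T) (uz0 T)
     ww : ∀ {x} (T : Frame x) → w0 T ⟶ w₂ T
     ww T = into (uw0 T) (xu0 T) (wx0 T) (wu2 T) (2≢k (oddS (xu2 T) (uw2 T) (wx2 T)))
     wq : ∀ {x} (T : Frame x) → w0 T ⟶ q0 T
     wq T = into (uw0 T) (xu0 T) (wx0 T) (qu0 T) (2≢k (cxq T))
     apart : ∀ {x u w q} → x ⟶ u → u ⟶ w → Cb 2 3 q x ≡ true → co w q ≢ k
     apart p q s e = 1+n≰n (eq≥ (Cb-snd s) » d≤2 p (twin-in e q))
     zq : ∀ {x} (T : Frame x) → z0 T ⟶ q2 T
     zq T = into (toPrev T) (wu1 T) (¬t λ e → a0 (toNext T) e (uw1 T)) (qu2 T) (apart (xu1 T) (uw1 T) (qS2 T))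
     zw : ∀ {x} (T : Frame x) → z0 T ⟶ w0 T
     zw T = into (toNext T) (qu1 T) (¬t λ e → t≢f (twin-in (in-pin (cxq (turn T)) (zx2 T) (zq (turn (turn T))) (zx0 T) e) (toNext (turn (turn T)))) (uz0 T)) (wu0 T) (λ e → apart (xu0 T) (uw0 T) (qS1 T) (co-sym _ (q1 T) · e))
     qz : ∀ {x} (T : Frame x) → q0 T ⟶ z0 T
     qz T = into (wq T) (ww (turn T)) (¬t λ e → a0 (zq (turn T)) e (zw (turn T))) (zw T) (λ e → t≢f (twin-out (co-sym _ (w₁ T) · e) (zx0 T)) (wx1 T))
     qq : ∀ {x} (T : Frame x) → q0 T ⟶ q1 T
     qq T = into (zq (turn T)) (toNext (turn T)) (¬t λ e → 2≢k (c02 T) (co-pin (cxq T) (xu0 T) (qu0 T) (xu2 T) e)) (qz (turn T)) (λ e → 1≢3 (sym (A⇒d (twin-in e (xu2 T))) · Cb-snd (qS1 T)))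
    R26 : Fin 26 → Fin 26 → Bool
    R26 = CayZ 26 (1 ∷ 3 ∷ 9 ∷ 14 ∷ 16 ∷ 22 ∷ [])
    opaque
     result : IsomorphicTo A (Fin 26) R26
     result = go (frame1 x₀) where
      go : ∀ {x} → Frame x → IsomorphicTo A (Fin 26) R26
      go {x} T = double R26 o f (from-yes (table? 2 R26 o)) 0F arcs where
       o : Fin 13 → Vec (Fin 13) 3
       o = shifts 13 (1 ∷ 3 ∷ 9 ∷ [])
       T1 T₂ : Frame x
       T1 = turn T
       T₂ = turn T1
       -- `turn` acts as multiplication by 3 on ℤ₁₃: the `u` sit at 1, 3, 9 and the `w` at 2, 6, 5,
       -- with the `z` and the `q` at their respective negatives.
       f : Fin 13 → V
       f = lookup (x ∷ u0 T ∷ w0 T ∷ u1 T ∷ z₂ T ∷ w₂ T ∷ w₁ T ∷ q1 T ∷ q2 T ∷ u2 T ∷ z1 T ∷ q0 T ∷ z0 T ∷ [])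
       arcs : ∀ p i → f p ⟶ f (lookup (o p) i)
       arcs 0F 0F = xu0 T
       arcs 0F 1F = xu1 T
       arcs 0F 2F = xu2 T
       arcs 1F 0F = uw0 T
       arcs 1F 1F = toNext T₂
       arcs 1F 2F = toPrev T1
       arcs 2F 0F = wu0 T
       arcs 2F 1F = ww T
       arcs 2F 2F = wq T
       arcs 3F 0F = toPrev T₂
       arcs 3F 1F = uw1 T
       arcs 3F 2F = toNext T
       arcs 4F 0F = zw T₂
       arcs 4F 1F = zq T₂
       arcs 4F 2F = zx2 T
       arcs 5F 0F = ww T₂
       arcs 5F 1F = wq T₂
       arcs 5F 2F = wu2 T
       arcs 6F 0F = wq T1
       arcs 6F 1F = wu1 T
       arcs 6F 2F = ww T1
       arcs 7F 0F = qq T1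
       arcs 7F 1F = qz T1
       arcs 7F 2F = qu1 T
       arcs 8F 0F = qu2 T
       arcs 8F 1F = qq T₂
       arcs 8F 2F = qz T₂
       arcs 9F 0F = toNext T1
       arcs 9F 1F = toPrev T
       arcs 9F 2F = uw2 T
       arcs (suc 9F) 0F = zq T1
       arcs (suc 9F) 1F = zx1 T
       arcs (suc 9F) 2F = zw T1
       arcs (2+ 9F) 0F = qz T
       arcs (2+ 9F) 1F = qu0 T
       arcs (2+ 9F) 2F = qq T
       arcs (3+ 9F) 0F = zx0 T
       arcs (3+ 9F) 1F = zw T
       arcs (3+ 9F) 2F = zq T

-- Girth at most two, and assembly of the cases

least-one : ∀ {n} {A : Rel n} (P : ℕ → Bool) b → least A P (2 + b) ≡ 1 → P 1 ≡ true
least-one P b e with P 0 | P 1 | e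
... | false | true | _ = refl
... | true | _ | ()
... | false | false | ()

walk-one : ∀ {n} {A : Rel n} {x y} → walk A 1 x y ≡ true → A x y ≡ true
walk-one {A = A} {x} {y} e = let (z , p) = any-tab (λ z → A x z ∧ (z == y)) id e in subst (λ z → A x z ≡ true) (==⇒≡ (∧-snd {A x z} p)) (∧-fst p)

-- With a single vertex the value 1 would be the default of the bounded search; distinct ends give
-- at least two vertices.
dist-one : ∀ {n} {A : Rel n} {x y} → x ≢ y → dist A x y ≡ 1 → A x y ≡ true
dist-one {x = zero} {zero} ne _ = ⊥-elim (ne refl)
dist-one {2+ b} {A} {x} {y} ne e = walk-one {A = A} (least-one {A = A} (λ m → walk A m x y) b e)

gap : ∀ {P k} → k ∸ 2 ≤ P → P ≤ k → P ≡ k ⊎ suc P ≡ k ⊎ 2 + P ≡ k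
gap {P} {k} lo hi = go (P ≟ k) (suc P ≟ k) where
 go : Dec (P ≡ k) → Dec (suc P ≡ k) → P ≡ k ⊎ suc P ≡ k ⊎ 2 + P ≡ k
 go (yes e) _ = inj₁ e
 go (no _) (yes e) = in1 e
 go (no m) (no l) = inj₂ (inj₂ (≤-antisym (≤∧≢⇒< (≤∧≢⇒< hi m) l) (m≤n+m∸n k 2 » +-monoʳ-≤ 2 lo)))

module _ {n : ℕ} {A : Rel n} where
 long : ∀ {k g₁} (H : Hyp A k (suc g₁)) → Girth4.Outcome H → ⊥
 long H (Girth4.o2 refl p q r) = Val4.Two.absurd H p q r
 long H (Girth4.o3 refl p q r) = go H p q r where
  go : ∀ {g₁} (H : Hyp A 4 (suc g₁)) (p : Theory.P H ≡ 2) (q : Theory.Qv H ≡ 3) (r : Theory.t H ≡ 6) → ⊥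
  go {zero} H p q r = [ (λ (e , f) → Quad.Spread.absurd H p q r e f) , (λ (e , f) → Quad.ThinW.absurd H p q r e f) ]′ (Val4.Three.small H p q r)
  go {suc _} H p q r = Long.absurd H p q r
 long H (Girth4.o4 refl p q r) = Val4.Case4.absurd H p q r
 long H (Girth4.o6 refl p q r) = Case6.absurd H p q r
 Goal : ℕ → ℕ → Set
 Goal k g = IsomorphicTo A (Fin 11) (CayZ 11 (1 ∷ 3 ∷ 4 ∷ 5 ∷ 9 ∷ []))
  ⊎ IsomorphicTo A (Fin 14) (CayZ 14 (1 ∷ 2 ∷ 4 ∷ 8 ∷ 9 ∷ 11 ∷ []))
  ⊎ IsomorphicTo A (Fin 26) (CayZ 26 (1 ∷ 3 ∷ 9 ∷ 14 ∷ 16 ∷ 22 ∷ []))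
  ⊎ IsomorphicTo A (Fin 3 × Fin (suc k)) (CayZ² 3 (suc k) (S-iv k))
  ⊎ IsomorphicTo A (Fin g × Fin k) (CayZ² g k (S-v k))
 short : ∀ {k} (H : Hyp A k 0) → 2 + Theory.P H ≡ k → Goal k 3
 short {k} H P2 = go (aCases) where
  open Theory H
  open Girth3 H
  open TwoShort P2
  go : a# ≡ 0 ⊎ (a# ≡ 2 × k ≡ 5) ⊎ (a# ≡ 2 × k ≡ 6) → Goal k 3
  go (inj₁ az) = left (Zero.classify az) where
   left : Zero.Left az → Goal k 3
   left (Zero.left4 e v o) = ⊥-elim (Zero.Left4.absurd az e v o)
   left (Zero.left5 e v o) = ⊥-elim (Zero.Left5.absurd az e v o)
   left (Zero.left6 e v f) = inj₂ (inj₂ (inj₁ (Zero.Thirteen.result az e v f)))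
  go (inj₂ (inj₁ (a2 , k5))) = inj₁ (Two.Eleven.result a2 k5)
  go (inj₂ (inj₂ (a2 , k6))) = inj₂ (inj₁ (Two.Seven.result a2 k6))
 classification : ∀ {k g0} → Hyp A k g0 → Goal k (3 + g0)
 classification {k} {g0} H = go g0 H (gap (Theory.Pℓ H) ((#-mono λ z → ∧-fst) » eq≤ (Theory.out H (Theory.x₀ H)))) where
  go : ∀ g0 (H : Hyp A k g0) → Theory.P H ≡ k ⊎ suc (Theory.P H) ≡ k ⊎ 2 + Theory.P H ≡ k → Goal k (3 + g0)
  go g0 H (inj₁ e) = inj₂ (inj₂ (inj₂ (inj₂ (Theory.Full.iso H e))))
  go zero H (in1 e) = inj₂ (inj₂ (inj₂ (inj₁ (Girth3.OneShort.result H e))))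
  go zero H (inj₂ (inj₂ e)) = short H e
  go (suc g₁) H (in1 e) = ⊥-elim (long H (Girth4.outcome H (eq≤ e)))
  go (suc g₁) H (inj₂ (inj₂ e)) = ⊥-elim (long H (Girth4.outcome H (n≤1+n _ » eq≤ e)))

theorem1p1 : (n : ℕ) (A : Rel n) (k g : ℕ) →
    IsDigraph A → IsWeaklyDistanceRegular A → IsCommutative A →
    HasValency A k → 3 < k → HasGirth A g → AllArcsOfType A g →
    (∃₂ λ x y → (dist2 A x y ≡ (2 , g ∸ 2)) × (k ∸ 2 ≤ pcount A x y (1 , g ∸ 1) (1 , g ∸ 1))) →
    IsomorphicTo A (Fin 11) (CayZ 11 (1 ∷ 3 ∷ 4 ∷ 5 ∷ 9 ∷ []))
    ⊎ IsomorphicTo A (Fin 14) (CayZ 14 (1 ∷ 2 ∷ 4 ∷ 8 ∷ 9 ∷ 11 ∷ []))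
    ⊎ IsomorphicTo A (Fin 26) (CayZ 26 (1 ∷ 3 ∷ 9 ∷ 14 ∷ 16 ∷ 22 ∷ []))
    ⊎ IsomorphicTo A (Fin 3 × Fin (suc k)) (CayZ² 3 (suc k) (S-iv k))
    ⊎ IsomorphicTo A (Fin g × Fin k) (CayZ² g k (S-v k))
theorem1p1 n A k 0 _ _ _ _ _ (() , _) _ _
theorem1p1 n A k 1 (irr , _) _ _ _ _ (_ , (x , w) , _) _ _ = t≢f (walk-one {A = A} w) (irr x)
-- For `g = 2` every arc has a reverse arc, against the one-way arc in `IsDigraph`.
theorem1p1 n A k 2 (irr , _ , x , y , p , q) _ _ _ _ _ ty _ = t≢f (dist-one {A = A} (λ { refl → t≢f p q }) (ty x y p)) q
theorem1p1 n A k (3+ g0) (irr , str , _) wdr com val k>3 (_ , _ , ac) ty (x , y , e , l) =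
 classification record { loopless = irr ; strong = str ; wdr = wdr ; commut = com ; valency = val ; k>3 = k>3 ; acyclic = ac ; types = ty ; x₀ = x ; y₀ = y ; d1 = fst (,-injective e) ; d₂ = snd (,-injective e) ; big = l }
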